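{- Let $\lambda/\mu$ be a skew shape and $n$ a positive integer, and write $\mathbf{x}_n=(x_1,\ldots,x_n)$. Then $$G_{\lambda/\mu}(\mathbf{x}_n;\mathbf{t};\mathbf{w})=\sum_{\gamma}\sum_{\theta}\mathbf{t}^{\gamma}\mathbf{w}^{\theta}\sum_{\nu}H^{\nu,\gamma,\theta}_{\lambda/\mu,n}\,s_\nu(\mathbf{x}_n),$$ where $\gamma,\theta$ range over weak compositions, $\nu$ ranges over partitions, $s_\nu(\mathbf{x}_n)$ is the Schur polynomial, and $H^{\nu,\gamma,\theta}_{\lambda/\mu,n}$ is the number of $T\in\mathrm{SVRPP}^n(\lambda/\mu)$ with $\mathrm{ircont}(T)=\nu$, $\mathrm{ceq}(T)=\gamma$, $\mathrm{ex}(T)=\theta$, such that $\mathrm{read}(T)$ is a reverse lattice word.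
   Context: Boxes are $(i,j)$ (row $i$, column $j$, matrix coordinates); $\lambda/\mu$ is the set of boxes of the Young diagram of $\lambda$ not in that of $\mu$. For nonempty finite sets of positive integers, $A\le B$ means $\max A\le\min B$. An SVRPP of shape $\lambda/\mu$ is a filling $T$ assigning a nonempty finite set $T(i,j)$ of positive integers to each box, weakly increasing (w.r.t. $\le$) along rows left to right and down columns. $\mathrm{SVRPP}^n(\lambda/\mu)$ is the set of SVRPPs all of whose sets are subsets of $[n]=\{1,\ldots,n\}$. Statistics: $\mathrm{ircont}(T)=(r_1,r_2,\ldots)$, $r_k$ = number of columns of $T$ containing a box whose set contains $k$; $\mathrm{ceq}(T)=(c_1,c_2,\ldots)$, $c_i$ = number of boxes $(i,j)\in\lambda/\mu$ with $(i+1,j)\in\lambda/\mu$ and $\max T(i,j)=\min T(i+1,j)$; $\mathrm{ex}(T)=(e_1,e_2,\ldots)$, $e_i=\sum_{(i,j)\in\lambda/\mu}(|T(i,j)|-1)$. The hybrid Grothendieck polynomial is $G_{\lambda/\mu}(\mathbf{x};\mathbf{t};\mathbf{w})=\sum_{T\in\mathrm{SVRPP}(\lambda/\mu)}\mathbf{x}^{\mathrm{ircont}(T)}\mathbf{t}^{\mathrm{ceq}(T)}\mathbf{w}^{\mathrm{ex}(T)}$ (with $\mathbf{y}^\alpha=\prod_k y_k^{\alpha_k}$), and $G_{\lambda/\mu}(\mathbf{x}_n;\mathbf{t};\mathbf{w})$ is obtained by setting $x_k=0$ for $k>n$ (equivalently, summing over $\mathrm{SVRPP}^n(\lambda/\mu)$).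 Reading word: the minimum of each set $T(i,j)$ is the pivot of box $(i,j)$. $\mathrm{read}(T)=w^{(N)}w^{(N-1)}\cdots w^{(1)}$, where $N$ is the number of rows and $w^{(i)}$ is the word of row $i$ (so rows are read bottom to top), formed as follows: first list all non-pivot entries of the boxes of row $i$, taking the boxes from right to left and, within each box, the entries from largest to smallest; then list the pivots of the boxes of row $i$ from left to right, except that the pivot of box $(i,j)$ is omitted whenever $(i-1,j)\in\lambda/\mu$ and this pivot equals $\max T(i-1,j)$. A word $w_1\cdots w_r$ is a reverse lattice word if for every $k$ and all $a<b$, the suffix $w_k\cdots w_r$ contains at least as many letters $a$ as letters $b$. -}

module Defs where

open import Data.Nat using (ℕ; zero; suc; _+_; _*_; _∸_; _≤_; _⊔_; _⊓_; _≡ᵇ_; _<ᵇ_; _≤ᵇ_)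
open import Data.Bool using (Bool; true; false; _∧_; _∨_; not; if_then_else_)
open import Data.List using (List; []; _∷_; map; _++_; concat; concatMap; foldr; length; reverse; drop; upTo)
open import Data.Nat.ListAction using (sum)
open import Data.Vec using (Vec; tabulate; toList)
import Data.Vec as Vec
open import Data.Fin using (Fin; toℕ)
open import Data.Product using (_×_)

atD : {A : Set} → List A → ℕ → A → A
atD []       _       d = d
atD (x ∷ xs) zero    d = x
atD (x ∷ xs) (suc i) d = atD xs i d

at : List ℕ → ℕ → ℕ
at xs i = atD xs i 0

countB : {A : Set} → (A → Bool) → List A → ℕ
countB p []       = 0
countB p (x ∷ xs) = if p x then suc (countB p xs) else countB p xs

allB : {A : Set} → (A → Bool) → List A → Bool
allB p []       = true
allB p (x ∷ xs) = p x ∧ allB p xs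

anyB : {A : Set} → (A → Bool) → List A → Bool
anyB p []       = false
anyB p (x ∷ xs) = p x ∨ anyB p xs

filterB : {A : Set} → (A → Bool) → List A → List A
filterB p []       = []
filterB p (x ∷ xs) = if p x then x ∷ filterB p xs else filterB p xs

sublists : {A : Set} → List A → List (List A)
sublists []       = [] ∷ []
sublists (x ∷ xs) = map (x ∷_) (sublists xs) ++ sublists xs

allLists : {A : Set} → List A → ℕ → List (List A)
allLists xs zero    = [] ∷ []
allLists xs (suc k) = concatMap (λ x → map (x ∷_) (allLists xs k)) xs

allVecs : {A : Set} → List A → (k : ℕ) → List (Vec A k)
allVecs xs zero    = Vec.[] ∷ []
allVecs xs (suc k) = concatMap (λ x → map (x Vec.∷_) (allVecs xs k)) xs

cartesian : {A : Set} → List (List A) → List (List A)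
cartesian []         = [] ∷ []
cartesian (xs ∷ xss) = concatMap (λ x → map (x ∷_) (cartesian xss)) xs

range1 : ℕ → List ℕ
range1 n = map suc (upTo n)

eqVecᵇ : {k : ℕ} → Vec ℕ k → Vec ℕ k → Bool
eqVecᵇ Vec.[]       Vec.[]       = true
eqVecᵇ (x Vec.∷ xs) (y Vec.∷ ys) = (x ≡ᵇ y) ∧ eqVecᵇ xs ys

maxL : List ℕ → ℕ
maxL = foldr _⊔_ 0

minL : List ℕ → ℕ
minL []       = 0
minL (x ∷ xs) = foldr _⊓_ x xs

memB : ℕ → List ℕ → Bool
memB k S = anyB (k ≡ᵇ_) S

-- Partitions and skew shapes.
-- A partition is a list of naturals, read with trailing zeros, that is
-- weakly decreasing.  Rows/columns are 0-indexed internally: row r of the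
-- code is row r+1 of the paper, column j of the code is column j+1.

IsPartition : List ℕ → Set
IsPartition xs = ∀ i → at xs (suc i) ≤ at xs i

IsSkewShape : List ℕ → List ℕ → Set
IsSkewShape la mu = IsPartition la × IsPartition mu × (∀ i → at mu i ≤ at la i)

suffixes : List ℕ → List (List ℕ)
suffixes []       = [] ∷ []
suffixes (x ∷ xs) = (x ∷ xs) ∷ suffixes xs

occ : ℕ → List ℕ → ℕ
occ a w = countB (a ≡ᵇ_) w

-- every suffix contains at least as many a's as b's, for all positive a < b.
-- (letters b larger than the maximal letter m of w occur 0 times, so it
-- suffices to let a, b range over [1..m].)
isRevLattice : List ℕ → Bool
isRevLattice w =
  allB (λ s → allB (λ a → allB (λ b → not (a <ᵇ b) ∨ (occ b s ≤ᵇ occ a s))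
                                (range1 (maxL w)))
                   (range1 (maxL w)))
       (suffixes w)

-- Set-valued fillings of λ/μ with entries in [n].
-- A filling is a list of rows; row r is the list of its boxes from left to
-- right (columns μ_r, ..., λ_r - 1); each box holds a finite set of
-- positive integers, represented as a strictly increasing list.

Filling : Set
Filling = List (List (List ℕ))

module _ (n : ℕ) (la mu : List ℕ) where

  numRows : ℕ
  numRows = length la

  numCols : ℕ
  numCols = at la 0

  rowsR : List ℕ
  rowsR = upTo numRows

  colsR : List ℕ
  colsR = upTo numCols

  inShape : ℕ → ℕ → Bool
  inShape r j = (at mu r ≤ᵇ j) ∧ (j <ᵇ at la r)

  -- the set in box (r , j) (meaningful when inShape r j)
  get : Filling → ℕ → ℕ → List ℕ
  get T r j = atD (atD T r []) (j ∸ at mu r) []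

  subsetsN : List (List ℕ)
  subsetsN = filterB (λ { [] → false ; (_ ∷ _) → true }) (sublists (range1 n))

  fillings : List Filling
  fillings = cartesian (map (λ r → allLists subsetsN (at la r ∸ at mu r)) rowsR)

  leSet : List ℕ → List ℕ → Bool
  leSet A B = maxL A ≤ᵇ minL B

  isSVRPP : Filling → Bool
  isSVRPP T = allB (λ r → allB (λ j →
      (not (inShape r j ∧ inShape r (suc j)) ∨ leSet (get T r j) (get T r (suc j)))
    ∧ (not (inShape r j ∧ inShape (suc r) j) ∨ leSet (get T r j) (get T (suc r) j)))
    colsR) rowsR

  -- ircont restricted to x_1..x_n (entries lie in [n]); component k-1 is r_k
  ircont : Filling → Vec ℕ n
  ircont T = tabulate (λ i → countB (λ j →
      anyB (λ r → inShape r j ∧ memB (suc (toℕ i)) (get T r j)) rowsR) colsR)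

  -- ceq; component r is c_{r+1}
  ceq : Filling → Vec ℕ numRows
  ceq T = tabulate (λ i → countB (λ j →
      inShape (toℕ i) j ∧ inShape (suc (toℕ i)) j
    ∧ (maxL (get T (toℕ i) j) ≡ᵇ minL (get T (suc (toℕ i)) j))) colsR)

  -- ex; component r is e_{r+1}
  ex : Filling → Vec ℕ numRows
  ex T = tabulate (λ i → sum (map (λ j →
      if inShape (toℕ i) j then length (get T (toℕ i) j) ∸ 1 else 0) colsR))

  rowCols : ℕ → List ℕ
  rowCols r = map (at mu r +_) (upTo (at la r ∸ at mu r))

  omitPivot : Filling → ℕ → ℕ → Bool
  omitPivot T zero    j = false
  omitPivot T (suc r) j = inShape r j ∧ (minL (get T (suc r) j) ≡ᵇ maxL (get T r j))

  rowWord : Filling → ℕ → List ℕ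
  rowWord T r =
    concatMap (λ j → reverse (drop 1 (get T r j))) (reverse (rowCols r))
    ++ concatMap (λ j → if omitPivot T r j then [] else minL (get T r j) ∷ []) (rowCols r)

  readWord : Filling → List ℕ
  readWord T = concatMap (rowWord T) (reverse rowsR)

  -- coefficient of x^α t^γ w^θ in G_{λ/μ}(x_n; t; w)
  coeffG : Vec ℕ n → Vec ℕ numRows → Vec ℕ numRows → ℕ
  coeffG α γ θ = countB (λ T → isSVRPP T ∧ eqVecᵇ (ircont T) α
                              ∧ eqVecᵇ (ceq T) γ ∧ eqVecᵇ (ex T) θ) fillings

  H : Vec ℕ n → Vec ℕ numRows → Vec ℕ numRows → ℕ
  H ν γ θ = countB (λ T → isSVRPP T ∧ eqVecᵇ (ircont T) ν
                          ∧ eqVecᵇ (ceq T) γ ∧ eqVecᵇ (ex T) θ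
                          ∧ isRevLattice (readWord T)) fillings

module _ (n : ℕ) where

  tabFillings : Vec ℕ n → List (List (List ℕ))
  tabFillings ν = map (λ r → at (toList ν) r) (upTo n) |> λ lens →
                  cartesian (map (allLists (range1 n)) lens)
    where
      _|>_ : {A B : Set} → A → (A → B) → B
      x |> f = f x

  isSSYT : Vec ℕ n → List (List ℕ) → Bool
  isSSYT ν S = allB (λ r → allB (λ j →
      (not (inν r j ∧ inν r (suc j)) ∨ (g r j ≤ᵇ g r (suc j)))
    ∧ (not (inν r j ∧ inν (suc r) j) ∨ (g r j <ᵇ g (suc r) j)))
    (upTo (at (toList ν) 0))) (upTo n)
    where
      inν : ℕ → ℕ → Bool
      inν r j = j <ᵇ at (toList ν) r
      g : ℕ → ℕ → ℕ
      g r j = at (atD S r []) j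

  content : List (List ℕ) → Vec ℕ n
  content S = tabulate (λ i → countB (suc (toℕ i) ≡ᵇ_) (concat S))

  schurCoeff : Vec ℕ n → Vec ℕ n → ℕ
  schurCoeff ν α = countB (λ S → isSSYT ν S ∧ eqVecᵇ (content S) α) (tabFillings ν)

  partitionsBounded : ℕ → List (Vec ℕ n)
  partitionsBounded c = filterB (λ v → allB (λ i → at (toList v) (suc i) ≤ᵇ at (toList v) i) (upTo n))
                                (allVecs (upTo (suc c)) n)

{-# OPTIONS --safe #-}

-- Fix a letter i and match every i + 1 of a word with the nearest free i to its right; the operator f raises the
-- rightmost unmatched i, and e is its inverse.  Both lift from reading words to fillings, preserving ceq and ex: in a
-- row only the boundary between the entries ≤ i and those ≥ i + 1 moves, by one step, and the rows below follow as
-- long as the prescribed number of vertical equalities ties them to it.  A filling is determined by its reading word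
-- once ceq and ex are fixed, so the fillings with given ceq and ex become a set of words closed under e and f.
-- For such a set, reflecting the i-string through the first violation of the lattice condition is a sign-reversing
-- involution, whence the sum of the alternants of weight + δ over all words reduces to the lattice words.  The
-- semistandard tableaux of shape ν are the case of the shape ν / ∅ with ceq = ex = 0, whose only lattice word has
-- weight ν.  The difference of the two sides of the theorem is therefore a symmetric function all of whose products
-- with alternants vanish, and such a function is zero.

module Submission where

-- Moving one entry of a filling can break the order with the row below or change the number of
-- equalities there, and the repair must not alter the word of that lower row. So boxes are never
-- edited: a row is replaced by two functions, the columns `y k` reached by minima at most `k` and
-- the bits `ε k` of the non-pivot entries. A non-pivot fits into only one box, so nothing is lost,
-- and order, equalities and omitted pivots become linear relations between `y` and the thresholds
-- `x` of the row above; hence the decision procedure for linear arithmetic. The repair rests on an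
-- invariant: the columns between the thresholds for `i - 1` and `i` never outnumber the letters `i`
-- left unmatched in the word of that row and the rows above it. Whenever the boundary moves this is
-- an equality, and it forces an affected lower row to gain and lose one vertical equality at once,
-- so that its word stays the same. A word determines the profiles because shape, `ceq` and `ex` fix
-- the length of every row's word.

module LIA where
  -- Linear arithmetic over ℕ by refutation: the negated formula is split into systems of linear constraints, each of
  -- which is refuted by Gauss and Fourier–Motzkin elimination.
  open import Defs using (filterB; anyB)
  open import Data.Nat using (ℕ; zero; suc; _+_; _*_; _∸_; _⊓_; _≤_; _<_; _≤?_; z≤n)
  import Data.Nat.Properties as ℕ
  open import Data.Integer as ℤ using (ℤ; +_; -[1+_]; 0ℤ; +≤+)
  import Data.Integer.Properties as ℤ
  open import Data.Integer.Tactic.RingSolver using (solve-∀)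
  open import Data.Bool using (Bool; true; false; _∧_; _∨_; not; if_then_else_; T)
  open import Data.Vec as Vec using (Vec; []; _∷_; zipWith; lookup)
  open import Data.Vec.N-ary using (N-ary; _$ⁿ_)
  open import Data.Fin as Fin using (Fin; zero; suc)
  open import Data.List using (List; []; _∷_; _++_; map; concatMap; length)
  open import Data.List.Relation.Unary.All as All using (All; []; _∷_)
  open import Data.List.Relation.Unary.All.Properties as All using ()
  open import Data.List.Relation.Unary.Any as Any using (Any; here; there)
  open import Data.List.Relation.Unary.Any.Properties as Any using ()
  open import Data.Product using (_×_; _,_; proj₁; proj₂)
  open import Data.Sum using (_⊎_; inj₁; inj₂)
  open import Data.Empty using (⊥; ⊥-elim)
  open import Data.Unit using (tt)
  open import Relation.Nullary using (¬_; Dec; yes; no)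
  open import Relation.Nullary.Decidable using (_×-dec_; _⊎-dec_; _→-dec_)
  open import Relation.Binary.PropositionalEquality hiding ([_])
  open import Relation.Binary.Definitions using (tri<; tri≈; tri>)
  open import Function using (_∘_)

  infixl 7 _:∸_ _:⊓_
  infixl 6 _:+_
  infix 4 _:≤_ _:<_ _:≡_
  infixr 3 _:∧_
  infixr 2 _:∨_
  infixr 1 _⇒_

  data Term (n : ℕ) : Set where
    var            : Fin n → Term n
    #_             : ℕ → Term n
    _:+_ _:∸_ _:⊓_ : Term n → Term n → Term n

  data Formula (n : ℕ) : Set where
    _:≤_ _:≡_       : Term n → Term n → Formula n
    _:∧_ _:∨_ _⇒_   : Formula n → Formula n → Formula n
    :⊥              : Formula n

  _:<_ : ∀ {n} → Term n → Term n → Formula n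
  s :< t = (# 1 :+ s) :≤ t

  ⟦_⟧ₜ : ∀ {n} → Term n → Vec ℕ n → ℕ
  ⟦ var i ⟧ₜ ρ  = lookup ρ i
  ⟦ # k ⟧ₜ ρ    = k
  ⟦ s :+ t ⟧ₜ ρ = ⟦ s ⟧ₜ ρ + ⟦ t ⟧ₜ ρ
  ⟦ s :∸ t ⟧ₜ ρ = ⟦ s ⟧ₜ ρ ∸ ⟦ t ⟧ₜ ρ
  ⟦ s :⊓ t ⟧ₜ ρ = ⟦ s ⟧ₜ ρ ⊓ ⟦ t ⟧ₜ ρ

  ⟦_⟧ : ∀ {n} → Formula n → Vec ℕ n → Set
  ⟦ s :≤ t ⟧ ρ = ⟦ s ⟧ₜ ρ ≤ ⟦ t ⟧ₜ ρ
  ⟦ s :≡ t ⟧ ρ = ⟦ s ⟧ₜ ρ ≡ ⟦ t ⟧ₜ ρ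
  ⟦ φ :∧ ψ ⟧ ρ = ⟦ φ ⟧ ρ × ⟦ ψ ⟧ ρ
  ⟦ φ :∨ ψ ⟧ ρ = ⟦ φ ⟧ ρ ⊎ ⟦ ψ ⟧ ρ
  ⟦ φ ⇒ ψ ⟧ ρ  = ⟦ φ ⟧ ρ → ⟦ ψ ⟧ ρ
  ⟦ :⊥ ⟧ ρ     = ⊥

  -- Decidability turns a refutation of the negated formula into a proof of the formula; it also
  -- decides which branch of an implication is to be expanded.
  dec : ∀ {n} (φ : Formula n) ρ → Dec (⟦ φ ⟧ ρ)
  dec (s :≤ t) ρ = _ ≤? _
  dec (s :≡ t) ρ = _ ℕ.≟ _
  dec (φ :∧ ψ) ρ = dec φ ρ ×-dec dec ψ ρ
  dec (φ :∨ ψ) ρ = dec φ ρ ⊎-dec dec ψ ρ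
  dec (φ ⇒ ψ) ρ  = dec φ ρ →-dec dec ψ ρ
  dec :⊥ ρ       = no λ ()

  -- Linear forms: the head is the constant term.
  Lin : ℕ → Set
  Lin n = Vec ℤ (suc n)

  dot : ∀ {n} → Vec ℤ n → Vec ℕ n → ℤ
  dot []       []      = 0ℤ
  dot (c ∷ cs) (x ∷ ρ) = c ℤ.* + x ℤ.+ dot cs ρ

  eval : ∀ {n} → Lin n → Vec ℕ n → ℤ
  eval l ρ = dot l (1 ∷ ρ)

  comb : ∀ {n} → ℤ → Vec ℤ n → ℤ → Vec ℤ n → Vec ℤ n
  comb p l q m = zipWith (λ c d → p ℤ.* c ℤ.+ q ℤ.* d) l m

  dot-comb : ∀ {n} p (l : Vec ℤ n) q m ρ → dot (comb p l q m) ρ ≡ p ℤ.* dot l ρ ℤ.+ q ℤ.* dot m ρ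
  dot-comb p []      q []      []      = sym (cong₂ ℤ._+_ (ℤ.*-zeroʳ p) (ℤ.*-zeroʳ q))
  dot-comb p (c ∷ l) q (d ∷ m) (x ∷ ρ) rewrite dot-comb p l q m ρ = lemma p q c d (+ x) (dot l ρ) (dot m ρ)
    where
    lemma : ∀ p q c d x a b → (p ℤ.* c ℤ.+ q ℤ.* d) ℤ.* x ℤ.+ (p ℤ.* a ℤ.+ q ℤ.* b)
          ≡ p ℤ.* (c ℤ.* x ℤ.+ a) ℤ.+ q ℤ.* (d ℤ.* x ℤ.+ b)
    lemma = solve-∀

  data Con (n : ℕ) : Set where
    ≥0 ≡0 : Lin n → Con n

  Holds : ∀ {n} → Vec ℕ n → Con n → Set
  Holds ρ (≥0 l) = 0ℤ ℤ.≤ eval l ρ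
  Holds ρ (≡0 l) = eval l ρ ≡ 0ℤ

  zeroL : ∀ {n} → Vec ℤ n
  zeroL = Vec.replicate _ 0ℤ

  dot-zero : ∀ {n} (ρ : Vec ℕ n) → dot zeroL ρ ≡ 0ℤ
  dot-zero []      = refl
  dot-zero (x ∷ ρ) = trans (ℤ.+-identityˡ _) (dot-zero ρ)

  constL : ∀ {n} → ℤ → Lin n
  constL c = c ∷ zeroL

  eval-const : ∀ {n} c (ρ : Vec ℕ n) → eval (constL c) ρ ≡ c
  eval-const c ρ rewrite dot-zero ρ = trans (ℤ.+-identityʳ _) (ℤ.*-identityʳ c)

  unit : ∀ {n} → Fin n → Vec ℤ n
  unit zero    = ℤ.1ℤ ∷ zeroL
  unit (suc i) = 0ℤ ∷ unit i

  dot-unit : ∀ {n} (i : Fin n) ρ → dot (unit i) ρ ≡ + lookup ρ i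
  dot-unit zero    (x ∷ ρ) rewrite dot-zero ρ = trans (ℤ.+-identityʳ _) (ℤ.*-identityˡ _)
  dot-unit (suc i) (x ∷ ρ) = trans (ℤ.+-identityˡ _) (dot-unit i ρ)

  _⊕_ _⊖_ : ∀ {n} → Lin n → Lin n → Lin n
  _⊕_ = zipWith ℤ._+_
  _⊖_ = zipWith ℤ._-_

  dot-⊕ : ∀ {n} (l m : Vec ℤ n) ρ → dot (zipWith ℤ._+_ l m) ρ ≡ dot l ρ ℤ.+ dot m ρ
  dot-⊕ []      []      []      = refl
  dot-⊕ (c ∷ l) (d ∷ m) (x ∷ ρ) rewrite dot-⊕ l m ρ = lemma c d (+ x) (dot l ρ) (dot m ρ)
    where
    lemma : ∀ c d x a b → (c ℤ.+ d) ℤ.* x ℤ.+ (a ℤ.+ b) ≡ (c ℤ.* x ℤ.+ a) ℤ.+ (d ℤ.* x ℤ.+ b)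
    lemma = solve-∀

  dot-⊖ : ∀ {n} (l m : Vec ℤ n) ρ → dot (zipWith ℤ._-_ l m) ρ ≡ dot l ρ ℤ.- dot m ρ
  dot-⊖ []      []      []      = refl
  dot-⊖ (c ∷ l) (d ∷ m) (x ∷ ρ) rewrite dot-⊖ l m ρ = lemma c d (+ x) (dot l ρ) (dot m ρ)
    where
    lemma : ∀ c d x a b → (c ℤ.- d) ℤ.* x ℤ.+ (a ℤ.- b) ≡ (c ℤ.* x ℤ.+ a) ℤ.- (d ℤ.* x ℤ.+ b)
    lemma = solve-∀

  -- A term is linear on each of finitely many regions; the listed alternatives cover all cases of ∸ and ⊓.
  Pieces : ℕ → Set
  Pieces n = List (List (Con n) × Lin n)

  linearise : ∀ {n} → Term n → Pieces n
  combine : ∀ {n} → (List (Con n) × Lin n → List (Con n) × Lin n → Pieces n) → Pieces n → Pieces n → Pieces n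
  combine f ps qs = concatMap (λ p → concatMap (f p) qs) ps

  plusP minusP minP : ∀ {n} → List (Con n) × Lin n → List (Con n) × Lin n → Pieces n
  plusP  (c , l) (d , m) = (c ++ d , l ⊕ m) ∷ []
  minusP (c , l) (d , m) = (≥0 (l ⊖ m) ∷ c ++ d , l ⊖ m) ∷ (≥0 (m ⊖ l) ∷ c ++ d , constL 0ℤ) ∷ []
  minP   (c , l) (d , m) = (≥0 (l ⊖ m) ∷ c ++ d , m) ∷ (≥0 (m ⊖ l) ∷ c ++ d , l) ∷ []

  linearise (var i)  = ([] , 0ℤ ∷ unit i) ∷ []
  linearise (# k)    = ([] , constL (+ k)) ∷ []
  linearise (s :+ t) = combine plusP (linearise s) (linearise t)
  linearise (s :∸ t) = combine minusP (linearise s) (linearise t)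
  linearise (s :⊓ t) = combine minP (linearise s) (linearise t)

  Piece : ∀ {n} → Vec ℕ n → ℕ → List (Con n) × Lin n → Set
  Piece ρ v (c , l) = All (Holds ρ) c × eval l ρ ≡ + v

  combine-sound : ∀ {n} {ρ : Vec ℕ n} {u v w} {f : List (Con n) × Lin n → List (Con n) × Lin n → Pieces n} →
    (∀ {p q} → Piece ρ u p → Piece ρ v q → Any (Piece ρ w) (f p q)) →
    ∀ {ps qs} → Any (Piece ρ u) ps → Any (Piece ρ v) qs → Any (Piece ρ w) (combine f ps qs)
  combine-sound {f = f} h a b =
    Any.concatMap⁺ _ (Any.map (λ pu → Any.concatMap⁺ _ (Any.map (λ pv → h pu pv) b)) a)

  diff≥0 : ∀ {n} {ρ : Vec ℕ n} (l m : Lin n) {u v} → eval l ρ ≡ + u → eval m ρ ≡ + v → v ≤ u → 0ℤ ℤ.≤ eval (l ⊖ m) ρ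
  diff≥0 {ρ = ρ} l m {u} {v} p q v≤u rewrite dot-⊖ l m (1 ∷ ρ) | p | q = ℤ.i≤j⇒0≤j-i (+≤+ v≤u)

  linearise-sound : ∀ {n} (t : Term n) ρ → Any (Piece ρ (⟦ t ⟧ₜ ρ)) (linearise t)
  linearise-sound (var i) ρ = here ([] , trans (ℤ.+-identityˡ _) (dot-unit i ρ))
  linearise-sound (# k) ρ = here ([] , eval-const (+ k) ρ)
  linearise-sound (s :+ t) ρ = combine-sound
    (λ {p} {q} (c , e) (d , e′) → here (All.++⁺ c d , trans (dot-⊕ (proj₂ p) (proj₂ q) (1 ∷ ρ)) (cong₂ ℤ._+_ e e′)))
    (linearise-sound s ρ) (linearise-sound t ρ)
  linearise-sound (s :∸ t) ρ = combine-sound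
    (λ {p} {q} (c , e) (d , e′) → split p q c e d e′ (ℕ.≤-total (⟦ t ⟧ₜ ρ) (⟦ s ⟧ₜ ρ)))
    (linearise-sound s ρ) (linearise-sound t ρ)
    where
    split : ∀ p q (c : All (Holds ρ) (proj₁ p)) (e : eval (proj₂ p) ρ ≡ + ⟦ s ⟧ₜ ρ)
            (d : All (Holds ρ) (proj₁ q)) (e′ : eval (proj₂ q) ρ ≡ + ⟦ t ⟧ₜ ρ) →
            ⟦ t ⟧ₜ ρ ≤ ⟦ s ⟧ₜ ρ ⊎ ⟦ s ⟧ₜ ρ ≤ ⟦ t ⟧ₜ ρ → Any (Piece ρ (⟦ s ⟧ₜ ρ ∸ ⟦ t ⟧ₜ ρ)) (minusP p q)
    split p q c e d e′ (inj₁ h) = here (diff≥0 (proj₂ p) (proj₂ q) e e′ h ∷ All.++⁺ c d ,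
      trans (dot-⊖ (proj₂ p) (proj₂ q) (1 ∷ ρ)) (trans (cong₂ ℤ._-_ e e′) (trans (ℤ.[+m]-[+n]≡m⊖n (⟦ s ⟧ₜ ρ) (⟦ t ⟧ₜ ρ)) (ℤ.⊖-≥ h))))
    split p q c e d e′ (inj₂ h) = there (here (diff≥0 (proj₂ q) (proj₂ p) e′ e h ∷ All.++⁺ c d ,
      trans (eval-const 0ℤ ρ) (cong +_ (sym (ℕ.m≤n⇒m∸n≡0 h)))))
  linearise-sound (s :⊓ t) ρ = combine-sound
    (λ {p} {q} (c , e) (d , e′) → split p q c e d e′ (ℕ.≤-total (⟦ t ⟧ₜ ρ) (⟦ s ⟧ₜ ρ)))
    (linearise-sound s ρ) (linearise-sound t ρ)
    where
    split : ∀ p q (c : All (Holds ρ) (proj₁ p)) (e : eval (proj₂ p) ρ ≡ + ⟦ s ⟧ₜ ρ)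
            (d : All (Holds ρ) (proj₁ q)) (e′ : eval (proj₂ q) ρ ≡ + ⟦ t ⟧ₜ ρ) →
            ⟦ t ⟧ₜ ρ ≤ ⟦ s ⟧ₜ ρ ⊎ ⟦ s ⟧ₜ ρ ≤ ⟦ t ⟧ₜ ρ → Any (Piece ρ (⟦ s ⟧ₜ ρ ⊓ ⟦ t ⟧ₜ ρ)) (minP p q)
    split p q c e d e′ (inj₁ h) = here (diff≥0 (proj₂ p) (proj₂ q) e e′ h ∷ All.++⁺ c d ,
      trans e′ (cong +_ (sym (ℕ.m≥n⇒m⊓n≡n h))))
    split p q c e d e′ (inj₂ h) = there (here (diff≥0 (proj₂ q) (proj₂ p) e′ e h ∷ All.++⁺ c d ,
      trans e (cong +_ (sym (ℕ.m≤n⇒m⊓n≡m h)))))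

  Cases : ℕ → Set
  Cases n = List (List (Con n))

  AnyCase : ∀ {n} → Vec ℕ n → Cases n → Set
  AnyCase ρ = Any (All (Holds ρ))

  both : ∀ {n} → Cases n → Cases n → Cases n
  both cs ds = concatMap (λ c → map (c ++_) ds) cs

  both-sound : ∀ {n} {ρ : Vec ℕ n} {cs ds} → AnyCase ρ cs → AnyCase ρ ds → AnyCase ρ (both cs ds)
  both-sound a b = Any.concatMap⁺ _ (Any.map (λ hc → Any.map⁺ (Any.map (All.++⁺ hc) b)) a)

  relate : ∀ {n} → (Lin n → Con n) → Term n → Term n → Cases n
  relate k s t = concatMap (λ (c , l) → map (λ (d , m) → k (m ⊖ l) ∷ c ++ d) (linearise t)) (linearise s)

  relate-sound : ∀ {n} (k : Lin n → Con n) (s t : Term n) ρ →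
    (∀ l m → eval l ρ ≡ + ⟦ s ⟧ₜ ρ → eval m ρ ≡ + ⟦ t ⟧ₜ ρ → Holds ρ (k (m ⊖ l))) → AnyCase ρ (relate k s t)
  relate-sound k s t ρ h = Any.concatMap⁺ _ (Any.map
    (λ {(_ , l)} (c , e) → Any.map⁺ (Any.map (λ {(_ , m)} (d , e′) → h l m e e′ ∷ All.++⁺ c d) (linearise-sound t ρ)))
    (linearise-sound s ρ))

  leq eqn : ∀ {n} → Term n → Term n → Cases n
  leq = relate ≥0
  eqn = relate ≡0

  leq-sound : ∀ {n} (s t : Term n) ρ → ⟦ s ⟧ₜ ρ ≤ ⟦ t ⟧ₜ ρ → AnyCase ρ (leq s t)
  leq-sound s t ρ h = relate-sound ≥0 s t ρ (λ l m e e′ → diff≥0 m l e′ e h)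

  eqn-sound : ∀ {n} (s t : Term n) ρ → ⟦ s ⟧ₜ ρ ≡ ⟦ t ⟧ₜ ρ → AnyCase ρ (eqn s t)
  eqn-sound s t ρ h = relate-sound ≡0 s t ρ (λ l m e e′ → trans (dot-⊖ m l (1 ∷ ρ))
    (trans (cong₂ ℤ._-_ e′ e) (ℤ.i≡j⇒i-j≡0 (cong +_ (sym h)))))

  -- Disjunctive normal forms of a formula and of its negation, produced together so that the two
  -- sides of an implication can call each other. A failing equation splits into two strict
  -- inequalities, written with `1 +` over ℕ.
  holdsCases failsCases : ∀ {n} → Formula n → Cases n
  holdsCases (s :≤ t) = leq s t
  holdsCases (s :≡ t) = eqn s t
  holdsCases (φ :∧ ψ) = both (holdsCases φ) (holdsCases ψ)
  holdsCases (φ :∨ ψ) = holdsCases φ ++ holdsCases ψ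
  holdsCases (φ ⇒ ψ)  = failsCases φ ++ holdsCases ψ
  holdsCases :⊥       = []
  failsCases (s :≤ t) = leq (# 1 :+ t) s
  failsCases (s :≡ t) = leq (# 1 :+ t) s ++ leq (# 1 :+ s) t
  failsCases (φ :∧ ψ) = failsCases φ ++ failsCases ψ
  failsCases (φ :∨ ψ) = both (failsCases φ) (failsCases ψ)
  failsCases (φ ⇒ ψ)  = both (holdsCases φ) (failsCases ψ)
  failsCases :⊥       = [] ∷ []

  holds-sound : ∀ {n} (φ : Formula n) ρ → ⟦ φ ⟧ ρ → AnyCase ρ (holdsCases φ)
  fails-sound : ∀ {n} (φ : Formula n) ρ → ¬ ⟦ φ ⟧ ρ → AnyCase ρ (failsCases φ)
  holds-sound (s :≤ t) ρ h = leq-sound s t ρ h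
  holds-sound (s :≡ t) ρ h = eqn-sound s t ρ h
  holds-sound (φ :∧ ψ) ρ (h , k) = both-sound (holds-sound φ ρ h) (holds-sound ψ ρ k)
  holds-sound (φ :∨ ψ) ρ (inj₁ h) = Any.++⁺ˡ (holds-sound φ ρ h)
  holds-sound (φ :∨ ψ) ρ (inj₂ h) = Any.++⁺ʳ _ (holds-sound ψ ρ h)
  holds-sound (φ ⇒ ψ) ρ h with dec φ ρ
  ... | yes p = Any.++⁺ʳ _ (holds-sound ψ ρ (h p))
  ... | no ¬p = Any.++⁺ˡ (fails-sound φ ρ ¬p)
  fails-sound (s :≤ t) ρ h = leq-sound (# 1 :+ t) s ρ (ℕ.≰⇒> h)
  fails-sound (s :≡ t) ρ h with ℕ.<-cmp (⟦ s ⟧ₜ ρ) (⟦ t ⟧ₜ ρ)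
  ... | tri< lt _ _ = Any.++⁺ʳ _ (leq-sound (# 1 :+ s) t ρ lt)
  ... | tri≈ _ eq _ = ⊥-elim (h eq)
  ... | tri> _ _ gt = Any.++⁺ˡ (leq-sound (# 1 :+ t) s ρ gt)
  fails-sound (φ :∧ ψ) ρ h with dec φ ρ
  ... | yes p = Any.++⁺ʳ _ (fails-sound ψ ρ (h ∘ (p ,_)))
  ... | no ¬p = Any.++⁺ˡ (fails-sound φ ρ ¬p)
  fails-sound (φ :∨ ψ) ρ h = both-sound (fails-sound φ ρ (h ∘ inj₁)) (fails-sound ψ ρ (h ∘ inj₂))
  fails-sound (φ ⇒ ψ) ρ h with dec φ ρ
  ... | yes p = both-sound (holds-sound φ ρ p) (fails-sound ψ ρ (λ q → h (λ _ → q)))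
  ... | no ¬p = ⊥-elim (h (⊥-elim ∘ ¬p))
  fails-sound :⊥ ρ h = here []

  nonPos nonNeg nonZero : ℤ → Bool
  nonPos (+ 0)      = true
  nonPos (+ suc _)  = false
  nonPos -[1+ _ ]   = true
  nonNeg (+ _)      = true
  nonNeg -[1+ _ ]   = false
  nonZero (+ 0)     = false
  nonZero _         = true

  allV : ∀ {n} → (ℤ → Bool) → Vec ℤ n → Bool
  allV p []       = true
  allV p (c ∷ cs) = p c ∧ allV p cs

  -- The variables range over ℕ: a negative constant with no positive coefficient is never
  -- nonnegative, and a form without negative coefficients always is. Forms of the second kind are
  -- discarded to keep the elimination small.
  absurdL trivialL : ∀ {n} → Lin n → Bool
  absurdL (+ _ ∷ _)       = false
  absurdL (-[1+ _ ] ∷ cs) = allV nonPos cs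
  trivialL = allV nonNeg

  dot-nonPos : ∀ {n} (cs : Vec ℤ n) ρ → T (allV nonPos cs) → dot cs ρ ℤ.≤ 0ℤ
  dot-nonPos [] [] _ = ℤ.≤-refl
  dot-nonPos (+ 0 ∷ cs) (x ∷ ρ) h = ℤ.+-mono-≤ (ℤ.≤-refl {0ℤ}) (dot-nonPos cs ρ h)
  dot-nonPos (-[1+ k ] ∷ cs) (x ∷ ρ) h =
    ℤ.+-mono-≤ (ℤ.≤-trans (ℤ.*-monoʳ-≤-nonNeg (+ x) (ℤ.-≤+ {k} {0})) ℤ.≤-refl) (dot-nonPos cs ρ h)

  absurd-sound : ∀ {n} (l : Lin n) ρ → T (absurdL l) → ¬ (0ℤ ℤ.≤ eval l ρ)
  absurd-sound (-[1+ k ] ∷ cs) ρ h 0≤ = ℤ.<⇒≱ neg 0≤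
    where
    neg : eval (-[1+ k ] ∷ cs) ρ ℤ.< 0ℤ
    neg = ℤ.+-mono-<-≤ (subst (ℤ._< 0ℤ) (sym (ℤ.*-identityʳ -[1+ k ])) ℤ.-<+) (dot-nonPos cs ρ h)

  coef : ∀ {n} → Fin n → Lin n → ℤ
  coef i (_ ∷ cs) = lookup cs i

  abs : ℤ → ℤ
  abs c = + ℤ.∣ c ∣

  -- If `c` and `d` are the coefficients of the pivot variable in the equation `e` and in `m`, then
  -- `abs c * m + signed c d * e` is free of that variable. The factor of `m` is nonnegative, so the
  -- step is sound for inequalities too, while an equation may be scaled by either sign.
  signed : ℤ → ℤ → ℤ
  signed (+ _)    d = ℤ.- d
  signed -[1+ _ ] d = d

  NN : ∀ {n} → Vec ℕ n → Lin n → Set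
  NN ρ l = 0ℤ ℤ.≤ eval l ρ

  scale≥0 : ∀ c {x} → 0ℤ ℤ.≤ x → 0ℤ ℤ.≤ abs c ℤ.* x
  scale≥0 c {x} h = subst (ℤ._≤ abs c ℤ.* x) (ℤ.*-zeroʳ (abs c)) (ℤ.*-monoˡ-≤-nonNeg (abs c) h)

  comb≥0 : ∀ {n} p q (l m : Lin n) ρ → NN ρ l → NN ρ m → NN ρ (comb (abs p) l (abs q) m)
  comb≥0 p q l m ρ h k = subst (0ℤ ℤ.≤_) (sym (dot-comb (abs p) l (abs q) m (1 ∷ ρ)))
    (ℤ.+-mono-≤ (scale≥0 p h) (scale≥0 q k))

  combEq : ∀ {n} p q (l m : Lin n) ρ → NN ρ l → eval m ρ ≡ 0ℤ → NN ρ (comb (abs p) l q m)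
  combEq p q l m ρ h k = subst (0ℤ ℤ.≤_) (sym (trans (dot-comb (abs p) l q m (1 ∷ ρ))
    (trans (cong (λ z → abs p ℤ.* eval l ρ ℤ.+ q ℤ.* z) k)
    (trans (cong (λ z → abs p ℤ.* eval l ρ ℤ.+ z) (ℤ.*-zeroʳ q)) (ℤ.+-identityʳ _))))) (scale≥0 p h)

  combEqs : ∀ {n} p q (l m : Lin n) ρ → eval l ρ ≡ 0ℤ → eval m ρ ≡ 0ℤ → eval (comb p l q m) ρ ≡ 0ℤ
  combEqs p q l m ρ h k = trans (dot-comb p l q m (1 ∷ ρ))
    (trans (cong₂ (λ y z → p ℤ.* y ℤ.+ q ℤ.* z) h k) (cong₂ ℤ._+_ (ℤ.*-zeroʳ p) (ℤ.*-zeroʳ q)))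

  All-filterB : ∀ {A : Set} {P : A → Set} (p : A → Bool) {xs} → All P xs → All P (filterB p xs)
  All-filterB p [] = []
  All-filterB p (_∷_ {x} h hs) with p x
  ... | true  = h ∷ All-filterB p hs
  ... | false = All-filterB p hs

  variable≥0 : ∀ {n} (i : Fin n) ρ → NN ρ (0ℤ ∷ unit i)
  variable≥0 i ρ = subst (0ℤ ℤ.≤_) (sym (trans (ℤ.+-identityˡ _) (dot-unit i ρ))) (+≤+ z≤n)

  -- Fourier–Motzkin elimination of one variable, the constraint "variable ≥ 0" being implicit.
  eliminate : ∀ {n} → Fin n → List (Lin n) → List (Lin n)
  eliminate i cs = filterB (not ∘ trivialL)
    (filterB (λ l → not (nonZero (coef i l))) cs
     ++ map (λ m → comb (abs ℤ.1ℤ) m (abs (coef i m)) (0ℤ ∷ unit i)) negs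
     ++ concatMap (λ l → map (λ m → comb (abs (coef i m)) l (abs (coef i l)) m) negs) poss)
    where
    poss = filterB (λ l → not (nonPos (coef i l))) cs
    negs = filterB (λ l → not (nonNeg (coef i l))) cs

  eliminate-sound : ∀ {n} (i : Fin n) {cs} ρ → All (NN ρ) cs → All (NN ρ) (eliminate i cs)
  eliminate-sound i {cs} ρ h = All-filterB _ (All.++⁺ (All-filterB _ h) (All.++⁺
    (All.map⁺ (All.map (λ {m} hm → comb≥0 ℤ.1ℤ (coef i m) m (0ℤ ∷ unit i) ρ hm (variable≥0 i ρ)) negs))
    (All.concat⁺ (All.map⁺ (All.map (λ {l} hl → All.map⁺ (All.map
      (λ {m} hm → comb≥0 (coef i m) (coef i l) l m ρ hl hm) negs)) poss)))))
    where
    poss = All-filterB (λ l → not (nonPos (coef i l))) h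
    negs = All-filterB (λ l → not (nonNeg (coef i l))) h

  -- The number of pairs that elimination would combine. The penalty 1000 puts variables that do not
  -- occur last, since eliminating them only uses up fuel.
  cost : ∀ {n} → Fin n → List (Lin n) → ℕ
  cost i cs = p * q + (if anyB (λ l → nonZero (coef i l)) cs then 0 else 1000)
    where
    p = length (filterB (λ l → not (nonPos (coef i l))) cs)
    q = length (filterB (λ l → not (nonNeg (coef i l))) cs)

  cheapest : ∀ {n m} → Fin n → ℕ → Vec (Fin n) m → List (Lin n) → Fin n
  cheapest i c []       cs = i
  cheapest i c (j ∷ js) cs with cost j cs
  ... | d = if d Data.Nat.<ᵇ c then cheapest j d js cs else cheapest i c js cs

  fm : ∀ {n} → ℕ → List (Lin n) → Bool
  fm zero    cs = anyB absurdL cs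
  fm {zero}  (suc k) cs = anyB absurdL cs
  fm {suc n} (suc k) cs = anyB absurdL cs ∨ fm k (eliminate (cheapest zero 2000 (Vec.allFin _) cs) cs)

  any-absurd : ∀ {n} (cs : List (Lin n)) ρ → T (anyB absurdL cs) → ¬ All (NN ρ) cs
  any-absurd (l ∷ cs) ρ t (h ∷ hs) with absurdL l in eq
  ... | true  = absurd-sound l ρ (subst T (sym eq) tt) h
  ... | false = any-absurd cs ρ t hs

  fm-sound : ∀ {n} k (cs : List (Lin n)) ρ → T (fm k cs) → ¬ All (NN ρ) cs
  fm-sound zero    cs ρ t h = any-absurd cs ρ t h
  fm-sound {zero}  (suc k) cs ρ t h = any-absurd cs ρ t h
  fm-sound {suc n} (suc k) cs ρ t h with anyB absurdL cs in eq
  ... | true  = any-absurd cs ρ (subst T (sym eq) tt) h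
  ... | false = fm-sound k _ ρ t (eliminate-sound (cheapest zero 2000 (Vec.allFin _) cs) ρ h)

  pivot : ∀ {n m} → Vec (Fin n) m → Lin n → Fin n → Fin n
  pivot []       l d = d
  pivot (i ∷ is) l d = if nonZero (coef i l) then i else pivot is l d

  gauss : ∀ {n} → ℕ → List (Lin n) → List (Lin n) → Bool
  gauss {n} zero _ cs = fm n cs
  gauss {n} (suc k) [] cs = fm n cs
  gauss {zero} (suc k) (e ∷ es) cs = fm 0 (e ∷ comb (ℤ.- ℤ.1ℤ) e 0ℤ e ∷ cs)
  gauss {suc n} (suc k) (e ∷ es) cs with pivot (Vec.allFin _) e zero
  ... | i = if nonZero (coef i e)
            then gauss k (map (λ m → comb (abs (coef i e)) m (signed (coef i e) (coef i m)) e) es)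
                         (filterB (not ∘ trivialL)
                           -- Once the pivot variable has been substituted, its implicit bound `≥ 0`
                           -- would be lost; it is therefore added to the inequalities before the
                           -- substitution.
                           (map (λ m → comb (abs (coef i e)) m (signed (coef i e) (coef i m)) e) ((0ℤ ∷ unit i) ∷ cs)))
            -- An equation without variables survives as two opposite inequalities, one of which is
            -- absurd if its constant is nonzero.
            else gauss k es (e ∷ comb (ℤ.- ℤ.1ℤ) e 0ℤ e ∷ cs)

  eq⇒NN : ∀ {n} (e : Lin n) ρ → eval e ρ ≡ 0ℤ → NN ρ e
  eq⇒NN e ρ h = ℤ.≤-reflexive (sym h)

  twoSided : ∀ {n} (e : Lin n) ρ {cs} → eval e ρ ≡ 0ℤ → All (NN ρ) cs →
             All (NN ρ) (e ∷ comb (ℤ.- ℤ.1ℤ) e 0ℤ e ∷ cs)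
  twoSided e ρ {cs} h hs = _∷_ {P = NN ρ} {x = e} (eq⇒NN e ρ h)
    (_∷_ {P = NN ρ} {x = comb (ℤ.- ℤ.1ℤ) e 0ℤ e}
      (eq⇒NN (comb (ℤ.- ℤ.1ℤ) e 0ℤ e) ρ (combEqs (ℤ.- ℤ.1ℤ) 0ℤ e e ρ h h)) hs)

  gauss-sound : ∀ {n} k (es cs : List (Lin n)) ρ → T (gauss k es cs) →
                All (λ e → eval e ρ ≡ 0ℤ) es → ¬ All (NN ρ) cs
  gauss-sound {n} zero es cs ρ t he h = fm-sound n cs ρ t h
  gauss-sound {n} (suc k) [] cs ρ t he h = fm-sound n cs ρ t h
  gauss-sound {zero} (suc k) (e ∷ es) cs ρ t (h₀ ∷ he) h = fm-sound 0 _ ρ t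
    (twoSided e ρ h₀ h)
  gauss-sound {suc n} (suc k) (e ∷ es) cs ρ t (h₀ ∷ he) h with pivot (Vec.allFin _) e zero
  ... | i with nonZero (coef i e)
  ... | true = gauss-sound k _ _ ρ t
    (All.map⁺ (All.map (λ {m} hm → combEqs (abs (coef i e)) (signed (coef i e) (coef i m)) m e ρ hm h₀) he))
    (All-filterB (not ∘ trivialL)
      (All.map⁺ (All.map (λ {m} hm → combEq (coef i e) (signed (coef i e) (coef i m)) m e ρ hm h₀) (variable≥0 i ρ ∷ h))))
  ... | false = gauss-sound k es _ ρ t he
    (twoSided e ρ h₀ h)

  equations inequalities : ∀ {n} → List (Con n) → List (Lin n)
  equations []          = []
  equations (≥0 l ∷ cs) = equations cs
  equations (≡0 l ∷ cs) = l ∷ equations cs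
  inequalities []          = []
  inequalities (≥0 l ∷ cs) = l ∷ inequalities cs
  inequalities (≡0 l ∷ cs) = inequalities cs

  equations-hold : ∀ {n} {ρ : Vec ℕ n} {cs} → All (Holds ρ) cs → All (λ e → eval e ρ ≡ 0ℤ) (equations cs)
  equations-hold [] = []
  equations-hold {cs = ≥0 _ ∷ _} (h ∷ hs) = equations-hold hs
  equations-hold {cs = ≡0 _ ∷ _} (h ∷ hs) = h ∷ equations-hold hs

  inequalities-hold : ∀ {n} {ρ : Vec ℕ n} {cs} → All (Holds ρ) cs → All (NN ρ) (inequalities cs)
  inequalities-hold [] = []
  inequalities-hold {cs = ≥0 _ ∷ _} (h ∷ hs) = h ∷ inequalities-hold hs
  inequalities-hold {cs = ≡0 _ ∷ _} (h ∷ hs) = inequalities-hold hs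

  refuted : ∀ {n} → List (Con n) → Bool
  refuted cs = gauss (length (equations cs)) (equations cs) (inequalities cs)

  allRefuted : ∀ {n} → Cases n → Bool
  allRefuted []       = true
  allRefuted (c ∷ cs) = refuted c ∧ allRefuted cs

  allRefuted-sound : ∀ {n} (cs : Cases n) ρ → T (allRefuted cs) → ¬ AnyCase ρ cs
  allRefuted-sound (c ∷ cs) ρ t (here h) with refuted c in eq
  ... | true = gauss-sound (length (equations c)) _ _ ρ (subst T (sym eq) tt) (equations-hold h) (inequalities-hold h)
  allRefuted-sound (c ∷ cs) ρ t (there h) with refuted c
  ... | true = allRefuted-sound cs ρ t h

  valid : ∀ {n} → Formula n → Bool
  valid φ = allRefuted (failsCases φ)

  valid-sound : ∀ {n} (φ : Formula n) ρ → T (valid φ) → ⟦ φ ⟧ ρ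
  valid-sound φ ρ t with dec φ ρ
  ... | yes p = p
  ... | no ¬p = ⊥-elim (allRefuted-sound _ ρ t (fails-sound φ ρ ¬p))

  close : ∀ {n} → N-ary n (Term n) (Formula n) → Formula n
  close {n} f = f $ⁿ Vec.map var (Vec.allFin n)

  -- The validity premise is proved by `refl`, so type checking runs the procedure. Nonlinear
  -- subterms, such as counts of letters or products, enter as entries of `ρ` and are treated as
  -- atoms.
  lia : ∀ {n} (ρ : Vec ℕ n) (f : N-ary n (Term n) (Formula n)) → valid (close f) ≡ true → ⟦ close f ⟧ ρ
  lia ρ f eq = valid-sound (close f) ρ (subst T (sym eq) tt)

-- Words, the bracketing rule for the letters i and i + 1, and its operators.

module Words where
  open import Defs using (occ)
  open LIA
  open import Data.Nat using (ℕ; zero; suc; _+_; _∸_; _≤_; _<_; z≤n; s≤s; _≟_; _≡ᵇ_)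
  import Data.Nat.Properties as ℕ
  open import Data.Bool using (true; false; T)
  open import Data.List using (List; []; _∷_)
  open import Data.List.Relation.Unary.All using (All; []; _∷_)
  open import Data.Maybe using (Maybe; just; nothing)
  open import Data.Vec using ([]; _∷_)
  open import Data.Product using (_×_; _,_; proj₁; proj₂)
  open import Data.Sum using (inj₁; inj₂)
  open import Data.Empty using (⊥-elim)
  open import Data.Unit using (tt)
  open import Relation.Nullary using (yes; no)
  open import Relation.Binary.PropositionalEquality hiding ([_])

  Word : Set
  Word = List ℕ

  ≡ᵇ-refl : ∀ m → (m ≡ᵇ m) ≡ true
  ≡ᵇ-refl zero    = refl
  ≡ᵇ-refl (suc m) = ≡ᵇ-refl m

  ≢⇒≡ᵇ : ∀ {m k} → m ≢ k → (m ≡ᵇ k) ≡ false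
  ≢⇒≡ᵇ {m} {k} h with m ≡ᵇ k in eq
  ... | true  = ⊥-elim (h (ℕ.≡ᵇ⇒≡ m k (subst T (sym eq) tt)))
  ... | false = refl

  data Kind : Set where
    lo hi other : Kind

  kind : ℕ → ℕ → Kind
  kind i c with c ≟ i | c ≟ suc i
  ... | yes _ | _     = lo
  ... | no _  | yes _ = hi
  ... | no _  | no _  = other

  data KindView (i : ℕ) : ℕ → Kind → Set where
    lo    : KindView i i lo
    hi    : KindView i (suc i) hi
    other : ∀ {c} → c ≢ i → c ≢ suc i → KindView i c other

  kindView : ∀ i c → KindView i c (kind i c)
  kindView i c with c ≟ i | c ≟ suc i
  ... | yes refl | _        = lo
  ... | no _     | yes refl = hi
  ... | no p     | no q     = other p q

  kind-lo : ∀ i → kind i i ≡ lo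
  kind-lo i with kind i i | kindView i i
  ... | .lo    | lo        = refl
  ... | .other | other p _ = ⊥-elim (p refl)

  kind-hi : ∀ i → kind i (suc i) ≡ hi
  kind-hi i with kind i (suc i) | kindView i (suc i)
  ... | .hi    | hi        = refl
  ... | .other | other _ q = ⊥-elim (q refl)

  kind-other : ∀ {i c} → c ≢ i → c ≢ suc i → kind i c ≡ other
  kind-other {i} {c} p q with kind i c | kindView i c
  ... | .lo    | lo        = ⊥-elim (p refl)
  ... | .hi    | hi        = ⊥-elim (q refl)
  ... | .other | other _ _ = refl

  -- Every letter i + 1 is matched with the nearest free letter i to its right;
  -- A i and B i count the unmatched letters i and i + 1.
  stepA : Kind → ℕ → ℕ
  stepA lo    a = suc a
  stepA hi    a = a ∸ 1
  stepA other a = a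

  stepB : Kind → ℕ → ℕ → ℕ
  stepB lo    a       b = b
  stepB hi    zero    b = suc b
  stepB hi    (suc a) b = b
  stepB other a       b = b

  A : ℕ → Word → ℕ
  A i []      = 0
  A i (c ∷ w) = stepA (kind i c) (A i w)

  B : ℕ → Word → ℕ
  B i []      = 0
  B i (c ∷ w) = stepB (kind i c) (A i w) (B i w)

  -- f raises the rightmost unmatched i, e lowers the leftmost unmatched i + 1.
  stepF stepE : Kind → ℕ → ℕ → ℕ → Word → Word → Word
  stepF lo    zero    i c w r = suc i ∷ w
  stepF lo    (suc _) i c w r = c ∷ r
  stepF hi    _       i c w r = c ∷ r
  stepF other _       i c w r = c ∷ r
  stepE hi    zero    i c w r = i ∷ w
  stepE hi    (suc _) i c w r = c ∷ r
  stepE lo    _       i c w r = c ∷ r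
  stepE other _       i c w r = c ∷ r

  f e : ℕ → Word → Word
  f i []      = []
  f i (c ∷ w) = stepF (kind i c) (A i w) i c w (f i w)
  e i []      = []
  e i (c ∷ w) = stepE (kind i c) (A i w) i c w (e i w)

  -- No `i` is free to the right of the rightmost unmatched one, so after it is raised the new
  -- `i + 1` is unmatched and all matched pairs stay as they were.
  AB-f : ∀ i w {a} → A i w ≡ suc a → A i (f i w) ≡ a × B i (f i w) ≡ suc (B i w)
  AB-f i (c ∷ w) h with kind i c in k | kindView i c
  AB-f i (.i ∷ w) h | .lo | lo with A i w in eq
  AB-f i (.i ∷ w) refl | .lo | lo | zero rewrite kind-hi i | eq = refl , refl
  AB-f i (.i ∷ w) refl | .lo | lo | suc a with AB-f i w eq
  ... | p , q rewrite k | p | q = refl , refl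
  AB-f i (.(suc i) ∷ w) h | .hi | hi with A i w in eq
  AB-f i (.(suc i) ∷ w) refl | .hi | hi | suc (suc a) with AB-f i w eq
  ... | p , q rewrite k | p | q = refl , refl
  AB-f i (c ∷ w) h | .other | other _ _ with AB-f i w h
  ... | p , q rewrite k | p | q = refl , refl

  AB-e : ∀ i w {b} → B i w ≡ suc b → A i (e i w) ≡ suc (A i w) × B i (e i w) ≡ b
  AB-e i (c ∷ w) h with kind i c in k | kindView i c
  AB-e i (.i ∷ w) h | .lo | lo with AB-e i w h
  ... | p , q rewrite k | p | q = refl , refl
  AB-e i (.(suc i) ∷ w) h | .hi | hi with A i w in eq
  AB-e i (.(suc i) ∷ w) refl | .hi | hi | zero rewrite kind-lo i | eq = refl , refl
  AB-e i (.(suc i) ∷ w) h | .hi | hi | suc a with AB-e i w h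
  ... | p , q rewrite k | p | q | eq = refl , refl
  AB-e i (c ∷ w) h | .other | other _ _ with AB-e i w h
  ... | p , q rewrite k | p | q = refl , refl

  e-f : ∀ i w {a} → A i w ≡ suc a → e i (f i w) ≡ w
  e-f i (c ∷ w) h with kind i c in k | kindView i c
  e-f i (.i ∷ w) h | .lo | lo with A i w in eq
  ... | zero rewrite kind-hi i | eq = refl
  ... | suc a rewrite k = cong (i ∷_) (e-f i w eq)
  e-f i (.(suc i) ∷ w) h | .hi | hi with A i w in eq
  e-f i (.(suc i) ∷ w) refl | .hi | hi | suc (suc a) rewrite k | proj₁ (AB-f i w eq) = cong (suc i ∷_) (e-f i w eq)
  e-f i (c ∷ w) h | .other | other _ _ rewrite k = cong (c ∷_) (e-f i w h)

  f-e : ∀ i w {b} → B i w ≡ suc b → f i (e i w) ≡ w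
  f-e i (c ∷ w) h with kind i c in k | kindView i c
  f-e i (.i ∷ w) h | .lo | lo rewrite k | proj₁ (AB-e i w h) = cong (i ∷_) (f-e i w h)
  f-e i (.(suc i) ∷ w) h | .hi | hi with A i w in eq
  ... | zero rewrite kind-lo i | eq = refl
  ... | suc a rewrite k = cong (suc i ∷_) (f-e i w h)
  f-e i (c ∷ w) h | .other | other _ _ rewrite k = cong (c ∷_) (f-e i w h)

  occ-≡ : ∀ c w → occ c (c ∷ w) ≡ suc (occ c w)
  occ-≡ c w rewrite ≡ᵇ-refl c = refl

  occ-≢ : ∀ {k c} w → k ≢ c → occ k (c ∷ w) ≡ occ k w
  occ-≢ w h rewrite ≢⇒≡ᵇ h = refl

  occ-∷ : ∀ k c w w′ → occ k w ≡ occ k w′ → occ k (c ∷ w) ≡ occ k (c ∷ w′)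
  occ-∷ k c w w′ h with k ≡ᵇ c
  ... | true  = cong suc h
  ... | false = h

  -- Both `occ i w - A i w` and `occ (suc i) w - B i w` count the matched pairs; the identity is
  -- arranged to avoid subtraction.
  occ-balance : ∀ i w → occ i w + B i w ≡ A i w + occ (suc i) w
  occ-balance i [] = refl
  occ-balance i (c ∷ w) with kind i c | kindView i c
  ... | .lo | lo rewrite occ-≡ i w | occ-≢ w (λ (p : suc i ≡ i) → ℕ.1+n≢n p) = cong suc (occ-balance i w)
  ... | .other | other p q rewrite occ-≢ w (≢-sym p) | occ-≢ w (≢-sym q) = occ-balance i w
  ... | .hi | hi with A i w | occ-balance i w
  ...   | zero  | ih rewrite occ-≡ (suc i) w | occ-≢ w (λ (p : i ≡ suc i) → ℕ.1+n≢n (sym p)) = trans (ℕ.+-suc _ _) (cong suc ih)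
  ...   | suc a | ih rewrite occ-≡ (suc i) w | occ-≢ w (λ (p : i ≡ suc i) → ℕ.1+n≢n (sym p)) = trans ih (sym (ℕ.+-suc a _))

  occ-f-other : ∀ i w k → k ≢ i → k ≢ suc i → occ k (f i w) ≡ occ k w
  occ-f-other i [] k p q = refl
  occ-f-other i (c ∷ w) k p q with kind i c | kindView i c
  ... | .hi | hi = occ-∷ k (suc i) (f i w) w (occ-f-other i w k p q)
  ... | .other | other _ _ = occ-∷ k c (f i w) w (occ-f-other i w k p q)
  ... | .lo | lo with A i w
  ...   | zero  = trans (occ-≢ w q) (sym (occ-≢ w p))
  ...   | suc _ = occ-∷ k i (f i w) w (occ-f-other i w k p q)

  occ-f-sum : ∀ i w → occ i (f i w) + occ (suc i) (f i w) ≡ occ i w + occ (suc i) w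
  occ-f-sum i [] = refl
  occ-f-sum i (c ∷ w) with kind i c | kindView i c
  ... | .hi | hi rewrite occ-≡ (suc i) w | occ-≡ (suc i) (f i w)
                       | occ-≢ w (λ (p : i ≡ suc i) → ℕ.1+n≢n (sym p))
                       | occ-≢ (f i w) (λ (p : i ≡ suc i) → ℕ.1+n≢n (sym p)) =
    trans (ℕ.+-suc _ _) (trans (cong suc (occ-f-sum i w)) (sym (ℕ.+-suc _ _)))
  ... | .other | other p q rewrite occ-≢ w (≢-sym p) | occ-≢ w (≢-sym q)
                                 | occ-≢ (f i w) (≢-sym p) | occ-≢ (f i w) (≢-sym q) = occ-f-sum i w
  ... | .lo | lo with A i w
  ...   | zero rewrite occ-≡ (suc i) w | occ-≢ w (λ (p : i ≡ suc i) → ℕ.1+n≢n (sym p))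
                     | occ-≡ i w | occ-≢ w (λ (p : suc i ≡ i) → ℕ.1+n≢n p) = ℕ.+-suc _ _
  ...   | suc _ rewrite occ-≡ i w | occ-≢ w (λ (p : suc i ≡ i) → ℕ.1+n≢n p)
                      | occ-≡ i (f i w) | occ-≢ (f i w) (λ (p : suc i ≡ i) → ℕ.1+n≢n p) = cong suc (occ-f-sum i w)

  -- The letter i for which the shortest suffix violating the lattice condition has more letters i + 1 than i.
  extend : ℕ → (ℕ → ℕ) → Maybe ℕ → Maybe ℕ
  extend c             a (just i) = just i
  extend 0             a nothing  = nothing
  extend 1             a nothing  = nothing
  extend (suc (suc j)) a nothing  with a (suc j)
  ... | zero  = just (suc j)
  ... | suc _ = nothing

  violation : Word → Maybe ℕ
  violation []      = nothing
  violation (c ∷ w) = extend c (λ i → A i w) (violation w)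

  B-mono : ∀ i c w → B i w ≤ B i (c ∷ w)
  B-mono i c w with kind i c
  ... | lo    = ℕ.≤-refl
  ... | other = ℕ.≤-refl
  ... | hi with A i w
  ...   | zero  = ℕ.n≤1+n _
  ...   | suc _ = ℕ.≤-refl

  -- Without a violation every letter `j + 2` met a free `j + 1` when it was added, so none of them
  -- is left unmatched.
  violation-nothing : ∀ w → violation w ≡ nothing → ∀ j → B (suc j) w ≡ 0
  violation-nothing [] h j = refl
  violation-nothing (c ∷ w) h j with violation w in eq
  violation-nothing (zero ∷ w) h j | nothing = violation-nothing w eq j
  violation-nothing (suc zero ∷ w) h j | nothing with kind (suc j) 1 | kindView (suc j) 1
  ... | .lo | lo = violation-nothing w eq j
  ... | .other | other _ _ = violation-nothing w eq j
  violation-nothing (suc (suc k) ∷ w) h j | nothing with A (suc k) w in eqA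
  violation-nothing (suc (suc k) ∷ w) h j | nothing | suc a with kind (suc j) (suc (suc k)) | kindView (suc j) (suc (suc k))
  ... | .lo | lo = violation-nothing w eq j
  ... | .other | other _ _ = violation-nothing w eq j
  ... | .hi | hi rewrite eqA = violation-nothing w eq j

  violation-just : ∀ w {i} → violation w ≡ just i → 1 ≤ i × 1 ≤ B i w
  violation-just (c ∷ w) h with violation w in eq
  violation-just (c ∷ w) refl | just i with violation-just w eq
  ... | p , q = p , ℕ.≤-trans q (B-mono i c w)
  violation-just (suc (suc k) ∷ w) h | nothing with A (suc k) w in eqA
  violation-just (suc (suc k) ∷ w) refl | nothing | zero rewrite kind-hi (suc k) | eqA = s≤s z≤n , s≤s z≤n

  violation-bound : ∀ w {i n} → violation w ≡ just i → All (_≤ n) w → suc i ≤ n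
  violation-bound (c ∷ w) h (_ ∷ bs) with violation w in eq
  violation-bound (c ∷ w) refl (_ ∷ bs) | just i = violation-bound w eq bs
  violation-bound (suc (suc k) ∷ w) h (b ∷ bs) | nothing with A (suc k) w
  violation-bound (suc (suc k) ∷ w) refl (b ∷ bs) | nothing | zero = b

  -- The shortest violating suffix contains no unmatched `i`. The raised letter therefore lies to
  -- its left, and the suffix is untouched.
  violation-f : ∀ w {i} → violation w ≡ just i → ∀ {a} → A i w ≡ suc a → violation (f i w) ≡ just i
  violation-f (c ∷ w) {i} h hA with violation w in eq
  violation-f (c ∷ w) {i} refl hA | just i with kind i c | kindView i c
  ... | .other | other _ _ rewrite violation-f w eq hA = refl
  ... | .hi | hi with A i w in eqA
  violation-f (c ∷ w) {i} refl refl | just i | .hi | hi | suc (suc a) rewrite violation-f w eq eqA = refl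
  violation-f (c ∷ w) {i} refl hA | just i | .lo | lo with A i w in eqA
  ... | zero rewrite eq = refl
  ... | suc a rewrite violation-f w eq eqA = refl
  violation-f (suc (suc k) ∷ w) h hA | nothing with A (suc k) w in eqA
  violation-f (suc (suc k) ∷ w) refl hA | nothing | zero rewrite kind-hi (suc k) | eqA = ⊥-elim (0≢suc hA)
    where
    0≢suc : ∀ {a} → 0 ≢ suc a
    0≢suc ()

  -- The letter that starts the violating suffix is the rightmost unmatched `i + 1`. A second
  -- unmatched one lies further left, and that side is where `e` acts.
  violation-e : ∀ w {i} → violation w ≡ just i → ∀ {b} → B i w ≡ suc (suc b) → violation (e i w) ≡ just i
  violation-e (c ∷ w) {i} h hB with violation w in eq
  violation-e (c ∷ w) {i} refl hB | just i with kind i c | kindView i c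
  ... | .other | other _ _ rewrite violation-e w eq hB = refl
  ... | .lo | lo rewrite violation-e w eq hB = refl
  ... | .hi | hi with A i w
  ...   | zero rewrite eq = refl
  ...   | suc a rewrite violation-e w eq hB = refl
  violation-e (suc (suc k) ∷ w) h hB | nothing with A (suc k) w in eqA
  violation-e (suc (suc k) ∷ w) refl hB | nothing | zero
    rewrite kind-hi (suc k) | eqA | violation-nothing w eq k with hB
  ... | ()

  fs es : ℕ → ℕ → Word → Word
  fs i zero    w = w
  fs i (suc k) w = f i (fs i k w)
  es i zero    w = w
  es i (suc k) w = e i (es i k w)

  AB-fs : ∀ i k w → k ≤ A i w → A i (fs i k w) ≡ A i w ∸ k × B i (fs i k w) ≡ B i w + k
  AB-fs i zero    w h = refl , sym (ℕ.+-identityʳ _)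
  AB-fs i (suc k) w h with AB-fs i k w (ℕ.<⇒≤ h)
  ... | p , q with AB-f i (fs i k w) {A i w ∸ suc k}
                   (trans p (lia (A i w ∷ k ∷ []) (λ a k → (# 1 :+ k) :≤ a ⇒ a :∸ k :≡ # 1 :+ (a :∸ (# 1 :+ k))) refl h))
  ... | p′ , q′ = p′ , trans q′ (trans (cong suc q) (sym (ℕ.+-suc _ k)))

  AB-es : ∀ i k w → k ≤ B i w → A i (es i k w) ≡ A i w + k × B i (es i k w) ≡ B i w ∸ k
  AB-es i zero    w h = sym (ℕ.+-identityʳ _) , refl
  AB-es i (suc k) w h with AB-es i k w (ℕ.<⇒≤ h)
  ... | p , q with AB-e i (es i k w) {B i w ∸ suc k}
                   (trans q (lia (B i w ∷ k ∷ []) (λ a k → (# 1 :+ k) :≤ a ⇒ a :∸ k :≡ # 1 :+ (a :∸ (# 1 :+ k))) refl h))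
  ... | p′ , q′ = trans p′ (trans (cong suc p) (sym (ℕ.+-suc _ k))) , q′

  suc-∸1 : ∀ {m} → 1 ≤ m → m ≡ suc (m ∸ 1)
  suc-∸1 {m} h = lia (m ∷ []) (λ m → # 1 :≤ m ⇒ m :≡ # 1 :+ (m :∸ # 1)) refl h

  fs-shift : ∀ i k w → fs i k (f i w) ≡ f i (fs i k w)
  fs-shift i zero    w = refl
  fs-shift i (suc k) w = cong (f i) (fs-shift i k w)

  es-shift : ∀ i k w → es i k (e i w) ≡ e i (es i k w)
  es-shift i zero    w = refl
  es-shift i (suc k) w = cong (e i) (es-shift i k w)

  es-fs : ∀ i k w → k ≤ A i w → es i k (fs i k w) ≡ w
  es-fs i zero    w h = refl
  es-fs i (suc k) w h = trans (sym (es-shift i k _)) (trans (cong (es i k) (e-f i (fs i k w)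
    (suc-∸1 (subst (1 ≤_) (sym (proj₁ (AB-fs i k w (ℕ.<⇒≤ h)))) (ℕ.m<n⇒0<n∸m h)))))
    (es-fs i k w (ℕ.<⇒≤ h)))

  fs-es : ∀ i k w → k ≤ B i w → fs i k (es i k w) ≡ w
  fs-es i zero    w h = refl
  fs-es i (suc k) w h = trans (sym (fs-shift i k _)) (trans (cong (fs i k) (f-e i (es i k w)
    (suc-∸1 (subst (1 ≤_) (sym (proj₂ (AB-es i k w (ℕ.<⇒≤ h)))) (ℕ.m<n⇒0<n∸m h)))))
    (fs-es i k w (ℕ.<⇒≤ h)))

  -- The element of the i-string of w with exactly t unmatched letters i.
  to : ℕ → ℕ → Word → Word
  to i t w = es i (t ∸ A i w) (fs i (A i w ∸ t) w)

  module _ (i t : ℕ) (w : Word) (bound : t ≤ A i w + B i w) where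
    private
      a = A i w
      b = B i w
      t∸a≤b : t ∸ a ≤ b
      t∸a≤b = lia (t ∷ a ∷ b ∷ []) (λ t a b → t :≤ a :+ b ⇒ t :∸ a :≤ b) refl bound
      F = AB-fs i (a ∸ t) w (ℕ.m∸n≤m a t)
      E = AB-es i (t ∸ a) (fs i (a ∸ t) w)
            (subst (t ∸ a ≤_) (sym (proj₂ F)) (ℕ.≤-trans t∸a≤b (ℕ.m≤m+n b (a ∸ t))))

    A-to : A i (to i t w) ≡ t
    A-to = trans (proj₁ E) (trans (cong (_+ (t ∸ a)) (proj₁ F))
      (lia (t ∷ a ∷ []) (λ t a → (a :∸ (a :∸ t)) :+ (t :∸ a) :≡ t) refl))

    B-to : B i (to i t w) ≡ a + b ∸ t
    B-to = trans (proj₂ E) (trans (cong (_∸ (t ∸ a)) (proj₂ F))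
      (lia (t ∷ a ∷ b ∷ []) (λ t a b → t :≤ a :+ b ⇒ (b :+ (a :∸ t)) :∸ (t :∸ a) :≡ (a :+ b) :∸ t) refl bound))

    to-to : to i a (to i t w) ≡ w
    to-to rewrite A-to with ℕ.≤-total a t
    ... | inj₁ h rewrite ℕ.m≤n⇒m∸n≡0 h = fs-es i (t ∸ a) w t∸a≤b
    ... | inj₂ h rewrite ℕ.m≤n⇒m∸n≡0 h = es-fs i (a ∸ t) w (ℕ.m∸n≤m a t)

  module _ {P : Word → Set} (i : ℕ)
           (closed-f : ∀ {w a} → P w → A i w ≡ suc a → P (f i w))
           (closed-e : ∀ {w b} → P w → B i w ≡ suc b → P (e i w)) where

    closed-fs : ∀ k {w} → P w → k ≤ A i w → P (fs i k w)
    closed-fs zero    h _ = h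
    closed-fs (suc k) {w} h b = closed-f (closed-fs k h (ℕ.<⇒≤ b))
      (suc-∸1 (subst (1 ≤_) (sym (proj₁ (AB-fs i k w (ℕ.<⇒≤ b)))) (ℕ.m<n⇒0<n∸m b)))

    closed-es : ∀ k {w} → P w → k ≤ B i w → P (es i k w)
    closed-es zero    h _ = h
    closed-es (suc k) {w} h b = closed-e (closed-es k h (ℕ.<⇒≤ b))
      (suc-∸1 (subst (1 ≤_) (sym (proj₂ (AB-es i k w (ℕ.<⇒≤ b)))) (ℕ.m<n⇒0<n∸m b)))

    closed-to : ∀ t w → P w → t ≤ A i w + B i w → P (to i t w)
    closed-to t w h b = closed-es (t ∸ A i w) (closed-fs (A i w ∸ t) h (ℕ.m∸n≤m (A i w) t))
      (subst (t ∸ A i w ≤_) (sym (proj₂ (AB-fs i (A i w ∸ t) w (ℕ.m∸n≤m (A i w) t))))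
        (lia (t ∷ A i w ∷ B i w ∷ []) (λ t a b → t :≤ a :+ b ⇒ t :∸ a :≤ b :+ (a :∸ t)) refl b))

  occ-e-other : ∀ i w k {b} → B i w ≡ suc b → k ≢ i → k ≢ suc i → occ k (e i w) ≡ occ k w
  occ-e-other i w k h p q = trans (sym (occ-f-other i (e i w) k p q)) (cong (occ k) (f-e i w h))

  occ-e-sum : ∀ i w {b} → B i w ≡ suc b → occ i (e i w) + occ (suc i) (e i w) ≡ occ i w + occ (suc i) w
  occ-e-sum i w h = trans (sym (occ-f-sum i (e i w))) (cong (λ v → occ i v + occ (suc i) v) (f-e i w h))

  module _ (i : ℕ) (w : Word) where

    occ-to-other : ∀ t k → t ≤ A i w + B i w → k ≢ i → k ≢ suc i → occ k (to i t w) ≡ occ k w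
    occ-to-other t k b p q = closed-to {P = λ v → occ k v ≡ occ k w} i
      (λ {v} h _ → trans (occ-f-other i v k p q) h)
      (λ {v} h x → trans (occ-e-other i v k x p q) h) t w refl b

    occ-to-sum : ∀ t → t ≤ A i w + B i w → occ i (to i t w) + occ (suc i) (to i t w) ≡ occ i w + occ (suc i) w
    occ-to-sum t b = closed-to {P = λ v → occ i v + occ (suc i) v ≡ occ i w + occ (suc i) w} i
      (λ {v} h _ → trans (occ-f-sum i v) h)
      (λ {v} h x → trans (occ-e-sum i v x) h) t w refl b

  -- The Lascoux-Schützenberger reflection, which reverses the `i`-string of the word.
  reflect : ℕ → Word → Word
  reflect i w = to i (B i w) w

  -- Sends multiplicities (p , q + 1) of i and i + 1 to (q , p + 1), which becomes an exchange after adding the staircase.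
  dotReflect : ℕ → Word → Word
  dotReflect i w = to i (B i w ∸ 1) w

  module _ (i : ℕ) (w : Word) where
    private
      a = A i w
      b = B i w
      b≤ : b ≤ a + b
      b≤ = ℕ.m≤n+m b a
      b-1≤ : b ∸ 1 ≤ a + b
      b-1≤ = ℕ.≤-trans (ℕ.m∸n≤m b 1) b≤

    reflect-involutive : reflect i (reflect i w) ≡ w
    reflect-involutive rewrite B-to i b w b≤ | ℕ.m+n∸n≡m a b = to-to i b w b≤

    -- The balances before and after the reflection, together with the constant sum of the two
    -- multiplicities, determine both of them linearly.
    occ-reflect : occ i (reflect i w) ≡ occ (suc i) w × occ (suc i) (reflect i w) ≡ occ i w
    occ-reflect = lia (occ i w ∷ occ (suc i) w ∷ a ∷ b ∷ occ i v ∷ occ (suc i) v ∷ A i v ∷ B i v ∷ [])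
      (λ p q a b p′ q′ a′ b′ → p :+ b :≡ a :+ q ⇒ p′ :+ b′ :≡ a′ :+ q′ ⇒ a′ :≡ b ⇒ b′ :≡ (a :+ b) :∸ b ⇒
        p′ :+ q′ :≡ p :+ q ⇒ (p′ :≡ q) :∧ (q′ :≡ p)) refl
      (occ-balance i w) (occ-balance i v) (A-to i b w b≤) (B-to i b w b≤) (occ-to-sum i w b b≤)
      where v = reflect i w

    occ-reflect-other : ∀ k → k ≢ i → k ≢ suc i → occ k (reflect i w) ≡ occ k w
    occ-reflect-other k = occ-to-other i w b k b≤

    occ-dotReflect : 1 ≤ b → suc (occ i (dotReflect i w)) ≡ occ (suc i) w × occ (suc i) (dotReflect i w) ≡ suc (occ i w)
    occ-dotReflect = lia (occ i w ∷ occ (suc i) w ∷ a ∷ b ∷ occ i v ∷ occ (suc i) v ∷ A i v ∷ B i v ∷ [])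
      (λ p q a b p′ q′ a′ b′ → p :+ b :≡ a :+ q ⇒ p′ :+ b′ :≡ a′ :+ q′ ⇒ a′ :≡ b :∸ # 1 ⇒ b′ :≡ (a :+ b) :∸ (b :∸ # 1) ⇒
        p′ :+ q′ :≡ p :+ q ⇒ # 1 :≤ b ⇒ (# 1 :+ p′ :≡ q) :∧ (q′ :≡ # 1 :+ p)) refl
      (occ-balance i w) (occ-balance i v) (A-to i (b ∸ 1) w b-1≤) (B-to i (b ∸ 1) w b-1≤) (occ-to-sum i w (b ∸ 1) b-1≤)
      where v = dotReflect i w

    occ-dotReflect-other : ∀ k → k ≢ i → k ≢ suc i → occ k (dotReflect i w) ≡ occ k w
    occ-dotReflect-other k = occ-to-other i w (b ∸ 1) k b-1≤

    dotReflect-involutive : 1 ≤ b → dotReflect i (dotReflect i w) ≡ w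
    dotReflect-involutive h = trans (cong (λ z → to i (z ∸ 1) (dotReflect i w)) (B-to i (b ∸ 1) w b-1≤))
      (trans (cong (λ z → to i z (dotReflect i w))
        (lia (a ∷ b ∷ []) (λ a b → # 1 :≤ b ⇒ ((a :+ b) :∸ (b :∸ # 1)) :∸ # 1 :≡ a) refl h))
        (to-to i (b ∸ 1) w b-1≤))

  -- Raising letters never disturbs the violating suffix. Lowering them does not either, because the
  -- target word keeps `A i w + 1` unmatched letters `i + 1`, so the last one is never lowered.
  violation-dotReflect : ∀ i w → violation w ≡ just i → violation (dotReflect i w) ≡ just i
  violation-dotReflect i w h = go
    where
    a = A i w
    b = B i w
    goF : ∀ k → k ≤ a → violation (fs i k w) ≡ just i
    goF zero    _  = h
    goF (suc k) k≤ = violation-f (fs i k w) (goF k (ℕ.<⇒≤ k≤))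
      (suc-∸1 (subst (1 ≤_) (sym (proj₁ (AB-fs i k w (ℕ.<⇒≤ k≤)))) (ℕ.m<n⇒0<n∸m k≤)))
    goE : ∀ v → violation v ≡ just i → ∀ k → k < B i v → violation (es i k v) ≡ just i
    goE v hv zero    _  = hv
    goE v hv (suc k) k< = violation-e (es i k v) (goE v hv k (ℕ.<⇒≤ k<)) {B i v ∸ suc (suc k)}
      (trans (proj₂ (AB-es i k v (ℕ.<⇒≤ (ℕ.<⇒≤ k<))))
        (lia (B i v ∷ k ∷ []) (λ b k → # 2 :+ k :≤ b ⇒ b :∸ k :≡ # 2 :+ (b :∸ (# 2 :+ k))) refl k<))
    go : violation (dotReflect i w) ≡ just i
    go = goE (fs i (a ∸ (b ∸ 1)) w) (goF _ (ℕ.m∸n≤m a (b ∸ 1))) ((b ∸ 1) ∸ a)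
      (subst ((b ∸ 1) ∸ a <_) (sym (proj₂ (AB-fs i (a ∸ (b ∸ 1)) w (ℕ.m∸n≤m a (b ∸ 1)))))
        (lia (a ∷ b ∷ []) (λ a b → # 1 :≤ b ⇒ (# 1 :+ ((b :∸ # 1) :∸ a)) :≤ b :+ (a :∸ (b :∸ # 1))) refl
          (proj₂ (violation-just w h))))

-- Signed sums over lists, involutions and bijections.

module Counting where
  open import Defs using (countB; filterB)
  open import Data.Nat using (suc)
  open import Data.Integer as ℤ using (ℤ; +_; 0ℤ; 1ℤ)
  import Data.Integer.Properties as ℤ
  open import Data.Integer.Tactic.RingSolver using (solve-∀)
  open import Data.Bool using (Bool; true; false; _∧_)
  open import Data.List using (List; []; _∷_; map)
  open import Data.List.Membership.Propositional using (_∈_)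
  open import Data.List.Membership.Propositional.Properties using (∈-map⁺; ∈-map⁻)
  open import Data.List.Membership.Propositional.Properties.WithK using (unique∧set⇒bag)
  open import Data.List.Relation.Unary.Any using (here; there)
  open import Data.List.Relation.Unary.All as All using (All; []; _∷_)
  import Data.List.Relation.Unary.All.Properties as All
  open import Data.List.Relation.Unary.AllPairs using ([]; _∷_)
  open import Data.List.Relation.Unary.Unique.Propositional using (Unique)
  open import Data.List.Relation.Binary.BagAndSetEquality using (∼bag⇒↭)
  open import Data.List.Relation.Binary.Permutation.Propositional using (_↭_; refl; prep; swap; trans)
  open import Data.Product using (_×_; _,_; proj₁)
  open import Function using (_∘_; mk⇔)
  open import Relation.Binary.PropositionalEquality hiding ([_]; trans)
  import Relation.Binary.PropositionalEquality as ≡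

  private variable
    X Y : Set

  ∑ : List X → (X → ℤ) → ℤ
  ∑ []       F = 0ℤ
  ∑ (x ∷ xs) F = F x ℤ.+ ∑ xs F

  ∑-cong : ∀ (xs : List X) {F G : X → ℤ} → (∀ {x} → x ∈ xs → F x ≡ G x) → ∑ xs F ≡ ∑ xs G
  ∑-cong []       h = refl
  ∑-cong (x ∷ xs) h = cong₂ ℤ._+_ (h (here refl)) (∑-cong xs (h ∘ there))

  ∑-zero : ∀ (xs : List X) → ∑ xs (λ _ → 0ℤ) ≡ 0ℤ
  ∑-zero []       = refl
  ∑-zero (x ∷ xs) = ≡.trans (ℤ.+-identityˡ _) (∑-zero xs)

  ∑-+ : ∀ (xs : List X) (F G : X → ℤ) → ∑ xs (λ x → F x ℤ.+ G x) ≡ ∑ xs F ℤ.+ ∑ xs G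
  ∑-+ []       F G = refl
  ∑-+ (x ∷ xs) F G rewrite ∑-+ xs F G = lemma (F x) (G x) (∑ xs F) (∑ xs G)
    where
    lemma : ∀ a b c d → (a ℤ.+ b) ℤ.+ (c ℤ.+ d) ≡ (a ℤ.+ c) ℤ.+ (b ℤ.+ d)
    lemma = solve-∀

  ∑-*ˡ : ∀ (xs : List X) c (F : X → ℤ) → ∑ xs (λ x → c ℤ.* F x) ≡ c ℤ.* ∑ xs F
  ∑-*ˡ []       c F = sym (ℤ.*-zeroʳ c)
  ∑-*ˡ (x ∷ xs) c F rewrite ∑-*ˡ xs c F = sym (ℤ.*-distribˡ-+ c (F x) (∑ xs F))

  ∑-*ʳ : ∀ (xs : List X) c (F : X → ℤ) → ∑ xs (λ x → F x ℤ.* c) ≡ ∑ xs F ℤ.* c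
  ∑-*ʳ []       c F = refl
  ∑-*ʳ (x ∷ xs) c F rewrite ∑-*ʳ xs c F = sym (ℤ.*-distribʳ-+ c (F x) (∑ xs F))

  ∑-neg : ∀ (xs : List X) (F : X → ℤ) → ∑ xs (λ x → ℤ.- F x) ≡ ℤ.- ∑ xs F
  ∑-neg []       F = refl
  ∑-neg (x ∷ xs) F rewrite ∑-neg xs F = sym (ℤ.neg-distrib-+ (F x) (∑ xs F))

  ∑-swap : ∀ (xs : List X) (ys : List Y) (F : X → Y → ℤ) →
           ∑ xs (λ x → ∑ ys (F x)) ≡ ∑ ys (λ y → ∑ xs (λ x → F x y))
  ∑-swap []       ys F = sym (∑-zero ys)
  ∑-swap (x ∷ xs) ys F rewrite ∑-swap xs ys F = sym (∑-+ ys (F x) (λ y → ∑ xs (λ x → F x y)))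

  ∑-map : ∀ (φ : X → Y) xs (F : Y → ℤ) → ∑ (map φ xs) F ≡ ∑ xs (F ∘ φ)
  ∑-map φ []       F = refl
  ∑-map φ (x ∷ xs) F = cong (λ z → F (φ x) ℤ.+ z) (∑-map φ xs F)

  ∑-↭ : ∀ {xs ys : List X} (F : X → ℤ) → xs ↭ ys → ∑ xs F ≡ ∑ ys F
  ∑-↭ F refl = refl
  ∑-↭ F (prep x p) = cong (λ z → F x ℤ.+ z) (∑-↭ F p)
  ∑-↭ F (swap {xs} {ys} x y p) rewrite ∑-↭ F p = lemma (F x) (F y) (∑ ys F)
    where
    lemma : ∀ a b c → a ℤ.+ (b ℤ.+ c) ≡ b ℤ.+ (a ℤ.+ c)
    lemma = solve-∀
  ∑-↭ F (trans p q) = ≡.trans (∑-↭ F p) (∑-↭ F q)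

  Unique-map : ∀ (φ : X → Y) {xs} → (∀ {x y} → x ∈ xs → y ∈ xs → φ x ≡ φ y → x ≡ y) → Unique xs → Unique (map φ xs)
  Unique-map φ {[]}     inj []       = []
  Unique-map φ {x ∷ xs} inj (p ∷ ps) =
    All.map⁺ (All.tabulate (λ y∈ eq → All.lookup p y∈ (inj (here refl) (there y∈) eq)))
    ∷ Unique-map φ (λ a b → inj (there a) (there b)) ps

  -- Lists without repetitions that have the same members are permutations of each other.
  bijection-↭ : ∀ (φ : X → Y) {xs ys} → Unique xs → Unique ys →
    (∀ {x} → x ∈ xs → φ x ∈ ys) →
    (∀ {x y} → x ∈ xs → y ∈ xs → φ x ≡ φ y → x ≡ y) →
    (∀ {y} → y ∈ ys → y ∈ map φ xs) → map φ xs ↭ ys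
  bijection-↭ φ {xs} {ys} ux uy to inj sur = ∼bag⇒↭ (unique∧set⇒bag (Unique-map φ inj ux) uy (mk⇔ into sur))
    where
    into : ∀ {y} → y ∈ map φ xs → y ∈ ys
    into h with ∈-map⁻ φ h
    ... | x , x∈ , refl = to x∈

  ∑-involution : ∀ {xs : List X} (φ : X → X) (F : X → ℤ) → Unique xs → (∀ {x} → x ∈ xs → φ x ∈ xs) →
    (∀ {x} → x ∈ xs → φ (φ x) ≡ x) → ∑ xs F ≡ ∑ xs (F ∘ φ)
  ∑-involution {xs = xs} φ F u to inv = ≡.trans (sym (∑-↭ F (bijection-↭ φ u u to
    (λ x∈ y∈ eq → ≡.trans (sym (inv x∈)) (≡.trans (cong φ eq) (inv y∈)))
    (λ {y} y∈ → subst (_∈ map φ xs) (inv y∈) (∈-map⁺ φ (to y∈)))))) (∑-map φ xs F)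

  ≡-neg⇒0 : ∀ {i} → i ≡ ℤ.- i → i ≡ 0ℤ
  ≡-neg⇒0 {+ 0} h = refl
  ≡-neg⇒0 {+ suc n} ()
  ≡-neg⇒0 {ℤ.-[1+ n ]} ()

  -- Reindexing by the involution makes the sum equal to its own negative, and ℤ has no 2-torsion.
  -- Fixed points are allowed: the sign rule makes their terms vanish.
  ∑-signReversing : ∀ {xs : List X} (φ : X → X) (F : X → ℤ) → Unique xs → (∀ {x} → x ∈ xs → φ x ∈ xs) →
    (∀ {x} → x ∈ xs → φ (φ x) ≡ x) → (∀ {x} → x ∈ xs → F (φ x) ≡ ℤ.- F x) → ∑ xs F ≡ 0ℤ
  ∑-signReversing {xs = xs} φ F u to inv neg =
    ≡-neg⇒0 (≡.trans (∑-involution φ F u to inv) (≡.trans (∑-cong xs neg) (∑-neg xs F)))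

  [_] : Bool → ℤ
  [ true ]  = 1ℤ
  [ false ] = 0ℤ

  countB-∑ : ∀ (p : X → Bool) xs → + countB p xs ≡ ∑ xs (λ x → [ p x ])
  countB-∑ p []       = refl
  countB-∑ p (x ∷ xs) with p x
  ... | true  = cong (λ z → 1ℤ ℤ.+ z) (countB-∑ p xs)
  ... | false = ≡.trans (countB-∑ p xs) (sym (ℤ.+-identityˡ _))

  ∑-single : ∀ {xs : List X} {x} (F : X → ℤ) → Unique xs → x ∈ xs →
    (∀ {y} → y ∈ xs → y ≢ x → F y ≡ 0ℤ) → ∑ xs F ≡ F x
  ∑-single {xs = x ∷ xs} F (p ∷ u) (here refl) h = ≡.trans (cong (λ z → F x ℤ.+ z)
    (≡.trans (∑-cong xs (λ y∈ → h (there y∈) (λ { refl → All.lookup p y∈ refl }))) (∑-zero xs))) (ℤ.+-identityʳ _)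
  ∑-single {xs = y ∷ xs} F (p ∷ u) (there x∈) h = ≡.trans
    (cong₂ ℤ._+_ (h (here refl) (λ { refl → All.lookup p x∈ refl })) (∑-single F u x∈ (h ∘ there))) (ℤ.+-identityˡ _)

  countB-map : ∀ (p : Y → Bool) (φ : X → Y) xs → countB p (map φ xs) ≡ countB (p ∘ φ) xs
  countB-map p φ []       = refl
  countB-map p φ (x ∷ xs) with p (φ x)
  ... | true  = cong suc (countB-map p φ xs)
  ... | false = countB-map p φ xs

  countB-filterB : ∀ (p q : X → Bool) xs → countB p (filterB q xs) ≡ countB (λ x → q x ∧ p x) xs
  countB-filterB p q []       = refl
  countB-filterB p q (x ∷ xs) with q x
  ... | false = countB-filterB p q xs
  ... | true with p x
  ...   | true  = cong suc (countB-filterB p q xs)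
  ...   | false = countB-filterB p q xs

  countB-cong : ∀ {p q : X → Bool} xs → (∀ {x} → x ∈ xs → p x ≡ q x) → countB p xs ≡ countB q xs
  countB-cong [] h = refl
  countB-cong {p = p} {q} (x ∷ xs) h with p x | q x | h (here refl)
  ... | true  | .true  | refl = cong suc (countB-cong xs (h ∘ there))
  ... | false | .false | refl = countB-cong xs (h ∘ there)

  countB-↭ : ∀ (p : X → Bool) {xs ys} → xs ↭ ys → countB p xs ≡ countB p ys
  countB-↭ p {xs} {ys} h = ℤ.+-injective (≡.trans (countB-∑ p xs) (≡.trans (∑-↭ _ h) (sym (countB-∑ p ys))))

  countB-none : ∀ (p : X → Bool) xs → (∀ {x} → x ∈ xs → p x ≡ false) → countB p xs ≡ 0
  countB-none p []       h = refl
  countB-none p (x ∷ xs) h rewrite h (here refl) = countB-none p xs (h ∘ there)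

  ∈-filterB⁺ : ∀ (p : X → Bool) {xs x} → x ∈ xs → p x ≡ true → x ∈ filterB p xs
  ∈-filterB⁺ p {x ∷ xs} (here refl) h rewrite h = here refl
  ∈-filterB⁺ p {x ∷ xs} (there x∈) h with p x
  ... | true  = there (∈-filterB⁺ p x∈ h)
  ... | false = ∈-filterB⁺ p x∈ h

  ∈-filterB⁻ : ∀ (p : X → Bool) {xs x} → x ∈ filterB p xs → x ∈ xs × p x ≡ true
  ∈-filterB⁻ p {y ∷ xs} h with p y in eq
  ∈-filterB⁻ p {y ∷ xs} (here refl) | true = here refl , eq
  ∈-filterB⁻ p {y ∷ xs} (there h) | true with ∈-filterB⁻ p h
  ... | a , b = there a , b
  ∈-filterB⁻ p {y ∷ xs} h | false with ∈-filterB⁻ p h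
  ... | a , b = there a , b

  Unique-filterB : ∀ (p : X → Bool) {xs} → Unique xs → Unique (filterB p xs)
  Unique-filterB p [] = []
  Unique-filterB p {x ∷ xs} (h ∷ u) with p x
  ... | true  = All.tabulate (λ y∈ → All.lookup h (proj₁ (∈-filterB⁻ p y∈))) ∷ Unique-filterB p u
  ... | false = Unique-filterB p u

-- Alternants, sorting, and the norm of exponent vectors.

module Alternants where
  open import Defs using (eqVecᵇ)
  open LIA
  open Counting
  open Words using (≡ᵇ-refl)
  open import Data.Nat using (ℕ; zero; suc; _+_; _*_; _≤_; _<_; z≤n; s≤s; _≤?_; _≡ᵇ_)
  import Data.Nat.Properties as ℕ
  import Data.Nat.Tactic.RingSolver as NR
  open import Data.Integer as ℤ using (ℤ; +_; 0ℤ; 1ℤ; -1ℤ)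
  import Data.Integer.Properties as ℤ
  open import Data.Integer.Tactic.RingSolver using (solve-∀)
  open import Data.Bool using (true; false; T)
  open import Data.Vec using (Vec; []; _∷_)
  open import Data.Vec.Properties using (∷-injective)
  open import Data.Vec.Relation.Unary.All as VAll using ([]; _∷_)
  open import Data.List using (List)
  open import Data.List.Membership.Propositional using (_∈_)
  open import Data.List.Relation.Unary.Unique.Propositional using (Unique)
  open import Data.Product using (_×_; _,_; proj₂)
  open import Data.Sum using (_⊎_; inj₁; inj₂)
  open import Data.Empty using (⊥-elim)
  open import Data.Unit using (⊤; tt)
  open import Relation.Nullary using (¬_; yes; no)
  open import Relation.Binary.Definitions using (tri<; tri≈; tri>)
  open import Relation.Binary.PropositionalEquality hiding ([_])

  eqVecᵇ-refl : ∀ {n} (u : Vec ℕ n) → eqVecᵇ u u ≡ true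
  eqVecᵇ-refl []      = refl
  eqVecᵇ-refl (x ∷ u) rewrite ≡ᵇ-refl x = eqVecᵇ-refl u

  eqVecᵇ-sound : ∀ {n} (u v : Vec ℕ n) → eqVecᵇ u v ≡ true → u ≡ v
  eqVecᵇ-sound []      []      h = refl
  eqVecᵇ-sound (x ∷ u) (y ∷ v) h with x ≡ᵇ y in eq
  ... | true = cong₂ _∷_ (ℕ.≡ᵇ⇒≡ x y (subst T (sym eq) tt)) (eqVecᵇ-sound u v h)

  eqVecᵇ-false : ∀ {n} {u v : Vec ℕ n} → u ≢ v → eqVecᵇ u v ≡ false
  eqVecᵇ-false {u = u} {v} h with eqVecᵇ u v in eq
  ... | true  = ⊥-elim (h (eqVecᵇ-sound u v eq))
  ... | false = refl

  eqVecᵇ-⇔ : ∀ {n m} {u v : Vec ℕ n} {x y : Vec ℕ m} → (u ≡ v → x ≡ y) → (x ≡ y → u ≡ v) → eqVecᵇ u v ≡ eqVecᵇ x y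
  eqVecᵇ-⇔ {u = u} {v} {x} {y} to from with eqVecᵇ x y in eq
  ... | false = eqVecᵇ-false λ h → true≢false (trans (sym (trans (cong (eqVecᵇ x) (sym (to h))) (eqVecᵇ-refl x))) eq)
    where
    true≢false : true ≢ false
    true≢false ()
  ... | true rewrite from (eqVecᵇ-sound x y eq) = eqVecᵇ-refl v

  -- Beyond the last adjacent pair this is the identity, so invariance can be stated for all `k`
  -- without a bound.
  swapAt : ∀ {n} → ℕ → Vec ℕ n → Vec ℕ n
  swapAt k       []          = []
  swapAt zero    (a ∷ [])    = a ∷ []
  swapAt zero    (a ∷ b ∷ v) = b ∷ a ∷ v
  swapAt (suc k) (a ∷ v)     = a ∷ swapAt k v

  swapAt-involutive : ∀ {n} k (v : Vec ℕ n) → swapAt k (swapAt k v) ≡ v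
  swapAt-involutive k       []          = refl
  swapAt-involutive zero    (a ∷ [])    = refl
  swapAt-involutive zero    (a ∷ b ∷ v) = refl
  swapAt-involutive (suc k) (a ∷ v)     = cong (a ∷_) (swapAt-involutive k v)

  -- Adds the staircase δ = (n - 1, ..., 1, 0).
  shift : ∀ {n} → Vec ℕ n → Vec ℕ n
  shift         []      = []
  shift {suc n} (a ∷ v) = a + n ∷ shift v

  shift-injective : ∀ {n} {u v : Vec ℕ n} → shift u ≡ shift v → u ≡ v
  shift-injective {u = []}    {[]}    h = refl
  shift-injective {suc n} {u = a ∷ u} {b ∷ v} h with ∷-injective h
  ... | p , q = cong₂ _∷_ (ℕ.+-cancelʳ-≡ n a b p) (shift-injective q)

  Decreasing : ∀ {n} → Vec ℕ n → Set
  Decreasing []          = ⊤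
  Decreasing (a ∷ [])    = ⊤
  Decreasing (a ∷ b ∷ v) = b ≤ a × Decreasing (b ∷ v)

  sg : ℕ → ℕ → ℤ
  sg zero    zero    = 0ℤ
  sg (suc a) zero    = 1ℤ
  sg zero    (suc b) = -1ℤ
  sg (suc a) (suc b) = sg a b

  sg-anti : ∀ a b → sg b a ≡ ℤ.- sg a b
  sg-anti zero    zero    = refl
  sg-anti zero    (suc b) = refl
  sg-anti (suc a) zero    = refl
  sg-anti (suc a) (suc b) = sg-anti a b

  sg-> : ∀ {a b} → b < a → sg a b ≡ 1ℤ
  sg-> {suc a} {zero}  h       = refl
  sg-> {suc a} {suc b} (s≤s h) = sg-> h

  row : ∀ {n} → ℕ → Vec ℕ n → ℤ
  row a []      = 1ℤ
  row a (b ∷ v) = sg a b ℤ.* row a v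

  -- The Vandermonde sign: the product of the signs of v_i - v_j over i < j. It is the sign of the
  -- sorting permutation, and 0 if two entries agree.
  sign : ∀ {n} → Vec ℕ n → ℤ
  sign []      = 1ℤ
  sign (a ∷ v) = row a v ℤ.* sign v

  row-swapAt : ∀ {n} a k (v : Vec ℕ n) → row a (swapAt k v) ≡ row a v
  row-swapAt a k       []          = refl
  row-swapAt a zero    (b ∷ [])    = refl
  row-swapAt a zero    (b ∷ c ∷ v) = lemma (sg a b) (sg a c) (row a v)
    where
    lemma : ∀ x y z → y ℤ.* (x ℤ.* z) ≡ x ℤ.* (y ℤ.* z)
    lemma = solve-∀
  row-swapAt a (suc k) (b ∷ v)     = cong (sg a b ℤ.*_) (row-swapAt a k v)

  sign-swapAt : ∀ {n} k (v : Vec ℕ n) → suc k < n → sign (swapAt k v) ≡ ℤ.- sign v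
  sign-swapAt zero (a ∷ []) (s≤s ())
  sign-swapAt zero (a ∷ b ∷ v) h rewrite sg-anti a b = lemma (sg a b) (row a v) (row b v) (sign v)
    where
    lemma : ∀ x y z w → (ℤ.- x ℤ.* z) ℤ.* (y ℤ.* w) ≡ ℤ.- ((x ℤ.* y) ℤ.* (z ℤ.* w))
    lemma = solve-∀
  sign-swapAt (suc k) (a ∷ v) (s≤s h) rewrite row-swapAt a k v | sign-swapAt k v h =
    sym (ℤ.neg-distribʳ-* (row a v) (sign v))

  Decreasing-raise : ∀ {n a b} (v : Vec ℕ n) → b ≤ a → Decreasing (b ∷ v) → Decreasing (a ∷ v)
  Decreasing-raise []      h _       = tt
  Decreasing-raise (c ∷ v) h (p , q) = ℕ.≤-trans p h , q

  -- The offset `m` is independent of the length of `v`, since in the recursion the tail shrinks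
  -- while the offset of the leading entry stays.
  row-shift-decreasing : ∀ {n} a (v : Vec ℕ n) m → n ≤ m → Decreasing (a ∷ v) → row (a + m) (shift v) ≡ 1ℤ
  row-shift-decreasing a [] m h d = refl
  row-shift-decreasing {suc n} a (b ∷ v) m h (b≤a , d)
    rewrite sg-> {a + m} {b + n} (ℕ.+-mono-≤-< b≤a h)
          | row-shift-decreasing a v m (ℕ.<⇒≤ h) (Decreasing-raise v b≤a d) = refl

  Decreasing-tail : ∀ {n} a (v : Vec ℕ n) → Decreasing (a ∷ v) → Decreasing v
  Decreasing-tail a []      d = tt
  Decreasing-tail a (b ∷ v) d = proj₂ d

  sign-shift-decreasing : ∀ {n} (v : Vec ℕ n) → Decreasing v → sign (shift v) ≡ 1ℤ
  sign-shift-decreasing [] d = refl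
  sign-shift-decreasing {suc n} (a ∷ v) d
    rewrite row-shift-decreasing a v n ℕ.≤-refl d | sign-shift-decreasing v (Decreasing-tail a v d) = refl

  insert : ∀ {n} → ℕ → Vec ℕ n → Vec ℕ (suc n)
  insert a []      = a ∷ []
  insert a (b ∷ v) with b ≤? a
  ... | yes _ = a ∷ b ∷ v
  ... | no  _ = b ∷ insert a v

  sort : ∀ {n} → Vec ℕ n → Vec ℕ n
  sort []      = []
  sort (a ∷ v) = insert a (sort v)

  insert-≥ : ∀ {n a b} (v : Vec ℕ n) → b ≤ a → insert a (b ∷ v) ≡ a ∷ b ∷ v
  insert-≥ {a = a} {b} v h with b ≤? a
  ... | yes _ = refl
  ... | no ¬p = ⊥-elim (¬p h)

  insert-< : ∀ {n a b} (v : Vec ℕ n) → a < b → insert a (b ∷ v) ≡ b ∷ insert a v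
  insert-< {a = a} {b} v h with b ≤? a
  ... | yes p = ⊥-elim (ℕ.<⇒≱ h p)
  ... | no _  = refl

  insert-comm-< : ∀ {n} a b (v : Vec ℕ n) → a < b → insert a (insert b v) ≡ insert b (insert a v)
  insert-comm-< a b [] h = trans (insert-< [] h) (sym (insert-≥ [] (ℕ.<⇒≤ h)))
  insert-comm-< a b (c ∷ v) h with c ≤? a
  ... | yes p rewrite insert-≥ v (ℕ.≤-trans p (ℕ.<⇒≤ h)) | insert-< (c ∷ v) h | insert-≥ v p
                    | insert-≥ (c ∷ v) (ℕ.<⇒≤ h) = refl
  ... | no p with c ≤? b
  ...   | yes q rewrite insert-< (c ∷ v) h | insert-< v (ℕ.≰⇒> p) = refl
  ...   | no q rewrite insert-< (insert b v) (ℕ.≰⇒> p) = cong (c ∷_) (insert-comm-< a b v h)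

  insert-comm : ∀ {n} a b (v : Vec ℕ n) → insert a (insert b v) ≡ insert b (insert a v)
  insert-comm a b v with ℕ.<-cmp a b
  ... | tri< a<b _ _ = insert-comm-< a b v a<b
  ... | tri≈ _ refl _ = refl
  ... | tri> _ _ b<a = sym (insert-comm-< b a v b<a)

  sort-swapAt : ∀ {n} k (v : Vec ℕ n) → sort (swapAt k v) ≡ sort v
  sort-swapAt k       []          = refl
  sort-swapAt zero    (a ∷ [])    = refl
  sort-swapAt zero    (a ∷ b ∷ v) = insert-comm b a (sort v)
  sort-swapAt (suc k) (a ∷ v)     = cong (insert a) (sort-swapAt k v)

  sort-decreasing : ∀ {n} (v : Vec ℕ n) → Decreasing (sort v)
  sort-decreasing [] = tt
  sort-decreasing (a ∷ v) = go a (sort v) (sort-decreasing v)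
    where
    go : ∀ {n} a (v : Vec ℕ n) → Decreasing v → Decreasing (insert a v)
    go a [] d = tt
    go a (b ∷ v) d with b ≤? a
    ... | yes p = p , d
    go a (b ∷ []) d | no p = ℕ.<⇒≤ (ℕ.≰⇒> p) , tt
    go a (b ∷ c ∷ v) (q , d) | no p with c ≤? a | go a (c ∷ v) d
    ... | yes r | ih = ℕ.<⇒≤ (ℕ.≰⇒> p) , ih
    ... | no r  | ih = q , ih

  sort-id : ∀ {n} (v : Vec ℕ n) → Decreasing v → sort v ≡ v
  sort-id [] d = refl
  sort-id (a ∷ []) d = refl
  sort-id (a ∷ b ∷ v) (p , d) rewrite sort-id (b ∷ v) d = insert-≥ v p

  shift-decreasing : ∀ {n} (v : Vec ℕ n) → Decreasing v → Decreasing (shift v)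
  shift-decreasing [] d = tt
  shift-decreasing (a ∷ []) d = tt
  shift-decreasing {suc (suc n)} (a ∷ b ∷ v) (p , d) =
    ℕ.+-mono-≤ p (ℕ.n≤1+n n) , shift-decreasing (b ∷ v) d

  -- The induction is over the function as well: after the swap brings `b` to the front, `b` is
  -- absorbed into `h` and `a` is inserted into the rest.
  insert-invariant : ∀ {n} {X : Set} (h : Vec ℕ (suc n) → X) → (∀ k v → h (swapAt k v) ≡ h v) →
                     ∀ a v → h (a ∷ v) ≡ h (insert a v)
  insert-invariant h inv a [] = refl
  insert-invariant h inv a (b ∷ v) with b ≤? a
  ... | yes _ = refl
  ... | no _  = trans (sym (inv 0 (a ∷ b ∷ v)))
    (insert-invariant (λ v → h (b ∷ v)) (λ k v → inv (suc k) (b ∷ v)) a v)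

  sort-invariant : ∀ {n} {X : Set} (h : Vec ℕ n → X) → (∀ k v → h (swapAt k v) ≡ h v) → ∀ v → h v ≡ h (sort v)
  sort-invariant h inv [] = refl
  sort-invariant h inv (a ∷ v) = trans
    (sort-invariant (λ v → h (a ∷ v)) (λ k v → inv (suc k) (a ∷ v)) v)
    (insert-invariant h inv a (sort v))

  sq : ∀ {n} → Vec ℕ n → ℕ
  sq []      = 0
  sq (a ∷ v) = a * a + sq v

  dotδ : ∀ {n} → Vec ℕ n → ℕ
  dotδ         []      = 0
  dotδ {suc n} (a ∷ v) = a * n + dotδ v

  δδ : ℕ → ℕ
  δδ zero    = 0
  δδ (suc n) = n * n + δδ n

  sq-swapAt : ∀ {n} k (v : Vec ℕ n) → sq (swapAt k v) ≡ sq v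
  sq-swapAt k       []          = refl
  sq-swapAt zero    (a ∷ [])    = refl
  sq-swapAt zero    (a ∷ b ∷ v) = lemma (a * a) (b * b) (sq v)
    where
    lemma : ∀ x y z → y + (x + z) ≡ x + (y + z)
    lemma = NR.solve-∀
  sq-swapAt (suc k) (a ∷ v)     = cong (λ z → a * a + z) (sq-swapAt k v)

  sq-sort : ∀ {n} (v : Vec ℕ n) → sq (sort v) ≡ sq v
  sq-sort v = sym (sort-invariant sq sq-swapAt v)

  -- The expansion of the squared norm of `v` written as (v + δ) - δ, with negative terms moved
  -- across; `δδ n` is the squared norm of δ.
  sq-shift : ∀ {n} (v : Vec ℕ n) → sq v + (dotδ (shift v) + dotδ (shift v)) ≡ sq (shift v) + δδ n
  sq-shift [] = refl
  sq-shift {suc n} (a ∷ v) = trans (lemma₁ a n (sq v) (dotδ (shift v)))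
    (trans (cong (λ z → ((a + n) * (a + n) + n * n) + z) (sq-shift v)) (lemma₂ a n (sq (shift v)) (δδ n)))
    where
    lemma₁ : ∀ a n s d → (a * a + s) + (((a + n) * n + d) + ((a + n) * n + d))
           ≡ ((a + n) * (a + n) + n * n) + (s + (d + d))
    lemma₁ = NR.solve-∀
    lemma₂ : ∀ a n s d → ((a + n) * (a + n) + n * n) + (s + d) ≡ ((a + n) * (a + n) + s) + (n * n + d)
    lemma₂ = NR.solve-∀

  -- The rearrangement inequality for a single insertion: carrying a larger entry to a larger
  -- component of δ strictly increases the product with δ.
  dotδ-insert : ∀ {n} a (v : Vec ℕ n) → a ∷ v ≡ insert a v ⊎ dotδ (a ∷ v) < dotδ (insert a v)
  dotδ-insert a [] = inj₁ refl
  dotδ-insert {suc n} a (b ∷ v) with b ≤? a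
  ... | yes _ = inj₁ refl
  ... | no p = inj₂ (subst₂ (λ x y → x + (b * n + dotδ v) < y + dotδ (insert a v)) (sym (ℕ.*-suc a n)) (sym (ℕ.*-suc b n))
    (lia (a ∷ b ∷ a * n ∷ b * n ∷ dotδ v ∷ dotδ (insert a v) ∷ [])
      (λ a b an bn d d′ → a :< b ⇒ an :+ d :≤ d′ ⇒ ((a :+ an) :+ (bn :+ d)) :< ((b :+ bn) :+ d′)) refl (ℕ.≰⇒> p) weak))
    where
    weak : a * n + dotδ v ≤ dotδ (insert a v)
    weak with dotδ-insert a v
    ... | inj₁ eq = ℕ.≤-reflexive (cong dotδ eq)
    ... | inj₂ lt = ℕ.<⇒≤ lt

  dotδ-sort : ∀ {n} (v : Vec ℕ n) → v ≡ sort v ⊎ dotδ v < dotδ (sort v)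
  dotδ-sort [] = inj₁ refl
  dotδ-sort {suc n} (a ∷ v) with dotδ-sort v | dotδ-insert a (sort v)
  ... | inj₁ eq | inj₁ eq′ = inj₁ (trans (cong (a ∷_) eq) eq′)
  ... | inj₁ eq | inj₂ lt  = inj₂ (subst (λ z → a * n + dotδ z < dotδ (insert a (sort v))) (sym eq) lt)
  ... | inj₂ lt | inj₁ eq′ = inj₂ (ℕ.<-≤-trans (ℕ.+-monoʳ-< (a * n) lt) (ℕ.≤-reflexive (cong dotδ eq′)))
  ... | inj₂ lt | inj₂ lt′ = inj₂ (ℕ.<-trans (ℕ.+-monoʳ-< (a * n) lt) lt′)

  -- Coefficients of the alternant of κ + δ, indexed by α instead of α + δ.
  alternant : ∀ {n} → Vec ℕ n → Vec ℕ n → ℤ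
  alternant κ α = sign (shift α) ℤ.* [ eqVecᵇ (sort (shift α)) (shift κ) ]

  alternant-anti : ∀ {n} k (κ α α′ : Vec ℕ n) → suc k < n → shift α′ ≡ swapAt k (shift α) →
                   alternant κ α′ ≡ ℤ.- alternant κ α
  alternant-anti k κ α α′ h eq rewrite eq | sign-swapAt k (shift α) h | sort-swapAt k (shift α) =
    sym (ℤ.neg-distribˡ-* (sign (shift α)) _)

  alternant-decreasing : ∀ {n} (κ α : Vec ℕ n) → Decreasing α → alternant κ α ≡ [ eqVecᵇ α κ ]
  alternant-decreasing κ α d rewrite sign-shift-decreasing α d | sort-id (shift α) (shift-decreasing α d) =
    trans (ℤ.*-identityˡ _) (cong [_] (eqVecᵇ-⇔ {u = shift α} {shift κ} {α} {κ} shift-injective (cong shift)))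

  -- If α + δ sorts to κ + δ, both have the same norm, while sorting strictly increases the product
  -- with δ unless α = κ. By `sq-shift` the norm of α then exceeds that of κ. So the alternant of κ
  -- has κ as its unique exponent of least norm.
  alternant-leading : ∀ {n} (κ α : Vec ℕ n) → α ≢ κ → sq α ≤ sq κ → alternant κ α ≡ 0ℤ
  alternant-leading {n} κ α α≢κ h with eqVecᵇ (sort (shift α)) (shift κ) in eq
  ... | false = ℤ.*-zeroʳ (sign (shift α))
  ... | true with eqVecᵇ-sound (sort (shift α)) (shift κ) eq | dotδ-sort (shift α)
  ...   | e | inj₁ e′ = ⊥-elim (α≢κ (shift-injective (trans e′ e)))
  ...   | e | inj₂ lt = ⊥-elim (lia
    (sq α ∷ sq κ ∷ dotδ (shift α) ∷ dotδ (shift κ) ∷ sq (shift α) ∷ sq (shift κ) ∷ δδ n ∷ [])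
    (λ a k x y s t d → a :≤ k ⇒ a :+ (x :+ x) :≡ s :+ d ⇒ k :+ (y :+ y) :≡ t :+ d ⇒ s :≡ t ⇒ x :< y ⇒ :⊥) refl
    h (sq-shift α) (sq-shift κ) (trans (sym (sq-sort (shift α))) (cong sq e)) (subst (λ z → dotδ (shift α) < dotδ z) e lt))

  Bounded : ∀ {n} → ℕ → Vec ℕ n → Set
  Bounded c = VAll.All (_≤ c)

  sq-bounded : ∀ {n c} (v : Vec ℕ n) → Bounded c v → sq v ≤ n * (c * c)
  sq-bounded []      []      = z≤n
  sq-bounded (a ∷ v) (p ∷ b) = ℕ.+-mono-≤ (ℕ.*-mono-≤ p p) (sq-bounded v b)

  insert-bounded : ∀ {n c a} (v : Vec ℕ n) → a ≤ c → Bounded c v → Bounded c (insert a v)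
  insert-bounded []      p []      = p ∷ []
  insert-bounded {a = a} (b ∷ v) p (q ∷ h) with b ≤? a
  ... | yes _ = p ∷ q ∷ h
  ... | no _  = q ∷ insert-bounded v p h

  sort-bounded : ∀ {n c} (v : Vec ℕ n) → Bounded c v → Bounded c (sort v)
  sort-bounded []      []      = []
  sort-bounded (a ∷ v) (p ∷ h) = insert-bounded (sort v) p (sort-bounded v h)

  -- A symmetric function whose products with all alternants vanish is zero: the partition κ of largest norm in its
  -- support would be the only contribution to the coefficient of κ + δ.
  module _ {n c : ℕ} {box : List (Vec ℕ n)} (unique : Unique box) (complete : ∀ α → Bounded c α → α ∈ box)
           (h : Vec ℕ n → ℤ)
           (symmetric : ∀ k α → h (swapAt k α) ≡ h α)
           (support : ∀ α → ¬ Bounded c α → h α ≡ 0ℤ)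
           (annihilated : ∀ κ → Bounded c κ → Decreasing κ → ∑ box (λ α → h α ℤ.* alternant κ α) ≡ 0ℤ) where
    private
      top : ℕ
      -- One more than the largest possible squared norm of a bounded vector, by `sq-bounded`.
      top = suc (n * (c * c))

      leading : ∀ κ → Bounded c κ → Decreasing κ → (∀ β → sq κ < sq β → h β ≡ 0ℤ) → h κ ≡ 0ℤ
      leading κ b d ih = trans (sym (trans (∑-single (λ α → h α ℤ.* alternant κ α) unique (complete κ b) others)
          (trans (cong (h κ ℤ.*_) (trans (alternant-decreasing κ κ d) (cong [_] (eqVecᵇ-refl κ)))) (ℤ.*-identityʳ (h κ)))))
        (annihilated κ b d)
        where
        others : ∀ {α} → α ∈ box → α ≢ κ → h α ℤ.* alternant κ α ≡ 0ℤ
        others {α} _ α≢κ with sq α ≤? sq κ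
        ... | yes p = trans (cong (h α ℤ.*_) (alternant-leading κ α α≢κ p)) (ℤ.*-zeroʳ (h α))
        ... | no ¬p = cong (ℤ._* alternant κ α) (ih α (ℕ.≰⇒> ¬p))

      -- Induction from large norms to small ones; `m` bounds the distance of the squared norm from
      -- `top`.
      descend : ∀ m α → top ≤ sq α + m → h α ≡ 0ℤ
      descend zero α p = support α λ b → ℕ.<⇒≱ (subst (top ≤_) (ℕ.+-identityʳ _) p) (sq-bounded α b)
      descend (suc m) α p with VAll.all? (_≤? c) α
      ... | no ¬b = support α ¬b
      -- Symmetry transfers the claim to the sorted vector, which has the same norm; there `leading`
      -- needs vanishing only at strictly larger norms.
      ... | yes b = trans (sort-invariant h symmetric α)
        (leading (sort α) (sort-bounded α b) (sort-decreasing α)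
          λ β lt → descend m β (ℕ.≤-trans p (subst (_≤ sq β + m) (sym (ℕ.+-suc (sq α) m))
            (ℕ.+-monoˡ-≤ m (subst (_< sq β) (sq-sort α) lt)))))

    annihilated⇒zero : ∀ α → h α ≡ 0ℤ
    annihilated⇒zero α = descend top α (ℕ.m≤n+m top (sq α))

-- Sets of words closed under the operators, and their Schur expansion.

module Crystal where
  open import Defs using (eqVecᵇ; countB; occ)
  open Counting
  open Words
  open Alternants
  open import Data.Nat using (ℕ; zero; suc; _+_; _*_; _≤_; _<_; z≤n; s≤s)
  import Data.Nat.Properties as ℕ
  open import Data.Nat.ListAction using (sum)
  open import Data.Integer as ℤ using (ℤ; +_; 0ℤ)
  import Data.Integer.Properties as ℤ
  open import Data.Integer.Tactic.RingSolver using (solve-∀)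
  open import Data.Bool using (Bool; true; false; _∧_)
  open import Data.Maybe using (Maybe; just; nothing)
  open import Data.Vec using (Vec; []; _∷_)
  open import Data.List using (List; []; _∷_; map)
  open import Data.List.Membership.Propositional using (_∈_)
  open import Data.List.Relation.Unary.All using (All)
  open import Data.List.Relation.Unary.Unique.Propositional using (Unique)
  open import Data.Product using (_,_; proj₁; proj₂)
  open import Data.Empty using (⊥-elim)
  open import Function using (_∘_)
  open import Relation.Nullary using (¬_; yes; no)
  open import Relation.Binary.PropositionalEquality hiding ([_])

  -- What the involution arguments need from a set of fillings, stated for its reading words. The
  -- absence of repetitions allows a sum over the list to be reindexed by an involution.
  record CrystalClosed (n : ℕ) (ws : List Word) : Set where
    field
      unique   : Unique ws
      bounded  : ∀ {w} → w ∈ ws → All (_≤ n) w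
      closed-f : ∀ {i w a} → 1 ≤ i → i < n → w ∈ ws → A i w ≡ suc a → f i w ∈ ws
      closed-e : ∀ {i w b} → 1 ≤ i → i < n → w ∈ ws → B i w ≡ suc b → e i w ∈ ws

  vec : (ℕ → ℕ) → ∀ n → Vec ℕ n
  vec c zero    = []
  vec c (suc n) = c 0 ∷ vec (c ∘ suc) n

  vec-cong : ∀ {c c′} n → (∀ j → c j ≡ c′ j) → vec c n ≡ vec c′ n
  vec-cong zero    h = refl
  vec-cong (suc n) h = cong₂ _∷_ (h 0) (vec-cong n (h ∘ suc))

  vec-swapAt : ∀ {c c′} n k → suc k < n → (∀ j → j ≢ k → j ≢ suc k → c′ j ≡ c j) →
    c′ k ≡ c (suc k) → c′ (suc k) ≡ c k → vec c′ n ≡ swapAt k (vec c n)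
  vec-swapAt (suc zero) zero (s≤s ())
  vec-swapAt (suc (suc n)) zero h same p q =
    cong₂ _∷_ p (cong₂ _∷_ q (vec-cong n λ j → same (suc (suc j)) (λ ()) (λ ())))
  vec-swapAt (suc n) (suc k) (s≤s h) same p q = cong₂ _∷_ (same 0 (λ ()) (λ ()))
    (vec-swapAt n k h (λ j a b → same (suc j) (a ∘ ℕ.suc-injective) (b ∘ ℕ.suc-injective)) p q)

  -- The component of δ at `k` is larger by one than that at `k + 1`; the two off-by-one hypotheses
  -- compensate exactly for this.
  shift-vec-swapAt : ∀ {c c′} n k → suc k < n → (∀ j → j ≢ k → j ≢ suc k → c′ j ≡ c j) →
    suc (c′ k) ≡ c (suc k) → c′ (suc k) ≡ suc (c k) → shift (vec c′ n) ≡ swapAt k (shift (vec c n))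
  shift-vec-swapAt (suc zero) zero (s≤s ())
  shift-vec-swapAt (suc (suc n)) zero h same p q =
    cong₂ _∷_ (trans (ℕ.+-suc _ n) (cong (λ z → z + n) p)) (cong₂ _∷_ (trans (cong (λ z → z + n) q) (sym (ℕ.+-suc _ n)))
      (cong shift (vec-cong n λ j → same (suc (suc j)) (λ ()) (λ ()))))
  shift-vec-swapAt (suc n) (suc k) (s≤s h) same p q = cong₂ _∷_ (cong (λ z → z + n) (same 0 (λ ()) (λ ())))
    (shift-vec-swapAt n k h (λ j a b → same (suc j) (a ∘ ℕ.suc-injective) (b ∘ ℕ.suc-injective)) p q)

  vec-decreasing : ∀ {c} n → (∀ j → c (suc j) ≤ c j) → Decreasing (vec c n)
  vec-decreasing zero          h = _
  vec-decreasing (suc zero)    h = _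
  vec-decreasing (suc (suc n)) h = h 0 , vec-decreasing (suc n) (h ∘ suc)

  content : ∀ n → Word → Vec ℕ n
  content n w = vec (λ j → occ (suc j) w) n

  isLattice : Word → Bool
  isLattice w with violation w
  ... | just _  = false
  ... | nothing = true

  lattice-decreasing : ∀ n w → violation w ≡ nothing → Decreasing (content n w)
  lattice-decreasing n w h = vec-decreasing n λ j → ℕ.≤-trans (ℕ.m≤n+m _ (A (suc j) w))
    (ℕ.≤-reflexive (trans (sym (occ-balance (suc j) w))
      (trans (cong (λ z → occ (suc j) w + z) (violation-nothing w h j)) (ℕ.+-identityʳ _))))

  multiplicity latticeMultiplicity : ∀ {n} → List Word → Vec ℕ n → ℕ
  multiplicity        {n} ws α = countB (λ w → eqVecᵇ (content n w) α) ws
  latticeMultiplicity {n} ws α = countB (λ w → eqVecᵇ (content n w) α ∧ isLattice w) ws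

  []-∧ : ∀ x y → [ x ∧ y ] ≡ [ x ] ℤ.* [ y ]
  []-∧ true  true  = refl
  []-∧ true  false = refl
  []-∧ false y     = refl

  module _ {n : ℕ} {ws : List Word} (closed : CrystalClosed n ws) where
    open CrystalClosed closed

    reflect-∈ : ∀ {i w} → 1 ≤ i → i < n → w ∈ ws → reflect i w ∈ ws
    reflect-∈ {i} {w} p q w∈ = closed-to {P = _∈ ws} i (closed-f p q) (closed-e p q) _ w w∈ (ℕ.m≤n+m (B i w) (A i w))

    dotReflect-∈ : ∀ {i w} → 1 ≤ i → i < n → w ∈ ws → dotReflect i w ∈ ws
    dotReflect-∈ {i} {w} p q w∈ = closed-to {P = _∈ ws} i (closed-f p q) (closed-e p q) _ w w∈
      (ℕ.≤-trans (ℕ.m∸n≤m (B i w) 1) (ℕ.m≤n+m (B i w) (A i w)))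

    content-reflect : ∀ k w → suc k < n → content n (reflect (suc k) w) ≡ swapAt k (content n w)
    content-reflect k w h = vec-swapAt n k h
      (λ j p q → occ-reflect-other (suc k) w (suc j) (p ∘ ℕ.suc-injective) (q ∘ ℕ.suc-injective))
      (proj₁ (occ-reflect (suc k) w)) (proj₂ (occ-reflect (suc k) w))

    content-dotReflect : ∀ k w → suc k < n → 1 ≤ B (suc k) w →
      shift (content n (dotReflect (suc k) w)) ≡ swapAt k (shift (content n w))
    content-dotReflect k w h b = shift-vec-swapAt n k h
      (λ j p q → occ-dotReflect-other (suc k) w (suc j) (p ∘ ℕ.suc-injective) (q ∘ ℕ.suc-injective))
      (proj₁ (occ-dotReflect (suc k) w b)) (proj₂ (occ-dotReflect (suc k) w b))

    swapAt-last : ∀ {m} k (v : Vec ℕ m) → ¬ (suc k < m) → swapAt k v ≡ v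
    swapAt-last k       []          h = refl
    swapAt-last zero    (a ∷ [])    h = refl
    swapAt-last zero    (a ∷ b ∷ v) h = ⊥-elim (h (s≤s (s≤s z≤n)))
    swapAt-last (suc k) (a ∷ v)     h = cong (a ∷_) (swapAt-last k v (h ∘ s≤s))

    -- In the role of a Bender-Knuth involution, `reflect` permutes the words and exchanges two
    -- neighbouring multiplicities.
    multiplicity-symmetric : ∀ k (α : Vec ℕ n) → multiplicity ws (swapAt k α) ≡ multiplicity ws α
    multiplicity-symmetric k α with suc k ℕ.<? n
    ... | no h = cong (multiplicity ws) (swapAt-last k α h)
    ... | yes h = ℤ.+-injective (trans (countB-∑ _ ws) (trans
        (∑-involution (reflect (suc k)) (λ w → [ eqVecᵇ (content n w) (swapAt k α) ]) unique
          (reflect-∈ (s≤s z≤n) h) (λ {w} _ → reflect-involutive (suc k) w))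
        (trans (∑-cong ws (λ {w} _ → cong [_] (pointwise w))) (sym (countB-∑ _ ws)))))
      where
      pointwise : ∀ w → eqVecᵇ (content n (reflect (suc k) w)) (swapAt k α) ≡ eqVecᵇ (content n w) α
      pointwise w rewrite content-reflect k w h = eqVecᵇ-⇔ {u = swapAt k (content n w)} {swapAt k α} {content n w} {α}
        (λ eq → trans (sym (swapAt-involutive k (content n w))) (trans (cong (swapAt k) eq) (swapAt-involutive k α)))
        (cong (swapAt k))

    -- dotReflect at the first violation cancels all words that are not lattice words.
    private
      step : Maybe ℕ → Word → Word
      step (just i) w = dotReflect i w
      step nothing  w = w

      φ : Word → Word
      φ w = step (violation w) w

      φ-∈ : ∀ {w} → w ∈ ws → φ w ∈ ws
      φ-∈ {w} w∈ with violation w in eq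
      ... | nothing = w∈
      ... | just i  = dotReflect-∈ (proj₁ (violation-just w eq)) (violation-bound w eq (bounded w∈)) w∈

      φ-involutive : ∀ w → φ (φ w) ≡ w
      φ-involutive w with violation w in eq
      ... | nothing rewrite eq = refl
      ... | just i rewrite violation-dotReflect i w eq = dotReflect-involutive i w (proj₂ (violation-just w eq))

      bad : (Vec ℕ n → ℤ) → Word → ℤ
      bad G w with violation w
      ... | just _  = G (content n w)
      ... | nothing = 0ℤ

      good : (Vec ℕ n → ℤ) → Word → ℤ
      good G w with violation w
      ... | just _  = 0ℤ
      ... | nothing = G (content n w)

      good+bad : ∀ G w → G (content n w) ≡ good G w ℤ.+ bad G w
      good+bad G w with violation w
      ... | just _  = sym (ℤ.+-identityˡ _)
      ... | nothing = sym (ℤ.+-identityʳ _)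

      bad-φ : ∀ κ {w} → w ∈ ws → bad (alternant κ) (φ w) ≡ ℤ.- bad (alternant κ) w
      bad-φ κ {w} w∈ with violation w in eq
      ... | nothing rewrite eq = refl
      bad-φ κ {w} w∈ | just zero with violation-just w eq
      ... | () , _
      bad-φ κ {w} w∈ | just (suc k) rewrite violation-dotReflect (suc k) w eq =
        alternant-anti k κ (content n w) (content n (dotReflect (suc k) w)) bound
          (content-dotReflect k w bound (proj₂ (violation-just w eq)))
        where bound = violation-bound w eq (bounded w∈)

      -- Lattice words have decreasing content, and at a decreasing exponent the alternant of κ is 1
      -- for κ itself and 0 otherwise.
      good-lattice : ∀ κ w → good (alternant κ) w ≡ [ eqVecᵇ (content n w) κ ∧ isLattice w ]
      good-lattice κ w with violation w in eq
      ... | just _  rewrite []-∧ (eqVecᵇ (content n w) κ) false = sym (ℤ.*-zeroʳ [ eqVecᵇ (content n w) κ ])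
      ... | nothing rewrite []-∧ (eqVecᵇ (content n w) κ) true =
        trans (alternant-decreasing κ (content n w) (lattice-decreasing n w eq)) (sym (ℤ.*-identityʳ _))

    ∑-alternant : ∀ κ → ∑ ws (λ w → alternant κ (content n w)) ≡ + latticeMultiplicity ws κ
    ∑-alternant κ = trans (∑-cong ws (λ {w} _ → good+bad (alternant κ) w)) (trans (∑-+ ws (good (alternant κ)) (bad (alternant κ)))
      (trans (cong (ℤ._+_ (∑ ws (good (alternant κ))))
        (∑-signReversing φ (bad (alternant κ)) unique φ-∈ (λ {w} _ → φ-involutive w) (bad-φ κ)))
      (trans (ℤ.+-identityʳ _) (trans (∑-cong ws (λ {w} _ → good-lattice κ w)) (sym (countB-∑ _ ws))))))

  module _ {n : ℕ} {box : List (Vec ℕ n)} (unique : Unique box) (ws : List Word)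
           (inBox : ∀ {w} → w ∈ ws → content n w ∈ box) where

    ∑-content : ∀ (G : Vec ℕ n → ℤ) → ∑ ws (λ w → G (content n w)) ≡ ∑ box (λ α → + multiplicity ws α ℤ.* G α)
    ∑-content G = trans (∑-cong ws (λ {w} w∈ → sym (trans
        (∑-single (λ α → [ eqVecᵇ (content n w) α ] ℤ.* G α) unique (inBox w∈)
          (λ {α} _ α≢ → cong (λ z → [ z ] ℤ.* G α) (eqVecᵇ-false (α≢ ∘ sym))))
        (trans (cong (λ z → [ z ] ℤ.* G (content n w)) (eqVecᵇ-refl (content n w))) (ℤ.*-identityˡ _)))))
      (trans (∑-swap ws box (λ w α → [ eqVecᵇ (content n w) α ] ℤ.* G α))
        (∑-cong box (λ {α} _ → trans (∑-*ʳ ws (G α) (λ w → [ eqVecᵇ (content n w) α ]))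
          (cong (ℤ._* G α) (sym (countB-∑ _ ws))))))

  +sum : ∀ {X : Set} (xs : List X) (g : X → ℕ) → + sum (map g xs) ≡ ∑ xs (λ x → + g x)
  +sum []       g = refl
  +sum (x ∷ xs) g = cong (λ z → + g x ℤ.+ z) (+sum xs g)

  -- The list `us ν` stands for the Schur polynomial of ν. Besides closure and bounded contents, the
  -- only fact about it is that its lattice words are counted by the indicator of content ν.
  module LittlewoodRichardson {n c : ℕ} {box partitions : List (Vec ℕ n)}
    (box-unique : Unique box) (box-complete : ∀ α → Bounded c α → α ∈ box)
    (partitions-unique : Unique partitions)
    (partitions-complete : ∀ κ → Bounded c κ → Decreasing κ → κ ∈ partitions)
    (ws : List Word) (closed : CrystalClosed n ws) (bounded : ∀ {w} → w ∈ ws → Bounded c (content n w))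
    (us : Vec ℕ n → List Word) (us-closed : ∀ {ν} → ν ∈ partitions → CrystalClosed n (us ν))
    (us-bounded : ∀ {ν w} → ν ∈ partitions → w ∈ us ν → Bounded c (content n w))
    (us-lattice : ∀ {ν} → ν ∈ partitions → ∀ κ → + latticeMultiplicity (us ν) κ ≡ [ eqVecᵇ ν κ ]) where

    private
      H : Vec ℕ n → ℤ
      H ν = + latticeMultiplicity ws ν

      K : Vec ℕ n → Vec ℕ n → ℤ
      K ν α = + multiplicity (us ν) α

      h : Vec ℕ n → ℤ
      h α = + multiplicity ws α ℤ.- ∑ partitions (λ ν → H ν ℤ.* K ν α)

      symmetric : ∀ k α → h (swapAt k α) ≡ h α
      symmetric k α = cong₂ ℤ._-_ (cong +_ (multiplicity-symmetric closed k α))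
        (∑-cong partitions (λ {ν} ν∈ → cong (λ z → H ν ℤ.* + z) (multiplicity-symmetric (us-closed ν∈) k α)))

      unsupported : ∀ vs → (∀ {w} → w ∈ vs → Bounded c (content n w)) → ∀ α → ¬ Bounded c α → multiplicity vs α ≡ 0
      unsupported vs b α ¬b = countB-none _ vs λ {w} w∈ → eqVecᵇ-false λ eq → ¬b (subst (Bounded c) eq (b w∈))

      support : ∀ α → ¬ Bounded c α → h α ≡ 0ℤ
      support α ¬b = cong₂ ℤ._-_ (cong +_ (unsupported ws bounded α ¬b))
        (trans (∑-cong partitions (λ {ν} ν∈ → trans (cong (λ z → H ν ℤ.* + z) (unsupported (us ν) (us-bounded ν∈) α ¬b))
          (ℤ.*-zeroʳ (H ν)))) (∑-zero partitions))

      expand : ∀ vs → CrystalClosed n vs → (∀ {w} → w ∈ vs → Bounded c (content n w)) → ∀ κ →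
        ∑ box (λ α → + multiplicity vs α ℤ.* alternant κ α) ≡ + latticeMultiplicity vs κ
      expand vs cl b κ = trans (sym (∑-content box-unique vs (λ w∈ → box-complete _ (b w∈)) (alternant κ))) (∑-alternant cl κ)

      distrib : ∀ a b g → (a ℤ.- b) ℤ.* g ≡ a ℤ.* g ℤ.+ ℤ.- (b ℤ.* g)
      distrib = solve-∀

      annihilated : ∀ κ → Bounded c κ → Decreasing κ → ∑ box (λ α → h α ℤ.* alternant κ α) ≡ 0ℤ
      annihilated κ b d = trans (∑-cong box (λ {α} _ → distrib (+ multiplicity ws α) (∑ partitions (λ ν → H ν ℤ.* K ν α)) (alternant κ α)))
        (trans (∑-+ box (λ α → + multiplicity ws α ℤ.* alternant κ α) _)
        (trans (cong₂ ℤ._+_ (expand ws closed bounded κ) (trans (∑-neg box _) (cong ℤ.-_ second)))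
        (ℤ.+-inverseʳ (H κ))))
        where
        -- Pairing with the alternant of κ replaces the multiplicities in `us ν` by the indicator of
        -- ν = κ, so of the sum over partitions only `H κ` survives.
        second : ∑ box (λ α → ∑ partitions (λ ν → H ν ℤ.* K ν α) ℤ.* alternant κ α) ≡ H κ
        second = trans (∑-cong box (λ {α} _ → trans (sym (∑-*ʳ partitions (alternant κ α) _))
            (∑-cong partitions (λ {ν} _ → ℤ.*-assoc (H ν) (K ν α) (alternant κ α)))))
          (trans (∑-swap box partitions (λ α ν → H ν ℤ.* (K ν α ℤ.* alternant κ α)))
          (trans (∑-cong partitions (λ {ν} ν∈ → trans (∑-*ˡ box (H ν) _)
            (cong (λ z → H ν ℤ.* z) (trans (expand (us ν) (us-closed ν∈) (us-bounded ν∈) κ) (us-lattice ν∈ κ)))))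
          (trans (∑-single (λ ν → H ν ℤ.* [ eqVecᵇ ν κ ]) partitions-unique (partitions-complete κ b d)
            (λ {ν} _ ν≢κ → trans (cong (λ z → H ν ℤ.* [ z ]) (eqVecᵇ-false ν≢κ)) (ℤ.*-zeroʳ (H ν))))
          (trans (cong (λ z → H κ ℤ.* [ z ]) (eqVecᵇ-refl κ)) (ℤ.*-identityʳ (H κ))))))

    expansion : ∀ α → multiplicity ws α ≡ sum (map (λ ν → latticeMultiplicity ws ν * multiplicity (us ν) α) partitions)
    expansion α = ℤ.+-injective (trans
      (ℤ.i-j≡0⇒i≡j (+ multiplicity ws α) _ (annihilated⇒zero box-unique box-complete h symmetric support annihilated α))
      (sym (trans (+sum partitions _) (∑-cong partitions (λ {ν} _ → ℤ.pos-* (latticeMultiplicity ws ν) _)))))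

-- The operators on the word of a single row.

module RowWords where
  open LIA
  open Words
  open import Data.Nat using (ℕ; zero; suc; _+_; _∸_; _≤_; _<_; z≤n; s≤s)
  import Data.Nat.Properties as ℕ
  open import Data.List using (List; []; _∷_; _++_; replicate)
  import Data.List.Properties as List
  open import Data.List.Relation.Unary.All using (All; []; _∷_)
  import Data.List.Relation.Unary.All.Properties as All
  open import Data.Vec using ([]; _∷_)
  open import Data.Empty using (⊥-elim)
  open import Relation.Binary.PropositionalEquality hiding ([_]; J)

  -- Multiplicities are indexed from 0 and letters from 1: the letter `k + 1` occurs `ε k` or `u k`
  -- times.
  descending ascending : (ℕ → ℕ) → ℕ → Word
  descending ε zero    = []
  descending ε (suc n) = replicate (ε n) (suc n) ++ descending ε n
  ascending u zero     = []
  ascending u (suc n)  = ascending u n ++ replicate (u n) (suc n)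

  rowWord : ℕ → (ℕ → ℕ) → (ℕ → ℕ) → Word
  rowWord n ε u = descending ε n ++ ascending u n

  descending-cong : ∀ {ε ε′} n → (∀ k → k < n → ε k ≡ ε′ k) → descending ε n ≡ descending ε′ n
  descending-cong zero    h = refl
  descending-cong (suc n) h = cong₂ _++_ (cong (λ z → replicate z (suc n)) (h n ℕ.≤-refl))
    (descending-cong n λ k k< → h k (ℕ.m≤n⇒m≤1+n k<))

  ascending-cong : ∀ {u u′} n → (∀ k → k < n → u k ≡ u′ k) → ascending u n ≡ ascending u′ n
  ascending-cong zero    h = refl
  ascending-cong (suc n) h = cong₂ _++_ (ascending-cong n λ k k< → h k (ℕ.m≤n⇒m≤1+n k<))
    (cong (λ z → replicate z (suc n)) (h n ℕ.≤-refl))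

  module _ (i : ℕ) where

    Neutral : Word → Set
    Neutral = All (λ c → kind i c ≡ other)

    A-neutral : ∀ {v} w → Neutral v → A i (v ++ w) ≡ A i w
    A-neutral w [] = refl
    A-neutral w (_∷_ {c} {v} h hs) rewrite h = A-neutral w hs

    B-neutral : ∀ {v} w → Neutral v → B i (v ++ w) ≡ B i w
    B-neutral w [] = refl
    B-neutral w (_∷_ {c} {v} h hs) rewrite h = B-neutral w hs

    f-neutral : ∀ {v} w → Neutral v → f i (v ++ w) ≡ v ++ f i w
    f-neutral w [] = refl
    f-neutral w (_∷_ {c} {v} h hs) rewrite h = cong (c ∷_) (f-neutral w hs)

    e-neutral : ∀ {v} w → Neutral v → e i (v ++ w) ≡ v ++ e i w
    e-neutral w [] = refl
    e-neutral w (_∷_ {c} {v} h hs) rewrite h = cong (c ∷_) (e-neutral w hs)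

    los his : ℕ → Word → Word
    los k w = replicate k i ++ w
    his k w = replicate k (suc i) ++ w

    A-los : ∀ k w → A i (los k w) ≡ k + A i w
    A-los zero    w = refl
    A-los (suc k) w rewrite kind-lo i = cong suc (A-los k w)

    A-his : ∀ k w → A i (his k w) ≡ A i w ∸ k
    A-his zero    w = refl
    A-his (suc k) w rewrite kind-hi i | A-his k w =
      lia (A i w ∷ k ∷ []) (λ a k → (a :∸ k) :∸ # 1 :≡ a :∸ (# 1 :+ k)) refl

    B-los : ∀ k w → B i (los k w) ≡ B i w
    B-los zero    w = refl
    B-los (suc k) w rewrite kind-lo i = B-los k w

    B-his : ∀ k w → k ≤ A i w → B i (his k w) ≡ B i w
    B-his zero    w h = refl
    B-his (suc k) w h rewrite kind-hi i | A-his k w with A i w ∸ k in eq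
    ... | zero  = ⊥-elim (lia (A i w ∷ k ∷ []) (λ a k → (# 1 :+ k) :≤ a ⇒ a :∸ k :≡ # 0 ⇒ :⊥) refl h eq)
    ... | suc _ = B-his k w (ℕ.<⇒≤ h)

    -- A free `i` further right takes precedence over every letter of the block.
    f-los : ∀ k w → 1 ≤ A i w → f i (los k w) ≡ los k (f i w)
    f-los zero    w h = refl
    f-los (suc k) w h rewrite kind-lo i | A-los k w with k + A i w in eq
    ... | zero  = ⊥-elim (lia (A i w ∷ k ∷ []) (λ a k → # 1 :≤ a ⇒ k :+ a :≡ # 0 ⇒ :⊥) refl h eq)
    ... | suc _ = cong (i ∷_) (f-los k w h)

    f-los-last : ∀ k w → A i w ≡ 0 → f i (los (suc k) w) ≡ los k (suc i ∷ w)
    f-los-last zero    w h rewrite kind-lo i | h = refl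
    f-los-last (suc k) w h = go
      where
      go : f i (i ∷ los (suc k) w) ≡ i ∷ los k (suc i ∷ w)
      go rewrite kind-lo i with A i (los (suc k) w) in eq
      ... | zero  = ⊥-elim (lia (A i w ∷ k ∷ []) (λ a k → (# 1 :+ k) :+ a :≡ # 0 ⇒ :⊥) refl (trans (sym (A-los (suc k) w)) eq))
      ... | suc _ = cong (i ∷_) (trans (cong₂ (λ z r → stepF z (A i (los k w)) i i (los k w) r) (sym (kind-lo i)) refl) (f-los-last k w h))

    f-his : ∀ k w → f i (his k w) ≡ his k (f i w)
    f-his zero    w = refl
    f-his (suc k) w rewrite kind-hi i = cong (suc i ∷_) (f-his k w)

    e-los : ∀ k w → e i (los k w) ≡ los k (e i w)
    e-los zero    w = refl
    e-los (suc k) w rewrite kind-lo i = cong (i ∷_) (e-los k w)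

    -- All `k` letters of the block find partners in `w`, so none of them is the one to be lowered.
    e-his : ∀ k w → k ≤ A i w → e i (his k w) ≡ his k (e i w)
    e-his zero    w h = refl
    e-his (suc k) w h rewrite kind-hi i | A-his k w with A i w ∸ k in eq
    ... | zero  = ⊥-elim (lia (A i w ∷ k ∷ []) (λ a k → (# 1 :+ k) :≤ a ⇒ a :∸ k :≡ # 0 ⇒ :⊥) refl h eq)
    ... | suc _ = cong (suc i ∷_) (e-his k w (ℕ.<⇒≤ h))

    e-his-first : ∀ k w → A i w ≤ k → e i (his (suc k) w) ≡ i ∷ his k w
    e-his-first k w h rewrite kind-hi i | A-his k w | ℕ.m≤n⇒m∸n≡0 h = refl

  replicate-snoc : ∀ k (c : ℕ) w → replicate k c ++ (c ∷ w) ≡ replicate (suc k) c ++ w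
  replicate-snoc zero    c w = refl
  replicate-snoc (suc k) c w = cong (c ∷_) (replicate-snoc k c w)

  module _ (κ : ℕ) where
    private
      i : ℕ
      i = suc κ

    highD highI : ℕ → (ℕ → ℕ) → Word
    highD zero    ε = []
    highD (suc m) ε = replicate (ε (m + suc (suc κ))) (suc (m + suc (suc κ))) ++ highD m ε
    highI zero    u = []
    highI (suc m) u = highI m u ++ replicate (u (m + suc (suc κ))) (suc (m + suc (suc κ)))

    low : (ℕ → ℕ) → (ℕ → ℕ) → Word
    low ε u = descending ε κ ++ ascending u κ

    descending-split : ∀ m ε → descending ε (m + suc (suc κ)) ≡ highD m ε ++ descending ε (suc (suc κ))
    descending-split zero    ε = refl
    descending-split (suc m) ε = trans (cong (replicate (ε (m + suc (suc κ))) (suc (m + suc (suc κ))) ++_) (descending-split m ε))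
      (sym (List.++-assoc (replicate (ε (m + suc (suc κ))) (suc (m + suc (suc κ)))) (highD m ε) _))

    ascending-split : ∀ m u → ascending u (m + suc (suc κ)) ≡ ascending u (suc (suc κ)) ++ highI m u
    ascending-split zero    u = sym (List.++-identityʳ _)
    ascending-split (suc m) u = trans (cong (_++ replicate (u (m + suc (suc κ))) (suc (m + suc (suc κ)))) (ascending-split m u))
      (List.++-assoc (ascending u (suc (suc κ))) (highI m u) _)

    -- Only four blocks matter to the operators for `i`: the non-pivots `i + 1` and `i`, then the
    -- pivots `i` and `i + 1`. Writing the number of letters as `m + suc (suc κ)` guarantees that
    -- both letters exist and lets the blocks of larger letters unfold by recursion on `m`.
    rowWord-split : ∀ m ε u w → rowWord (m + suc (suc κ)) ε u ++ w ≡
      highD m ε ++ his i (ε (suc κ)) (los i (ε κ) (low ε u ++ los i (u κ) (his i (u (suc κ)) (highI m u ++ w))))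
    rowWord-split m ε u w rewrite descending-split m ε | ascending-split m u = begin
      ((H ++ (E2 ++ (E1 ++ D))) ++ (((I ++ U1) ++ U2) ++ J)) ++ w ≡⟨ List.++-assoc (H ++ (E2 ++ (E1 ++ D))) _ w ⟩
      (H ++ (E2 ++ (E1 ++ D))) ++ ((((I ++ U1) ++ U2) ++ J) ++ w) ≡⟨ List.++-assoc H _ _ ⟩
      H ++ ((E2 ++ (E1 ++ D)) ++ ((((I ++ U1) ++ U2) ++ J) ++ w)) ≡⟨ cong (H ++_) (List.++-assoc E2 _ _) ⟩
      H ++ (E2 ++ ((E1 ++ D) ++ ((((I ++ U1) ++ U2) ++ J) ++ w))) ≡⟨ cong (λ z → H ++ (E2 ++ z)) (List.++-assoc E1 D _) ⟩
      H ++ (E2 ++ (E1 ++ (D ++ ((((I ++ U1) ++ U2) ++ J) ++ w)))) ≡⟨ cong (λ z → H ++ (E2 ++ (E1 ++ (D ++ z)))) inner ⟩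
      H ++ (E2 ++ (E1 ++ (D ++ (I ++ (U1 ++ (U2 ++ (J ++ w))))))) ≡⟨ cong (λ z → H ++ (E2 ++ (E1 ++ z))) (sym (List.++-assoc D I _)) ⟩
      H ++ (E2 ++ (E1 ++ ((D ++ I) ++ (U1 ++ (U2 ++ (J ++ w)))))) ∎
      where
      open ≡-Reasoning
      H = highD m ε
      E2 = replicate (ε (suc κ)) (suc i)
      E1 = replicate (ε κ) i
      D = descending ε κ
      I = ascending u κ
      U1 = replicate (u κ) i
      U2 = replicate (u (suc κ)) (suc i)
      J = highI m u
      inner : ((((I ++ U1) ++ U2) ++ J) ++ w) ≡ I ++ (U1 ++ (U2 ++ (J ++ w)))
      inner = trans (List.++-assoc ((I ++ U1) ++ U2) J w) (trans (List.++-assoc (I ++ U1) U2 _) (List.++-assoc I U1 _))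

    private
      big : ∀ m → kind i (suc (m + suc (suc κ))) ≡ other
      big m = kind-other (λ p → lia (m ∷ κ ∷ []) (λ m k → # 1 :+ (m :+ (# 2 :+ k)) :≡ # 1 :+ k ⇒ :⊥) refl p)
                         (λ p → lia (m ∷ κ ∷ []) (λ m k → # 1 :+ (m :+ (# 2 :+ k)) :≡ # 2 :+ k ⇒ :⊥) refl p)
      small : ∀ {k} → k < κ → kind i (suc k) ≡ other
      small {k} h = kind-other (λ p → lia (k ∷ κ ∷ []) (λ m k → # 1 :+ m :≡ # 1 :+ k ⇒ m :< k ⇒ :⊥) refl p h)
                               (λ p → lia (k ∷ κ ∷ []) (λ m k → # 1 :+ m :≡ # 2 :+ k ⇒ m :< k ⇒ :⊥) refl p h)
      neutral-replicate : ∀ j {c} → kind i c ≡ other → Neutral i (replicate j c)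
      neutral-replicate zero    h = []
      neutral-replicate (suc j) h = h ∷ neutral-replicate j h
      highD-neutral : ∀ m ε → Neutral i (highD m ε)
      highD-neutral zero    ε = []
      highD-neutral (suc m) ε = All.++⁺ (neutral-replicate _ (big m)) (highD-neutral m ε)
      highI-neutral : ∀ m u → Neutral i (highI m u)
      highI-neutral zero    u = []
      highI-neutral (suc m) u = All.++⁺ (highI-neutral m u) (neutral-replicate _ (big m))
      desc-neutral : ∀ k ε → k ≤ κ → Neutral i (descending ε k)
      desc-neutral zero    ε h = []
      desc-neutral (suc k) ε h = All.++⁺ (neutral-replicate _ (small h)) (desc-neutral k ε (ℕ.<⇒≤ h))
      asc-neutral : ∀ k u → k ≤ κ → Neutral i (ascending u k)
      asc-neutral zero    u h = []
      asc-neutral (suc k) u h = All.++⁺ (asc-neutral k u (ℕ.<⇒≤ h)) (neutral-replicate _ (small h))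
      low-neutral : ∀ ε u → Neutral i (low ε u)
      low-neutral ε u = All.++⁺ (desc-neutral κ ε ℕ.≤-refl) (asc-neutral κ u ℕ.≤-refl)

      highD-cong : ∀ m {ε ε′} → (∀ k → k ≢ κ → k ≢ suc κ → ε k ≡ ε′ k) → highD m ε ≡ highD m ε′
      highD-cong zero    h = refl
      highD-cong (suc m) h = cong₂ (λ z r → replicate z (suc (m + suc (suc κ))) ++ r)
        (h _ (λ p → lia (m ∷ κ ∷ []) (λ m k → m :+ (# 2 :+ k) :≡ k ⇒ :⊥) refl p)
             (λ p → lia (m ∷ κ ∷ []) (λ m k → m :+ (# 2 :+ k) :≡ # 1 :+ k ⇒ :⊥) refl p)) (highD-cong m h)
      highI-cong : ∀ m {u u′} → (∀ k → k ≢ κ → k ≢ suc κ → u k ≡ u′ k) → highI m u ≡ highI m u′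
      highI-cong zero    h = refl
      highI-cong (suc m) h = cong₂ (λ r z → r ++ replicate z (suc (m + suc (suc κ)))) (highI-cong m h)
        (h _ (λ p → lia (m ∷ κ ∷ []) (λ m k → m :+ (# 2 :+ k) :≡ k ⇒ :⊥) refl p)
             (λ p → lia (m ∷ κ ∷ []) (λ m k → m :+ (# 2 :+ k) :≡ # 1 :+ k ⇒ :⊥) refl p))
      low-cong : ∀ {ε ε′ u u′} → (∀ k → k ≢ κ → k ≢ suc κ → ε k ≡ ε′ k) → (∀ k → k ≢ κ → k ≢ suc κ → u k ≡ u′ k) →
                 low ε u ≡ low ε′ u′
      low-cong h g = cong₂ _++_
        (descending-cong κ λ k k< → h k (ℕ.<⇒≢ k<) (ℕ.<⇒≢ (ℕ.m≤n⇒m≤1+n k<)))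
        (ascending-cong κ λ k k< → g k (ℕ.<⇒≢ k<) (ℕ.<⇒≢ (ℕ.m≤n⇒m≤1+n k<)))

    module _ (m : ℕ) (ε u : ℕ → ℕ) (w : Word) where
      private
        n : ℕ
        n = m + suc (suc κ)
        v : Word
        v = highI m u ++ w
        Av : A i v ≡ A i w
        Av = A-neutral i w (highI-neutral m u)
        inner : Word
        inner = low ε u ++ los i (u κ) (his i (u (suc κ)) v)
        A-inner : A i inner ≡ u κ + (A i w ∸ u (suc κ))
        A-inner = trans (A-neutral i _ (low-neutral ε u)) (trans (A-los i (u κ) _)
          (cong (u κ +_) (trans (A-his i (u (suc κ)) v) (cong (_∸ u (suc κ)) Av))))
        A-ε : A i (los i (ε κ) inner) ≡ (ε κ + u κ) + (A i w ∸ u (suc κ))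
        A-ε = trans (A-los i (ε κ) inner) (trans (cong (ε κ +_) A-inner) (sym (ℕ.+-assoc (ε κ) (u κ) _)))

      -- Reading from right to left, the pivots `i + 1` consume free letters of `w`, then the
      -- letters `i` of both kinds become free, and finally the non-pivots `i + 1` consume from all
      -- of these.
      A-rowWord : A i (rowWord n ε u ++ w) ≡ ((ε κ + u κ) + (A i w ∸ u (suc κ))) ∸ ε (suc κ)
      A-rowWord rewrite rowWord-split m ε u w = trans (A-neutral i _ (highD-neutral m ε))
        (trans (A-his i (ε (suc κ)) _) (cong (_∸ ε (suc κ)) A-ε))

      B-rowWord : u (suc κ) ≤ A i w → ε (suc κ) ≤ (ε κ + u κ) + (A i w ∸ u (suc κ)) → B i (rowWord n ε u ++ w) ≡ B i w
      B-rowWord h k rewrite rowWord-split m ε u w = trans (B-neutral i _ (highD-neutral m ε))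
        (trans (B-his i (ε (suc κ)) _ (subst (ε (suc κ) ≤_) (sym A-ε) k))
        (trans (B-los i (ε κ) inner) (trans (B-neutral i _ (low-neutral ε u)) (trans (B-los i (u κ) _)
        (trans (B-his i (u (suc κ)) v (subst (u (suc κ) ≤_) (sym Av) h)) (B-neutral i w (highI-neutral m u)))))))

      -- The pivots `i + 1` do not use up the free letters of `w`, so the rightmost unmatched `i` is
      -- among them.
      f-above : u (suc κ) < A i w → f i (rowWord n ε u ++ w) ≡ rowWord n ε u ++ f i w
      f-above h rewrite rowWord-split m ε u w | rowWord-split m ε u (f i w) =
        trans (f-neutral i _ (highD-neutral m ε)) (cong (highD m ε ++_)
        (trans (f-his i (ε (suc κ)) _) (cong (his i (ε (suc κ)))
        (trans (f-los i (ε κ) inner (subst (1 ≤_) (sym A-inner) (ℕ.≤-trans (ℕ.m<n⇒0<n∸m h) (ℕ.m≤n+m _ (u κ)))))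
        (cong (los i (ε κ))
        (trans (f-neutral i _ (low-neutral ε u)) (cong (low ε u ++_)
        (trans (f-los i (u κ) _ (subst (1 ≤_) (sym (trans (A-his i (u (suc κ)) v) (cong (_∸ u (suc κ)) Av))) (ℕ.m<n⇒0<n∸m h)))
        (cong (los i (u κ)) (trans (f-his i (u (suc κ)) v)
        (cong (his i (u (suc κ))) (f-neutral i w (highI-neutral m u))))))))))))) 

      e-above : u (suc κ) ≤ A i w → ε (suc κ) ≤ (ε κ + u κ) + (A i w ∸ u (suc κ)) → e i (rowWord n ε u ++ w) ≡ rowWord n ε u ++ e i w
      e-above h k rewrite rowWord-split m ε u w | rowWord-split m ε u (e i w) =
        trans (e-neutral i _ (highD-neutral m ε)) (cong (highD m ε ++_)
        (trans (e-his i (ε (suc κ)) _ (subst (ε (suc κ) ≤_) (sym A-ε) k)) (cong (his i (ε (suc κ)))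
        (trans (e-los i (ε κ) inner) (cong (los i (ε κ))
        (trans (e-neutral i _ (low-neutral ε u)) (cong (low ε u ++_)
        (trans (e-los i (u κ) _)
        (cong (los i (u κ)) (trans (e-his i (u (suc κ)) v (subst (u (suc κ) ≤_) (sym Av) h))
        (cong (his i (u (suc κ))) (e-neutral i w (highI-neutral m u)))))))))))))

      module _ {ε′ u′ : ℕ → ℕ} (same-ε : ∀ k → k ≢ κ → k ≢ suc κ → ε′ k ≡ ε k)
               (same-u : ∀ k → k ≢ κ → k ≢ suc κ → u′ k ≡ u k) where

        -- The free letters of `w` are exhausted, so the last pivot `i` is raised. It stands
        -- directly before the pivots `i + 1` and joins their block, which keeps the word of the
        -- form of a row word.
        f-pivot : A i w ≤ u (suc κ) → ε′ κ ≡ ε κ → ε′ (suc κ) ≡ ε (suc κ) → suc (u′ κ) ≡ u κ → u′ (suc κ) ≡ suc (u (suc κ)) →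
                  f i (rowWord n ε u ++ w) ≡ rowWord n ε′ u′ ++ w
        f-pivot h p q r s rewrite rowWord-split m ε u w | rowWord-split m ε′ u′ w | p | q | s | sym r
          | highD-cong m same-ε | highI-cong m same-u | low-cong same-ε same-u =
          trans (f-neutral i _ (highD-neutral m ε)) (cong (highD m ε ++_)
          (trans (f-his i (ε (suc κ)) _) (cong (his i (ε (suc κ)))
          (trans (f-los i (ε κ) _ (subst (1 ≤_) (sym (trans (A-neutral i _ (low-neutral ε u)) (A-los i (suc (u′ κ)) _))) (s≤s z≤n)))
          (cong (los i (ε κ))
          (trans (f-neutral i _ (low-neutral ε u)) (cong (low ε u ++_)
          (f-los-last i (u′ κ) _ (trans (A-his i (u (suc κ)) v) (trans (cong (_∸ u (suc κ)) Av) (ℕ.m≤n⇒m∸n≡0 h)))))))))))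

        -- Without pivots `i` the operator reaches the non-pivot `i`, which becomes a non-pivot
        -- `i + 1` in the position where such a letter is read.
        f-nonpivot : A i w ≤ u (suc κ) → ε κ ≡ 1 → ε (suc κ) ≡ 0 → ε′ κ ≡ 0 → ε′ (suc κ) ≡ 1 → u κ ≡ 0 → u′ κ ≡ 0 →
                     u′ (suc κ) ≡ u (suc κ) → f i (rowWord n ε u ++ w) ≡ rowWord n ε′ u′ ++ w
        f-nonpivot h p q p′ q′ r r′ s rewrite rowWord-split m ε u w | rowWord-split m ε′ u′ w | p | q | p′ | q′ | r | r′ | s
          | highD-cong m same-ε | highI-cong m same-u | low-cong same-ε same-u =
          trans (f-neutral i _ (highD-neutral m ε)) (cong (highD m ε ++_)
          (f-los-last i 0 _ (trans (A-neutral i _ (low-neutral ε u))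
            (trans (A-his i (u (suc κ)) v) (trans (cong (_∸ u (suc κ)) Av) (ℕ.m≤n⇒m∸n≡0 h))))))

        -- The non-pivots `i + 1` are matched within the row, so the leftmost unmatched letter is
        -- the first pivot `i + 1`; lowered, it extends the block of pivots `i` just before it.
        e-pivot : A i w < u (suc κ) → ε (suc κ) ≤ ε κ + u κ → ε′ κ ≡ ε κ → ε′ (suc κ) ≡ ε (suc κ) → u′ κ ≡ suc (u κ) →
                  suc (u′ (suc κ)) ≡ u (suc κ) → e i (rowWord n ε u ++ w) ≡ rowWord n ε′ u′ ++ w
        e-pivot h k p q r s rewrite rowWord-split m ε u w | rowWord-split m ε′ u′ w | p | q | r | sym s
          | highD-cong m same-ε | highI-cong m same-u | low-cong same-ε same-u =
          trans (e-neutral i _ (highD-neutral m ε)) (cong (highD m ε ++_)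
          (trans (e-his i (ε (suc κ)) _ (subst (ε (suc κ) ≤_)
             (sym (trans (A-los i (ε κ) _) (cong (ε κ +_) (trans (A-neutral i _ (low-neutral ε u)) (A-los i (u κ) _)))))
             (ℕ.≤-trans k (ℕ.≤-trans (ℕ.m≤m+n _ _) (ℕ.≤-reflexive (ℕ.+-assoc (ε κ) (u κ) _))))))
          (cong (his i (ε (suc κ)))
          (trans (e-los i (ε κ) _) (cong (los i (ε κ))
          (trans (e-neutral i _ (low-neutral ε u)) (cong (low ε u ++_)
          (trans (e-los i (u κ) _) (trans (cong (los i (u κ)) (e-his-first i (u′ (suc κ)) v (subst (_≤ u′ (suc κ)) (sym Av) (ℕ.≤-pred h))))
            (replicate-snoc (u κ) i _))))))))))

        e-nonpivot : A i w ≤ u (suc κ) → ε κ ≡ 0 → ε (suc κ) ≡ 1 → ε′ κ ≡ 1 → ε′ (suc κ) ≡ 0 → u κ ≡ 0 → u′ κ ≡ 0 →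
                     u′ (suc κ) ≡ u (suc κ) → e i (rowWord n ε u ++ w) ≡ rowWord n ε′ u′ ++ w
        e-nonpivot h p q p′ q′ r r′ s rewrite rowWord-split m ε u w | rowWord-split m ε′ u′ w | p | q | p′ | q′ | r | r′ | s
          | highD-cong m same-ε | highI-cong m same-u | low-cong same-ε same-u =
          trans (e-neutral i _ (highD-neutral m ε)) (cong (highD m ε ++_)
          (e-his-first i 0 _ (ℕ.≤-reflexive (trans (A-neutral i _ (low-neutral ε u))
            (trans (A-his i (u (suc κ)) v) (trans (cong (_∸ u (suc κ)) Av) (ℕ.m≤n⇒m∸n≡0 h)))))))

-- Profiles of rows, stacks of profiles, and the change of a profile at one letter.

module Profiles where
  open LIA
  open Words
  open RowWords
  open import Data.Nat using (ℕ; zero; suc; _+_; _∸_; _⊓_; _≤_; _<_; _≟_; _≡ᵇ_)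
  import Data.Nat.Properties as ℕ
  open import Data.Bool using (if_then_else_)
  open import Data.List using (List; []; _∷_; _++_)
  open import Data.Vec using ([]; _∷_)
  open import Data.Product using (_×_; _,_)
  open import Data.Sum using (_⊎_; inj₁; inj₂)
  open import Relation.Nullary using (yes; no)
  open import Relation.Binary.PropositionalEquality hiding ([_])

  -- A row of a filling, seen through the numbers y k of columns up to the last box with minimum ≤ k
  -- and the numbers ε k ∈ {0 , 1} of non-pivot entries k.
  record Profile : Set where
    constructor profile
    field
      y ε : ℕ → ℕ
    -- The boxes up to column x k have maximum ≤ k, except that x k can be too large by one when the last of them
    -- has no entry k + 1; this discrepancy is invisible to the next row.
    x : ℕ → ℕ
    x k = y k ∸ ε (suc k)
  open Profile public

  total : (ℕ → ℕ) → ℕ → ℕ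
  total g zero    = 0
  total g (suc n) = total g n + g n

  -- `room` says that a non-pivot `k + 1` needs a box with minimum at most `k`. `bit` reflects that
  -- two boxes of a row cannot share a non-pivot: the minimum of the right one would lie below the
  -- maximum of the left one. `size` fixes the component of `ex`.
  record Row (n a b t : ℕ) (p : Profile) : Set where
    constructor mkRow
    field
      start : y p 0 ≡ a
      end   : y p n ≡ b
      mono  : ∀ k → k < n → y p k ≤ y p (suc k)
      room  : ∀ k → k < n → ε p (suc k) + a ≤ y p k
      bit   : ∀ k → ε p k ≤ 1
      last  : ε p (suc n) ≡ 0
      size  : total (λ k → ε p (suc k)) n ≡ t
  open Row public

  -- The row p fits below a row with thresholds X, with g equalities between vertical neighbours.
  record Below (n g : ℕ) (X : ℕ → ℕ) (p : Profile) : Set where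
    constructor mkBelow
    field
      under    : ∀ k → k ≤ n → y p k ≤ X k
      equality : total (λ k → y p (suc k) ∸ X k) n ≡ g
  open Below public

  -- The minima `k + 1` fill the columns from `y k` to `y (k + 1)`. Those from column `X k` on
  -- repeat the maximum of the box above, and their pivots are omitted from the word.
  pivots : (ℕ → ℕ) → Profile → ℕ → ℕ
  pivots X p k = (y p (suc k) ⊓ X k) ∸ y p k

  wordBelow : ℕ → (ℕ → ℕ) → Profile → Word
  wordBelow n X p = rowWord n (λ k → ε p (suc k)) (pivots X p)

  record Shape : Set where
    constructor shape
    field
      a b t g : ℕ

  module _ (n c : ℕ) where

    -- Rows are listed from bottom to top; the top row lies below a fictitious row of infinite entries.
    thresholds : List Profile → ℕ → ℕ
    thresholds []      k = c
    thresholds (p ∷ _) k = x p k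

    data Valid : List Shape → List Profile → Set where
      []  : Valid [] []
      _∷_ : ∀ {s ss p ps} → Row n (Shape.a s) (Shape.b s) (Shape.t s) p × Below n (Shape.g s) (thresholds ps) p →
            Valid ss ps → Valid (s ∷ ss) (p ∷ ps)

    stackWord : List Profile → Word
    stackWord []       = []
    stackWord (p ∷ ps) = wordBelow n (thresholds ps) p ++ stackWord ps

  total-cong : ∀ {g h} n → (∀ k → k < n → g k ≡ h k) → total g n ≡ total h n
  total-cong zero    eq = refl
  total-cong (suc n) eq = cong₂ _+_ (total-cong n λ k k< → eq k (ℕ.m≤n⇒m≤1+n k<)) (eq n ℕ.≤-refl)

  total-local : ∀ {g h} κ m → (∀ k → k ≢ κ → k ≢ suc κ → g k ≡ h k) → g κ + g (suc κ) ≡ h κ + h (suc κ) →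
                total g (m + suc (suc κ)) ≡ total h (m + suc (suc κ))
  total-local {g} {h} κ zero same eq
    rewrite total-cong {g} {h} κ (λ k k< → same k (ℕ.<⇒≢ k<) (ℕ.<⇒≢ (ℕ.m≤n⇒m≤1+n k<))) =
    trans (ℕ.+-assoc (total h κ) _ _) (trans (cong (total h κ +_) eq) (sym (ℕ.+-assoc (total h κ) _ _)))
  total-local κ (suc m) same eq = cong₂ _+_ (total-local κ m same eq)
    (same _ (λ p → lia (m ∷ κ ∷ []) (λ m k → m :+ (# 2 :+ k) :≡ k ⇒ :⊥) refl p)
            (λ p → lia (m ∷ κ ∷ []) (λ m k → m :+ (# 2 :+ k) :≡ # 1 :+ k ⇒ :⊥) refl p))

  update : (ℕ → ℕ) → ℕ → ℕ → ℕ → ℕ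
  update h k v j = if j ≡ᵇ k then v else h j

  update-same : ∀ (h : ℕ → ℕ) k v → update h k v k ≡ v
  update-same h k v rewrite ≡ᵇ-refl k = refl

  update-other : ∀ (h : ℕ → ℕ) k v {j} → j ≢ k → update h k v j ≡ h j
  update-other h k v p rewrite ≢⇒≡ᵇ p = refl

  module Step (κ m c : ℕ) where
    private
      n i : ℕ
      n = m + suc (suc κ)
      i = suc κ
      κ<n : κ < n
      κ<n = lia (m ∷ κ ∷ []) (λ m k → k :< m :+ (# 2 :+ k)) refl
      i<n : i < n
      i<n = lia (m ∷ κ ∷ []) (λ m k → # 1 :+ k :< m :+ (# 2 :+ k)) refl

    -- In terms of the boxes that meet {i , i + 1}, the row below starts to see such boxes above it in column left X.
    left : (ℕ → ℕ) → ℕ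
    left X = X κ ⊓ X i

    SameOutside : (ℕ → ℕ) → (ℕ → ℕ) → Set
    SameOutside X X′ = ∀ k → k ≢ κ → k ≢ i → X′ k ≡ X k

    module _ (a p R : ℕ) where
      LocalRow : ℕ → ℕ → ℕ → Set
      LocalRow y e₁ e₂ = (p ≤ y × y ≤ R) × (e₁ + a ≤ p × e₂ + a ≤ y) × (e₁ ≤ 1 × e₂ ≤ 1)

    -- Since `y κ` and `y (suc i)` stay, only the division of the columns between the minima `i` and
    -- `i + 1` and the two bits can change.
    adjust : Profile → ℕ → ℕ → ℕ → Profile
    adjust q y′ e₁ e₂ = profile (update (y q) i y′) (update (update (ε q) (suc i) e₂) i e₁)

    module _ (q : Profile) (y′ e₁ e₂ : ℕ) where
      private
        q′ = adjust q y′ e₁ e₂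
        i≢si : i ≢ suc i
        i≢si p = ℕ.1+n≢n (sym p)

      adjust-y : y q′ i ≡ y′
      adjust-y = update-same (y q) i y′
      adjust-y-other : ∀ {k} → k ≢ i → y q′ k ≡ y q k
      adjust-y-other = update-other (y q) i y′
      adjust-ε₁ : ε q′ i ≡ e₁
      adjust-ε₁ = update-same (update (ε q) (suc i) e₂) i e₁
      adjust-ε₂ : ε q′ (suc i) ≡ e₂
      adjust-ε₂ = trans (update-other (update (ε q) (suc i) e₂) i e₁ (≢-sym i≢si)) (update-same (ε q) (suc i) e₂)
      adjust-ε-other : ∀ {k} → k ≢ i → k ≢ suc i → ε q′ k ≡ ε q k
      adjust-ε-other r s = trans (update-other (update (ε q) (suc i) e₂) i e₁ r) (update-other (ε q) (suc i) e₂ s)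

      adjust-ε-suc : ∀ k → k ≢ κ → k ≢ i → ε q′ (suc k) ≡ ε q (suc k)
      adjust-ε-suc k r s = adjust-ε-other (λ e → r (ℕ.suc-injective e)) (λ e → s (ℕ.suc-injective e))

      adjust-y-κ : y q′ κ ≡ y q κ
      adjust-y-κ = adjust-y-other (≢-sym ℕ.1+n≢n)
      adjust-y-si : y q′ (suc i) ≡ y q (suc i)
      adjust-y-si = adjust-y-other (≢-sym i≢si)

      adjust-x : SameOutside (x q) (x q′)
      adjust-x k r s = cong₂ _∸_ (adjust-y-other s) (adjust-ε-suc k r s)
      adjust-x-κ : x q′ κ ≡ y q κ ∸ e₁
      adjust-x-κ = cong₂ _∸_ adjust-y-κ adjust-ε₁
      adjust-x-i : x q′ i ≡ y′ ∸ e₂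
      adjust-x-i = cong₂ _∸_ adjust-y adjust-ε₂

      adjust-Row : ∀ {a b t} → Row n a b t q → LocalRow a (y q κ) (y q (suc i)) y′ e₁ e₂ →
                   e₁ + e₂ ≡ ε q i + ε q (suc i) → Row n a b t q′
      adjust-Row {a} {b} {t} r ((py , yR) , (r₁ , r₂) , (b₁ , b₂)) eq = mkRow
        (trans (adjust-y-other (λ ())) (start r))
        (trans (adjust-y-other λ e → ℕ.<⇒≢ i<n (sym e)) (end r))
        mono′ room′ bit′
        (trans (adjust-ε-suc n (λ e → ℕ.<⇒≢ κ<n (sym e)) (λ e → ℕ.<⇒≢ i<n (sym e))) (last r))
        (trans (total-local κ m adjust-ε-suc (trans (cong₂ _+_ adjust-ε₁ adjust-ε₂) eq)) (size r))
        where
        mono′ : ∀ k → k < n → y q′ k ≤ y q′ (suc k)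
        mono′ k k< with k ≟ κ | k ≟ i
        ... | yes refl | _ rewrite adjust-y-κ | adjust-y = py
        ... | no _ | yes refl rewrite adjust-y-si | adjust-y = yR
        ... | no r′ | no s = subst₂ _≤_ (sym (adjust-y-other s)) (sym (adjust-y-other (λ e → r′ (ℕ.suc-injective e)))) (mono r k k<)
        room′ : ∀ k → k < n → ε q′ (suc k) + a ≤ y q′ k
        room′ k k< with k ≟ κ | k ≟ i
        ... | yes refl | _ rewrite adjust-y-κ | adjust-ε₁ = r₁
        ... | no _ | yes refl rewrite adjust-ε₂ | adjust-y = r₂
        ... | no r′ | no s = subst₂ (λ z w → z + a ≤ w) (sym (adjust-ε-suc k r′ s)) (sym (adjust-y-other s)) (room r k k<)
        bit′ : ∀ k → ε q′ k ≤ 1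
        bit′ k with k ≟ i | k ≟ suc i
        ... | yes refl | _ rewrite adjust-ε₁ = b₁
        ... | no _ | yes refl rewrite adjust-ε₂ = b₂
        ... | no r′ | no s = subst (_≤ 1) (sym (adjust-ε-other r′ s)) (bit r k)

      -- The threshold at κ matters only through `left`: `y κ` is bounded by both thresholds, and
      -- `y i ∸ X κ` equals `y i ∸ left X` because `y i ≤ X i`.
      adjust-Below : ∀ {g X X′} → y q κ ≤ y q i → Below n g X q → SameOutside X X′ → left X′ ≡ left X →
        (y q i ∸ left X) + (y q (suc i) ∸ X i) ≡ (y′ ∸ left X) + (y q (suc i) ∸ X′ i) → y′ ≤ X′ i →
        Below n g X′ q′
      adjust-Below {g} {X} {X′} py bl same eqL eqG y′≤ = mkBelow under′
        (trans (total-local κ m outside inside) (equality bl))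
        where
        p≤ : y q κ ≤ X′ κ
        p≤ = lia (y q κ ∷ y q i ∷ X κ ∷ X i ∷ X′ κ ∷ X′ i ∷ [])
          (λ p y L X L′ X′ → p :≤ y ⇒ y :≤ X ⇒ p :≤ L ⇒ L′ :⊓ X′ :≡ L :⊓ X ⇒ p :≤ L′) refl
          py (under bl i (ℕ.<⇒≤ i<n)) (under bl κ (ℕ.<⇒≤ κ<n)) eqL
        under′ : ∀ k → k ≤ n → y q′ k ≤ X′ k
        under′ k k≤ with k ≟ κ | k ≟ i
        ... | yes refl | _ rewrite adjust-y-κ = p≤
        ... | no _ | yes refl rewrite adjust-y = y′≤
        ... | no r | no s = subst₂ _≤_ (sym (adjust-y-other s)) (sym (same k r s)) (under bl k k≤)
        outside : ∀ k → k ≢ κ → k ≢ i → y q′ (suc k) ∸ X′ k ≡ y q (suc k) ∸ X k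
        outside k r s = cong₂ _∸_ (adjust-y-other (λ e → r (ℕ.suc-injective e))) (same k r s)
        inside : (y q′ i ∸ X′ κ) + (y q′ (suc i) ∸ X′ i) ≡ (y q i ∸ X κ) + (y q (suc i) ∸ X i)
        inside rewrite adjust-y | adjust-y-si = lia
          (y q i ∷ y q (suc i) ∷ X κ ∷ X i ∷ y′ ∷ X′ κ ∷ X′ i ∷ left X ∷ y q (suc i) ∸ X i ∷ y q (suc i) ∸ X′ i ∷ [])
          (λ y R L X y′ L′ X′ l d d′ → (y :∸ l) :+ d :≡ (y′ :∸ l) :+ d′ ⇒ l :≡ L :⊓ X ⇒ L′ :⊓ X′ :≡ l ⇒ y :≤ X ⇒ y′ :≤ X′ ⇒
            (y′ :∸ L′) :+ d′ :≡ (y :∸ L) :+ d) refl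
          eqG refl eqL (under bl i (ℕ.<⇒≤ i<n)) y′≤

    pivots-κ : ∀ X q → y q i ≤ X i → pivots X q κ ≡ (y q i ⊓ left X) ∸ y q κ
    pivots-κ X q h = lia (y q κ ∷ y q i ∷ X κ ∷ X i ∷ [])
      (λ p y L X → y :≤ X ⇒ (y :⊓ L) :∸ p :≡ (y :⊓ (L :⊓ X)) :∸ p) refl h

    pivots-other : ∀ {X X′ q y′ e₁ e₂} → SameOutside X X′ → SameOutside (pivots X q) (pivots X′ (adjust q y′ e₁ e₂))
    pivots-other {X} {X′} {q} {y′} {e₁} {e₂} same k r s
      rewrite same k r s | adjust-y-other q y′ e₁ e₂ {suc k} (λ e → r (ℕ.suc-injective e)) | adjust-y-other q y′ e₁ e₂ {k} s = refl

    -- Names for one row below the rows `ps`: `p`, `yi`, `R` are its boundaries at κ, `i`, `i + 1`;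
    -- `e₁`, `e₂` its bits and `u₁`, `u₂` its read pivots for `i` and `i + 1`; `L`, `X` are the
    -- thresholds seen from below and `w` counts the letters `i` left free above. The hypothesis
    -- `inv` says that these free letters cover the columns from `L` to `X`.
    module Local {a b t g q ps} (r : Row n a b t q) (bl : Below n g (thresholds n c ps) q)
                 (inv : thresholds n c ps i ≤ A i (stackWord n c ps) + left (thresholds n c ps)) where
      Xs : ℕ → ℕ
      Xs = thresholds n c ps
      p yi R e₁ e₂ L X w u₁ u₂ : ℕ
      p = y q κ
      yi = y q i
      R = y q (suc i)
      e₁ = ε q i
      e₂ = ε q (suc i)
      L = left Xs
      X = Xs i
      w = A i (stackWord n c ps)
      u₁ = pivots Xs q κ
      u₂ = pivots Xs q i

      p≤y : p ≤ yi
      p≤y = mono r κ κ<n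
      y≤R : yi ≤ R
      y≤R = mono r i i<n
      y≤X : yi ≤ X
      y≤X = under bl i (ℕ.<⇒≤ i<n)
      p≤L : p ≤ L
      p≤L = ℕ.⊓-glb (under bl κ (ℕ.<⇒≤ κ<n)) (ℕ.≤-trans p≤y y≤X)

      e₁+a≤p : e₁ + a ≤ p
      e₁+a≤p = room r κ κ<n
      e₂+a≤y : e₂ + a ≤ yi
      e₂+a≤y = room r i i<n

      pivots₁ : (yi ≤ L × u₁ + p ≡ yi) ⊎ (L ≤ yi × u₁ + p ≡ L)
      pivots₁ = lia (p ∷ yi ∷ L ∷ u₁ ∷ [])
        (λ p y L u → p :≤ y ⇒ p :≤ L ⇒ u :≡ (y :⊓ L) :∸ p ⇒ (y :≤ L :∧ u :+ p :≡ y) :∨ (L :≤ y :∧ u :+ p :≡ L)) refl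
        p≤y p≤L (pivots-κ Xs q y≤X)

      pivots₂ : (R ≤ X × u₂ + yi ≡ R) ⊎ (X ≤ R × u₂ + yi ≡ X)
      pivots₂ = lia (yi ∷ R ∷ X ∷ [])
        (λ y R X → y :≤ R ⇒ y :≤ X ⇒
          (R :≤ X :∧ ((R :⊓ X) :∸ y) :+ y :≡ R) :∨ (X :≤ R :∧ ((R :⊓ X) :∸ y) :+ y :≡ X)) refl
        y≤R y≤X

      u₂+y≤X : u₂ + yi ≤ X
      u₂+y≤X = lia (yi ∷ R ∷ X ∷ []) (λ y R X → y :≤ R ⇒ y :≤ X ⇒ ((R :⊓ X) :∸ y) :+ y :≤ X) refl y≤R y≤X
      u₂+y≤R : u₂ + yi ≤ R
      u₂+y≤R = lia (yi ∷ R ∷ X ∷ []) (λ y R X → y :≤ R ⇒ y :≤ X ⇒ ((R :⊓ X) :∸ y) :+ y :≤ R) refl y≤R y≤X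

      A-row : A i (stackWord n c (q ∷ ps)) ≡ ((e₁ + u₁) + (w ∸ u₂)) ∸ e₂
      A-row = A-rowWord κ m (λ k → ε q (suc k)) (pivots Xs q) (stackWord n c ps)

      -- Either all pivots `i` of the row are read and supply enough free letters themselves, or
      -- some are omitted below boxes of maximum `i`, and then `inv` for the row above supplies the
      -- rest.
      invariant : x q i ≤ A i (stackWord n c (q ∷ ps)) + left (x q)
      invariant = subst (λ z → x q i ≤ z + left (x q)) (sym A-row)
        (lia (p ∷ yi ∷ e₁ ∷ e₂ ∷ u₁ ∷ w ∸ u₂ ∷ []) (λ p y e₁ e₂ u₁ d → y :≤ (u₁ :+ p) :+ d ⇒
           y :∸ e₂ :≤ (((e₁ :+ u₁) :+ d) :∸ e₂) :+ ((p :∸ e₁) :⊓ (y :∸ e₂))) refl enough)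
        where
        enough : yi ≤ (u₁ + p) + (w ∸ u₂)
        enough with pivots₁
        ... | inj₁ (_ , eq) = ℕ.≤-trans (ℕ.≤-reflexive (sym eq)) (ℕ.m≤m+n _ _)
        ... | inj₂ (_ , eq) = lia (p ∷ yi ∷ L ∷ X ∷ w ∷ u₁ ∷ u₂ ∷ [])
          (λ p y L X w u₁ u₂ → u₁ :+ p :≡ L ⇒ u₂ :+ y :≤ X ⇒ X :≤ w :+ L ⇒ y :≤ (u₁ :+ p) :+ (w :∸ u₂)) refl eq u₂+y≤X inv

-- Valid stacks are closed under both operators.

module Closure where
  open LIA
  open Words
  open RowWords
  open Profiles
  open import Data.Nat using (ℕ; suc; _+_; _∸_; _⊓_; _≤_; _<_; z≤n; s≤s; _≟_; _≤?_; _<?_)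
  import Data.Nat.Properties as ℕ
  open import Data.List using (List; []; _∷_; _++_)
  open import Data.Vec using ([]; _∷_)
  open import Data.Product using (_×_; _,_; proj₁; proj₂)
  open import Data.Sum using (_⊎_; inj₁; inj₂)
  open import Relation.Nullary using (Dec; yes; no)
  open import Relation.Binary.PropositionalEquality hiding ([_]; J)

  module _ (κ m c : ℕ) where
    open Step κ m c
    private
      n i : ℕ
      n = m + suc (suc κ)
      i = suc κ
      κ<n : κ < n
      κ<n = lia (m ∷ κ ∷ []) (λ m k → k :< m :+ (# 2 :+ k)) refl
      i<n : i < n
      i<n = lia (m ∷ κ ∷ []) (λ m k → # 1 :+ k :< m :+ (# 2 :+ k)) refl

    -- The fields after `word` are what the next row has to react to. The induction needs more than
    -- the existence of a new stack: a threshold moves only if the invariant was tight before the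
    -- operation, and tightness is what determines the reaction.
    record Outcome (op : Word → Word) (Moved : ℕ → ℕ → Set) (ss : List Shape) (ps : List Profile) : Set where
      constructor outcome
      field
        ps′      : List Profile
        isValid  : Valid n c ss ps′
        word     : stackWord n c ps′ ≡ op (stackWord n c ps)
        same     : SameOutside (thresholds n c ps) (thresholds n c ps′)
        left-≡   : left (thresholds n c ps′) ≡ left (thresholds n c ps)
        moved    : thresholds n c ps′ i ≡ thresholds n c ps i ⊎
                   Moved (thresholds n c ps′ i) (thresholds n c ps i) ×
                   A i (stackWord n c ps) + left (thresholds n c ps) ≡ thresholds n c ps i

    Down Up : ℕ → ℕ → Set
    Down x′ x = suc x′ ≡ x
    Up   x′ x = x′ ≡ suc x

    -- In order: the row axioms for the new values, preservation of `ex`, preservation of `ceq`, the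
    -- fit under the new threshold, and an unchanged `left` for the next row.
    good : ∀ {k} → Term k → Term k → Term k → Term k → Term k → Term k → Term k → Term k →
           Term k → Term k → Term k → Term k → Formula k
    good a p y R e₁ e₂ L X y′ e₁′ e₂′ X′ =
      p :≤ y′ :∧ y′ :≤ R :∧ e₁′ :+ a :≤ p :∧ e₂′ :+ a :≤ y′ :∧ e₁′ :≤ # 1 :∧ e₂′ :≤ # 1 :∧ e₁′ :+ e₂′ :≡ e₁ :+ e₂ :∧
      (y :∸ L) :+ (R :∸ X) :≡ (y′ :∸ L) :+ (R :∸ X′) :∧ y′ :≤ X′ :∧
      (p :∸ e₁′) :⊓ (y′ :∸ e₂′) :≡ (p :∸ e₁) :⊓ (y :∸ e₂)

    rowWord-adjust : ∀ {ε ε′ u u′} → (∀ k → k ≢ κ → k ≢ i → ε′ k ≡ ε k) → (∀ k → k ≢ κ → k ≢ i → u′ k ≡ u k) →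
      ε′ κ ≡ ε κ → ε′ i ≡ ε i → u′ κ ≡ u κ → u′ i ≡ u i → rowWord n ε u ≡ rowWord n ε′ u′
    rowWord-adjust {ε} {ε′} {u} {u′} sε su p q r s =
      cong₂ _++_ (descending-cong n λ k _ → sym (all sε p q k)) (ascending-cong n λ k _ → sym (all su r s k))
      where
      all : ∀ {g h : ℕ → ℕ} → (∀ k → k ≢ κ → k ≢ i → g k ≡ h k) → g κ ≡ h κ → g i ≡ h i → ∀ k → g k ≡ h k
      all s p q k with k ≟ κ | k ≟ i
      ... | yes refl | _ = p
      ... | no _ | yes refl = q
      ... | no a | no b = s k a b

    invariant-stack : ∀ {ss ps} → Valid n c ss ps →
      thresholds n c ps i ≤ A i (stackWord n c ps) + left (thresholds n c ps)
    invariant-stack [] = ℕ.≤-reflexive (sym (ℕ.⊓-idem c))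
    invariant-stack {ps = _ ∷ ps} ((r , bl) ∷ v) = Local.invariant {ps = ps} r bl (invariant-stack v)

    module Finish {s ss q ps} (r : Row n (Shape.a s) (Shape.b s) (Shape.t s) q) (bl : Below n (Shape.g s) (thresholds n c ps) q)
                  (v : Valid n c ss ps) where
      open Local {ps = ps} r bl (invariant-stack v) public

      a : ℕ
      a = Shape.a s

      Good : ℕ → ℕ → ℕ → ℕ → Set
      Good y′ e₁′ e₂′ X′ = ⟦ close good ⟧ (a ∷ p ∷ yi ∷ R ∷ e₁ ∷ e₂ ∷ L ∷ X ∷ y′ ∷ e₁′ ∷ e₂′ ∷ X′ ∷ [])

      module _ {ps′} (v′ : Valid n c ss ps′) (same : SameOutside Xs (thresholds n c ps′))
               (left-≡ : left (thresholds n c ps′) ≡ L) (y′ e₁′ e₂′ : ℕ) (ok : Good y′ e₁′ e₂′ (thresholds n c ps′ i)) where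
        private
          X′ = thresholds n c ps′
          q′ = adjust q y′ e₁′ e₂′

        valid′ : Valid n c (s ∷ ss) (q′ ∷ ps′)
        valid′ = let g₁ , g₂ , g₃ , g₄ , g₅ , g₆ , g₇ , g₈ , g₉ , _ = ok in
          (adjust-Row q y′ e₁′ e₂′ r ((g₁ , g₂) , (g₃ , g₄) , (g₅ , g₆)) g₇ ,
           adjust-Below q y′ e₁′ e₂′ p≤y bl same left-≡ g₈ g₉) ∷ v′

        u₁′ : pivots X′ q′ κ ≡ (y′ ⊓ L) ∸ p
        u₁′ = let _ , _ , _ , _ , _ , _ , _ , _ , g₉ , _ = ok in trans
          (pivots-κ X′ q′ (subst (_≤ X′ i) (sym (adjust-y q y′ e₁′ e₂′)) g₉))
          (cong₂ _∸_ (cong₂ _⊓_ (adjust-y q y′ e₁′ e₂′) left-≡) (adjust-y-κ q y′ e₁′ e₂′))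

        u₂′ : pivots X′ q′ i ≡ (R ⊓ X′ i) ∸ y′
        u₂′ = cong₂ _∸_ (cong (_⊓ X′ i) (adjust-y-si q y′ e₁′ e₂′)) (adjust-y q y′ e₁′ e₂′)

        sameε : ∀ k → k ≢ κ → k ≢ i → ε q′ (suc k) ≡ ε q (suc k)
        sameε = adjust-ε-suc q y′ e₁′ e₂′

        sameu : ∀ k → k ≢ κ → k ≢ i → pivots X′ q′ k ≡ pivots Xs q k
        sameu = pivots-other {Xs} {X′} {q} {y′} {e₁′} {e₂′} same

        module _ {op : Word → Word} {Moved : ℕ → ℕ → Set} where
          done : stackWord n c (q′ ∷ ps′) ≡ op (stackWord n c (q ∷ ps)) →
                 (y′ ∸ e₂′ ≡ yi ∸ e₂ ⊎ Moved (y′ ∸ e₂′) (yi ∸ e₂) ×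
                   (((e₁ + u₁) + (w ∸ u₂)) ∸ e₂) + ((p ∸ e₁) ⊓ (yi ∸ e₂)) ≡ yi ∸ e₂) →
                 Outcome op Moved (s ∷ ss) (q ∷ ps)
          done eq mv = outcome (q′ ∷ ps′) valid′ eq (adjust-x q y′ e₁′ e₂′) left′ (moved mv)
            where
            left′ : left (x q′) ≡ left (x q)
            left′ = let _ , _ , _ , _ , _ , _ , _ , _ , _ , g = ok in trans (cong₂ _⊓_ (adjust-x-κ q y′ e₁′ e₂′) (adjust-x-i q y′ e₁′ e₂′)) g
            moved : _ → _
            moved (inj₁ h)       = inj₁ (trans (adjust-x-i q y′ e₁′ e₂′) h)
            moved (inj₂ (h , k)) = inj₂ (subst (λ z → Moved z (yi ∸ e₂)) (sym (adjust-x-i q y′ e₁′ e₂′)) h ,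
              trans (cong (_+ left (x q)) A-row) k)

          -- The profile may change while its word does not: equal bits and equal numbers of read
          -- pivots suffice, even if the boundary `yi` has moved.
          keep : op (stackWord n c (q ∷ ps)) ≡ wordBelow n Xs q ++ stackWord n c ps′ →
                 e₁′ ≡ e₁ → e₂′ ≡ e₂ → (y′ ⊓ L) ∸ p ≡ u₁ → (R ⊓ X′ i) ∸ y′ ≡ u₂ → 
                 (y′ ∸ e₂′ ≡ yi ∸ e₂ ⊎ Moved (y′ ∸ e₂′) (yi ∸ e₂) ×
                   (((e₁ + u₁) + (w ∸ u₂)) ∸ e₂) + ((p ∸ e₁) ⊓ (yi ∸ e₂)) ≡ yi ∸ e₂) →
                 Outcome op Moved (s ∷ ss) (q ∷ ps)
          keep eq h₁ h₂ k₁ k₂ = done (trans (cong (_++ stackWord n c ps′) (sym (rowWord-adjust sameε sameu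
            (trans (adjust-ε₁ q y′ e₁′ e₂′) h₁) (trans (adjust-ε₂ q y′ e₁′ e₂′) h₂) (trans u₁′ k₁) (trans u₂′ k₂)))) (sym eq))

    module Cases {s ss q ps} (r : Row n (Shape.a s) (Shape.b s) (Shape.t s) q) (bl : Below n (Shape.g s) (thresholds n c ps) q)
                 (v : Valid n c ss ps) where
      open Finish {ps = ps} r bl v

      F : Set
      F = Outcome (f i) Down (s ∷ ss) (q ∷ ps)
      E : Set
      E = Outcome (e i) Up (s ∷ ss) (q ∷ ps)

      u₁≡ : (yi ⊓ L) ∸ p ≡ u₁
      u₁≡ = sym (pivots-κ Xs q y≤X)

      unmoved-good : ∀ {X′} → X′ ≡ X → Good yi e₁ e₂ X′
      unmoved-good refl = p≤y , y≤R , room r κ κ<n , room r i i<n , bit r i , bit r (suc i) , refl , refl , y≤X , refl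

      e₂<⇒ : 1 ≤ ((e₁ + u₁) + (w ∸ u₂)) ∸ e₂ → suc e₂ ≤ (e₁ + u₁) + (w ∸ u₂)
      e₂<⇒ h = lia ((e₁ + u₁) + (w ∸ u₂) ∷ e₂ ∷ []) (λ t e → # 1 :≤ t :∸ e ⇒ e :< t) refl h

      -- If the matching in the row does not use up the letters i above, then the boxes i of the row
      -- reach below boxes of the upper row that contain i only.
      overlaps : u₂ ≤ w → w + L ≡ X → X ≤ R → L ≤ yi × u₁ + p ≡ L
      overlaps h t X≤R with pivots₁
      ... | inj₂ eq = eq
      ... | inj₁ (le , eq) = lia (p ∷ yi ∷ L ∷ X ∷ w ∷ u₁ ∷ u₂ ∷ R ∷ [])
        (λ p y L X w u₁ u₂ R → (R :≤ X :∧ u₂ :+ y :≡ R) :∨ (X :≤ R :∧ u₂ :+ y :≡ X) ⇒ y :≤ L ⇒ u₁ :+ p :≡ y ⇒ u₂ :≤ w ⇒ w :+ L :≡ X ⇒ X :≤ R ⇒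
          L :≤ y :∧ u₁ :+ p :≡ L) refl pivots₂ le eq h t X≤R

      u₂+y≡X : X ≤ R → u₂ + yi ≡ X
      u₂+y≡X h with pivots₂
      ... | inj₁ (le , eq) = trans eq (ℕ.≤-antisym le h)
      ... | inj₂ (_ , eq)  = eq

      -- From `u₂ + yi ≤ X ≤ w + L` and `w ≤ u₂` follows `yi ≤ L`: no pivot `i` of the row is
      -- omitted.
      noOverlap : w ≤ u₂ → yi ≤ L × u₁ + p ≡ yi
      noOverlap h with pivots₁
      ... | inj₁ eq = eq
      ... | inj₂ (le , eq) = lia (p ∷ yi ∷ L ∷ X ∷ w ∷ u₁ ∷ u₂ ∷ [])
        (λ p y L X w u₁ u₂ → L :≤ y ⇒ u₁ :+ p :≡ L ⇒ u₂ :+ y :≤ X ⇒ X :≤ w :+ L ⇒ w :≤ u₂ ⇒ y :≤ L :∧ u₁ :+ p :≡ y) refl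
        le eq u₂+y≤X (invariant-stack v) h

      module _ (alive : suc e₂ ≤ (e₁ + u₁) + (w ∸ u₂)) where

        -- The operator acts in the rows above and this row keeps its word. If the threshold drops
        -- and the row reaches it, an equality in the letter `i + 1` arises; lowering `yi` by one
        -- destroys an equality in `i`, and the numbers of read pivots are unaffected.
        f-upper : u₂ < w → Outcome (f i) Down ss ps → F
        f-upper u₂<w (outcome ps′ v′ word same left-≡ (inj₁ eq)) =
          keep v′ same left-≡ yi e₁ e₂ (unmoved-good eq)
            (trans (f-above κ m _ _ _ u₂<w) (cong (wordBelow n Xs q ++_) (sym word)))
            refl refl u₁≡ (cong (λ z → (R ⊓ z) ∸ yi) eq) (inj₁ refl)
        f-upper u₂<w (outcome ps′ v′ word same left-≡ (inj₂ (dn , tight))) with R <? X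
        -- The minima up to `i + 1` end before the threshold even after it drops, so the row does
        -- not notice the move.
        ... | yes R<X = keep v′ same left-≡ yi e₁ e₂
            (p≤y , y≤R , e₁+a≤p , e₂+a≤y , bit r i , bit r (suc i) , refl ,
              lia (yi ∸ L ∷ R ∷ X ∷ X′ ∷ []) (λ d R X X′ → R :< X ⇒ # 1 :+ X′ :≡ X ⇒ d :+ (R :∸ X) :≡ d :+ (R :∸ X′)) refl R<X dn ,
              lia (yi ∷ R ∷ X ∷ X′ ∷ []) (λ y R X X′ → y :≤ R ⇒ R :< X ⇒ # 1 :+ X′ :≡ X ⇒ y :≤ X′) refl y≤R R<X dn , refl)
            (trans (f-above κ m _ _ _ u₂<w) (cong (wordBelow n Xs q ++_) (sym word)))
            refl refl u₁≡
            (lia (yi ∷ R ∷ X ∷ X′ ∷ []) (λ y R X X′ → R :< X ⇒ # 1 :+ X′ :≡ X ⇒ (R :⊓ X′) :∸ y :≡ (R :⊓ X) :∸ y) refl R<X dn)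
            (inj₁ refl)
          where X′ = thresholds n c ps′ i
        ... | no R≮X = keep v′ same left-≡ (yi ∸ 1) e₁ e₂
            (lia (p ∷ yi ∷ L ∷ []) (λ p y L → p :≤ L ⇒ L :< y ⇒ p :≤ y :∸ # 1) refl p≤L L<y ,
             ℕ.≤-trans (ℕ.m∸n≤m yi 1) y≤R , e₁+a≤p ,
             lia (a ∷ p ∷ yi ∷ e₁ ∷ e₂ ∷ []) (λ a p y e₁ e₂ → e₁ :+ a :≤ p ⇒ # 1 :+ (p :+ e₂) :≤ y :+ e₁ ⇒ e₂ :+ a :≤ y :∸ # 1) refl
               e₁+a≤p slack , bit r i , bit r (suc i) , refl ,
             lia (yi ∷ L ∷ R ∷ X ∷ X′ ∷ []) (λ y L R X X′ → L :< y ⇒ X :≤ R ⇒ # 1 :+ X′ :≡ X ⇒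
               (y :∸ L) :+ (R :∸ X) :≡ ((y :∸ # 1) :∸ L) :+ (R :∸ X′)) refl L<y X≤R dn ,
             lia (yi ∷ X ∷ X′ ∷ []) (λ y X X′ → y :≤ X ⇒ # 1 :+ X′ :≡ X ⇒ y :∸ # 1 :≤ X′) refl y≤X dn ,
             lia (p ∷ yi ∷ e₁ ∷ e₂ ∷ []) (λ p y e₁ e₂ → # 1 :+ (p :+ e₂) :≤ y :+ e₁ ⇒
               (p :∸ e₁) :⊓ ((y :∸ # 1) :∸ e₂) :≡ (p :∸ e₁) :⊓ (y :∸ e₂)) refl slack)
            (trans (f-above κ m _ _ _ u₂<w) (cong (wordBelow n Xs q ++_) (sym word)))
            refl refl
            (lia (p ∷ yi ∷ L ∷ u₁ ∷ []) (λ p y L u₁ → L :< y ⇒ u₁ :+ p :≡ L ⇒ ((y :∸ # 1) :⊓ L) :∸ p :≡ u₁) refl L<y (proj₂ ov))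
            (lia (yi ∷ R ∷ X ∷ X′ ∷ u₂ ∷ []) (λ y R X X′ u₂ → u₂ :+ y :≡ X ⇒ X :≤ R ⇒ # 1 :+ X′ :≡ X ⇒ # 1 :≤ y ⇒
               (R :⊓ X′) :∸ (y :∸ # 1) :≡ u₂) refl (u₂+y≡X X≤R) X≤R dn (ℕ.≤-trans (s≤s z≤n) L<y))
            (inj₂ (lia (yi ∷ e₂ ∷ a ∷ p ∷ e₁ ∷ []) (λ y e₂ a p e₁ → # 1 :+ (p :+ e₂) :≤ y :+ e₁ ⇒ e₁ :+ a :≤ p ⇒
                     # 1 :+ ((y :∸ # 1) :∸ e₂) :≡ y :∸ e₂) refl slack e₁+a≤p ,
                   lia (p ∷ yi ∷ L ∷ e₁ ∷ e₂ ∷ u₁ ∷ w ∸ u₂ ∷ a ∷ [])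
                     (λ p y L e₁ e₂ u₁ d a → d :+ L :≡ y ⇒ u₁ :+ p :≡ L ⇒ # 1 :+ (p :+ e₂) :≤ y :+ e₁ ⇒ e₁ :+ a :≤ p ⇒
                       (((e₁ :+ u₁) :+ d) :∸ e₂) :+ ((p :∸ e₁) :⊓ (y :∸ e₂)) :≡ y :∸ e₂) refl gap (proj₂ ov) slack e₁+a≤p))
          where
          X′ = thresholds n c ps′ i
          X≤R = ℕ.≮⇒≥ R≮X
          ov = overlaps (ℕ.<⇒≤ u₂<w) tight X≤R
          gap : (w ∸ u₂) + L ≡ yi
          gap = lia (yi ∷ L ∷ X ∷ w ∷ u₂ ∷ []) (λ y L X w u₂ → u₂ :+ y :≡ X ⇒ u₂ :< w ⇒ w :+ L :≡ X ⇒ (w :∸ u₂) :+ L :≡ y) refl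
            (u₂+y≡X X≤R) u₂<w tight
          L<y : L < yi
          L<y = lia (yi ∷ L ∷ X ∷ w ∷ u₂ ∷ []) (λ y L X w u₂ → u₂ :+ y :≡ X ⇒ u₂ :< w ⇒ w :+ L :≡ X ⇒ L :< y) refl
            (u₂+y≡X X≤R) u₂<w tight
          -- Strictness puts `p ∸ e₁` below `yi ∸ e₂`, so `left` of this row is the value at κ and
          -- is not affected when `yi` loses a column.
          slack : suc (p + e₂) ≤ yi + e₁
          slack = lia (p ∷ yi ∷ L ∷ e₁ ∷ e₂ ∷ u₁ ∷ w ∸ u₂ ∷ []) (λ p y L e₁ e₂ u₁ d → # 1 :+ e₂ :≤ (e₁ :+ u₁) :+ d ⇒ d :+ L :≡ y ⇒
            u₁ :+ p :≡ L ⇒ # 1 :+ (p :+ e₂) :≤ y :+ e₁) refl alive gap (proj₂ ov)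

        -- Pivots are read after non-pivots, so a pivot `i` is raised if there is one, and `yi`
        -- drops. Otherwise `alive` forces a non-pivot `i` and no non-pivot `i + 1`; with `p ≡ yi`
        -- the two share a box, and the bits are exchanged.
        f-here : w ≤ u₂ → F
        f-here w≤u₂ with noOverlap w≤u₂ | u₁ ℕ.≟ 0
        ... | y≤L , eq | no u₁≢0 = done v (λ _ _ _ → refl) refl (yi ∸ 1) e₁ e₂ ok
            (sym (f-pivot κ m _ _ _ (sameε v (λ _ _ _ → refl) refl (yi ∸ 1) e₁ e₂ ok) (sameu v (λ _ _ _ → refl) refl (yi ∸ 1) e₁ e₂ ok) w≤u₂
              (adjust-ε₁ q (yi ∸ 1) e₁ e₂) (adjust-ε₂ q (yi ∸ 1) e₁ e₂)
              (trans (cong suc (u₁′ v (λ _ _ _ → refl) refl (yi ∸ 1) e₁ e₂ ok))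
                (lia (p ∷ yi ∷ L ∷ u₁ ∷ []) (λ p y L u₁ → y :≤ L ⇒ u₁ :+ p :≡ y ⇒ # 1 :≤ u₁ ⇒
                   # 1 :+ (((y :∸ # 1) :⊓ L) :∸ p) :≡ u₁) refl y≤L eq 1≤u₁))
              (trans (u₂′ v (λ _ _ _ → refl) refl (yi ∸ 1) e₁ e₂ ok)
                (lia (yi ∷ R ∷ X ∷ u₁ ∷ p ∷ []) (λ y R X u₁ p → u₁ :+ p :≡ y ⇒ # 1 :≤ u₁ ⇒ y :≤ R ⇒ y :≤ X ⇒
                   (R :⊓ X) :∸ (y :∸ # 1) :≡ # 1 :+ ((R :⊓ X) :∸ y)) refl eq 1≤u₁ y≤R y≤X))))
            (inj₂ (lia (p ∷ yi ∷ e₁ ∷ e₂ ∷ u₁ ∷ a ∷ []) (λ p y e₁ e₂ u₁ a → u₁ :+ p :≡ y ⇒ # 1 :+ e₂ :≤ e₁ :+ u₁ ⇒ e₁ :+ a :≤ p ⇒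
                     # 1 :+ ((y :∸ # 1) :∸ e₂) :≡ y :∸ e₂) refl eq alive′ e₁+a≤p ,
                   lia (p ∷ yi ∷ e₁ ∷ e₂ ∷ u₁ ∷ w ∸ u₂ ∷ a ∷ []) (λ p y e₁ e₂ u₁ d a → d :≡ # 0 ⇒ u₁ :+ p :≡ y ⇒ # 1 :+ e₂ :≤ e₁ :+ u₁ ⇒
                     e₁ :+ a :≤ p ⇒ (((e₁ :+ u₁) :+ d) :∸ e₂) :+ ((p :∸ e₁) :⊓ (y :∸ e₂)) :≡ y :∸ e₂) refl d≡0 eq alive′ e₁+a≤p))
          where
          1≤u₁ : 1 ≤ u₁
          1≤u₁ = ℕ.n≢0⇒n>0 u₁≢0
          d≡0 : w ∸ u₂ ≡ 0
          d≡0 = ℕ.m≤n⇒m∸n≡0 w≤u₂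
          alive′ : suc e₂ ≤ e₁ + u₁
          alive′ = subst (suc e₂ ≤_) (trans (cong ((e₁ + u₁) +_) d≡0) (ℕ.+-identityʳ _)) alive
          ok : Good (yi ∸ 1) e₁ e₂ X
          ok = lia (p ∷ yi ∷ u₁ ∷ []) (λ p y u₁ → u₁ :+ p :≡ y ⇒ # 1 :≤ u₁ ⇒ p :≤ y :∸ # 1) refl eq 1≤u₁ ,
            ℕ.≤-trans (ℕ.m∸n≤m yi 1) y≤R , e₁+a≤p ,
            lia (a ∷ p ∷ yi ∷ e₁ ∷ e₂ ∷ u₁ ∷ []) (λ a p y e₁ e₂ u₁ → e₁ :+ a :≤ p ⇒ u₁ :+ p :≡ y ⇒ # 1 :+ e₂ :≤ e₁ :+ u₁ ⇒
              e₂ :+ a :≤ y :∸ # 1) refl e₁+a≤p eq alive′ ,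
            bit r i , bit r (suc i) , refl ,
            lia (yi ∷ L ∷ R ∸ X ∷ []) (λ y L d → y :≤ L ⇒ (y :∸ L) :+ d :≡ ((y :∸ # 1) :∸ L) :+ d) refl y≤L ,
            ℕ.≤-trans (ℕ.m∸n≤m yi 1) y≤X ,
            lia (p ∷ yi ∷ e₁ ∷ e₂ ∷ u₁ ∷ []) (λ p y e₁ e₂ u₁ → u₁ :+ p :≡ y ⇒ # 1 :+ e₂ :≤ e₁ :+ u₁ ⇒
               (p :∸ e₁) :⊓ ((y :∸ # 1) :∸ e₂) :≡ (p :∸ e₁) :⊓ (y :∸ e₂)) refl eq alive′
        ... | y≤L , eq | yes u₁≡0 = done v (λ _ _ _ → refl) refl yi 0 1 ok
            (sym (f-nonpivot κ m _ _ _ (sameε v (λ _ _ _ → refl) refl yi 0 1 ok) (sameu v (λ _ _ _ → refl) refl yi 0 1 ok) w≤u₂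
              e₁≡1 e₂≡0 (adjust-ε₁ q yi 0 1) (adjust-ε₂ q yi 0 1) u₁≡0
              (trans (u₁′ v (λ _ _ _ → refl) refl yi 0 1 ok) (trans u₁≡ u₁≡0)) (u₂′ v (λ _ _ _ → refl) refl yi 0 1 ok)))
            (inj₂ (lia (p ∷ yi ∷ e₁ ∷ e₂ ∷ a ∷ []) (λ p y e₁ e₂ a → p :≡ y ⇒ e₁ :≡ # 1 ⇒ e₂ :≡ # 0 ⇒ e₁ :+ a :≤ p ⇒
                     # 1 :+ (y :∸ # 1) :≡ y :∸ e₂) refl p≡y e₁≡1 e₂≡0 e₁+a≤p ,
                   lia (p ∷ yi ∷ e₁ ∷ e₂ ∷ u₁ ∷ w ∸ u₂ ∷ a ∷ []) (λ p y e₁ e₂ u₁ d a → d :≡ # 0 ⇒ u₁ :≡ # 0 ⇒ p :≡ y ⇒ e₁ :≡ # 1 ⇒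
                     e₂ :≡ # 0 ⇒ e₁ :+ a :≤ p ⇒ (((e₁ :+ u₁) :+ d) :∸ e₂) :+ ((p :∸ e₁) :⊓ (y :∸ e₂)) :≡ y :∸ e₂) refl
                     d≡0 u₁≡0 p≡y e₁≡1 e₂≡0 e₁+a≤p))
          where
          d≡0 : w ∸ u₂ ≡ 0
          d≡0 = ℕ.m≤n⇒m∸n≡0 w≤u₂
          p≡y : p ≡ yi
          p≡y = trans (cong (_+ p) (sym u₁≡0)) eq
          e₁≡1 : e₁ ≡ 1
          e₁≡1 = lia (e₁ ∷ e₂ ∷ u₁ ∷ w ∸ u₂ ∷ []) (λ e₁ e₂ u₁ d → # 1 :+ e₂ :≤ (e₁ :+ u₁) :+ d ⇒ u₁ :≡ # 0 ⇒ d :≡ # 0 ⇒ e₁ :≤ # 1 ⇒ e₁ :≡ # 1) refl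
            alive u₁≡0 d≡0 (bit r i)
          e₂≡0 : e₂ ≡ 0
          e₂≡0 = lia (e₁ ∷ e₂ ∷ u₁ ∷ w ∸ u₂ ∷ []) (λ e₁ e₂ u₁ d → # 1 :+ e₂ :≤ (e₁ :+ u₁) :+ d ⇒ u₁ :≡ # 0 ⇒ d :≡ # 0 ⇒ e₁ :≤ # 1 ⇒ e₂ :≡ # 0) refl
            alive u₁≡0 d≡0 (bit r i)
          ok : Good yi 0 1 X
          ok = p≤y , y≤R , ℕ.≤-trans (ℕ.m≤n+m a e₁) e₁+a≤p ,
            subst₂ (λ z t → z + a ≤ t) e₁≡1 p≡y e₁+a≤p , z≤n , s≤s z≤n , sym (cong₂ _+_ e₁≡1 e₂≡0) , refl , y≤X ,
            lia (p ∷ yi ∷ e₁ ∷ e₂ ∷ []) (λ p y e₁ e₂ → p :≡ y ⇒ e₁ :≡ # 1 ⇒ e₂ :≡ # 0 ⇒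
               p :⊓ (y :∸ # 1) :≡ (p :∸ e₁) :⊓ (y :∸ e₂)) refl p≡y e₁≡1 e₂≡0

      -- The mirror image of `f-upper`: a rising threshold destroys an equality in `i + 1` if the
      -- row extends beyond it, and raising `yi` creates one in `i`.
      e-upper : u₂ ≤ w → e₂ ≤ (e₁ + u₁) + (w ∸ u₂) → Outcome (e i) Up ss ps → E
      e-upper u₂≤w fits (outcome ps′ v′ word same left-≡ (inj₁ eq)) =
        keep v′ same left-≡ yi e₁ e₂ (unmoved-good eq)
          (trans (e-above κ m _ _ _ u₂≤w fits) (cong (wordBelow n Xs q ++_) (sym word)))
          refl refl u₁≡ (cong (λ z → (R ⊓ z) ∸ yi) eq) (inj₁ refl)
      e-upper u₂≤w fits (outcome ps′ v′ word same left-≡ (inj₂ (up , tight))) with R ≤? X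
      ... | yes R≤X = keep v′ same left-≡ yi e₁ e₂
          (p≤y , y≤R , e₁+a≤p , e₂+a≤y , bit r i , bit r (suc i) , refl ,
            lia (yi ∸ L ∷ R ∷ X ∷ X′ ∷ []) (λ d R X X′ → R :≤ X ⇒ X′ :≡ # 1 :+ X ⇒ d :+ (R :∸ X) :≡ d :+ (R :∸ X′)) refl R≤X up ,
            ℕ.≤-trans y≤X (ℕ.≤-trans (ℕ.n≤1+n X) (ℕ.≤-reflexive (sym up))) , refl)
          (trans (e-above κ m _ _ _ u₂≤w fits) (cong (wordBelow n Xs q ++_) (sym word)))
          refl refl u₁≡
          (lia (yi ∷ R ∷ X ∷ X′ ∷ []) (λ y R X X′ → R :≤ X ⇒ X′ :≡ # 1 :+ X ⇒ (R :⊓ X′) :∸ y :≡ (R :⊓ X) :∸ y) refl R≤X up)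
          (inj₁ refl)
        where X′ = thresholds n c ps′ i
      ... | no R≰X = keep v′ same left-≡ (suc yi) e₁ e₂
          (ℕ.≤-trans p≤y (ℕ.n≤1+n yi) , ℕ.≤-trans (s≤s y≤X) X<R , e₁+a≤p , ℕ.≤-trans e₂+a≤y (ℕ.n≤1+n yi) ,
            bit r i , bit r (suc i) , refl ,
            lia (yi ∷ L ∷ R ∷ X ∷ X′ ∷ []) (λ y L R X X′ → L :≤ y ⇒ X :< R ⇒ X′ :≡ # 1 :+ X ⇒
               (y :∸ L) :+ (R :∸ X) :≡ ((# 1 :+ y) :∸ L) :+ (R :∸ X′)) refl (proj₁ ov) X<R up ,
            ℕ.≤-trans (s≤s y≤X) (ℕ.≤-reflexive (sym up)) ,
            lia (p ∷ yi ∷ e₁ ∷ e₂ ∷ []) (λ p y e₁ e₂ → p :+ e₂ :≤ y :+ e₁ ⇒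
               (p :∸ e₁) :⊓ ((# 1 :+ y) :∸ e₂) :≡ (p :∸ e₁) :⊓ (y :∸ e₂)) refl slack)
          (trans (e-above κ m _ _ _ u₂≤w fits) (cong (wordBelow n Xs q ++_) (sym word)))
          refl refl
          (lia (p ∷ yi ∷ L ∷ u₁ ∷ []) (λ p y L u₁ → L :≤ y ⇒ u₁ :+ p :≡ L ⇒ ((# 1 :+ y) :⊓ L) :∸ p :≡ u₁) refl (proj₁ ov) (proj₂ ov))
          (lia (yi ∷ R ∷ X ∷ X′ ∷ u₂ ∷ []) (λ y R X X′ u₂ → u₂ :+ y :≡ X ⇒ X :< R ⇒ X′ :≡ # 1 :+ X ⇒
             (R :⊓ X′) :∸ (# 1 :+ y) :≡ u₂) refl (u₂+y≡X (ℕ.<⇒≤ X<R)) X<R up)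
          (inj₂ (lia (yi ∷ e₂ ∷ a ∷ []) (λ y e₂ a → e₂ :+ a :≤ y ⇒ (# 1 :+ y) :∸ e₂ :≡ # 1 :+ (y :∸ e₂)) refl e₂+a≤y ,
                 lia (p ∷ yi ∷ L ∷ e₁ ∷ e₂ ∷ u₁ ∷ w ∸ u₂ ∷ a ∷ [])
                   (λ p y L e₁ e₂ u₁ d a → d :+ L :≡ y ⇒ u₁ :+ p :≡ L ⇒ p :+ e₂ :≤ y :+ e₁ ⇒ e₁ :+ a :≤ p ⇒ e₂ :+ a :≤ y ⇒
                     (((e₁ :+ u₁) :+ d) :∸ e₂) :+ ((p :∸ e₁) :⊓ (y :∸ e₂)) :≡ y :∸ e₂) refl gap (proj₂ ov) slack e₁+a≤p e₂+a≤y))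
        where
        X′ = thresholds n c ps′ i
        X<R = ℕ.≰⇒> R≰X
        ov = overlaps u₂≤w tight (ℕ.<⇒≤ X<R)
        gap : (w ∸ u₂) + L ≡ yi
        gap = lia (yi ∷ L ∷ X ∷ w ∷ u₂ ∷ []) (λ y L X w u₂ → u₂ :+ y :≡ X ⇒ u₂ :≤ w ⇒ w :+ L :≡ X ⇒ (w :∸ u₂) :+ L :≡ y) refl
          (u₂+y≡X (ℕ.<⇒≤ X<R)) u₂≤w tight
        slack : p + e₂ ≤ yi + e₁
        slack = lia (p ∷ yi ∷ L ∷ e₁ ∷ e₂ ∷ u₁ ∷ w ∸ u₂ ∷ []) (λ p y L e₁ e₂ u₁ d → e₂ :≤ (e₁ :+ u₁) :+ d ⇒ d :+ L :≡ y ⇒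
          u₁ :+ p :≡ L ⇒ p :+ e₂ :≤ y :+ e₁) refl fits gap (proj₂ ov)

      e-pivot-here : w < u₂ → e₂ ≤ e₁ + u₁ → E
      e-pivot-here w<u₂ fits = done v (λ _ _ _ → refl) refl (suc yi) e₁ e₂ ok
          (sym (e-pivot κ m _ _ _ (sameε v (λ _ _ _ → refl) refl (suc yi) e₁ e₂ ok) (sameu v (λ _ _ _ → refl) refl (suc yi) e₁ e₂ ok) w<u₂ fits
            (adjust-ε₁ q (suc yi) e₁ e₂) (adjust-ε₂ q (suc yi) e₁ e₂)
            (trans (u₁′ v (λ _ _ _ → refl) refl (suc yi) e₁ e₂ ok)
              (lia (p ∷ yi ∷ L ∷ u₁ ∷ []) (λ p y L u₁ → y :< L ⇒ u₁ :+ p :≡ y ⇒ ((# 1 :+ y) :⊓ L) :∸ p :≡ # 1 :+ u₁) refl y<L eq))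
            (trans (cong suc (u₂′ v (λ _ _ _ → refl) refl (suc yi) e₁ e₂ ok))
              (lia (yi ∷ R ∷ X ∷ []) (λ y R X → y :< R ⇒ y :< X ⇒
                 # 1 :+ ((R :⊓ X) :∸ (# 1 :+ y)) :≡ (R :⊓ X) :∸ y) refl y<R y<X))))
          (inj₂ (lia (yi ∷ e₂ ∷ a ∷ []) (λ y e₂ a → e₂ :+ a :≤ y ⇒ (# 1 :+ y) :∸ e₂ :≡ # 1 :+ (y :∸ e₂)) refl e₂+a≤y ,
                 lia (p ∷ yi ∷ e₁ ∷ e₂ ∷ u₁ ∷ w ∸ u₂ ∷ a ∷ []) (λ p y e₁ e₂ u₁ d a → d :≡ # 0 ⇒ u₁ :+ p :≡ y ⇒ e₂ :≤ e₁ :+ u₁ ⇒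
                   e₁ :+ a :≤ p ⇒ e₂ :+ a :≤ y ⇒ (((e₁ :+ u₁) :+ d) :∸ e₂) :+ ((p :∸ e₁) :⊓ (y :∸ e₂)) :≡ y :∸ e₂) refl
                   (ℕ.m≤n⇒m∸n≡0 (ℕ.<⇒≤ w<u₂)) eq fits e₁+a≤p e₂+a≤y))
        where
        eq : u₁ + p ≡ yi
        eq = proj₂ (noOverlap (ℕ.<⇒≤ w<u₂))
        y<L : yi < L
        y<L = lia (yi ∷ L ∷ X ∷ w ∷ u₂ ∷ []) (λ y L X w u₂ → u₂ :+ y :≤ X ⇒ X :≤ w :+ L ⇒ w :< u₂ ⇒ y :< L) refl u₂+y≤X (invariant-stack v) w<u₂
        y<R : yi < R
        y<R = ℕ.≤-trans (ℕ.+-monoˡ-≤ yi (ℕ.≤-trans (s≤s z≤n) w<u₂)) u₂+y≤R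
        y<X : yi < X
        y<X = ℕ.≤-trans (ℕ.+-monoˡ-≤ yi (ℕ.≤-trans (s≤s z≤n) w<u₂)) u₂+y≤X
        ok : Good (suc yi) e₁ e₂ X
        ok = ℕ.≤-trans p≤y (ℕ.n≤1+n yi) , y<R , e₁+a≤p , ℕ.≤-trans e₂+a≤y (ℕ.n≤1+n yi) , bit r i , bit r (suc i) , refl ,
          lia (yi ∷ L ∷ R ∸ X ∷ []) (λ y L d → y :< L ⇒ (y :∸ L) :+ d :≡ ((# 1 :+ y) :∸ L) :+ d) refl y<L , y<X ,
          lia (p ∷ yi ∷ e₁ ∷ e₂ ∷ u₁ ∷ []) (λ p y e₁ e₂ u₁ → u₁ :+ p :≡ y ⇒ e₂ :≤ e₁ :+ u₁ ⇒
             (p :∸ e₁) :⊓ ((# 1 :+ y) :∸ e₂) :≡ (p :∸ e₁) :⊓ (y :∸ e₂)) refl eq fits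

      -- As `e₂ ≤ 1`, an unmatched non-pivot `i + 1` forces `e₁` and `u₁` to vanish. Then `p ≡ yi`,
      -- and the room that served `i + 1` also serves `i`.
      e-nonpivot-here : w ≤ u₂ → e₁ + u₁ < e₂ → E
      e-nonpivot-here w≤u₂ lt = done v (λ _ _ _ → refl) refl yi 1 0 ok
          (sym (e-nonpivot κ m _ _ _ (sameε v (λ _ _ _ → refl) refl yi 1 0 ok) (sameu v (λ _ _ _ → refl) refl yi 1 0 ok) w≤u₂
            e₁≡0 e₂≡1 (adjust-ε₁ q yi 1 0) (adjust-ε₂ q yi 1 0) u₁≡0
            (trans (u₁′ v (λ _ _ _ → refl) refl yi 1 0 ok) (trans u₁≡ u₁≡0)) (u₂′ v (λ _ _ _ → refl) refl yi 1 0 ok)))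
          (inj₂ (lia (yi ∷ e₂ ∷ a ∷ []) (λ y e₂ a → e₂ :≡ # 1 ⇒ e₂ :+ a :≤ y ⇒ y :≡ # 1 :+ (y :∸ e₂)) refl e₂≡1 e₂+a≤y ,
                 lia (p ∷ yi ∷ e₁ ∷ e₂ ∷ u₁ ∷ w ∸ u₂ ∷ []) (λ p y e₁ e₂ u₁ d → d :≡ # 0 ⇒ u₁ :≡ # 0 ⇒ p :≡ y ⇒ e₁ :≡ # 0 ⇒
                   e₂ :≡ # 1 ⇒ (((e₁ :+ u₁) :+ d) :∸ e₂) :+ ((p :∸ e₁) :⊓ (y :∸ e₂)) :≡ y :∸ e₂) refl
                   (ℕ.m≤n⇒m∸n≡0 w≤u₂) u₁≡0 p≡y e₁≡0 e₂≡1))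
        where
        e₂≡1 : e₂ ≡ 1
        e₂≡1 = ℕ.≤-antisym (bit r (suc i)) (ℕ.≤-trans (s≤s z≤n) lt)
        0≡sum : e₁ + u₁ ≡ 0
        0≡sum = ℕ.n≤0⇒n≡0 (ℕ.≤-pred (ℕ.≤-trans lt (bit r (suc i))))
        e₁≡0 : e₁ ≡ 0
        e₁≡0 = ℕ.m+n≡0⇒m≡0 e₁ 0≡sum
        u₁≡0 : u₁ ≡ 0
        u₁≡0 = ℕ.m+n≡0⇒n≡0 e₁ 0≡sum
        p≡y : p ≡ yi
        p≡y = trans (cong (_+ p) (sym u₁≡0)) (proj₂ (noOverlap w≤u₂))
        ok : Good yi 1 0 X
        ok = p≤y , y≤R , subst₂ (λ z t → z + a ≤ t) e₂≡1 (sym p≡y) e₂+a≤y , ℕ.≤-trans (ℕ.m≤n+m a e₂) e₂+a≤y ,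
          s≤s z≤n , z≤n , sym (cong₂ _+_ e₁≡0 e₂≡1) , refl , y≤X ,
          lia (p ∷ yi ∷ e₁ ∷ e₂ ∷ []) (λ p y e₁ e₂ → p :≡ y ⇒ e₁ :≡ # 0 ⇒ e₂ :≡ # 1 ⇒
             (p :∸ # 1) :⊓ y :≡ (p :∸ e₁) :⊓ (y :∸ e₂)) refl p≡y e₁≡0 e₂≡1

    lower : ∀ {ss ps} → Valid n c ss ps → 1 ≤ A i (stackWord n c ps) → Outcome (f i) Down ss ps
    lower {ss} {q ∷ ps} ((r , bl) ∷ v) h = go (u₂ <? w)
      where
      open Cases {ps = ps} r bl v
      open Finish {ps = ps} r bl v using (A-row; u₂; w; e₂; e₁; u₁)
      alive : suc e₂ ≤ (e₁ + u₁) + (w ∸ u₂)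
      alive = e₂<⇒ (subst (1 ≤_) A-row h)
      go : Dec (u₂ < w) → F
      go (yes u₂<w) = f-upper alive u₂<w (lower v (ℕ.≤-trans (s≤s z≤n) u₂<w))
      go (no u₂≮w)  = f-here alive (ℕ.≮⇒≥ u₂≮w)

    -- The tests reflect the reading order: non-pivot `i + 1`, then pivots, then the rows above, to
    -- which the operator passes only if nothing in this row is unmatched.
    raise : ∀ {ss ps} → Valid n c ss ps → 1 ≤ B i (stackWord n c ps) → Outcome (e i) Up ss ps
    raise {ss} {q ∷ ps} ((r , bl) ∷ v) h = go (u₂ ≤? w) (e₂ ≤? (e₁ + u₁) + (w ∸ u₂)) (e₂ ≤? e₁ + u₁)
      where
      open Cases {ps = ps} r bl v
      open Finish {ps = ps} r bl v using (A-row; u₂; w; e₂; e₁; u₁)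
      go : Dec (u₂ ≤ w) → Dec (e₂ ≤ (e₁ + u₁) + (w ∸ u₂)) → Dec (e₂ ≤ e₁ + u₁) → E
      go (yes u₂≤w) (yes fits) _ = e-upper u₂≤w fits (raise v (subst (1 ≤_) (B-rowWord κ m _ _ _ u₂≤w fits) h))
      go (yes u₂≤w) (no ¬fits) _ = e-nonpivot-here
        (lia (e₁ + u₁ ∷ e₂ ∷ w ∷ u₂ ∷ []) (λ s e₂ w u₂ → s :+ (w :∸ u₂) :< e₂ ⇒ e₂ :≤ # 1 ⇒ w :≤ u₂) refl (ℕ.≰⇒> ¬fits) (bit r (suc i)))
        (ℕ.≤-trans (s≤s (ℕ.m≤m+n _ _)) (ℕ.≰⇒> ¬fits))
      go (no u₂≰w) _ (yes fits) = e-pivot-here (ℕ.≰⇒> u₂≰w) fits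
      go (no u₂≰w) _ (no ¬fits) = e-nonpivot-here (ℕ.<⇒≤ (ℕ.≰⇒> u₂≰w)) (ℕ.≰⇒> ¬fits)

-- Rows of boxes and their translation into profiles and back.

module Rows where
  open import Defs using (countB; occ; minL; maxL; at; atD)
  open LIA
  open Words
  open RowWords
  open Profiles
  open import Data.Nat using (ℕ; zero; suc; _+_; _∸_; _⊓_; _⊔_; _≤_; _<_; z≤n; s≤s; _≟_; _≤?_; _≡ᵇ_; _≤ᵇ_)
  import Data.Nat.Properties as ℕ
  open import Data.Bool using (true; false; T)
  open import Data.List using (List; foldr; []; _∷_; _++_; map; concatMap; length; drop; replicate; reverse)
  import Data.List.Properties as List
  open import Data.List.Membership.Propositional using (_∈_)
  open import Data.List.Membership.Propositional.Properties using (∈-++⁺ˡ; ∈-++⁺ʳ; ∈-++⁻)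
  open import Data.List.Relation.Unary.Any using (here; there)
  open import Data.Vec using ([]; _∷_)
  open import Data.Product using (∃; _×_; _,_; proj₁; proj₂)
  open import Data.Sum using (_⊎_; inj₁; inj₂)
  open import Data.Empty using (⊥-elim)
  open import Data.Unit using (tt)
  open import Relation.Nullary using (yes; no)
  open import Relation.Binary.Definitions using (tri<; tri≈; tri>)
  open import Relation.Binary.PropositionalEquality hiding ([_]; J)

  ≤ᵇ-true : ∀ {m k} → m ≤ k → (m ≤ᵇ k) ≡ true
  ≤ᵇ-true {m} {k} h with m ≤ᵇ k in eq
  ... | true  = refl
  ... | false = ⊥-elim (subst T eq (ℕ.≤⇒≤ᵇ h))

  ≤ᵇ-false : ∀ {m k} → k < m → (m ≤ᵇ k) ≡ false
  ≤ᵇ-false {m} {k} h with m ≤ᵇ k in eq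
  ... | false = refl
  ... | true  = ⊥-elim (ℕ.<⇒≱ h (ℕ.≤ᵇ⇒≤ m k (subst T (sym eq) tt)))

  data Weak (n : ℕ) : ℕ → List ℕ → Set where
    []  : ∀ {s} → Weak n s []
    _∷_ : ∀ {s x xs} → s ≤ x × x ≤ n → Weak n x xs → Weak n s (x ∷ xs)

  data Strict (n : ℕ) : ℕ → List ℕ → Set where
    []  : ∀ {s} → Strict n s []
    _∷_ : ∀ {s x xs} → s < x × x ≤ n → Strict n x xs → Strict n s (x ∷ xs)

  top : ℕ → List ℕ → ℕ
  top m []      = m
  top m (x ∷ R) = top x R

  -- The index is a lower bound for the next minimum; passing on the maximum of each box imposes the
  -- row condition between neighbours.
  data Boxes (n : ℕ) : ℕ → List (List ℕ) → Set where
    []  : ∀ {s} → Boxes n s []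
    box : ∀ {s m R ρ} → s ≤ m → m ≤ n → Strict n m R → Boxes n (top m R) ρ → Boxes n s ((m ∷ R) ∷ ρ)

  Weak-≤ : ∀ {n s s′ xs} → s′ ≤ s → Weak n s xs → Weak n s′ xs
  Weak-≤ h []             = []
  Weak-≤ h ((p , q) ∷ xs) = (ℕ.≤-trans h p , q) ∷ xs

  Strict-≤ : ∀ {n s s′ xs} → s′ ≤ s → Strict n s xs → Strict n s′ xs
  Strict-≤ h []             = []
  Strict-≤ h ((p , q) ∷ xs) = (ℕ.≤-trans (s≤s h) p , q) ∷ xs

  Strict⇒Weak : ∀ {n s xs} → Strict n s xs → Weak n s xs
  Strict⇒Weak []             = []
  Strict⇒Weak ((p , q) ∷ xs) = (ℕ.<⇒≤ p , q) ∷ Strict⇒Weak xs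

  Strict-≤top : ∀ {n m R} → Strict n m R → m ≤ top m R
  Strict-≤top []            = ℕ.≤-refl
  Strict-≤top ((p , _) ∷ R) = ℕ.≤-trans (ℕ.<⇒≤ p) (Strict-≤top R)

  Strict-∈ : ∀ {n m R z} → Strict n m R → z ∈ R → m < z × z ≤ top m R
  Strict-∈ ((p , _) ∷ R) (here refl) = p , Strict-≤top R
  Strict-∈ ((p , _) ∷ R) (there h) with Strict-∈ R h
  ... | a , b = ℕ.<-trans p a , b

  top-∈ : ∀ m R → top m R ∈ m ∷ R
  top-∈ m []      = here refl
  top-∈ m (x ∷ R) = there (top-∈ x R)

  foldr-⊓ : ∀ {n m s R} → m ≤ s → Strict n s R → foldr _⊓_ m R ≡ m
  foldr-⊓ h [] = refl
  foldr-⊓ {m = m} h (_∷_ {x = x} (p , _) R) =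
    trans (cong (x ⊓_) (foldr-⊓ (ℕ.≤-trans h (ℕ.<⇒≤ p)) R)) (ℕ.m≥n⇒m⊓n≡n (ℕ.≤-trans h (ℕ.<⇒≤ p)))

  minL-box : ∀ {n m R} → Strict n m R → minL (m ∷ R) ≡ m
  minL-box = foldr-⊓ ℕ.≤-refl

  maxL-box : ∀ {n m R} → Strict n m R → maxL (m ∷ R) ≡ top m R
  maxL-box {m = m} [] = ℕ.⊔-identityʳ m
  maxL-box {m = m} (_∷_ {x = x} (p , _) R) = trans (cong (m ⊔_) (maxL-box R))
    (ℕ.m≤n⇒m⊔n≡n (ℕ.≤-trans (ℕ.<⇒≤ p) (Strict-≤top R)))

  mins nonPivots : List (List ℕ) → List ℕ
  mins      = map minL
  nonPivots = concatMap (drop 1)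

  Boxes-≤ : ∀ {n s s′ ρ} → s′ ≤ s → Boxes n s ρ → Boxes n s′ ρ
  Boxes-≤ h []            = []
  Boxes-≤ h (box p q R ρ) = box (ℕ.≤-trans h p) q R ρ

  mins-Weak : ∀ {n s ρ} → Boxes n s ρ → Weak n s (mins ρ)
  mins-Weak [] = []
  mins-Weak (box p q R ρ) rewrite minL-box R = (p , q) ∷ Weak-≤ (Strict-≤top R) (mins-Weak ρ)

  Strict-++ : ∀ {n m R N} → Strict n m R → Strict n (top m R) N → Strict n m (R ++ N)
  Strict-++ []      h = h
  Strict-++ (p ∷ R) h = p ∷ Strict-++ R h

  -- A non-pivot exceeds the minimum of its own box and thereby every entry further left. This is
  -- why one bit per letter records all non-pivots of a row.
  nonPivots-Strict : ∀ {n s ρ} → Boxes n s ρ → Strict n s (nonPivots ρ)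
  nonPivots-Strict []            = []
  nonPivots-Strict (box p q R ρ) = Strict-≤ p (Strict-++ R (nonPivots-Strict ρ))

  count≤ : ℕ → List ℕ → ℕ
  count≤ k = countB (_≤ᵇ k)

  count≤-none : ∀ {n s k xs} → k < s → Weak n s xs → count≤ k xs ≡ 0
  count≤-none h [] = refl
  count≤-none h ((p , _) ∷ xs) rewrite ≤ᵇ-false (ℕ.≤-trans h p) = count≤-none (ℕ.≤-trans h p) xs

  count≤-all : ∀ {n s xs} → Weak n s xs → count≤ n xs ≡ length xs
  count≤-all [] = refl
  count≤-all ((_ , q) ∷ xs) rewrite ≤ᵇ-true q = cong suc (count≤-all xs)

  count≤-length : ∀ k xs → count≤ k xs ≤ length xs
  count≤-length k [] = z≤n
  count≤-length k (x ∷ xs) with x ≤ᵇ k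
  ... | true  = s≤s (count≤-length k xs)
  ... | false = ℕ.m≤n⇒m≤1+n (count≤-length k xs)

  -- The counting function is the lower adjoint of the entries of a weakly increasing list.
  count≤-galois⁺ : ∀ {n s k xs} → Weak n s xs → ∀ j → j < length xs → at xs j ≤ k → j < count≤ k xs
  count≤-galois⁺ (_ ∷ xs) zero    (s≤s h) le rewrite ≤ᵇ-true le = s≤s z≤n
  count≤-galois⁺ {k = k} (_∷_ {x = x} {xs = xs} _ w) (suc j) (s≤s h) le with x ≤? k
  ... | yes p rewrite ≤ᵇ-true p = s≤s (count≤-galois⁺ w j h le)
  ... | no ¬p = ⊥-elim (ℕ.n≮0 (subst (j <_) (count≤-none (ℕ.≰⇒> ¬p) w) (count≤-galois⁺ w j h le)))

  count≤-galois⁻ : ∀ {n s k xs} → Weak n s xs → ∀ j → j < count≤ k xs → at xs j ≤ k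
  count≤-galois⁻ {k = k} (_∷_ {x = x} _ w) j h with x ≤? k
  count≤-galois⁻ (_∷_ _ w) zero h | yes p = p
  count≤-galois⁻ {k = k} (_∷_ {x = x} _ w) (suc j) h | yes p rewrite ≤ᵇ-true p = count≤-galois⁻ w j (ℕ.≤-pred h)
  count≤-galois⁻ {k = k} (_∷_ {x = x} _ w) j h | no ¬p rewrite ≤ᵇ-false (ℕ.≰⇒> ¬p) =
    ⊥-elim (ℕ.n≮0 (subst (j <_) (count≤-none (ℕ.≰⇒> ¬p) w) h))

  count≤-suc : ∀ k xs → count≤ (suc k) xs ≡ count≤ k xs + occ (suc k) xs
  count≤-suc k [] = refl
  count≤-suc k (x ∷ xs) with ℕ.<-cmp x (suc k)
  ... | tri< (s≤s p) ¬q _ rewrite ≤ᵇ-true p | ≤ᵇ-true (ℕ.m≤n⇒m≤1+n p) | ≢⇒≡ᵇ (≢-sym ¬q) = cong suc (count≤-suc k xs)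
  ... | tri≈ _ refl _ rewrite ≤ᵇ-true (ℕ.≤-refl {suc k}) | ≤ᵇ-false (ℕ.≤-refl {suc k}) | ≡ᵇ-refl k =
    trans (cong suc (count≤-suc k xs)) (sym (ℕ.+-suc _ _))
  ... | tri> _ ¬q p rewrite ≤ᵇ-false p | ≤ᵇ-false (ℕ.<-trans (ℕ.n<1+n k) p) | ≢⇒≡ᵇ (≢-sym ¬q) = count≤-suc k xs

  occ-none : ∀ {n s k xs} → k < s → Weak n s xs → occ k xs ≡ 0
  occ-none h [] = refl
  occ-none h ((p , _) ∷ xs) rewrite ≢⇒≡ᵇ (ℕ.<⇒≢ (ℕ.≤-trans h p)) = occ-none (ℕ.≤-trans h p) xs

  occ-start : ∀ {n x xs} → Strict n x xs → occ x xs ≡ 0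
  occ-start []            = refl
  occ-start ((p , q) ∷ w) = occ-none p ((ℕ.≤-refl , q) ∷ Strict⇒Weak w)

  occ-bit : ∀ {n s xs} → Strict n s xs → ∀ k → occ k xs ≤ 1
  occ-bit [] k = z≤n
  occ-bit (_∷_ {x = x} {xs} _ w) k with k ≟ x
  ... | yes refl rewrite ≡ᵇ-refl x | occ-start w = s≤s z≤n
  ... | no ¬p rewrite ≢⇒≡ᵇ ¬p = occ-bit w k

  occ-∈ : ∀ {k} xs → 1 ≤ occ k xs → k ∈ xs
  occ-∈ {k} (x ∷ xs) h with k ≟ x
  ... | yes refl = here refl
  ... | no ¬p rewrite ≢⇒≡ᵇ ¬p = there (occ-∈ xs h)

  ∈-occ : ∀ {k xs} → k ∈ xs → 1 ≤ occ k xs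
  ∈-occ {k} {x ∷ xs} (here refl) rewrite ≡ᵇ-refl k = s≤s z≤n
  ∈-occ {k} {x ∷ xs} (there h) with k ≡ᵇ x
  ... | true  = s≤s z≤n
  ... | false = ∈-occ h

  length-ascending : ∀ u n → length (ascending u n) ≡ total u n
  length-ascending u zero    = refl
  length-ascending u (suc n) = trans (List.length-++ (ascending u n)) (cong₂ _+_ (length-ascending u n) (List.length-replicate (u n)))

  ascending-∷ : ∀ n {c u v} → suc c ≤ n → (∀ k → k < c → v k ≡ 0) → (∀ k → k ≢ c → u k ≡ v k) → u c ≡ suc (v c) →
                ascending u n ≡ suc c ∷ ascending v n
  ascending-∷ (suc n) {c} {u} {v} (s≤s h) zeros same one with c ≟ n
  ... | yes refl = cong₂ _++_ {x = ascending u n} {y = []} (none n λ k k< → trans (same k (ℕ.<⇒≢ k<)) (zeros k k<))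
          (cong (λ z → replicate z (suc n)) one) ▸ cong (λ z → suc n ∷ z ++ replicate (v n) (suc n)) (sym (none n zeros))
    where
    _▸_ : ∀ {x y z : Word} → x ≡ y → y ≡ z → x ≡ z
    _▸_ = trans
    none : ∀ m {g} → (∀ k → k < m → g k ≡ 0) → ascending g m ≡ []
    none zero    h = refl
    none (suc m) h rewrite h m ℕ.≤-refl = trans (List.++-identityʳ _) (none m λ k k< → h k (ℕ.m≤n⇒m≤1+n k<))
  ... | no c≢n = cong₂ _++_ (ascending-∷ n (ℕ.≤∧≢⇒< h c≢n) zeros same one)
          (cong (λ z → replicate z (suc n)) (same n (≢-sym c≢n)))

  -- A sorted list is recovered from its multiplicities, which is how both halves of a reading word
  -- become functions of the profile. The bound `1 ≤ s` excludes the letter 0, which `ascending`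
  -- never produces.
  ascending-occ : ∀ {n s xs} → 1 ≤ s → Weak n s xs → xs ≡ ascending (λ k → occ (suc k) xs) n
  ascending-occ {n} h [] = sym (none n)
    where
    none : ∀ m → ascending (λ _ → 0) m ≡ []
    none zero    = refl
    none (suc m) = trans (List.++-identityʳ _) (none m)
  ascending-occ {n} h (_∷_ {x = suc c} {xs} (p , q) w) = trans (cong (suc c ∷_) (ascending-occ (s≤s z≤n) w))
    (sym (ascending-∷ n q (λ k k< → occ-none (s≤s k<) w) (λ k k≢ → occ-≢ xs (λ e → k≢ (ℕ.suc-injective e))) (occ-≡ (suc c) xs)))
  ascending-occ (s≤s h) (_∷_ {x = zero} (() , q) w)

  replicate-snoc-≡ : ∀ k (c : ℕ) → replicate k c ++ c ∷ [] ≡ replicate (suc k) c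
  replicate-snoc-≡ zero    c = refl
  replicate-snoc-≡ (suc k) c = cong (c ∷_) (replicate-snoc-≡ k c)

  reverse-replicate : ∀ k (c : ℕ) → reverse (replicate k c) ≡ replicate k c
  reverse-replicate zero    c = refl
  reverse-replicate (suc k) c = trans (List.unfold-reverse c (replicate k c))
    (trans (cong (_++ c ∷ []) (reverse-replicate k c)) (replicate-snoc-≡ k c))

  reverse-ascending : ∀ u n → reverse (ascending u n) ≡ descending u n
  reverse-ascending u zero    = refl
  reverse-ascending u (suc n) = trans (List.reverse-++ (ascending u n) _)
    (cong₂ _++_ (reverse-replicate (u n) (suc n)) (reverse-ascending u n))

  ∈-nonPivots : ∀ ρ j {z} → z ∈ drop 1 (atD ρ j []) → z ∈ nonPivots ρ
  ∈-nonPivots (S ∷ ρ) zero    h = ∈-++⁺ˡ h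
  ∈-nonPivots (S ∷ ρ) (suc j) h = ∈-++⁺ʳ (drop 1 S) (∈-nonPivots ρ j h)

  -- All minima up to the box of `z` are below `z`, and the next minimum is at least `z`. So a
  -- non-pivot sits in the last box with smaller minimum, and its place need not be recorded.
  nonPivot-position : ∀ {n s ρ z} → Boxes n s ρ → ∀ j → z ∈ drop 1 (atD ρ j []) → count≤ (z ∸ 1) (mins ρ) ≡ suc j
  nonPivot-position {z = z} (box {m = m} {R} {ρ} p q St bs) zero h rewrite minL-box St with Strict-∈ St h
  nonPivot-position {z = suc z} (box {m = m} {R} {ρ} p q St bs) zero h | s≤s m≤z , z<top
    rewrite ≤ᵇ-true m≤z = cong suc (count≤-none z<top (mins-Weak bs))
  nonPivot-position {z = z} (box {m = m} {R} {ρ} p q St bs) (suc j) h rewrite minL-box St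
    with Strict-∈ (nonPivots-Strict bs) (∈-nonPivots ρ j h)
  nonPivot-position {z = suc z} (box {m = m} {R} {ρ} p q St bs) (suc j) h | s≤s t≤z , _
    rewrite ≤ᵇ-true (ℕ.≤-trans (Strict-≤top St) t≤z) = cong suc (nonPivot-position bs j h)

  nonPivots-∈ : ∀ ρ {z} → z ∈ nonPivots ρ → ∃ λ j → j < length ρ × z ∈ drop 1 (atD ρ j [])
  nonPivots-∈ (S ∷ ρ) h with ∈-++⁻ (drop 1 S) h
  ... | inj₁ h′ = 0 , s≤s z≤n , h′
  ... | inj₂ h′ with nonPivots-∈ ρ h′
  ...   | j , p , q = suc j , s≤s p , q

  data BoxView (n : ℕ) : List ℕ → Set where
    view : ∀ {m R} → 1 ≤ m → m ≤ n → Strict n m R → BoxView n (m ∷ R)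

  boxView : ∀ {n s ρ} → 1 ≤ s → Boxes n s ρ → ∀ j → j < length ρ → BoxView n (atD ρ j [])
  boxView h (box p q R bs) zero    _        = view (ℕ.≤-trans h p) q R
  boxView h (box p q R bs) (suc j) (s≤s j<) = boxView (ℕ.≤-trans h (ℕ.≤-trans p (Strict-≤top R))) bs j j<

  view-min≤max : ∀ {n S} → BoxView n S → minL S ≤ maxL S
  view-min≤max (view _ _ R) rewrite minL-box R | maxL-box R = Strict-≤top R

  view-≤max : ∀ {n S z} → BoxView n S → z ∈ drop 1 S → z ≤ maxL S
  view-≤max (view _ _ R) h rewrite maxL-box R = proj₂ (Strict-∈ R h)

  view-max : ∀ {n S} → BoxView n S → minL S ≡ maxL S ⊎ maxL S ∈ drop 1 S
  view-max (view {m} {R} _ _ St) rewrite minL-box St | maxL-box St with top-∈ m R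
  ... | here eq = inj₁ (sym eq)
  ... | there h = inj₂ h

  at-mins : ∀ ρ j → j < length ρ → at (mins ρ) j ≡ minL (atD ρ j [])
  at-mins (S ∷ ρ) zero    _       = refl
  at-mins (S ∷ ρ) (suc j) (s≤s h) = at-mins ρ j h

  profileOf : ℕ → List (List ℕ) → Profile
  profileOf a ρ = profile (λ k → a + count≤ k (mins ρ)) (λ k → occ k (nonPivots ρ))

  module _ {n : ℕ} {ρ : List (List ℕ)} (bs : Boxes n 1 ρ) where

    -- The subtracted bit removes only the last counted column, whose box holds `k + 1` as a
    -- non-pivot and thus has too large a maximum.
    max≤⇒column< : ∀ {j k} → j < length ρ → maxL (atD ρ j []) ≤ k → suc j ≤ count≤ k (mins ρ) ∸ occ (suc k) (nonPivots ρ)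
    max≤⇒column< {j} {k} j< h = go (occ (suc k) (nonPivots ρ)) refl
      where
      below : j < count≤ k (mins ρ)
      below = count≤-galois⁺ (mins-Weak bs) j (subst (j <_) (sym (List.length-map minL ρ)) j<)
        (subst (_≤ k) (sym (at-mins ρ j j<)) (ℕ.≤-trans (view-min≤max (boxView (s≤s z≤n) bs j j<)) h))
      go : ∀ o → occ (suc k) (nonPivots ρ) ≡ o → suc j ≤ count≤ k (mins ρ) ∸ o
      go zero    _  = below
      go (suc o) eq with nonPivots-∈ ρ (occ-∈ {suc k} (nonPivots ρ) (subst (1 ≤_) (sym eq) (s≤s z≤n)))
      ... | j₀ , j₀< , ∈R = subst₂ (λ z z′ → suc j ≤ z ∸ z′) (sym pos) (sym o≡1) (ℕ.≤∧≢⇒< (ℕ.≤-pred (subst (suc j ≤_) pos below)) j≢j₀)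
        where
        pos = nonPivot-position bs j₀ ∈R
        o≡1 : suc o ≡ 1
        o≡1 = ℕ.≤-antisym (subst (_≤ 1) eq (occ-bit (nonPivots-Strict bs) (suc k))) (s≤s z≤n)
        j≢j₀ : j ≢ j₀
        j≢j₀ refl = ℕ.<⇒≱ (ℕ.n<1+n k) (ℕ.≤-trans (view-≤max (boxView (s≤s z≤n) bs j j<) ∈R) h)

    -- The maximum has to be exactly `k + 1`: for a larger maximum in a box without the entry
    -- `k + 1` the bound can fail by one.
    column≥max : ∀ {j k} → j < length ρ → maxL (atD ρ j []) ≡ suc k → count≤ k (mins ρ) ∸ occ (suc k) (nonPivots ρ) ≤ j
    column≥max {j} {k} j< eq with view-max (boxView (s≤s z≤n) bs j j<)
    ... | inj₁ min≡ = ℕ.≤-trans (ℕ.m∸n≤m _ (occ (suc k) (nonPivots ρ))) (ℕ.≮⇒≥ λ lt →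
            ℕ.<⇒≱ (ℕ.n<1+n k) (subst (_≤ k) (trans (at-mins ρ j j<) (trans min≡ eq)) (count≤-galois⁻ (mins-Weak bs) j lt)))
    ... | inj₂ ∈R = lia (count≤ k (mins ρ) ∷ occ (suc k) (nonPivots ρ) ∷ j ∷ [])
            (λ c o j → c :≡ # 1 :+ j ⇒ # 1 :≤ o ⇒ c :∸ o :≤ j) refl
            (nonPivot-position bs j ∈R′) (∈-occ (∈-nonPivots ρ j ∈R′))
      where
      ∈R′ : suc k ∈ drop 1 (atD ρ j [])
      ∈R′ = subst (_∈ drop 1 (atD ρ j [])) eq ∈R

    total-occ : ∀ {m s xs} → 1 ≤ s → Weak m s xs → total (λ k → occ (suc k) xs) m ≡ length xs
    total-occ {m} h w = trans (sym (length-ascending _ m)) (cong length (sym (ascending-occ h w)))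

    profileOf-Row : ∀ a b → a + length ρ ≡ b → Row n a b (length (nonPivots ρ)) (profileOf a ρ)
    profileOf-Row a b len = mkRow
      (trans (cong (a +_) (count≤-none (s≤s z≤n) (mins-Weak bs))) (ℕ.+-identityʳ a))
      (trans (cong (a +_) (trans (count≤-all (mins-Weak bs)) (List.length-map minL ρ))) len)
      (λ k _ → ℕ.+-monoʳ-≤ a (subst (count≤ k (mins ρ) ≤_) (sym (count≤-suc k (mins ρ))) (ℕ.m≤m+n _ _)))
      (λ k _ → subst (_≤ a + count≤ k (mins ρ)) (ℕ.+-comm a _) (ℕ.+-monoʳ-≤ a (enough k)))
      (occ-bit (nonPivots-Strict bs))
      (beyond (nonPivots-Strict bs))
      (total-occ (s≤s z≤n) (Strict⇒Weak (nonPivots-Strict bs)))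
      where
      enough : ∀ k → occ (suc k) (nonPivots ρ) ≤ count≤ k (mins ρ)
      enough k with occ (suc k) (nonPivots ρ) in eq | occ-bit (nonPivots-Strict bs) (suc k)
      ... | zero  | _ = z≤n
      ... | suc zero | _ with nonPivots-∈ ρ (occ-∈ {suc k} (nonPivots ρ) (subst (1 ≤_) (sym eq) (s≤s z≤n)))
      ...   | j₀ , _ , ∈R rewrite nonPivot-position bs j₀ ∈R = s≤s z≤n
      enough k | suc (suc _) | s≤s ()
      beyond : ∀ {s xs} → Strict n s xs → occ (suc n) xs ≡ 0
      beyond [] = refl
      beyond (_∷_ {x = x} {xs} (_ , q) w) = trans (occ-≢ xs (λ e → ℕ.<⇒≢ (s≤s q) (sym e))) (beyond w)

  -- The inverse construction: every non-pivot entry goes to the last box whose pivot is smaller.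
  takeTo dropTo : ℕ → List ℕ → List ℕ
  takeTo b []       = []
  takeTo b (x ∷ xs) with x ≤? b
  ... | yes _ = x ∷ takeTo b xs
  ... | no  _ = []
  dropTo b []       = []
  dropTo b (x ∷ xs) with x ≤? b
  ... | yes _ = dropTo b xs
  ... | no  _ = x ∷ xs

  distribute : List ℕ → List ℕ → List (List ℕ)
  distribute []             N = []
  distribute (m ∷ [])       N = (m ∷ N) ∷ []
  distribute (m ∷ m′ ∷ pv)  N = (m ∷ takeTo m′ N) ∷ distribute (m′ ∷ pv) (dropTo m′ N)

  take++drop : ∀ b xs → takeTo b xs ++ dropTo b xs ≡ xs
  take++drop b [] = refl
  take++drop b (x ∷ xs) with x ≤? b
  ... | yes _ = cong (x ∷_) (take++drop b xs)
  ... | no  _ = refl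

  takeTo-Strict : ∀ {n s b xs} → Strict n s xs → Strict n s (takeTo b xs)
  takeTo-Strict [] = []
  takeTo-Strict {b = b} (_∷_ {x = x} p w) with x ≤? b
  ... | yes _ = p ∷ takeTo-Strict w
  ... | no  _ = []

  top-takeTo : ∀ {n s b xs} → s ≤ b → Strict n s xs → top s (takeTo b xs) ≤ b
  top-takeTo h [] = h
  top-takeTo {b = b} h (_∷_ {x = x} p w) with x ≤? b
  ... | yes q = top-takeTo q w
  ... | no  _ = h

  dropTo-Strict : ∀ {n s b xs} → Strict n s xs → Strict n b (dropTo b xs)
  dropTo-Strict [] = []
  dropTo-Strict {b = b} (_∷_ {x = x} p w) with x ≤? b
  ... | yes q = dropTo-Strict w
  ... | no ¬q = (ℕ.≰⇒> ¬q , proj₂ p) ∷ w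

  record Distributed (n s : ℕ) (pv N : List ℕ) (ρ : List (List ℕ)) : Set where
    field
      boxes : Boxes n s ρ
      mins≡ : mins ρ ≡ pv
      nonPivots≡ : nonPivots ρ ≡ N
  open Distributed public

  distribute-correct : ∀ {n s m pv N} → Weak n s (m ∷ pv) → Strict n m N → Distributed n s (m ∷ pv) N (distribute (m ∷ pv) N)
  distribute-correct {pv = []} ((p , q) ∷ []) St = record
    { boxes = box p q St []
    ; mins≡ = cong (_∷ []) (minL-box St)
    ; nonPivots≡ = List.++-identityʳ _ }
  distribute-correct {pv = m′ ∷ pv} {N} ((p , q) ∷ ((p′ , q′) ∷ w)) St = record
    { boxes = box p q (takeTo-Strict St) (Boxes-≤ (top-takeTo p′ St) (boxes rest))
    ; mins≡ = cong₂ _∷_ (minL-box (takeTo-Strict St)) (mins≡ rest)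
    ; nonPivots≡ = trans (cong (takeTo m′ N ++_) (nonPivots≡ rest)) (take++drop m′ N) }
    where rest = distribute-correct {s = m′} ((ℕ.≤-refl , q′) ∷ w) (dropTo-Strict St)

  takeTo-++ : ∀ {n m b R N} → Strict n m R → top m R ≤ b → Strict n b N → takeTo b (R ++ N) ≡ R × dropTo b (R ++ N) ≡ N
  takeTo-++ [] h [] = refl , refl
  takeTo-++ {b = b} [] h (_∷_ {x = x} (p , _) w) with x ≤? b
  ... | yes q = ⊥-elim (ℕ.<⇒≱ p q)
  ... | no _  = refl , refl
  takeTo-++ {b = b} (_∷_ {x = x} _ R) h N with x ≤? b
  ... | yes q = cong (x ∷_) (proj₁ (takeTo-++ R h N)) , proj₂ (takeTo-++ R h N)
  ... | no ¬q = ⊥-elim (¬q (ℕ.≤-trans (Strict-≤top R) h))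

  distribute-unique : ∀ {n s ρ} → Boxes n s ρ → ρ ≡ distribute (mins ρ) (nonPivots ρ)
  distribute-unique [] = refl
  distribute-unique (box {m = m} {R} p q St []) rewrite minL-box St | List.++-identityʳ R = refl
  distribute-unique (box {m = m} {R} p q St (box {m = m′} {R′} {ρ} p′ q′ St′ bs))
    with distribute-unique (box p′ q′ St′ bs)
  ... | ih rewrite minL-box St | minL-box St′ with takeTo-++ {b = m′} St p′ (Strict-++ St′ (nonPivots-Strict bs))
  ...   | t , d rewrite t | d = cong ((m ∷ R) ∷_) ih

-- Comparison of consecutive rows, and reading words as functions of profiles.

module Reading where
  open import Defs using (countB; occ; minL; maxL; atD)
  open LIA
  open Words hiding (lo; hi)
  open RowWords
  open Profiles
  open Rows
  open import Data.Nat using (ℕ; zero; suc; _+_; _∸_; _⊓_; _≤_; _<_; z≤n; s≤s; _≟_; _≤?_; _<?_; _≡ᵇ_; _≤ᵇ_; _<ᵇ_)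
  import Data.Nat.Properties as ℕ
  open import Data.Bool using (Bool; true; false; _∧_; T)
  open import Data.List using (List; []; _∷_; _++_; length; replicate; upTo; applyUpTo)
  import Data.List.Properties as List
  open import Data.Vec using ([]; _∷_)
  open import Data.Product using (_×_; _,_; proj₁; proj₂)
  open import Data.Sum using (inj₁; inj₂)
  open import Data.List.Relation.Unary.Any using (here)
  open import Data.Empty using (⊥; ⊥-elim)
  open import Data.Unit using (tt)
  open import Function using (_∘_)
  open import Relation.Nullary using (¬_; yes; no)
  open import Relation.Binary.PropositionalEquality hiding ([_]; J)

  indicator : Bool → ℕ
  indicator true  = 1
  indicator false = 0

  total-front : ∀ g n → total g (suc n) ≡ g 0 + total (g ∘ suc) n
  total-front g zero    = sym (ℕ.+-identityʳ (g 0))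
  total-front g (suc n) = trans (cong (_+ g (suc n)) (total-front g n)) (ℕ.+-assoc (g 0) _ _)

  countB-applyUpTo : ∀ {X : Set} (P : X → Bool) g n → countB P (applyUpTo g n) ≡ total (λ j → indicator (P (g j))) n
  countB-applyUpTo P g zero    = refl
  countB-applyUpTo P g (suc n) = trans (head (P (g 0)) refl) (sym (total-front _ n))
    where
    head : ∀ b → P (g 0) ≡ b → countB P (applyUpTo g (suc n)) ≡ indicator (P (g 0)) + total (λ j → indicator (P (g (suc j)))) n
    head true  eq rewrite eq = cong suc (countB-applyUpTo P (g ∘ suc) n)
    head false eq rewrite eq = countB-applyUpTo P (g ∘ suc) n

  total-zero : ∀ {g} n → (∀ k → k < n → g k ≡ 0) → total g n ≡ 0
  total-zero zero    h = refl
  total-zero (suc n) h = cong₂ _+_ (total-zero n λ k k< → h k (ℕ.m≤n⇒m≤1+n k<)) (h n ℕ.≤-refl)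

  total-+ : ∀ g h n → total (λ k → g k + h k) n ≡ total g n + total h n
  total-+ g h zero    = refl
  total-+ g h (suc n) rewrite total-+ g h n = lia (total g n ∷ total h n ∷ g n ∷ h n ∷ [])
    (λ a b c d → (a :+ b) :+ (c :+ d) :≡ (a :+ c) :+ (b :+ d)) refl

  total-swap : ∀ (F : ℕ → ℕ → ℕ) m n → total (λ j → total (F j) n) m ≡ total (λ k → total (λ j → F j k) m) n
  total-swap F zero    n = sym (total-zero n λ _ _ → refl)
  total-swap F (suc m) n rewrite total-swap F m n = sym (total-+ (λ k → total (λ j → F j k) m) (F m) n)

  total-single : ∀ {g} n k → k < n → (∀ j → j < n → j ≢ k → g j ≡ 0) → total g n ≡ g k
  total-single {g} (suc n) k k< h with k ≟ n
  ... | yes refl = cong (_+ g n) (total-zero n λ j j< → h j (ℕ.m≤n⇒m≤1+n j<) (ℕ.<⇒≢ j<))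
  ... | no k≢n   = trans (cong₂ _+_ (total-single n k (ℕ.≤∧≢⇒< (ℕ.≤-pred k<) k≢n) λ j j< → h j (ℕ.m≤n⇒m≤1+n j<))
                     (h n ℕ.≤-refl (≢-sym k≢n))) (ℕ.+-identityʳ _)

  between : ℕ → ℕ → ℕ → Bool
  between lo hi c = (lo ≤ᵇ c) ∧ (c <ᵇ hi)

  between-true : ∀ {lo hi c} → lo ≤ c → c < hi → between lo hi c ≡ true
  between-true h k rewrite ≤ᵇ-true h | ≤ᵇ-true k = refl

  between-sound : ∀ {lo hi c} → between lo hi c ≡ true → lo ≤ c × c < hi
  between-sound {lo} {hi} {c} h with lo ≤ᵇ c in p | c <ᵇ hi in q
  ... | true | true = ℕ.≤ᵇ⇒≤ lo c (subst T (sym p) tt) , ℕ.<ᵇ⇒< c hi (subst T (sym q) tt)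

  between-false : ∀ {lo hi c} → ¬ (lo ≤ c × c < hi) → between lo hi c ≡ false
  between-false {lo} {hi} {c} h with between lo hi c in eq
  ... | true  = ⊥-elim (h (between-sound eq))
  ... | false = refl

  total-between : ∀ lo hi a m → a ≤ lo → total (λ j → indicator (between lo hi (a + j))) m ≡ (hi ⊓ (a + m)) ∸ lo
  total-between lo hi a zero h = sym (lia (lo ∷ hi ∷ a ∷ []) (λ l h a → a :≤ l ⇒ (h :⊓ (a :+ # 0)) :∸ l :≡ # 0) refl h)
  total-between lo hi a (suc m) h rewrite total-between lo hi a m h | ℕ.+-suc a m with lo ≤? (a + m) | (a + m) <? hi
  ... | yes p | yes q rewrite between-true p q = lia (lo ∷ hi ∷ a + m ∷ [])
    (λ l h c → l :≤ c ⇒ c :< h ⇒ ((h :⊓ c) :∸ l) :+ # 1 :≡ (h :⊓ (# 1 :+ c)) :∸ l) refl p q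
  ... | yes p | no q rewrite between-false {lo} {hi} {a + m} (q ∘ proj₂) = lia (lo ∷ hi ∷ a + m ∷ [])
    (λ l h c → h :≤ c ⇒ ((h :⊓ c) :∸ l) :+ # 0 :≡ (h :⊓ (# 1 :+ c)) :∸ l) refl (ℕ.≮⇒≥ q)
  ... | no p | _ rewrite between-false {lo} {hi} {a + m} (p ∘ proj₁) = lia (lo ∷ hi ∷ a + m ∷ [])
    (λ l h c → c :< l ⇒ ((h :⊓ c) :∸ l) :+ # 0 :≡ (h :⊓ (# 1 :+ c)) :∸ l) refl (ℕ.≰⇒> p)

  -- The maxima M of the boxes of a row in columns [a , b), seen through thresholds X, and the minima p of a row
  -- seen through thresholds y.
  record Ceiling (n a b : ℕ) (M X : ℕ → ℕ) : Set where
    field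
      a≤X    : ∀ k → k < n → a ≤ X k
      M≤⇒<X  : ∀ {c k} → k ≤ n → a ≤ c → c < b → M c ≤ k → c < X k
      M≡⇒X≤  : ∀ {c k} → a ≤ c → c < b → M c ≡ suc k → X k ≤ c
      X-last : b ≤ X n

  record Floor (n a b : ℕ) (p y : ℕ → ℕ) : Set where
    field
      y≤b    : ∀ k → y k ≤ b
      a≤y    : ∀ k → a ≤ y k
      p≤⇒<y  : ∀ {c k} → a ≤ c → c < b → p c ≤ k → c < y k
      <y⇒p≤  : ∀ {c k} → a ≤ c → c < y k → p c ≤ k
      bounds : ∀ {c} → a ≤ c → c < b → 1 ≤ p c × p c ≤ n

  module _ {n a b a′ b′ : ℕ} {M X p y : ℕ → ℕ} (U : Ceiling n a b M X) (L : Floor n a′ b′ p y) (a′≤a : a′ ≤ a) (b′≤b : b′ ≤ b) where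
    open Ceiling U
    open Floor L

    Stacked : Set
    Stacked = ∀ c → a ≤ c → c < b′ → M c ≤ p c

    -- If `X k < y k`, then in column `X k` the minimum below is at most `k`, hence so is the
    -- maximum above, which would place this column before `X k`.
    stacked⇒under : Stacked → ∀ k → k ≤ n → y k ≤ X k
    stacked⇒under s k k≤n with ℕ.m≤n⇒m<n∨m≡n k≤n
    -- At the last letter both sides are ends of rows, and the inequality is that of the shape.
    ... | inj₂ refl = ℕ.≤-trans (y≤b n) (ℕ.≤-trans b′≤b X-last)
    ... | inj₁ k<n = ℕ.≮⇒≥ λ X<y →
      let a≤c = a≤X k k<n
          c<b′ = ℕ.≤-trans X<y (y≤b k)
      in ℕ.<-irrefl refl (M≤⇒<X k≤n a≤c (ℕ.≤-trans c<b′ b′≤b) (ℕ.≤-trans (s (X k) a≤c c<b′) (<y⇒p≤ (ℕ.≤-trans a′≤a a≤c) X<y)))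

    -- Each column is tested at one less than its maximum, where `M≡⇒X≤` guarantees that the
    -- threshold does not exceed the column.
    under⇒stacked : (∀ c → a ≤ c → c < b → M c ≤ n) → (∀ k → k ≤ n → y k ≤ X k) → Stacked
    under⇒stacked M≤n u c a≤c c<b′ = ℕ.≮⇒≥ λ p<M → go (M c) refl p<M
      where
      c<b = ℕ.≤-trans c<b′ b′≤b
      go : ∀ m → M c ≡ m → p c < m → ⊥
      go (suc k) eq (s≤s p≤k) = ℕ.<⇒≱ (p≤⇒<y (ℕ.≤-trans a′≤a a≤c) c<b′ p≤k)
        (ℕ.≤-trans (u k (ℕ.<⇒≤ (subst (_≤ n) eq (M≤n c a≤c c<b)))) (M≡⇒X≤ a≤c c<b eq))

    module _ (s : Stacked) {c k : ℕ} (k<n : k < n) where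
      equal⇒between : a ≤ c → c < b′ → M c ≡ p c → p c ≡ suc k → X k ≤ c × c < y (suc k)
      equal⇒between a≤c c<b′ eq pk = M≡⇒X≤ a≤c (ℕ.≤-trans c<b′ b′≤b) (trans eq pk) ,
        p≤⇒<y (ℕ.≤-trans a′≤a a≤c) c<b′ (ℕ.≤-reflexive pk)

      -- The maximum above is at least `k + 1`, the minimum below at most `k + 1`, and the column
      -- order squeezes both to `k + 1`.
      between⇒equal : X k ≤ c → c < y (suc k) → (a ≤ c × c < b′) × (M c ≡ p c × p c ≡ suc k)
      between⇒equal X≤c c<y = (a≤c , c<b′) , (ℕ.≤-antisym M≤ (ℕ.≤-trans p≤ k<M) , ℕ.≤-antisym p≤ (ℕ.≤-trans k<M M≤))
        where
        a≤c = ℕ.≤-trans (a≤X k k<n) X≤c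
        c<b′ = ℕ.≤-trans c<y (y≤b (suc k))
        M≤ = s c a≤c c<b′
        p≤ = <y⇒p≤ {k = suc k} (ℕ.≤-trans a′≤a a≤c) c<y
        k<M : k < M c
        k<M = ℕ.≰⇒> λ M≤k → ℕ.<⇒≱ (M≤⇒<X (ℕ.<⇒≤ k<n) a≤c (ℕ.≤-trans c<b′ b′≤b) M≤k) X≤c

    -- P is the predicate of the columns counted by ceq.
    count-equal : Stacked → ∀ C (P : ℕ → Bool) → b ≤ C →
      (∀ c → P c ≡ true → (a ≤ c × c < b′) × M c ≡ p c) → (∀ c → a ≤ c → c < b′ → M c ≡ p c → P c ≡ true) →
      countB P (upTo C) ≡ total (λ k → y (suc k) ∸ X k) n
    count-equal s C P b≤C sound complete = trans (countB-applyUpTo P (λ j → j) C)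
      (trans (total-cong C (λ c _ → column c)) (trans (total-swap (λ c k → indicator (between (X k) (y (suc k)) c)) C n)
      (total-cong n λ k _ → trans (total-between (X k) (y (suc k)) 0 C z≤n)
        (cong (_∸ X k) (ℕ.m≤n⇒m⊓n≡m (ℕ.≤-trans (y≤b (suc k)) (ℕ.≤-trans b′≤b b≤C)))))))
      where
      column : ∀ c → indicator (P c) ≡ total (λ k → indicator (between (X k) (y (suc k)) c)) n
      column c with P c in eq
      ... | false = sym (total-zero n λ k k<n → cong indicator (between-false λ (h , h′) →
              let ((a≤c , c<b′) , (e , _)) = between⇒equal s k<n h h′ in contra (trans (sym eq) (complete c a≤c c<b′ e))))
        where
        contra : false ≡ true → ⊥
        contra ()
      ... | true with sound c eq
      ...   | (a≤c , c<b′) , e with p c in pc | bounds {c} (ℕ.≤-trans a′≤a a≤c) c<b′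
      ...     | suc k | _ , k<n = sym (trans (total-single n k k<n λ j j<n j≢k → cong indicator (between-false λ (h , h′) →
                j≢k (ℕ.suc-injective (trans (sym (proj₂ (proj₂ (between⇒equal s j<n h h′)))) pc))))
                (cong indicator (let (h , h′) = equal⇒between s k<n a≤c c<b′ (trans e (sym pc)) pc in between-true h h′)))
      ...     | zero | () , _

    -- Q is the predicate of the boxes with minimum k + 1 whose pivot is read.
    count-pivots : Stacked → ∀ {k} → k < n → (Q : ℕ → Bool) →
      (∀ c → a′ ≤ c → c < b′ → Q c ≡ true → p c ≡ suc k × ¬ (a ≤ c × M c ≡ p c)) →
      (∀ c → a′ ≤ c → c < b′ → p c ≡ suc k → ¬ (a ≤ c × M c ≡ p c) → Q c ≡ true) →
      total (λ j → indicator (Q (a′ + j))) (b′ ∸ a′) ≡ (y (suc k) ⊓ X k) ∸ y k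
    count-pivots s {k} k<n Q sound complete = trans (total-cong (b′ ∸ a′) (λ j j< → cong indicator (column (a′ + j) (ℕ.m≤m+n a′ j)
        (lia (a′ ∷ b′ ∷ j ∷ []) (λ a b j → j :< b :∸ a ⇒ a :+ j :< b) refl j<))))
      (trans (total-between (y k) (y (suc k) ⊓ X k) a′ (b′ ∸ a′) (a≤y k))
      (cong (_∸ y k) (ℕ.m≤n⇒m⊓n≡m (ℕ.≤-trans (ℕ.m⊓n≤m _ (X k)) (ℕ.≤-trans (y≤b (suc k)) (ℕ.m≤n+m∸n b′ a′))))))
      where
      column : ∀ c → a′ ≤ c → c < b′ → Q c ≡ between (y k) (y (suc k) ⊓ X k) c
      column c a′≤c c<b′ with Q c in eq
      ... | true = let (pk , ¬e) = sound c a′≤c c<b′ eq in sym (between-true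
              (ℕ.≮⇒≥ λ c<y → ℕ.<⇒≱ (ℕ.n<1+n k) (subst (_≤ k) pk (<y⇒p≤ a′≤c c<y)))
              (ℕ.⊓-glb (p≤⇒<y a′≤c c<b′ (ℕ.≤-reflexive pk))
                (ℕ.≰⇒> λ X≤c → let ((a≤c , _) , (e , _)) = between⇒equal s k<n X≤c (p≤⇒<y a′≤c c<b′ (ℕ.≤-reflexive pk)) in ¬e (a≤c , e))))
      ... | false = sym (between-false λ (y≤c , c<) → contra (trans (sym eq) (complete c a′≤c c<b′ (pk y≤c c<)
              λ (a≤c , e) → ℕ.<⇒≱ (ℕ.≤-trans c< (ℕ.m⊓n≤n _ _)) (proj₁ (equal⇒between s k<n a≤c c<b′ e (pk y≤c c<))))))
        where
        contra : false ≡ true → ⊥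
        contra ()
        pk : y k ≤ c → c < y (suc k) ⊓ X k → p c ≡ suc k
        pk y≤c c< = ℕ.≤-antisym (<y⇒p≤ a′≤c (ℕ.≤-trans c< (ℕ.m⊓n≤m _ _)))
          (ℕ.≰⇒> λ p≤k → ℕ.<⇒≱ (p≤⇒<y a′≤c c<b′ p≤k) y≤c)

  module _ {n : ℕ} {ρ : List (List ℕ)} (bs : Boxes n 1 ρ) (a b : ℕ) (len : a + length ρ ≡ b) where
    private
      index< : ∀ {c} → a ≤ c → c < b → c ∸ a < length ρ
      index< {c} h k = lia (a ∷ b ∷ c ∷ length ρ ∷ []) (λ a b c l → a :≤ c ⇒ c :< b ⇒ a :+ l :≡ b ⇒ c :∸ a :< l) refl h k len
      entry : ∀ {c} → a ≤ c → c < b → BoxView n (atD ρ (c ∸ a) [])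
      entry h k = boxView (s≤s z≤n) bs _ (index< h k)
      row = profileOf-Row bs a b len

    max≤n : ∀ c → a ≤ c → c < b → maxL (atD ρ (c ∸ a) []) ≤ n
    max≤n c h k with atD ρ (c ∸ a) [] | entry h k
    ... | .(_ ∷ _) | view _ q R rewrite maxL-box R = top≤n q R
      where
      top≤n : ∀ {m R} → m ≤ n → Strict n m R → top m R ≤ n
      top≤n q []            = q
      top≤n q ((_ , r) ∷ R) = top≤n r R

    ceiling : Ceiling n a b (λ c → maxL (atD ρ (c ∸ a) [])) (x (profileOf a ρ))
    ceiling = record
      { a≤X = λ k k<n → lia (count≤ k (mins ρ) ∷ occ (suc k) (nonPivots ρ) ∷ a ∷ [])
          (λ c o a → o :+ a :≤ a :+ c ⇒ a :≤ (a :+ c) :∸ o) refl (room row k k<n)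
      ; M≤⇒<X = λ {c} {k} _ h h′ M≤ → lia (count≤ k (mins ρ) ∷ occ (suc k) (nonPivots ρ) ∷ a ∷ c ∷ [])
          (λ m o a c → a :≤ c ⇒ c :∸ a :< m :∸ o ⇒ c :< (a :+ m) :∸ o) refl h (max≤⇒column< bs (index< h h′) M≤)
      ; M≡⇒X≤ = λ {c} {k} h h′ eq → lia (count≤ k (mins ρ) ∷ occ (suc k) (nonPivots ρ) ∷ a ∷ c ∷ [])
          (λ m o a c → a :≤ c ⇒ m :∸ o :≤ c :∸ a ⇒ (a :+ m) :∸ o :≤ c) refl h (column≥max bs (index< h h′) eq)
      ; X-last = ℕ.≤-reflexive (sym (cong₂ _∸_ (end row) (last row))) }

    floor : Floor n a b (λ c → minL (atD ρ (c ∸ a) [])) (y (profileOf a ρ))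
    floor = record
      { y≤b = λ k → ℕ.≤-trans (ℕ.+-monoʳ-≤ a (subst (count≤ k (mins ρ) ≤_) (List.length-map minL ρ) (count≤-length k (mins ρ))))
          (ℕ.≤-reflexive len)
      ; a≤y = λ k → ℕ.m≤m+n a _
      ; p≤⇒<y = λ {c} {k} h h′ p≤ → lia (count≤ k (mins ρ) ∷ a ∷ c ∷ [])
          (λ m a c → a :≤ c ⇒ c :∸ a :< m ⇒ c :< a :+ m) refl h
          (count≤-galois⁺ (mins-Weak bs) (c ∸ a) (subst (c ∸ a <_) (sym (List.length-map minL ρ)) (index< h h′))
            (subst (_≤ k) (sym (at-mins ρ (c ∸ a) (index< h h′))) p≤))
      ; <y⇒p≤ = λ {c} {k} h h′ → subst (_≤ k)
          (at-mins ρ (c ∸ a) (index′ h h′)) (count≤-galois⁻ (mins-Weak bs) (c ∸ a) (shifted h h′))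
      ; bounds = λ {c} h h′ → bound (entry h h′) }
      where
      shifted : ∀ {c k} → a ≤ c → c < a + count≤ k (mins ρ) → c ∸ a < count≤ k (mins ρ)
      shifted {c} {k} h h′ = lia (count≤ k (mins ρ) ∷ a ∷ c ∷ []) (λ m a c → a :≤ c ⇒ c :< a :+ m ⇒ c :∸ a :< m) refl h h′
      index′ : ∀ {c k} → a ≤ c → c < a + count≤ k (mins ρ) → c ∸ a < length ρ
      index′ {c} {k} h h′ = ℕ.≤-trans (shifted {c} {k} h h′) (subst (count≤ k (mins ρ) ≤_) (List.length-map minL ρ) (count≤-length k (mins ρ)))
      bound : ∀ {S} → BoxView n S → 1 ≤ minL S × minL S ≤ n
      bound (view p q R) rewrite minL-box R = p , q

  occ-++ : ∀ k xs ys → occ k (xs ++ ys) ≡ occ k xs + occ k ys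
  occ-++ k []       ys = refl
  occ-++ k (x ∷ xs) ys with k ≡ᵇ x
  ... | true  = cong suc (occ-++ k xs ys)
  ... | false = occ-++ k xs ys

  occ-replicate : ∀ j c → occ c (replicate j c) ≡ j
  occ-replicate zero    c = refl
  occ-replicate (suc j) c = trans (occ-≡ c (replicate j c)) (cong suc (occ-replicate j c))

  occ-replicate-≢ : ∀ j {c k} → k ≢ c → occ k (replicate j c) ≡ 0
  occ-replicate-≢ zero    h = refl
  occ-replicate-≢ (suc j) {c} h = trans (occ-≢ (replicate j c) h) (occ-replicate-≢ j h)

  occ-ascending-≥ : ∀ u n {k} → n ≤ k → occ (suc k) (ascending u n) ≡ 0
  occ-ascending-≥ u zero    h = refl
  occ-ascending-≥ u (suc n) {k} h = trans (occ-++ (suc k) (ascending u n) _) (cong₂ _+_ (occ-ascending-≥ u n (ℕ.<⇒≤ h))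
    (occ-replicate-≢ (u n) (λ e → ℕ.<⇒≢ h (sym (ℕ.suc-injective e)))))

  occ-ascending : ∀ u n {k} → k < n → occ (suc k) (ascending u n) ≡ u k
  occ-ascending u (suc n) {k} k< with k ≟ n
  ... | yes refl = trans (occ-++ (suc n) (ascending u n) _) (cong₂ _+_ (occ-ascending-≥ u n ℕ.≤-refl) (occ-replicate (u n) (suc n)))
  ... | no k≢n = trans (occ-++ (suc k) (ascending u n) _) (trans (cong₂ _+_ (occ-ascending u n (ℕ.≤∧≢⇒< (ℕ.≤-pred k<) k≢n))
    (occ-replicate-≢ (u n) (λ e → k≢n (ℕ.suc-injective e)))) (ℕ.+-identityʳ _))

  length-descending : ∀ u n → length (descending u n) ≡ total u n
  length-descending u n = trans (cong length (sym (reverse-ascending u n)))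
    (trans (List.length-reverse (ascending u n)) (length-ascending u n))

  descending-injective : ∀ {u v} n → descending u n ≡ descending v n → ∀ k → k < n → u k ≡ v k
  descending-injective {u} {v} n eq k k< = trans (sym (occ-ascending u n k<)) (trans
    (cong (occ (suc k)) (List.reverse-injective {x = ascending u n} {ascending v n} (trans (reverse-ascending u n) (trans eq (sym (reverse-ascending v n))))))
    (occ-ascending v n k<))

  ascending-injective : ∀ {u v} n → ascending u n ≡ ascending v n → ∀ k → k < n → u k ≡ v k
  ascending-injective {u} {v} n eq k k< = trans (sym (occ-ascending u n k<)) (trans (cong (occ (suc k)) eq) (occ-ascending v n k<))

  ++-split : ∀ {X : Set} (xs ys : List X) {zs ws} → length xs ≡ length ys → xs ++ zs ≡ ys ++ ws → xs ≡ ys × zs ≡ ws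
  ++-split []       []       _ eq = refl , eq
  ++-split (x ∷ xs) (y ∷ ys) l eq with List.∷-injective eq
  ... | p , q with ++-split xs ys (ℕ.suc-injective l) q
  ...   | r , s = cong₂ _∷_ p r , s

  -- Each step from `y k` to `y (k + 1)` splits into read pivots and equalities, and the steps
  -- telescope. Hence shape and `ceq` fix the number of pivots in the word of a row, so equal words
  -- split into equal rows.
  total-pivots : ∀ {X p} n → (∀ k → k < n → y p k ≤ y p (suc k)) → (∀ k → k < n → y p k ≤ X k) →
    (total (pivots X p) n + total (λ k → y p (suc k) ∸ X k) n) + y p 0 ≡ y p n
  total-pivots zero mono under = refl
  total-pivots {X} {p} (suc n) mono under = lia
    (total (pivots X p) n ∷ total (λ k → y p (suc k) ∸ X k) n ∷ y p 0 ∷ y p n ∷ y p (suc n) ∷ X n ∷ [])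
    (λ P E y₀ y y′ X → (P :+ E) :+ y₀ :≡ y ⇒ y :≤ y′ ⇒ y :≤ X ⇒
      ((P :+ ((y′ :⊓ X) :∸ y)) :+ (E :+ (y′ :∸ X))) :+ y₀ :≡ y′) refl
    (total-pivots {X} {p} n (λ k k< → mono k (ℕ.m≤n⇒m≤1+n k<)) (λ k k< → under k (ℕ.m≤n⇒m≤1+n k<)))
    (mono n ℕ.≤-refl) (under n ℕ.≤-refl)

  -- Agreement on the letters up to `n` only; as functions on ℕ the profiles need not coincide.
  _≈[_]_ : Profile → ℕ → Profile → Set
  p ≈[ n ] q = (∀ k → k ≤ n → y p k ≡ y q k) × (∀ k → k < n → ε p (suc k) ≡ ε q (suc k))

  data Similar (n : ℕ) : List Profile → List Profile → Set where
    []  : Similar n [] []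
    _∷_ : ∀ {p q ps qs} → p ≈[ n ] q → Similar n ps qs → Similar n (p ∷ ps) (q ∷ qs)

  module _ (n c : ℕ) where

    private
      lengths : ∀ {a b t g X p} → Row n a b t p → Below n g X p →
        length (ascending (pivots X p) n) ≡ (b ∸ a) ∸ g
      lengths {a} {b} {t} {g} {X} {p} r bl = trans (length-ascending (pivots X p) n) (lia
        (total (pivots X p) n ∷ total (λ k → y p (suc k) ∸ X k) n ∷ y p 0 ∷ y p n ∷ a ∷ b ∷ g ∷ [])
        (λ P E y₀ y a b g → (P :+ E) :+ y₀ :≡ y ⇒ y₀ :≡ a ⇒ y :≡ b ⇒ E :≡ g ⇒ P :≡ (b :∸ a) :∸ g) refl
        (total-pivots {X} {p} n (mono r) (λ k k< → under bl k (ℕ.<⇒≤ k<))) (start r) (end r) (equality bl))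

    thresholds-similar : ∀ {ps qs} → Similar n ps qs → ∀ {k} → k < n → thresholds n c ps k ≡ thresholds n c qs k
    thresholds-similar [] _ = refl
    thresholds-similar ((h , h′) ∷ _) {k} k< = cong₂ _∸_ (h k (ℕ.<⇒≤ k<)) (h′ k k<)

    stackWord-similar : ∀ {ps qs} → Similar n ps qs → stackWord n c ps ≡ stackWord n c qs
    stackWord-similar [] = refl
    stackWord-similar ((h , h′) ∷ sim) = cong₂ _++_ (cong₂ _++_ (descending-cong n h′)
      (ascending-cong n λ k k< → cong₂ _∸_ (cong₂ _⊓_ (h (suc k) k<) (thresholds-similar sim k<)) (h k (ℕ.<⇒≤ k<))))
      (stackWord-similar sim)

    -- Reading from the largest letter downwards, each threshold of a row is determined by the next one.
    reading-injective : ∀ {ss ps qs} → Valid n c ss ps → Valid n c ss qs → stackWord n c ps ≡ stackWord n c qs → Similar n ps qs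
    reading-injective [] [] eq = []
    reading-injective {shape a b t g ∷ ss} {p ∷ ps} {q ∷ qs} ((r , bl) ∷ v) ((r′ , bl′) ∷ v′) eq
      with ++-split (wordBelow n (thresholds n c ps) p) (wordBelow n (thresholds n c qs) q) lengthEq eq
      where
      lengthEq : length (wordBelow n (thresholds n c ps) p) ≡ length (wordBelow n (thresholds n c qs) q)
      lengthEq = trans (List.length-++ (descending _ n)) (trans
        (cong₂ _+_ (trans (length-descending _ n) (trans (size r) (sym (trans (length-descending _ n) (size r′)))))
                   (trans (lengths r bl) (sym (lengths r′ bl′))))
        (sym (List.length-++ (descending _ n))))
    ... | rowEq , restEq with reading-injective v v′ restEq
                            | ++-split (descending (λ k → ε p (suc k)) n) (descending (λ k → ε q (suc k)) n)
                                (trans (length-descending _ n) (trans (size r) (sym (trans (length-descending _ n) (size r′))))) rowEq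
    ...   | sim | epsEq , pivEq = ((λ k k≤ → down (n ∸ k) k (ℕ.m+[n∸m]≡n k≤)) , descending-injective n epsEq) ∷ sim
      where
      down : ∀ d k → k + d ≡ n → y p k ≡ y q k
      down zero    k e = trans (cong (y p) k≡n) (trans (end r) (trans (sym (end r′)) (cong (y q) (sym k≡n))))
        where k≡n = trans (sym (ℕ.+-identityʳ k)) e
      down (suc d) k e = lia (y p k ∷ y p (suc k) ∷ thresholds n c ps k ∷ y q k ∷ thresholds n c qs k ∷
            pivots (thresholds n c ps) p k ∷ y q (suc k) ∷ [])
          (λ y y₁ X y′ X′ u y₁′ → y₁ :≡ y₁′ ⇒ X :≡ X′ ⇒ u :≡ (y₁ :⊓ X) :∸ y ⇒ u :≡ (y₁′ :⊓ X′) :∸ y′ ⇒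
            y :≤ y₁ ⇒ y :≤ X ⇒ y′ :≤ y₁′ ⇒ y′ :≤ X′ ⇒ y :≡ y′) refl
          (down d (suc k) (trans (sym (ℕ.+-suc k d)) e)) (thresholds-similar sim k<n) refl
          (ascending-injective n pivEq k k<n)
          (mono r k k<n) (under bl k (ℕ.<⇒≤ k<n)) (mono r′ k k<n) (under bl′ k (ℕ.<⇒≤ k<n))
        where k<n = lia (k ∷ d ∷ n ∷ []) (λ k d n → k :+ (# 1 :+ d) :≡ n ⇒ k :< n) refl e

  -- Successive differences of `y` give the multiplicities of the minima, the bits give the
  -- non-pivots, and `distribute` rebuilds the row from these two lists.
  profileOf-injective : ∀ {n a ρ ρ′} → Boxes n 1 ρ → Boxes n 1 ρ′ → profileOf a ρ ≈[ n ] profileOf a ρ′ → ρ ≡ ρ′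
  profileOf-injective {n} {a} {ρ} {ρ′} bs bs′ (hy , hε) = trans (distribute-unique bs)
    (trans (cong₂ distribute pivotsEq nonPivotsEq) (sym (distribute-unique bs′)))
    where
    pivotsEq : mins ρ ≡ mins ρ′
    pivotsEq = trans (ascending-occ (s≤s z≤n) (mins-Weak bs)) (trans (ascending-cong n λ k k<n →
        ℕ.+-cancelˡ-≡ (count≤ k (mins ρ)) _ _ (trans (sym (count≤-suc k (mins ρ))) (trans (ℕ.+-cancelˡ-≡ a _ _ (hy (suc k) k<n))
          (trans (count≤-suc k (mins ρ′)) (cong (_+ occ (suc k) (mins ρ′)) (sym (ℕ.+-cancelˡ-≡ a _ _ (hy k (ℕ.<⇒≤ k<n)))))))))
      (sym (ascending-occ (s≤s z≤n) (mins-Weak bs′))))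
    nonPivotsEq : nonPivots ρ ≡ nonPivots ρ′
    nonPivotsEq = trans (ascending-occ (s≤s z≤n) (Strict⇒Weak (nonPivots-Strict bs))) (trans (ascending-cong n hε)
      (sym (ascending-occ (s≤s z≤n) (Strict⇒Weak (nonPivots-Strict bs′)))))

  Weak-replicate : ∀ j {c s} → s ≤ c → Weak c s (replicate j c)
  Weak-replicate zero    h = []
  Weak-replicate (suc j) h = (h , ℕ.≤-refl) ∷ Weak-replicate j ℕ.≤-refl

  Weak-snoc : ∀ {m c s xs} j → m ≤ c → s ≤ c → Weak m s xs → Weak c s (xs ++ replicate j c)
  Weak-snoc j h k [] = Weak-replicate j k
  Weak-snoc j h k ((p , q) ∷ w) = (p , ℕ.≤-trans q h) ∷ Weak-snoc j h (ℕ.≤-trans q h) w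

  ascending-Weak : ∀ u n → Weak n 1 (ascending u n)
  ascending-Weak u zero    = []
  ascending-Weak u (suc n) = Weak-snoc (u n) (ℕ.n≤1+n n) (s≤s z≤n) (ascending-Weak u n)

  Strict-snoc : ∀ {m c s xs} j → j ≤ 1 → m < c → s < c → Strict m s xs → Strict c s (xs ++ replicate j c)
  Strict-snoc zero       _ h k [] = []
  Strict-snoc (suc zero) _ h k [] = (k , ℕ.≤-refl) ∷ []
  Strict-snoc (suc (suc _)) (s≤s ()) h k []
  Strict-snoc j b h k ((p , q) ∷ w) = (p , ℕ.<⇒≤ (ℕ.≤-trans (s≤s q) h)) ∷ Strict-snoc j b h (ℕ.≤-trans (s≤s q) h) w

  ascending-Strict : ∀ {u} n → (∀ k → u k ≤ 1) → Strict n 0 (ascending u n)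
  ascending-Strict zero    h = []
  ascending-Strict {u} (suc n) h = Strict-snoc (u n) (h n) ℕ.≤-refl (s≤s z≤n) (ascending-Strict n h)

  record Realises (n a b : ℕ) (p : Profile) : Set where
    constructor realises
    field
      ρ       : List (List ℕ)
      boxes-ρ : Boxes n 1 ρ
      length-ρ : length ρ ≡ b ∸ a
      similar : profileOf a ρ ≈[ n ] p

  -- The minima get the multiplicities `y (k + 1) ∸ y k`, and `room` ensures that every non-pivot
  -- finds a box; in particular an empty row has none.
  realise : ∀ {n a b t p} → Row n a b t p → Realises n a b p
  realise {n} {a} {b} {t} {p} r = go pv N refl refl (ascending-Weak _ n) (ascending-Strict n λ k → bit r (suc k))
    where
    pv N : List ℕ
    pv = ascending (λ k → y p (suc k) ∸ y p k) n
    N  = ascending (λ k → ε p (suc k)) n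
    counts : ∀ k → k ≤ n → a + count≤ k pv ≡ y p k
    counts zero _ = trans (cong (a +_) (count≤-none (s≤s z≤n) (ascending-Weak _ n))) (trans (ℕ.+-identityʳ a) (sym (start r)))
    counts (suc k) k< = lia (a ∷ count≤ k pv ∷ count≤ (suc k) pv ∷ occ (suc k) pv ∷ y p k ∷ y p (suc k) ∷ [])
      (λ a m m′ o y y′ → a :+ m :≡ y ⇒ m′ :≡ m :+ o ⇒ o :≡ y′ :∸ y ⇒ y :≤ y′ ⇒ a :+ m′ :≡ y′) refl
      (counts k (ℕ.<⇒≤ k<)) (count≤-suc k pv) (occ-ascending _ n k<) (mono r k k<)
    length-pv : length pv ≡ b ∸ a
    length-pv = lia (a ∷ b ∷ length pv ∷ count≤ n pv ∷ y p n ∷ []) (λ a b l m y → m :≡ l ⇒ a :+ m :≡ y ⇒ y :≡ b ⇒ l :≡ b :∸ a) refl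
      (count≤-all (ascending-Weak _ n)) (counts n ℕ.≤-refl) (end r)
    occupied : ∀ {k} → k < n → 1 ≤ occ (suc k) N → 1 ≤ count≤ k pv
    occupied {k} k< h = lia (a ∷ count≤ k pv ∷ y p k ∷ ε p (suc k) ∷ occ (suc k) N ∷ [])
      (λ a m y e o → o :≡ e ⇒ # 1 :≤ o ⇒ e :+ a :≤ y ⇒ a :+ m :≡ y ⇒ # 1 :≤ m) refl
      (occ-ascending _ n k<) h (room r k k<) (counts k (ℕ.<⇒≤ k<))
    finish : ∀ {ρ} → Boxes n 1 ρ → mins ρ ≡ pv → nonPivots ρ ≡ N → Realises n a b p
    finish {ρ} bs m≡ n≡ = realises ρ bs (trans (sym (List.length-map minL ρ)) (trans (cong length m≡) length-pv))
      ((λ k k≤ → trans (cong (λ z → a + count≤ k z) m≡) (counts k k≤)) ,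
       (λ k k< → trans (cong (occ (suc k)) n≡) (occ-ascending _ n k<)))
    -- The computed lists are replaced by variables with equations, so that they can be matched on.
    go : ∀ pv′ N′ → pv′ ≡ pv → N′ ≡ N → Weak n 1 pv → Strict n 0 N → Realises n a b p
    go pv′ N′ e e′ W St = go′ pv′ N′ e e′ (subst (Weak n 1) (sym e) W) (subst (Strict n 0) (sym e′) St)
      where
      go′ : ∀ pv′ N′ → pv′ ≡ pv → N′ ≡ N → Weak n 1 pv′ → Strict n 0 N′ → Realises n a b p
      go′ [] [] e e′ _ _ = finish [] e e′
      go′ [] (zero ∷ N′) e e′ _ ((() , _) ∷ _)
      go′ [] (suc k ∷ N′) e e′ _ ((_ , k<) ∷ _) = ⊥-elim (ℕ.n≮0 (subst (λ z → 0 < count≤ k z) (sym e)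
        (occupied k< (subst (λ z → 1 ≤ occ (suc k) z) e′ (∈-occ {suc k} {suc k ∷ N′} (here refl))))))
      go′ (m ∷ pv′) N′ e e′ w St = finish (boxes D) (trans (mins≡ D) e) (trans (nonPivots≡ D) e′)
        where
        raiseStart : ∀ N′ → N′ ≡ N → Strict n 0 N′ → Strict n m N′
        raiseStart [] _ [] = []
        raiseStart (zero ∷ N′) _ ((() , _) ∷ _)
        raiseStart (suc k ∷ N′) e′ ((_ , k<) ∷ St) = (s≤s (count≤-galois⁻ w 0 (subst (λ z → 0 < count≤ k z) (sym e)
          (occupied k< (subst (λ z → 1 ≤ occ (suc k) z) e′ (∈-occ {suc k} {suc k ∷ N′} (here refl)))))) , k<) ∷ St
        D : Distributed n 1 (m ∷ pv′) N′ (distribute (m ∷ pv′) N′)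
        D = distribute-correct w (raiseStart N′ e′ St)

-- The enumerations list exactly the intended objects, without repetitions.

module Lists where
  open import Defs
  open Counting using (∈-filterB⁻; ∈-filterB⁺; Unique-filterB)
  open Words
  open Rows using (Strict; []; _∷_; BoxView; view)
  open import Data.Nat using (ℕ; zero; suc; _+_; _∸_; _≤_; _<_; z≤n; s≤s; _≟_; _≡ᵇ_; _≤ᵇ_; _<ᵇ_)
  import Data.Nat.Properties as ℕ
  open import Data.Bool using (Bool; true; false; _∧_; _∨_; not; T)
  open import Data.List using (List; []; _∷_; map; concatMap; length; applyUpTo)
  import Data.List.Properties as List
  open import Data.List.Membership.Propositional using (_∈_)
  open import Data.List.Membership.Propositional.Properties using (∈-++⁺ˡ; ∈-++⁺ʳ; ∈-++⁻; ∈-map⁺; ∈-map⁻; ∈-concatMap⁺; ∈-upTo⁺; ∈-upTo⁻)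
  open import Data.List.Relation.Unary.Any as Any using (Any; here; there)
  open import Data.List.Relation.Unary.All as All using (All; []; _∷_)
  open import Data.List.Relation.Unary.AllPairs using ([]; _∷_)
  open import Data.List.Relation.Unary.Unique.Propositional using (Unique)
  import Data.List.Relation.Unary.Unique.Propositional.Properties as Unique
  open import Data.Vec as Vec using (Vec; []; _∷_; toList; tabulate)
  import Data.Vec.Properties as Vec
  open import Data.Fin using (toℕ)
  open import Data.Product using (∃; _×_; _,_; proj₁; proj₂)
  open import Data.Sum using (inj₁; inj₂)
  open import Data.Empty using (⊥-elim)
  open import Data.Unit using (tt)
  open import Function using (_∘_)
  open import Relation.Nullary using (yes; no)
  open import Relation.Binary.PropositionalEquality

  private variable
    X Y Z : Set

  bool-≡ : ∀ {x y} → (x ≡ true → y ≡ true) → (y ≡ true → x ≡ true) → x ≡ y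
  bool-≡ {true}  {y}     f g = sym (f refl)
  bool-≡ {false} {false} f g = refl
  bool-≡ {false} {true}  f g = g refl

  ∧-split : ∀ {x y} → x ∧ y ≡ true → x ≡ true × y ≡ true
  ∧-split {true} {true} h = refl , refl

  ∧-join : ∀ {x y} → x ≡ true → y ≡ true → x ∧ y ≡ true
  ∧-join refl refl = refl

  implies⁻ : ∀ {x y} → not x ∨ y ≡ true → x ≡ true → y ≡ true
  implies⁻ h refl = h

  implies⁺ : ∀ {x y} → (x ≡ true → y ≡ true) → not x ∨ y ≡ true
  implies⁺ {true}  h = h refl
  implies⁺ {false} h = refl

  ≤ᵇ⁻ : ∀ {m k} → (m ≤ᵇ k) ≡ true → m ≤ k
  ≤ᵇ⁻ {m} {k} h = ℕ.≤ᵇ⇒≤ m k (subst T (sym h) tt)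

  <ᵇ⁻ : ∀ {m k} → (m <ᵇ k) ≡ true → m < k
  <ᵇ⁻ {m} {k} h = ℕ.<ᵇ⇒< m k (subst T (sym h) tt)

  ≡ᵇ⁻ : ∀ {m k} → (m ≡ᵇ k) ≡ true → m ≡ k
  ≡ᵇ⁻ {m} {k} h = ℕ.≡ᵇ⇒≡ m k (subst T (sym h) tt)

  ≡ᵇ⁺ : ∀ {m k} → m ≡ k → (m ≡ᵇ k) ≡ true
  ≡ᵇ⁺ {m} refl = ≡ᵇ-refl m

  allB⁻ : ∀ (p : X → Bool) {xs} → allB p xs ≡ true → ∀ {x} → x ∈ xs → p x ≡ true
  allB⁻ p h (here refl) = proj₁ (∧-split h)
  allB⁻ p {x ∷ xs} h (there m) = allB⁻ p (proj₂ (∧-split {p x} h)) m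

  allB⁺ : ∀ (p : X → Bool) xs → (∀ {x} → x ∈ xs → p x ≡ true) → allB p xs ≡ true
  allB⁺ p []       h = refl
  allB⁺ p (x ∷ xs) h = ∧-join (h (here refl)) (allB⁺ p xs (h ∘ there))

  anyB⁻ : ∀ (p : X → Bool) xs → anyB p xs ≡ true → ∃ λ x → x ∈ xs × p x ≡ true
  anyB⁻ p (x ∷ xs) h with p x in eq
  ... | true  = x , here refl , eq
  ... | false with anyB⁻ p xs h
  ...   | y , y∈ , py = y , there y∈ , py

  anyB⁺ : ∀ (p : X → Bool) {xs x} → x ∈ xs → p x ≡ true → anyB p xs ≡ true
  anyB⁺ p (here refl) h rewrite h = refl
  anyB⁺ p {y ∷ xs} (there m) h with p y
  ... | true  = refl
  ... | false = anyB⁺ p m h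

  at-beyond : ∀ {A : Set} (xs : List A) d {i} → length xs ≤ i → atD xs i d ≡ d
  at-beyond []       d h = refl
  at-beyond (x ∷ xs) d {suc i} (s≤s h) = at-beyond xs d h

  atD-∈ : ∀ {A : Set} (xs : List A) d {i} → i < length xs → atD xs i d ∈ xs
  atD-∈ (x ∷ xs) d {zero}  h       = here refl
  atD-∈ (x ∷ xs) d {suc i} (s≤s h) = there (atD-∈ xs d h)

  atD-ext : ∀ {A : Set} (xs ys : List A) d → length xs ≡ length ys → (∀ i → i < length xs → atD xs i d ≡ atD ys i d) → xs ≡ ys
  atD-ext []       []       d l h = refl
  atD-ext (x ∷ xs) (y ∷ ys) d l h = cong₂ _∷_ (h 0 (s≤s z≤n)) (atD-ext xs ys d (ℕ.suc-injective l) λ i i< → h (suc i) (s≤s i<))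

  tabulate-at⁻ : ∀ {N} (g : ℕ → ℕ) (θ : Vec ℕ N) → eqVecᵇ (tabulate (g ∘ toℕ)) θ ≡ true → ∀ r → r < N → g r ≡ at (toList θ) r
  tabulate-at⁻ g (t ∷ θ) h zero    r<       = ≡ᵇ⁻ (proj₁ (∧-split h))
  tabulate-at⁻ g (t ∷ θ) h (suc r) (s≤s r<) = tabulate-at⁻ (g ∘ suc) θ (proj₂ (∧-split {g 0 ≡ᵇ t} h)) r r<

  tabulate-at⁺ : ∀ {N} (g : ℕ → ℕ) (θ : Vec ℕ N) → (∀ r → r < N → g r ≡ at (toList θ) r) → eqVecᵇ (tabulate (g ∘ toℕ)) θ ≡ true
  tabulate-at⁺ g []      h = refl
  tabulate-at⁺ g (t ∷ θ) h = ∧-join (≡ᵇ⁺ (h 0 (s≤s z≤n))) (tabulate-at⁺ (g ∘ suc) θ λ r r< → h (suc r) (s≤s r<))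

  -- Lists, vectors and products are all enumerated by a `concatMap` of this shape with `f` a
  -- constructor, so this fact and the two after it serve all three.
  ∈-prepend⁺ : ∀ (f : X → Y → Z) {xs ys x y} → x ∈ xs → y ∈ ys → f x y ∈ concatMap (λ x → map (f x) ys) xs
  ∈-prepend⁺ f {ys = ys} x∈ y∈ = ∈-concatMap⁺ (λ x → map (f x) ys) (Any.map (λ { refl → ∈-map⁺ (f _) y∈ }) x∈)

  ∈-prepend⁻ : ∀ (f : X → Y → Z) xs ys {z} → z ∈ concatMap (λ x → map (f x) ys) xs → ∃ λ x → ∃ λ y → x ∈ xs × y ∈ ys × z ≡ f x y
  ∈-prepend⁻ f (x ∷ xs) ys h with ∈-++⁻ (map (f x) ys) h
  ... | inj₁ h′ = let (y , y∈ , eq) = ∈-map⁻ (f x) h′ in x , y , here refl , y∈ , eq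
  ... | inj₂ h′ = let (x′ , y , x∈ , y∈ , eq) = ∈-prepend⁻ f xs ys h′ in x′ , y , there x∈ , y∈ , eq

  Unique-prepend : ∀ (f : X → Y → Z) → (∀ {x x′ y y′} → f x y ≡ f x′ y′ → x ≡ x′ × y ≡ y′) →
    ∀ {xs ys} → Unique xs → Unique ys → Unique (concatMap (λ x → map (f x) ys) xs)
  Unique-prepend f inj [] uy = []
  Unique-prepend f inj {x ∷ xs} {ys} (p ∷ ux) uy = Unique.++⁺ (Unique.map⁺ (λ e → proj₂ (inj e)) uy) (Unique-prepend f inj ux uy)
    λ (h , h′) → let (y , _ , eq) = ∈-map⁻ (f x) h
                     (x′ , y′ , x′∈ , _ , eq′) = ∈-prepend⁻ f xs ys h′
                 in All.lookup p x′∈ (proj₁ (inj (trans (sym eq) eq′)))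

  ∈-allLists⁺ : ∀ {xs : List X} (l : List X) → (∀ {x} → x ∈ l → x ∈ xs) → l ∈ allLists xs (length l)
  ∈-allLists⁺ []      h = here refl
  ∈-allLists⁺ (x ∷ l) h = ∈-prepend⁺ _∷_ (h (here refl)) (∈-allLists⁺ l (h ∘ there))

  ∈-allLists⁻ : ∀ {xs : List X} k {l} → l ∈ allLists xs k → length l ≡ k × (∀ {x} → x ∈ l → x ∈ xs)
  ∈-allLists⁻ zero (here refl) = refl , λ ()
  ∈-allLists⁻ {xs = xs} (suc k) h with ∈-prepend⁻ _∷_ xs (allLists xs k) h
  ... | x , l , x∈ , l∈ , refl = cong suc (proj₁ (∈-allLists⁻ k l∈)) ,
    λ { (here refl) → x∈ ; (there m) → proj₂ (∈-allLists⁻ k l∈) m }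

  Unique-allLists : ∀ {xs : List X} → Unique xs → ∀ k → Unique (allLists xs k)
  Unique-allLists u zero    = [] ∷ []
  Unique-allLists u (suc k) = Unique-prepend _∷_ (λ e → List.∷-injective e) u (Unique-allLists u k)

  ∈-allVecs⁺ : ∀ {xs : List X} {k} (v : Vec X k) → (∀ {i} → i < k → ∀ d → atD (toList v) i d ∈ xs) → v ∈ allVecs xs k
  ∈-allVecs⁺ []      h = here refl
  ∈-allVecs⁺ (x ∷ v) h = ∈-prepend⁺ Vec._∷_ (h {0} (s≤s z≤n) x) (∈-allVecs⁺ v λ {i} i< d → h {suc i} (s≤s i<) d)

  ∈-allVecs⁻ : ∀ {xs : List X} {k} (v : Vec X k) → v ∈ allVecs xs k → ∀ {x} → x ∈ toList v → x ∈ xs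
  ∈-allVecs⁻ {xs = xs} {suc k} (y ∷ v) h m with ∈-prepend⁻ Vec._∷_ xs (allVecs xs k) h
  ∈-allVecs⁻ (y ∷ v) h (here refl) | x , l , x∈ , l∈ , refl = x∈
  ∈-allVecs⁻ (y ∷ v) h (there m)   | x , l , x∈ , l∈ , refl = ∈-allVecs⁻ v l∈ m

  Unique-allVecs : ∀ {xs : List X} → Unique xs → ∀ k → Unique (allVecs xs k)
  Unique-allVecs u zero    = [] ∷ []
  Unique-allVecs u (suc k) = Unique-prepend Vec._∷_ (λ e → Vec.∷-injective e) u (Unique-allVecs u k)

  ∈-cartesian⁺ : ∀ (F : ℕ → List X) g N l d → length l ≡ N → (∀ r → r < N → atD l r d ∈ F (g r)) → l ∈ cartesian (map F (applyUpTo g N))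
  ∈-cartesian⁺ F g zero    []      d len h = here refl
  ∈-cartesian⁺ F g (suc N) (x ∷ l) d len h = ∈-prepend⁺ _∷_ (h 0 (s≤s z≤n))
    (∈-cartesian⁺ F (g ∘ suc) N l d (ℕ.suc-injective len) λ r r< → h (suc r) (s≤s r<))

  ∈-cartesian⁻ : ∀ (F : ℕ → List X) g N {l} d → l ∈ cartesian (map F (applyUpTo g N)) → length l ≡ N × (∀ r → r < N → atD l r d ∈ F (g r))
  ∈-cartesian⁻ F g zero d (here refl) = refl , λ _ ()
  ∈-cartesian⁻ F g (suc N) d h with ∈-prepend⁻ _∷_ (F (g 0)) (cartesian (map F (applyUpTo (g ∘ suc) N))) h
  ... | x , l , x∈ , l∈ , refl = cong suc (proj₁ (∈-cartesian⁻ F (g ∘ suc) N d l∈)) ,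
    λ { zero _ → x∈ ; (suc r) (s≤s r<) → proj₂ (∈-cartesian⁻ F (g ∘ suc) N d l∈) r r< }

  Unique-cartesian : ∀ {A : Set} {xss : List (List A)} → All Unique xss → Unique (cartesian xss)
  Unique-cartesian []       = [] ∷ []
  Unique-cartesian (u ∷ us) = Unique-prepend _∷_ (λ e → List.∷-injective e) u (Unique-cartesian us)

  ∈-sublists⁻ : ∀ (xs : List X) {S} → S ∈ sublists xs → ∀ {x} → x ∈ S → x ∈ xs
  ∈-sublists⁻ [] (here refl) ()
  ∈-sublists⁻ (y ∷ xs) h m with ∈-++⁻ (map (y ∷_) (sublists xs)) h
  ... | inj₂ h′ = there (∈-sublists⁻ xs h′ m)
  ... | inj₁ h′ with ∈-map⁻ (y ∷_) h′
  ∈-sublists⁻ (y ∷ xs) h (here refl) | inj₁ h′ | S , S∈ , refl = here refl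
  ∈-sublists⁻ (y ∷ xs) h (there m)   | inj₁ h′ | S , S∈ , refl = there (∈-sublists⁻ xs S∈ m)

  Unique-sublists : ∀ {xs : List X} → Unique xs → Unique (sublists xs)
  Unique-sublists [] = [] ∷ []
  Unique-sublists {xs = x ∷ xs} (p ∷ u) = Unique.++⁺ (Unique.map⁺ (λ e → proj₂ (List.∷-injective e)) (Unique-sublists u)) (Unique-sublists u)
    λ (h , h′) → let (S , _ , eq) = ∈-map⁻ (x ∷_) h in
      All.lookup p (∈-sublists⁻ xs h′ (subst (x ∈_) (sym eq) (here refl))) refl

  -- The letters of `range1` with a variable start, as needed for induction over sublists.
  from : ℕ → ℕ → List ℕ
  from s zero    = []
  from s (suc n) = s ∷ from (suc s) n

  range1-from : ∀ n → range1 n ≡ from 1 n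
  range1-from n = trans (List.map-applyUpTo (λ j → j) suc n) (go suc 1 n λ _ → refl)
    where
    go : ∀ (g : ℕ → ℕ) s n → (∀ j → g j ≡ s + j) → applyUpTo g n ≡ from s n
    go g s zero    h = refl
    go g s (suc n) h = cong₂ _∷_ (trans (h 0) (ℕ.+-identityʳ s)) (go (g ∘ suc) (suc s) n λ j → trans (h (suc j)) (ℕ.+-suc s j))

  range1-∈⁺ : ∀ {n k} → 1 ≤ k → k ≤ n → k ∈ range1 n
  range1-∈⁺ {k = suc k} (s≤s _) h = ∈-map⁺ suc (∈-upTo⁺ h)

  range1-∈⁻ : ∀ {n k} → k ∈ range1 n → 1 ≤ k × k ≤ n
  range1-∈⁻ h with ∈-map⁻ suc h
  ... | j , j∈ , refl = s≤s z≤n , ∈-upTo⁻ j∈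

  Unique-range1 : ∀ n → Unique (range1 n)
  Unique-range1 n = Unique.map⁺ ℕ.suc-injective (Unique.upTo⁺ n)

  sublists-[] : ∀ (xs : List X) → [] ∈ sublists xs
  sublists-[] []       = here refl
  sublists-[] (x ∷ xs) = ∈-++⁺ʳ (map (x ∷_) (sublists xs)) (sublists-[] xs)

  -- For positive `n`, the bound `n + s ∸ 1` is the last letter of `from s n`.
  sublists-Strict⁻ : ∀ s n {S m} → m < s → S ∈ sublists (from s n) → Strict (n + s ∸ 1) m S
  sublists-Strict⁻ s zero    h (here refl) = []
  sublists-Strict⁻ s (suc n) {S} {m} h h′ with ∈-++⁻ (map (s ∷_) (sublists (from (suc s) n))) h′
  ... | inj₂ k = subst (λ z → Strict z m S) (cong (_∸ 1) (ℕ.+-suc n s)) (sublists-Strict⁻ (suc s) n (ℕ.m≤n⇒m≤1+n h) k)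
  ... | inj₁ k with ∈-map⁻ (s ∷_) k
  ...   | S′ , S∈ , refl = (h , ℕ.m≤n+m s n) ∷ subst (λ z → Strict z s S′) (cong (_∸ 1) (ℕ.+-suc n s)) (sublists-Strict⁻ (suc s) n ℕ.≤-refl S∈)

  Strict-sublists⁺ : ∀ s n {S m N} → s ≤ suc m → N < n + s → Strict N m S → S ∈ sublists (from s n)
  Strict-sublists⁺ s n h hN [] = sublists-[] (from s n)
  Strict-sublists⁺ s zero h hN ((p , q) ∷ St) = ⊥-elim (ℕ.<⇒≱ hN (ℕ.≤-trans h (ℕ.≤-trans p q)))
  Strict-sublists⁺ s (suc n) {N = N} h hN (_∷_ {x = x} (p , q) St) with s ≟ x
  ... | yes refl = ∈-++⁺ˡ (∈-map⁺ (s ∷_) (Strict-sublists⁺ (suc s) n ℕ.≤-refl (subst (N <_) (sym (ℕ.+-suc n s)) hN) St))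
  ... | no s≢x = ∈-++⁺ʳ _ (Strict-sublists⁺ (suc s) n {m = x ∸ 1} (ℕ.≤-trans (ℕ.≤∧≢⇒< (ℕ.≤-trans h p) s≢x) (ℕ.m≤n+m∸n x 1))
      (subst (N <_) (sym (ℕ.+-suc n s)) hN) ((pred< p , q) ∷ St))
    where
    pred< : ∀ {m x} → m < x → x ∸ 1 < x
    pred< (s≤s _) = ℕ.≤-refl

  module _ (n : ℕ) (la mu : List ℕ) where

    ∈-subsetsN⁻ : ∀ {S} → S ∈ subsetsN n la mu → BoxView n S
    ∈-subsetsN⁻ {S} h with ∈-filterB⁻ _ {sublists (range1 n)} h
    ∈-subsetsN⁻ {m ∷ R} h | S∈ , _ with sublists-Strict⁻ 1 n {m = 0} (s≤s z≤n) (subst (λ z → (m ∷ R) ∈ sublists z) (range1-from n) S∈)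
    ... | _∷_ (p , q) St rewrite ℕ.m+n∸n≡m n 1 = view p q St

    ∈-subsetsN⁺ : ∀ {S} → BoxView n S → S ∈ subsetsN n la mu
    ∈-subsetsN⁺ {S} (view p q St) = ∈-filterB⁺ _ {sublists (range1 n)} (subst (λ z → S ∈ sublists z) (sym (range1-from n))
      (Strict-sublists⁺ 1 n {m = 0} (s≤s z≤n) (subst (n <_) (ℕ.+-comm 1 n) ℕ.≤-refl) ((p , q) ∷ St))) refl

    Unique-fillings : Unique (fillings n la mu)
    Unique-fillings = Unique-cartesian (go (rowsR n la mu))
      where
      go : ∀ rs → All Unique (map (λ r → allLists (subsetsN n la mu) (at la r ∸ at mu r)) rs)
      go []       = []
      go (r ∷ rs) = Unique-allLists (Unique-filterB _ (Unique-sublists (Unique-range1 n))) (at la r ∸ at mu r) ∷ go rs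

-- Fillings with given `ceq` and `ex` as valid stacks of profiles.

module Fillings where
  open import Defs hiding (rowWord)
  open LIA using (lia; _:≤_; _:<_; _:≡_; _⇒_; #_; _:+_; _:∸_)
  open Counting
  open Words hiding (lo; hi)
  open Crystal
  open RowWords
  open Profiles
  open Closure using (lower; raise; outcome)
  open Rows hiding (module Distributed; boxes; mins≡; nonPivots≡)
  open Reading
  open Lists
  open import Data.Nat using (ℕ; zero; suc; _+_; _∸_; _≤_; _<_; z≤n; s≤s; _≟_; _≤?_; _<?_; _≡ᵇ_)
  import Data.Nat.Properties as ℕ
  open import Data.Nat.ListAction using (sum)
  open import Data.Bool using (Bool; true; false; _∧_; _∨_; not; if_then_else_)
  open import Data.List using (List; []; _∷_; _++_; map; concatMap; length; drop; reverse; upTo; applyUpTo; downFrom)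
  import Data.List.Properties as List
  open import Data.List.Membership.Propositional using (_∈_)
  open import Data.List.Membership.Propositional.Properties using (∈-map⁺; ∈-map⁻; ∈-upTo⁺; ∈-upTo⁻)
  open import Data.List.Relation.Unary.Any using (here; there)
  open import Data.List.Relation.Unary.All as All using (All; []; _∷_)
  import Data.List.Relation.Unary.All.Properties as All
  open import Data.Vec as Vec using (Vec; []; _∷_; toList)
  open import Data.Product using (∃; _×_; _,_; proj₁; proj₂)
  open import Data.Sum using (inj₁; inj₂)
  open import Data.Empty using (⊥; ⊥-elim)
  open import Function using (_∘_; id)
  open import Relation.Nullary using (yes; no)
  open import Relation.Binary.PropositionalEquality hiding ([_]; J)

  module _ {n κ C : ℕ} {ss : List Shape} {ps : List Profile} (i<n : suc κ < n) (v : Valid n C ss ps) where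
    private
      split : ∃ λ m → n ≡ m + suc (suc κ)
      split = n ∸ suc (suc κ) , sym (ℕ.m∸n+n≡m i<n)

    stack-f : 1 ≤ A (suc κ) (stackWord n C ps) → ∃ λ ps′ → Valid n C ss ps′ × stackWord n C ps′ ≡ f (suc κ) (stackWord n C ps)
    stack-f h = go n (proj₂ split) v h
      where
      -- The number of letters is generalised so that matching on the equation can replace it by
      -- `m + suc (suc κ)`.
      go : ∀ n {m} → n ≡ m + suc (suc κ) → Valid n C ss ps → 1 ≤ A (suc κ) (stackWord n C ps) →
           ∃ λ ps′ → Valid n C ss ps′ × stackWord n C ps′ ≡ f (suc κ) (stackWord n C ps)
      go _ {m} refl v h with lower κ m C v h
      ... | outcome ps′ v′ word _ _ _ = ps′ , v′ , word

    stack-e : 1 ≤ B (suc κ) (stackWord n C ps) → ∃ λ ps′ → Valid n C ss ps′ × stackWord n C ps′ ≡ e (suc κ) (stackWord n C ps)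
    stack-e h = go n (proj₂ split) v h
      where
      go : ∀ n {m} → n ≡ m + suc (suc κ) → Valid n C ss ps → 1 ≤ B (suc κ) (stackWord n C ps) →
           ∃ λ ps′ → Valid n C ss ps′ × stackWord n C ps′ ≡ e (suc κ) (stackWord n C ps)
      go _ {m} refl v h with raise κ m C v h
      ... | outcome ps′ v′ word _ _ _ = ps′ , v′ , word

  Boxes-intro : ∀ {n} ρ s → (0 < length ρ → s ≤ minL (atD ρ 0 [])) → (∀ j → j < length ρ → BoxView n (atD ρ j [])) →
    (∀ j → suc j < length ρ → maxL (atD ρ j []) ≤ minL (atD ρ (suc j) [])) → Boxes n s ρ
  Boxes-intro [] s h v chain = []
  Boxes-intro {n} (S ∷ ρ) s h v chain with S | v 0 (s≤s z≤n) | h (s≤s z≤n) | (λ l → chain 0 (s≤s l))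
  ... | .(m ∷ R) | view {m} {R} p q St | s≤ | next = box (subst (s ≤_) (minL-box St) s≤) q St
    (Boxes-intro ρ (top m R) (λ l → subst (_≤ minL (atD ρ 0 [])) (maxL-box St) (next l))
      (λ j j< → v (suc j) (s≤s j<)) (λ j j< → chain (suc j) (s≤s j<)))

  Boxes-chain : ∀ {n s ρ} → Boxes n s ρ → ∀ j → suc j < length ρ → maxL (atD ρ j []) ≤ minL (atD ρ (suc j) [])
  Boxes-chain (box p q St (box p′ q′ St′ bs)) zero _ rewrite minL-box St′ | maxL-box St = p′
  Boxes-chain (box p q St bs) (suc j) (s≤s h) = Boxes-chain bs j h

  Boxes-∈ : ∀ {n s ρ S} → 1 ≤ s → Boxes n s ρ → S ∈ ρ → BoxView n S
  Boxes-∈ h (box p q St bs) (here refl) = view (ℕ.≤-trans h p) q St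
  Boxes-∈ h (box p q St bs) (there m)   = Boxes-∈ (ℕ.≤-trans h (ℕ.≤-trans p (Strict-≤top St))) bs m

  -- Boxes from right to left, each from its largest entry, give the reversal of the increasing list
  -- of all non-pivots.
  concatMap-reverse : ∀ {X : Set} (g : X → Word) xs → concatMap (reverse ∘ g) (reverse xs) ≡ reverse (concatMap g xs)
  concatMap-reverse g [] = refl
  concatMap-reverse g (x ∷ xs) = trans (cong (concatMap (reverse ∘ g)) (List.unfold-reverse x xs))
    (trans (List.concatMap-++ (reverse ∘ g) (reverse xs) (x ∷ []))
    (trans (cong₂ _++_ (concatMap-reverse g xs) (List.++-identityʳ (reverse (g x)))) (sym (List.reverse-++ (g x) (concatMap g xs)))))

  -- Omission is decided by position and not by value: equal pivots in different columns may have
  -- different boxes above them.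
  keep : (ℕ → Bool) → List ℕ → List ℕ
  keep om []       = []
  keep om (x ∷ xs) = (if om 0 then [] else x ∷ []) ++ keep (om ∘ suc) xs

  keep-Weak : ∀ om {n s xs} → Weak n s xs → Weak n s (keep om xs)
  keep-Weak om [] = []
  keep-Weak om ((p , q) ∷ w) with om 0
  ... | true  = Weak-≤ p (keep-Weak (om ∘ suc) w)
  ... | false = (p , q) ∷ keep-Weak (om ∘ suc) w

  occ-keep : ∀ om k xs → occ k (keep om xs) ≡ total (λ j → indicator (not (om j) ∧ (k ≡ᵇ at xs j))) (length xs)
  occ-keep om k [] = refl
  occ-keep om k (x ∷ xs) = trans (occ-++ k (if om 0 then [] else x ∷ []) (keep (om ∘ suc) xs))
    (trans (cong₂ _+_ (head (om 0)) (occ-keep (om ∘ suc) k xs)) (sym (total-front _ (length xs))))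
    where
    head : ∀ o → occ k (if o then [] else x ∷ []) ≡ indicator (not o ∧ (k ≡ᵇ x))
    head true = refl
    head false with k ≡ᵇ x
    ... | true  = refl
    ... | false = refl

  concatMap-keep : ∀ (om : ℕ → Bool) (p : ℕ → ℕ) (g : ℕ → ℕ) xs → (∀ j → j < length xs → p (g j) ≡ at xs j) →
    concatMap (λ c → if om c then [] else p c ∷ []) (applyUpTo g (length xs)) ≡ keep (om ∘ g) xs
  concatMap-keep om p g []       h = refl
  concatMap-keep om p g (x ∷ xs) h rewrite h 0 (s≤s z≤n) =
    cong ((if om (g 0) then [] else x ∷ []) ++_) (concatMap-keep om p (g ∘ suc) xs λ j j< → h (suc j) (s≤s j<))

  applyUpTo-atD : ∀ {X : Set} (xs : List X) d → applyUpTo (λ j → atD xs j d) (length xs) ≡ xs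
  applyUpTo-atD []       d = refl
  applyUpTo-atD (x ∷ xs) d = cong (x ∷_) (applyUpTo-atD xs d)

  sum-applyUpTo : ∀ g n → sum (applyUpTo g n) ≡ total g n
  sum-applyUpTo g zero    = refl
  sum-applyUpTo g (suc n) = trans (cong (g 0 +_) (sum-applyUpTo (g ∘ suc) n)) (sym (total-front g n))

  total-window : ∀ (h : ℕ → ℕ) a b C → a ≤ b → b ≤ C →
    total (λ j → if between a b j then h j else 0) C ≡ total (λ j → h (a + j)) (b ∸ a)
  total-window h a b zero    p q with ℕ.n≤0⇒n≡0 q
  ... | refl rewrite ℕ.0∸n≡0 a = refl
  total-window h a b (suc C) p q with b ≟ suc C
  ... | no b≢ rewrite between-false {a} {b} {C} (λ (_ , C<b) → b≢ (ℕ.≤-antisym q C<b)) =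
    trans (ℕ.+-identityʳ _) (total-window h a b C p (ℕ.≤-pred (ℕ.≤∧≢⇒< q b≢)))
  ... | yes refl with a ≤? C
  ...   | no a≰C rewrite ℕ.m≤n⇒m∸n≡0 (ℕ.≰⇒> a≰C) = total-zero (suc C) λ j j< → cong (λ z → if z then h j else 0)
            (between-false {a} {suc C} {j} λ (a≤j , _) → a≰C (ℕ.≤-trans a≤j (ℕ.≤-pred j<)))
  ...   | yes a≤C rewrite between-true {a} {suc C} {C} a≤C ℕ.≤-refl | ℕ.+-∸-assoc 1 a≤C = cong₂ _+_
            (trans (total-cong C λ j j< → cong (λ z → if z then h j else 0) (same j j<)) (total-window h a C C a≤C ℕ.≤-refl))
            (cong h (sym (ℕ.m+[n∸m]≡n a≤C)))
    where
    same : ∀ j → j < C → between a (suc C) j ≡ between a C j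
    same j j< = bool-≡ (λ t → between-true (proj₁ (between-sound {a} {suc C} {j} t)) j<)
                       (λ t → between-true (proj₁ (between-sound {a} {C} {j} t)) (ℕ.m≤n⇒m≤1+n j<))

  total-nonPivots : ∀ {n s} ρ → Boxes n s ρ → total (λ j → length (atD ρ j []) ∸ 1) (length ρ) ≡ length (nonPivots ρ)
  total-nonPivots [] [] = refl
  total-nonPivots ((m ∷ R) ∷ ρ) (box p q St bs) = trans (total-front _ (length ρ))
    (trans (cong (length R +_) (total-nonPivots ρ bs)) (sym (List.length-++ R)))

  descending-≤ : ∀ u n → All (_≤ n) (descending u n)
  descending-≤ u zero    = []
  descending-≤ u (suc n) = All.++⁺ (All.replicate⁺ (u n) ℕ.≤-refl) (All.map ℕ.m≤n⇒m≤1+n (descending-≤ u n))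

  ascending-≤ : ∀ u n → All (_≤ n) (ascending u n)
  ascending-≤ u zero    = []
  ascending-≤ u (suc n) = All.++⁺ (All.map ℕ.m≤n⇒m≤1+n (ascending-≤ u n)) (All.replicate⁺ (u n) ℕ.≤-refl)

  stackWord-≤ : ∀ n C ps → All (_≤ n) (stackWord n C ps)
  stackWord-≤ n C []       = []
  stackWord-≤ n C (p ∷ ps) = All.++⁺ (All.++⁺ (descending-≤ _ n) (ascending-≤ _ n)) (stackWord-≤ n C ps)

  module Family (n : ℕ) (la mu : List ℕ) (skew : IsSkewShape la mu) (γ θ : Vec ℕ (length la)) where

    N C : ℕ
    N = length la
    C = at la 0

    a b γ′ θ′ : ℕ → ℕ
    a r  = at mu r
    b r  = at la r
    γ′ r = at (toList γ) r
    θ′ r = at (toList θ) r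

    a-mono : ∀ r → a (suc r) ≤ a r
    a-mono = proj₁ (proj₂ skew)
    b-mono : ∀ r → b (suc r) ≤ b r
    b-mono = proj₁ skew
    a≤b : ∀ r → a r ≤ b r
    a≤b = proj₂ (proj₂ skew)
    b≤C : ∀ r → b r ≤ C
    b≤C zero    = ℕ.≤-refl
    b≤C (suc r) = ℕ.≤-trans (b-mono r) (b≤C r)
    b-beyond : ∀ {r} → N ≤ r → b r ≡ 0
    b-beyond = at-beyond la 0

    row : Filling → ℕ → List (List ℕ)
    row T r = atD T r []

    prof : Filling → ℕ → Profile
    prof T r = profileOf (a r) (row T r)

    stack : Filling → ℕ → List Profile
    stack T zero    = []
    stack T (suc r) = prof T r ∷ stack T r

    -- γ′ r counts the equalities between rows r and r + 1, whereas a shape records those with the row above.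
    equalities : ℕ → ℕ
    equalities zero    = 0
    equalities (suc r) = γ′ r

    shapes : ℕ → List Shape
    shapes zero    = []
    shapes (suc r) = shape (a r) (b r) (θ′ r) (equalities r) ∷ shapes r

    record RowsOK (T : Filling) : Set where
      field
        length-T : length T ≡ N
        boxes    : ∀ r → r < N → Boxes n 1 (row T r)
        length-r : ∀ r → r < N → a r + length (row T r) ≡ b r

    module Rowwise {T : Filling} (ok : RowsOK T) where
      open RowsOK ok public

      profRow : ∀ r → r < N → Row n (a r) (b r) (length (nonPivots (row T r))) (prof T r)
      profRow r r< = profileOf-Row (boxes r r<) (a r) (b r) (length-r r r<)

      U : ∀ r (r< : r < N) → Ceiling n (a r) (b r) (λ c → maxL (get n la mu T r c)) (x (prof T r))
      U r r< = ceiling (boxes r r<) (a r) (b r) (length-r r r<)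

      L : ∀ r (r< : r < N) → Floor n (a r) (b r) (λ c → minL (get n la mu T r c)) (y (prof T r))
      L r r< = floor (boxes r r<) (a r) (b r) (length-r r r<)

      Fits : ℕ → Set
      Fits r = ∀ c → a r ≤ c → c < b (suc r) → maxL (get n la mu T r c) ≤ minL (get n la mu T (suc r) c)

      y≤C : ∀ r → r < N → ∀ k → y (prof T r) k ≤ C
      y≤C r r< k = ℕ.≤-trans (Floor.y≤b (L r r<) k) (b≤C r)

      threshold-last : ∀ r → r ≤ N → b r ≤ thresholds n C (stack T r) n
      threshold-last zero    _  = ℕ.≤-refl
      threshold-last (suc r) r< = ℕ.≤-trans (b-mono r) (Ceiling.X-last (U r r<))

      equal : ℕ → ℕ → Bool
      equal r j = inShape n la mu r j ∧ inShape n la mu (suc r) j ∧ (maxL (get n la mu T r j) ≡ᵇ minL (get n la mu T (suc r) j))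

      count-ceq : ∀ r (r< : suc r < N) → Fits r →
        countB (equal r) (colsR n la mu) ≡ total (λ k → y (prof T (suc r)) (suc k) ∸ x (prof T r) k) n
      count-ceq r r< fits = count-equal (U r (ℕ.<⇒≤ r<)) (L (suc r) r<) (a-mono r) (b-mono r) fits C (equal r) (b≤C r)
        (λ c t → let (p , q) = ∧-split {inShape n la mu r c} t
                     (q₁ , q₂) = ∧-split {inShape n la mu (suc r) c} q
                 in (proj₁ (between-sound {a r} {b r} {c} p) , proj₂ (between-sound {a (suc r)} {b (suc r)} {c} q₁)) , ≡ᵇ⁻ q₂)
        (λ c a≤c c<b eq → ∧-join (between-true a≤c (ℕ.≤-trans c<b (b-mono r)))
          (∧-join (between-true (ℕ.≤-trans (a-mono r) a≤c) c<b) (≡ᵇ⁺ eq)))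

      count-ex : ∀ r → r < N →
        sum (map (λ j → if inShape n la mu r j then length (get n la mu T r j) ∸ 1 else 0) (colsR n la mu)) ≡ length (nonPivots (row T r))
      count-ex r r< = trans (cong sum (List.map-applyUpTo id _ C)) (trans (sum-applyUpTo _ C)
        (trans (total-window (λ j → length (get n la mu T r j) ∸ 1) (a r) (b r) C (a≤b r) (b≤C r))
        (trans (total-cong (b r ∸ a r) λ j _ → cong (λ z → length (atD (row T r) z []) ∸ 1) (ℕ.m+n∸m≡n (a r) j))
        (trans (cong (total _) width) (total-nonPivots (row T r) (boxes r r<))))))
        where
        width : b r ∸ a r ≡ length (row T r)
        width = trans (cong (_∸ a r) (sym (length-r r r<))) (ℕ.m+n∸m≡n (a r) _)

      -- Each half of the word is a monotone list, so it is identified by its multiplicities, and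
      -- these are the bits and the counts of `count-pivots`.
      read-row : ∀ r → r < N → (∀ s → r ≡ suc s → Fits s) → Defs.rowWord n la mu T r ≡ wordBelow n (thresholds n C (stack T r)) (prof T r)
      read-row r r< fits = cong₂ _++_ nonPivotPart pivotPart
        where
        ρ = row T r
        bs = boxes r r<
        width : b r ∸ a r ≡ length ρ
        width = trans (cong (_∸ a r) (sym (length-r r r<))) (ℕ.m+n∸m≡n (a r) _)
        cols : rowCols n la mu r ≡ applyUpTo (a r +_) (length ρ)
        cols = trans (cong (λ z → map (a r +_) (upTo z)) width) (List.map-applyUpTo id (a r +_) (length ρ))
        boxes-cols : map (get n la mu T r) (rowCols n la mu r) ≡ ρ
        boxes-cols = trans (cong (map _) cols) (trans (List.map-applyUpTo (a r +_) _ (length ρ))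
          (trans (applyUpTo-cong (length ρ) λ j → cong (λ z → atD ρ z []) (ℕ.m+n∸m≡n (a r) j)) (applyUpTo-atD ρ [])))
          where
          applyUpTo-cong : ∀ {X : Set} {g h : ℕ → X} m → (∀ j → g j ≡ h j) → applyUpTo g m ≡ applyUpTo h m
          applyUpTo-cong zero    eq = refl
          applyUpTo-cong (suc m) eq = cong₂ _∷_ (eq 0) (applyUpTo-cong m (eq ∘ suc))
        nonPivotPart : concatMap (λ j → reverse (drop 1 (get n la mu T r j))) (reverse (rowCols n la mu r)) ≡
                       descending (λ k → ε (prof T r) (suc k)) n
        nonPivotPart = trans (concatMap-reverse (drop 1 ∘ get n la mu T r) (rowCols n la mu r)) (trans (cong reverse
          (trans (sym (List.concatMap-map (drop 1) (get n la mu T r) (rowCols n la mu r))) (trans (cong (concatMap (drop 1)) boxes-cols)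
            (ascending-occ (s≤s z≤n) (Strict⇒Weak (nonPivots-Strict bs))))))
          (reverse-ascending _ n))
        omit : ℕ → Bool
        omit = omitPivot n la mu T r
        get-at : ∀ j → j < length ρ → minL (get n la mu T r (a r + j)) ≡ at (mins ρ) j
        get-at j j< = trans (cong (λ z → minL (atD ρ z [])) (ℕ.m+n∸m≡n (a r) j)) (sym (at-mins ρ j j<))
        length-mins : length (mins ρ) ≡ length ρ
        length-mins = List.length-map minL ρ
        kept : List ℕ
        kept = keep (omit ∘ (a r +_)) (mins ρ)
        pivotsList : concatMap (λ j → if omit j then [] else minL (get n la mu T r j) ∷ []) (rowCols n la mu r) ≡ kept
        pivotsList = trans (cong (concatMap _) (trans cols (cong (applyUpTo (a r +_)) (sym length-mins))))
          (concatMap-keep omit (λ j → minL (get n la mu T r j)) (a r +_) (mins ρ)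
            λ j j< → get-at j (subst (j <_) length-mins j<))
        occ-kept : ∀ k → occ k kept ≡ total (λ j → indicator (not (omit (a r + j)) ∧ (k ≡ᵇ minL (get n la mu T r (a r + j))))) (b r ∸ a r)
        occ-kept k = trans (occ-keep (omit ∘ (a r +_)) k (mins ρ)) (trans (cong (total _) length-mins)
          (trans (total-cong (length ρ) λ j j< → cong (λ z → indicator (not (omit (a r + j)) ∧ (k ≡ᵇ z))) (sym (get-at j j<)))
            (cong (total _) (sym width))))
        counted : ∀ r (r< : r < N) → (∀ s → r ≡ suc s → Fits s) → ∀ k → k < n →
          total (λ j → indicator (not (omitPivot n la mu T r (a r + j)) ∧ (suc k ≡ᵇ minL (get n la mu T r (a r + j))))) (b r ∸ a r) ≡
          pivots (thresholds n C (stack T r)) (prof T r) k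
        -- Nothing lies above the top row. Its fictitious threshold `C` is beyond every column, so
        -- the minimum in `pivots` cuts nothing off.
        counted zero r< fits k k<n = trans (total-cong (b 0 ∸ a 0) λ j j< → cong indicator (interval (a 0 + j) (ℕ.m≤m+n (a 0) j)
              (lia (a 0 ∷ b 0 ∷ j ∷ []) (λ a b j → j :< b :∸ a ⇒ a :+ j :< b) refl j<)))
            (trans (total-between (y (prof T 0) k) (y (prof T 0) (suc k)) (a 0) (b 0 ∸ a 0) (Floor.a≤y (L 0 r<) k))
            (cong (_∸ y (prof T 0) k) (trans (ℕ.m≤n⇒m⊓n≡m (ℕ.≤-trans (Floor.y≤b (L 0 r<) (suc k)) (ℕ.m≤n+m∸n (b 0) (a 0))))
              (sym (ℕ.m≤n⇒m⊓n≡m (y≤C 0 r< (suc k)))))))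
          where
          open Floor (L 0 r<)
          interval : ∀ c → a 0 ≤ c → c < b 0 → (suc k ≡ᵇ minL (get n la mu T 0 c)) ≡ between (y (prof T 0) k) (y (prof T 0) (suc k)) c
          interval c a≤c c<b = bool-≡
            (λ t → between-true (ℕ.≮⇒≥ λ c<y → ℕ.<⇒≱ (ℕ.n<1+n k) (subst (_≤ k) (sym (≡ᵇ⁻ {suc k} t)) (<y⇒p≤ a≤c c<y)))
                                (p≤⇒<y a≤c c<b (ℕ.≤-reflexive (sym (≡ᵇ⁻ {suc k} t)))))
            (λ t → let (p , q) = between-sound {y (prof T 0) k} {y (prof T 0) (suc k)} {c} t in
              ≡ᵇ⁺ (ℕ.≤-antisym (ℕ.≰⇒> λ p≤k → ℕ.<⇒≱ (p≤⇒<y a≤c c<b p≤k) p) (<y⇒p≤ a≤c q)))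
        counted (suc s) r< fits k k<n = count-pivots (U s (ℕ.<⇒≤ r<)) (L (suc s) r<) (a-mono s) (b-mono s) (fits s refl) k<n
          (λ c → not (omitPivot n la mu T (suc s) c) ∧ (suc k ≡ᵇ minL (get n la mu T (suc s) c)))
          (λ c a≤c c<b t → let (p , q) = ∧-split {not (omitPivot n la mu T (suc s) c)} t in sym (≡ᵇ⁻ {suc k} q) ,
            λ (a≤c′ , eq) → contra p (∧-join (between-true a≤c′ (ℕ.≤-trans c<b (b-mono s))) (≡ᵇ⁺ (sym eq))))
          (λ c a≤c c<b eq ¬e → ∧-join (notTrue λ t → let (p , q) = ∧-split {inShape n la mu s c} t in
              ¬e (proj₁ (between-sound {a s} {b s} {c} p) , sym (≡ᵇ⁻ q))) (≡ᵇ⁺ (sym eq)))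
          where
          contra : ∀ {z} → not z ≡ true → z ≡ true → ⊥
          contra {true} () _
          contra {false} _ ()
          notTrue : ∀ {z} → (z ≡ true → ⊥) → not z ≡ true
          notTrue {true}  h = ⊥-elim (h refl)
          notTrue {false} h = refl
        pivotPart : concatMap (λ j → if omit j then [] else minL (get n la mu T r j) ∷ []) (rowCols n la mu r) ≡
                    ascending (pivots (thresholds n C (stack T r)) (prof T r)) n
        pivotPart = trans pivotsList (trans (ascending-occ (s≤s z≤n) (keep-Weak (omit ∘ (a r +_)) (mins-Weak bs)))
          (ascending-cong n λ k k<n → trans (occ-kept (suc k)) (counted r r< fits k k<n)))

      read-stack : (∀ r → suc r < N → Fits r) → ∀ r → r ≤ N → concatMap (Defs.rowWord n la mu T) (downFrom r) ≡ stackWord n C (stack T r)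
      read-stack fits zero    _  = refl
      read-stack fits (suc r) r< = cong₂ _++_ (read-row r r< λ { s refl → fits s r< }) (read-stack fits r (ℕ.<⇒≤ r<))

      read : (∀ r → suc r < N → Fits r) → readWord n la mu T ≡ stackWord n C (stack T N)
      read fits = trans (cong (concatMap (Defs.rowWord n la mu T)) (List.reverse-upTo N)) (read-stack fits N ℕ.≤-refl)

      toValid : (∀ r → suc r < N → Fits r) → (∀ r → r < N → length (nonPivots (row T r)) ≡ θ′ r) →
        (∀ r → suc r < N → countB (equal r) (colsR n la mu) ≡ γ′ r) → ∀ r → r ≤ N → Valid n C (shapes r) (stack T r)
      toValid fits hθ hγ zero    _  = []
      toValid fits hθ hγ (suc r) r< = (subst (λ t → Row n (a r) (b r) t (prof T r)) (hθ r r<) (profRow r r<) , below r r<)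
                                      ∷ toValid fits hθ hγ r (ℕ.<⇒≤ r<)
        where
        below : ∀ r → r < N → Below n (equalities r) (thresholds n C (stack T r)) (prof T r)
        below zero    r< = mkBelow (λ k _ → y≤C 0 r< k) (total-zero n λ k _ → ℕ.m≤n⇒m∸n≡0 (y≤C 0 r< (suc k)))
        below (suc s) r< = mkBelow (stacked⇒under (U s (ℕ.<⇒≤ r<)) (L (suc s) r<) (a-mono s) (b-mono s) (fits s r<))
          (trans (sym (count-ceq s r< (fits s r<))) (hγ s r<))

      fromValid : ∀ {r} → r ≤ N → Valid n C (shapes r) (stack T r) →
        (∀ s → s < r → length (nonPivots (row T s)) ≡ θ′ s) ×
        (∀ s → suc s < r → Fits s × countB (equal s) (colsR n la mu) ≡ γ′ s)
      fromValid {zero} _ [] = (λ _ ()) , (λ _ ())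
      fromValid {suc r} r≤ ((rw , bl) ∷ v) with fromValid {r} (ℕ.<⇒≤ r≤) v
      ... | hθ , rest = sizes , fitting r rw bl r≤ rest
        where
        sizes : ∀ s → s < suc r → length (nonPivots (row T s)) ≡ θ′ s
        sizes s s< with s ≟ r
        ... | yes refl = trans (sym (size (profRow s r≤))) (size rw)
        ... | no s≢r   = hθ s (ℕ.≤∧≢⇒< (ℕ.≤-pred s<) s≢r)
        fitting : ∀ r → Row n (a r) (b r) (θ′ r) (prof T r) → Below n (equalities r) (thresholds n C (stack T r)) (prof T r) → r < N →
          (∀ s → suc s < r → Fits s × countB (equal s) (colsR n la mu) ≡ γ′ s) →
          ∀ s → suc s < suc r → Fits s × countB (equal s) (colsR n la mu) ≡ γ′ s
        fitting r rw bl r< rest s s< with suc s ≟ r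
        ... | no s≢r = rest s (ℕ.≤∧≢⇒< (ℕ.≤-pred s<) s≢r)
        ... | yes refl = fits , trans (count-ceq s r< fits) (equality bl)
          where
          fits : Fits s
          fits = under⇒stacked (U s (ℕ.<⇒≤ r<)) (L (suc s) r<) (a-mono s) (b-mono s)
            (max≤n (boxes s (ℕ.<⇒≤ r<)) (a s) (b s) (length-r s (ℕ.<⇒≤ r<))) (under bl)

    open RowsOK

    record Good (T : Filling) : Set where
      constructor good
      field
        rowsOK : RowsOK T
        fits   : ∀ r → suc r < N → Rowwise.Fits rowsOK r
    open Good

    private
      cell : Filling → ℕ → ℕ → Bool
      cell T r j = (not (inShape n la mu r j ∧ inShape n la mu r (suc j)) ∨ leSet n la mu (get n la mu T r j) (get n la mu T r (suc j)))
                 ∧ (not (inShape n la mu r j ∧ inShape n la mu (suc r) j) ∨ leSet n la mu (get n la mu T r j) (get n la mu T (suc r) j))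

    good⁻ : ∀ {T} → T ∈ fillings n la mu → isSVRPP n la mu T ≡ true → Good T
    good⁻ {T} T∈ ok = good (record { length-T = proj₁ mem ; boxes = boxes′ ; length-r = length-r′ })
      λ r r< c a≤c c<b → ≤ᵇ⁻ (implies⁻ (proj₂ (cells r c (ℕ.<⇒≤ r<) (ℕ.≤-trans c<b (b≤C (suc r)))))
        (∧-join (between-true a≤c (ℕ.≤-trans c<b (b-mono r))) (between-true (ℕ.≤-trans (a-mono r) a≤c) c<b)))
      where
      mem = ∈-cartesian⁻ (λ r → allLists (subsetsN n la mu) (b r ∸ a r)) id N [] T∈
      rowmem : ∀ r → r < N → length (row T r) ≡ b r ∸ a r × (∀ {S} → S ∈ row T r → S ∈ subsetsN n la mu)
      rowmem r r< = ∈-allLists⁻ (b r ∸ a r) (proj₂ mem r r<)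
      cells : ∀ r j → r < N → j < C → _
      cells r j r< j< = ∧-split {not (inShape n la mu r j ∧ inShape n la mu r (suc j)) ∨
        leSet n la mu (get n la mu T r j) (get n la mu T r (suc j))} (allB⁻ (cell T r) (allB⁻ (λ r → allB (cell T r) (colsR n la mu)) ok (∈-upTo⁺ r<)) (∈-upTo⁺ j<))
      length-r′ : ∀ r → r < N → a r + length (row T r) ≡ b r
      length-r′ r r< = trans (cong (a r +_) (proj₁ (rowmem r r<))) (ℕ.m+[n∸m]≡n (a≤b r))
      boxes′ : ∀ r → r < N → Boxes n 1 (row T r)
      boxes′ r r< = Boxes-intro (row T r) 1 (λ l → positive (views 0 l)) views chain
        where
        views : ∀ j → j < length (row T r) → BoxView n (atD (row T r) j [])
        views j j< = ∈-subsetsN⁻ n la mu (proj₂ (rowmem r r<) (atD-∈ (row T r) [] j<))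
        positive : ∀ {S} → BoxView n S → 1 ≤ minL S
        positive (view p _ St) rewrite minL-box St = p
        chain : ∀ j → suc j < length (row T r) → maxL (atD (row T r) j []) ≤ minL (atD (row T r) (suc j) [])
        chain j j< = subst₂ (λ z w → maxL (atD (row T r) z []) ≤ minL (atD (row T r) w [])) (ℕ.m+n∸m≡n (a r) j)
          (trans (cong (_∸ a r) (sym (ℕ.+-suc (a r) j))) (ℕ.m+n∸m≡n (a r) (suc j)))
          (≤ᵇ⁻ (implies⁻ (proj₁ (cells r (a r + j) r< (ℕ.≤-trans (ℕ.n≤1+n _) (ℕ.≤-trans c<b (b≤C r)))))
            (∧-join (between-true (ℕ.m≤m+n (a r) j) (ℕ.≤-trans (ℕ.n≤1+n _) c<b)) (between-true (ℕ.m≤n⇒m≤1+n (ℕ.m≤m+n (a r) j)) c<b))))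
          where
          c<b : suc (suc (a r + j)) ≤ b r
          c<b = lia (a r ∷ b r ∷ j ∷ length (row T r) ∷ []) (λ a b j l → # 2 :+ j :≤ l ⇒ a :+ l :≡ b ⇒ # 2 :+ (a :+ j) :≤ b) refl
            j< (length-r′ r r<)

    good⁺ : ∀ {T} → Good T → T ∈ fillings n la mu × isSVRPP n la mu T ≡ true
    good⁺ {T} (good ok fits) = ∈-cartesian⁺ (λ r → allLists (subsetsN n la mu) (b r ∸ a r)) id N T [] (length-T ok)
        (λ r r< → subst (λ z → row T r ∈ allLists (subsetsN n la mu) z) (trans (sym (ℕ.m+n∸m≡n (a r) _)) (cong (_∸ a r) (length-r ok r r<)))
          (∈-allLists⁺ (row T r) (λ S∈ → ∈-subsetsN⁺ n la mu (Boxes-∈ (s≤s z≤n) (boxes ok r r<) S∈)))) ,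
      allB⁺ (λ r → allB (cell T r) (colsR n la mu)) (rowsR n la mu)
        (λ {r} r∈ → allB⁺ (cell T r) (colsR n la mu) (λ {j} _ → ∧-join (implies⁺ (horizontal r j (∈-upTo⁻ r∈))) (implies⁺ (vertical r j))))
      where
      horizontal : ∀ r j → r < N → inShape n la mu r j ∧ inShape n la mu r (suc j) ≡ true → leSet n la mu (get n la mu T r j) (get n la mu T r (suc j)) ≡ true
      horizontal r j r< t = let (p , q) = ∧-split {inShape n la mu r j} t
                                (a≤j , _) = between-sound {a r} {b r} {j} p
                                (_ , j<b) = between-sound {a r} {b r} {suc j} q
        in ≤ᵇ-true (subst (λ z → maxL (atD (row T r) (j ∸ a r) []) ≤ minL (atD (row T r) z [])) (sym (ℕ.+-∸-assoc 1 a≤j))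
          (Boxes-chain (boxes ok r r<) (j ∸ a r)
            (lia (a r ∷ b r ∷ j ∷ length (row T r) ∷ []) (λ a b j l → a :≤ j ⇒ # 1 :+ j :< b ⇒ a :+ l :≡ b ⇒ # 1 :+ (j :∸ a) :< l) refl
              a≤j j<b (length-r ok r r<))))
      vertical : ∀ r j → inShape n la mu r j ∧ inShape n la mu (suc r) j ≡ true → leSet n la mu (get n la mu T r j) (get n la mu T (suc r) j) ≡ true
      vertical r j t with suc r <? N
      ... | yes r< = let (p , q) = ∧-split {inShape n la mu r j} t in
        ≤ᵇ-true (fits r r< j (proj₁ (between-sound {a r} {b r} {j} p)) (proj₂ (between-sound {a (suc r)} {b (suc r)} {j} q)))
      ... | no r≮ = ⊥-elim (ℕ.n≮0 (subst (j <_) (b-beyond (ℕ.≮⇒≥ r≮))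
        (proj₂ (between-sound {a (suc r)} {b (suc r)} {j} (proj₂ (∧-split {inShape n la mu r j} t))))))

    selected : Filling → Bool
    selected T = isSVRPP n la mu T ∧ eqVecᵇ (ceq n la mu T) γ ∧ eqVecᵇ (ex n la mu T) θ

    family : List Filling
    family = filterB selected (fillings n la mu)

    -- `ceq` also has a component for the last row, below which there is none. Since `shapes` does
    -- not record it, its vanishing is a separate condition.
    LastZero : Set
    LastZero = ∀ r → r < N → N ≤ suc r → γ′ r ≡ 0

    record Member (T : Filling) : Set where
      constructor member
      field
        isGood   : Good T
        isValid  : Valid n C (shapes N) (stack T N)
        lastZero : LastZero
    open Member

    no-ceq : ∀ {T} (ok : RowsOK T) r → N ≤ suc r → countB (Rowwise.equal ok r) (colsR n la mu) ≡ 0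
    no-ceq {T} ok r h = countB-none (Rowwise.equal ok r) (colsR n la mu) λ {j} _ → none j
      where
      none : ∀ j → Rowwise.equal ok r j ≡ false
      none j with Rowwise.equal ok r j in eq
      ... | false = refl
      ... | true  = ⊥-elim (ℕ.n≮0 (subst (j <_) (b-beyond h) (proj₂ (between-sound {a (suc r)} {b (suc r)} {j}
        (proj₁ (∧-split {inShape n la mu (suc r) j} (proj₂ (∧-split {inShape n la mu r j} eq))))))))

    member⁻ : ∀ {T} → T ∈ family → Member T
    member⁻ {T} T∈ with ∈-filterB⁻ selected {fillings n la mu} T∈
    ... | T∈f , sel with ∧-split {isSVRPP n la mu T} sel
    ... | sv , rest with ∧-split {eqVecᵇ (ceq n la mu T) γ} rest
    ... | hγ , hθ = member G (Rowwise.toValid ok (fits G)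
        (λ r r< → trans (sym (Rowwise.count-ex ok r r<)) (tabulate-at⁻ _ θ hθ r r<))
        (λ r r< → tabulate-at⁻ (λ r → countB (Rowwise.equal ok r) (colsR n la mu)) γ hγ r (ℕ.<⇒≤ r<)) N ℕ.≤-refl)
        (λ r r< h → trans (sym (tabulate-at⁻ (λ r → countB (Rowwise.equal ok r) (colsR n la mu)) γ hγ r r<)) (no-ceq ok r h))
      where
      G = good⁻ T∈f sv
      ok = rowsOK G

    member⁺ : ∀ {T} → RowsOK T → Valid n C (shapes N) (stack T N) → LastZero → T ∈ family
    member⁺ {T} ok v lz with Rowwise.fromValid ok ℕ.≤-refl v
    ... | hθ , rest with good⁺ {T} (good ok λ r r< → proj₁ (rest r r<))
    ... | T∈ , sv = ∈-filterB⁺ selected T∈ (∧-join sv (∧-join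
        (tabulate-at⁺ (λ r → countB (Rowwise.equal ok r) (colsR n la mu)) γ equalities-ok)
        (tabulate-at⁺ _ θ λ r r< → trans (Rowwise.count-ex ok r r<) (hθ r r<))))
      where
      equalities-ok : ∀ r → r < N → countB (Rowwise.equal ok r) (colsR n la mu) ≡ γ′ r
      equalities-ok r r< with suc r <? N
      ... | yes h = proj₂ (rest r h)
      ... | no h  = trans (no-ceq ok r (ℕ.≮⇒≥ h)) (sym (lz r r< (ℕ.≮⇒≥ h)))

    read-member : ∀ {T} (m : Member T) → readWord n la mu T ≡ stackWord n C (stack T N)
    read-member m = Rowwise.read (rowsOK (isGood m)) (fits (isGood m))

    -- The profiles of the constructed rows agree with the given ones only up to the letter `n`,
    -- whence `Similar` in place of an equation.
    record Built (r : ℕ) (ps : List Profile) : Set where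
      constructor built
      field
        T        : Filling
        length-≡ : length T ≡ r
        rows     : ∀ s → s < r → Boxes n 1 (row T s) × a s + length (row T s) ≡ b s
        similar  : Similar n (stack T r) ps

    stack-cong : ∀ {T T′} r → (∀ s → s < r → row T s ≡ row T′ s) → stack T r ≡ stack T′ r
    stack-cong zero    h = refl
    stack-cong (suc r) h = cong₂ _∷_ (cong (profileOf (a r)) (h r ℕ.≤-refl)) (stack-cong r λ s s< → h s (ℕ.m≤n⇒m≤1+n s<))

    atD-snoc-< : ∀ (T : Filling) ρ s → s < length T → row (T ++ ρ ∷ []) s ≡ row T s
    atD-snoc-< (x ∷ T) ρ zero    h       = refl
    atD-snoc-< (x ∷ T) ρ (suc s) (s≤s h) = atD-snoc-< T ρ s h

    atD-snoc-≡ : ∀ (T : Filling) ρ → row (T ++ ρ ∷ []) (length T) ≡ ρ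
    atD-snoc-≡ []      ρ = refl
    atD-snoc-≡ (x ∷ T) ρ = atD-snoc-≡ T ρ

    build : ∀ r {ps} → Valid n C (shapes r) ps → Built r ps
    build zero [] = built [] refl (λ _ ()) []
    build (suc r) {p ∷ ps} ((rw , _) ∷ v) with build r v | realise rw
    ... | built T len rows sim | realises ρ bs lenρ simρ = built T′ (trans (List.length-++ T) (trans (cong (_+ 1) len) (ℕ.+-comm r 1)))
        rows′ (subst (λ z → profileOf (a r) z ≈[ n ] p) (sym lastRow) simρ ∷
               subst (λ z → Similar n z ps) (sym (stack-cong {T′} {T} r λ s s< → atD-snoc-< T ρ s (subst (s <_) (sym len) s<))) sim)
      where
      T′ = T ++ ρ ∷ []
      lastRow : row T′ r ≡ ρ
      lastRow = subst (λ z → row T′ z ≡ ρ) len (atD-snoc-≡ T ρ)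
      rows′ : ∀ s → s < suc r → Boxes n 1 (row T′ s) × a s + length (row T′ s) ≡ b s
      rows′ s s< with s ≟ r
      ... | yes refl rewrite lastRow = bs , trans (cong (a r +_) lenρ) (ℕ.m+[n∸m]≡n (a≤b r))
      ... | no s≢r rewrite atD-snoc-< T ρ s (subst (s <_) (sym len) (ℕ.≤∧≢⇒< (ℕ.≤-pred s<) s≢r)) = rows s (ℕ.≤∧≢⇒< (ℕ.≤-pred s<) s≢r)

    valid-similar : ∀ {T} (ok : RowsOK T) r {ps} → r ≤ N → Valid n C (shapes r) ps → Similar n (stack T r) ps → Valid n C (shapes r) (stack T r)
    valid-similar ok zero _ [] [] = []
    valid-similar {T} ok (suc r) {p ∷ ps} r≤ ((rw , bl) ∷ v) ((hy , hε) ∷ sim) =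
      (subst (λ t → Row n (a r) (b r) t (prof T r)) (trans (sym (size R)) (trans (total-cong n hε) (size rw))) R ,
       mkBelow under′ (trans (total-cong n λ k k< → cong₂ _∸_ (hy (suc k) k<) (thresholds-similar n C sim k<)) (equality bl)))
      ∷ valid-similar ok r (ℕ.<⇒≤ r≤) v sim
      where
      R = Rowwise.profRow ok r r≤
      under′ : ∀ k → k ≤ n → y (prof T r) k ≤ thresholds n C (stack T r) k
      under′ k k≤ with ℕ.m≤n⇒m<n∨m≡n k≤
      ... | inj₁ k< = subst₂ _≤_ (sym (hy k k≤)) (sym (thresholds-similar n C sim k<)) (under bl k k≤)
      -- The threshold at `n` involves a bit for `n + 1`, which similarity does not control; there
      -- the ends of the rows decide.
      ... | inj₂ refl = subst (_≤ thresholds n C (stack T r) n) (sym (end R)) (Rowwise.threshold-last ok r (ℕ.<⇒≤ r≤))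

    words : List Word
    words = map (readWord n la mu) family

    -- Since every valid stack comes from a filling of the family, closure of stacks under the
    -- operators becomes closure of `words`.
    realise-stack : LastZero → ∀ {ps} → Valid n C (shapes N) ps → stackWord n C ps ∈ words
    realise-stack lz {ps} v with build N v
    ... | built T len rows sim = subst (_∈ words) (trans (read-member (member⁻ T∈)) (stackWord-similar n C sim)) (∈-map⁺ (readWord n la mu) T∈)
      where
      ok : RowsOK T
      ok = record { length-T = len ; boxes = λ r r< → proj₁ (rows r r<) ; length-r = λ r r< → proj₂ (rows r r<) }
      T∈ : T ∈ family
      T∈ = member⁺ ok (valid-similar ok N ℕ.≤-refl v sim) lz

    read-injective : ∀ {T T′} → T ∈ family → T′ ∈ family → readWord n la mu T ≡ readWord n la mu T′ → T ≡ T′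
    read-injective {T} {T′} T∈ T′∈ eq = atD-ext T T′ [] (trans (length-T ok) (sym (length-T ok′)))
        λ r r< → rowsEq N ℕ.≤-refl (reading-injective n C (isValid m) (isValid m′) (trans (sym (read-member m)) (trans eq (read-member m′))))
          r (subst (r <_) (length-T ok) r<)
      where
      m = member⁻ T∈
      m′ = member⁻ T′∈
      ok = rowsOK (isGood m)
      ok′ = rowsOK (isGood m′)
      rowsEq : ∀ N′ → N′ ≤ N → Similar n (stack T N′) (stack T′ N′) → ∀ r → r < N′ → row T r ≡ row T′ r
      rowsEq (suc N′) h (s ∷ sim) r r< with r ≟ N′
      ... | yes refl = profileOf-injective (boxes ok N′ h) (boxes ok′ N′ h) s
      ... | no r≢    = rowsEq N′ (ℕ.<⇒≤ h) sim r (ℕ.≤∧≢⇒< (ℕ.≤-pred r<) r≢)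

    closed : CrystalClosed n words
    closed = record
      { unique   = Unique-map (readWord n la mu) read-injective (Unique-filterB selected (Unique-fillings n la mu))
      ; bounded  = bounded′
      ; closed-f = λ { {suc κ} _ i<n w∈ h → closedWith w∈ (λ v → stack-f i<n v) (λ eq → subst (1 ≤_) (sym (trans (cong (A (suc κ)) (sym eq)) h)) (s≤s z≤n)) }
      ; closed-e = λ { {suc κ} _ i<n w∈ h → closedWith w∈ (λ v → stack-e i<n v) (λ eq → subst (1 ≤_) (sym (trans (cong (B (suc κ)) (sym eq)) h)) (s≤s z≤n)) } }
      where
      bounded′ : ∀ {w} → w ∈ words → All (_≤ n) w
      bounded′ w∈ with ∈-map⁻ (readWord n la mu) w∈
      ... | T , T∈ , refl = subst (All (_≤ n)) (sym (read-member (member⁻ T∈))) (stackWord-≤ n C (stack T N))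
      closedWith : ∀ {op : Word → Word} {P : Word → Set} {w} → w ∈ words →
        (∀ {ps} → Valid n C (shapes N) ps → P (stackWord n C ps) → ∃ λ ps′ → Valid n C (shapes N) ps′ × stackWord n C ps′ ≡ op (stackWord n C ps)) →
        (∀ {v} → w ≡ v → P v) → op w ∈ words
      closedWith {op} w∈ act h with ∈-map⁻ (readWord n la mu) w∈
      ... | T , T∈ , refl with act (isValid (member⁻ T∈)) (h (read-member (member⁻ T∈)))
      ...   | ps′ , v′ , eq = subst (_∈ words) (trans eq (cong op (sym (read-member (member⁻ T∈))))) (realise-stack (lastZero (member⁻ T∈)) v′)

-- `ircont` is the content of the reading word; comparison of the two lattice tests.

module Statistics where
  open import Defs hiding (rowWord; content)
  open LIA using (lia; _:≤_; _:<_; _:≡_; _⇒_; #_; _:+_; _:∸_; _:⊓_)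
  open Counting using (∈-filterB⁺; countB-map; countB-filterB; countB-cong)
  open Alternants using (Bounded)
  open Words hiding (lo; hi; to)
  open Crystal
  open RowWords
  open Profiles
  open Rows hiding (module Distributed; boxes; mins≡; nonPivots≡)
  open Reading
  open Lists
  open Fillings
  open import Data.Nat using (ℕ; zero; suc; _+_; _∸_; _⊓_; _⊔_; _≤_; _<_; z≤n; s≤s; _≟_; _≤?_; _≡ᵇ_; _≤ᵇ_; _<ᵇ_)
  import Data.Nat.Properties as ℕ
  open import Data.Bool using (Bool; true; false; _∧_; _∨_; not)
  open import Data.Maybe using (nothing)
  open import Data.List using (List; []; _∷_; _++_; length; drop; reverse; upTo)
  import Data.List.Properties as List
  open import Data.List.Membership.Propositional using (_∈_)
  open import Data.List.Membership.Propositional.Properties using (∈-map⁻)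
  open import Data.List.Relation.Unary.Any using (here; there)
  open import Data.Vec as Vec using (Vec; []; _∷_; tabulate)
  import Data.Vec.Relation.Unary.All as VAll
  open import Data.Fin using (toℕ)
  open import Data.Product using (_×_; _,_; proj₁; proj₂)
  open import Data.Sum using (_⊎_; inj₁; inj₂)
  open import Data.Empty using (⊥; ⊥-elim)
  open import Function using (_∘_; id)
  open import Relation.Nullary using (yes; no)
  open import Relation.Binary.PropositionalEquality hiding ([_]; J)

  memB⁺ : ∀ {k S} → k ∈ S → memB k S ≡ true
  memB⁺ {k} k∈ = anyB⁺ (k ≡ᵇ_) k∈ (≡ᵇ-refl k)

  memB⁻ : ∀ {k S} → memB k S ≡ true → k ∈ S
  memB⁻ {k} {S} h with anyB⁻ (k ≡ᵇ_) S h
  ... | x , x∈ , eq = subst (_∈ S) (sym (≡ᵇ⁻ {k} eq)) x∈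

  drop-∈ : ∀ {S : List ℕ} {z} → z ∈ drop 1 S → z ∈ S
  drop-∈ {_ ∷ S} h = there h

  minL-∈ : ∀ {n S} → BoxView n S → minL S ∈ S
  minL-∈ (view _ _ St) rewrite minL-box St = here refl

  -- The letter k + 1 occupies the columns [x k , y (k + 1)) of a row.
  module _ {n : ℕ} {ρ : List (List ℕ)} (bs : Boxes n 1 ρ) (a b : ℕ) (len : a + length ρ ≡ b) {c k : ℕ} (a≤c : a ≤ c) (c<b : c < b) where
    private
      S = atD ρ (c ∸ a) []
      p = profileOf a ρ
      module F = Floor (floor bs a b len)
      o = occ (suc k) (nonPivots ρ)
      index< : c ∸ a < length ρ
      index< = lia (a ∷ b ∷ c ∷ length ρ ∷ []) (λ a b c l → a :≤ c ⇒ c :< b ⇒ a :+ l :≡ b ⇒ c :∸ a :< l) refl a≤c c<b len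
      entry : BoxView n S
      entry = boxView (s≤s z≤n) bs (c ∸ a) index<
      nonPivot⇒ : suc k ∈ drop 1 S → suc c ≡ y p k × 1 ≤ o
      nonPivot⇒ h = lia (a ∷ c ∷ count≤ k (mins ρ) ∷ []) (λ a c m → a :≤ c ⇒ m :≡ # 1 :+ (c :∸ a) ⇒ # 1 :+ c :≡ a :+ m) refl a≤c
        (nonPivot-position bs (c ∸ a) h) , ∈-occ (∈-nonPivots ρ (c ∸ a) h)
      split : ∀ {S} → BoxView n S → suc k ∈ S → minL S ≡ suc k ⊎ suc k ∈ drop 1 S
      split (view _ _ St) (here refl) = inj₁ (minL-box St)
      split (view _ _ St) (there h)   = inj₂ h

    letter⇒ : suc k ∈ S → x p k ≤ c × c < y p (suc k)
    letter⇒ h with split entry h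
    ... | inj₁ eq = ℕ.≤-trans (ℕ.m∸n≤m (y p k) o) (ℕ.≮⇒≥ λ c<y → ℕ.<⇒≱ (ℕ.n<1+n k) (subst (_≤ k) eq (F.<y⇒p≤ a≤c c<y))) ,
                    F.p≤⇒<y a≤c c<b (ℕ.≤-reflexive eq)
    ... | inj₂ h′ with nonPivot⇒ h′
    ...   | yk , 1≤o = lia (c ∷ y p k ∷ o ∷ []) (λ c y o → # 1 :+ c :≡ y ⇒ # 1 :≤ o ⇒ y :∸ o :≤ c) refl yk 1≤o ,
                       ℕ.≤-trans (ℕ.≤-reflexive yk) (ℕ.+-monoʳ-≤ a (subst (count≤ k (mins ρ) ≤_) (sym (count≤-suc k (mins ρ))) (ℕ.m≤m+n _ _)))

    letter⇐ : x p k ≤ c → c < y p (suc k) → suc k ∈ S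
    letter⇐ h h′ with y p k ≤? c
    ... | yes y≤c = subst (_∈ S) (ℕ.≤-antisym (F.<y⇒p≤ a≤c h′) (ℕ.≰⇒> λ p≤k → ℕ.<⇒≱ (F.p≤⇒<y a≤c c<b p≤k) y≤c)) (minL-∈ entry)
    -- Between `x p k` and `y p k` there is at most one column, the one whose box holds `suc k` as a
    -- non-pivot.
    ... | no y≰c with nonPivots-∈ ρ (occ-∈ (nonPivots ρ)
                      (lia (c ∷ y p k ∷ o ∷ []) (λ c y o → y :∸ o :≤ c ⇒ c :< y ⇒ # 1 :≤ o) refl h (ℕ.≰⇒> y≰c)))
    ...   | j , _ , ∈R = drop-∈ (subst (λ z → suc k ∈ drop 1 (atD ρ z [])) j≡ ∈R)
      where
      j≡ : j ≡ c ∸ a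
      j≡ = lia (a ∷ c ∷ count≤ k (mins ρ) ∷ o ∷ j ∷ [])
        (λ a c m o j → m :≡ # 1 :+ j ⇒ (a :+ m) :∸ o :≤ c ⇒ c :< a :+ m ⇒ o :≤ # 1 ⇒ a :≤ c ⇒ j :≡ c :∸ a) refl
        (nonPivot-position bs j ∈R) h (ℕ.≰⇒> y≰c) (occ-bit (nonPivots-Strict bs) (suc k)) a≤c

  occ-reverse : ∀ k xs → occ k (reverse xs) ≡ occ k xs
  occ-reverse k [] = refl
  occ-reverse k (x ∷ xs) rewrite List.unfold-reverse x xs | occ-++ k (reverse xs) (x ∷ []) | occ-reverse k xs with k ≡ᵇ x
  ... | true  = ℕ.+-comm (occ k xs) 1
  ... | false = ℕ.+-identityʳ _

  occ-descending : ∀ u n {k} → k < n → occ (suc k) (descending u n) ≡ u k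
  occ-descending u n {k} k< = trans (cong (occ (suc k)) (sym (reverse-ascending u n)))
    (trans (occ-reverse (suc k) (ascending u n)) (occ-ascending u n k<))

  anyB-++ : ∀ {X : Set} (p : X → Bool) xs ys → anyB p (xs ++ ys) ≡ anyB p xs ∨ anyB p ys
  anyB-++ p []       ys = refl
  anyB-++ p (x ∷ xs) ys with p x
  ... | true  = refl
  ... | false = anyB-++ p xs ys

  tabulate-vec : ∀ (g : ℕ → ℕ) n → tabulate {n = n} (g ∘ toℕ) ≡ vec g n
  tabulate-vec g zero    = refl
  tabulate-vec g (suc n) = cong (g 0 ∷_) (tabulate-vec (g ∘ suc) n)

  vec-cong-< : ∀ {g h} n → (∀ k → k < n → g k ≡ h k) → vec g n ≡ vec h n
  vec-cong-< zero    eq = refl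
  vec-cong-< (suc n) eq = cong₂ _∷_ (eq 0 (s≤s z≤n)) (vec-cong-< n λ k k< → eq (suc k) (s≤s k<))

  vec-Bounded : ∀ {g c} n → (∀ k → g k ≤ c) → Bounded c (vec g n)
  vec-Bounded zero    h = VAll.[]
  vec-Bounded (suc n) h = h 0 VAll.∷ vec-Bounded n (h ∘ suc)

  -- A violating letter `j + 2` finds no free `j + 1`; by `occ-balance` the suffix after it already
  -- has at least as many letters `j + 2` as `j + 1`, and one more breaks the inequality.
  occ≤⇒lattice : ∀ w → (∀ {s} → s ∈ suffixes w → ∀ j → occ (suc (suc j)) s ≤ occ (suc j) s) → violation w ≡ nothing
  occ≤⇒lattice [] h = refl
  occ≤⇒lattice (c ∷ w) h with violation w | occ≤⇒lattice w (h ∘ there)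
  occ≤⇒lattice (zero ∷ w)        h | .nothing | refl = refl
  occ≤⇒lattice (suc zero ∷ w)    h | .nothing | refl = refl
  occ≤⇒lattice (suc (suc j) ∷ w) h | .nothing | refl with A (suc j) w in eq
  ... | suc _ = refl
  ... | zero = ⊥-elim (ℕ.<⇒≱ gt (h (here refl) j))
    where
    lat : violation w ≡ nothing
    lat = occ≤⇒lattice w (h ∘ there)
    gt : occ (suc j) (suc (suc j) ∷ w) < occ (suc (suc j)) (suc (suc j) ∷ w)
    gt = subst₂ _<_ (sym (occ-≢ {suc j} {suc (suc j)} w λ e → ℕ.1+n≢n (sym e))) (sym (occ-≡ (suc (suc j)) w)) (s≤s (ℕ.≤-trans (ℕ.m≤m+n (occ (suc j) w) (B (suc j) w))
      (ℕ.≤-reflexive (trans (occ-balance (suc j) w) (cong (_+ occ (suc (suc j)) w) eq)))))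

  lattice⇒occ≤ : ∀ w → violation w ≡ nothing → ∀ {s} → s ∈ suffixes w → ∀ j → occ (suc (suc j)) s ≤ occ (suc j) s
  lattice⇒occ≤ w h m j = aux w h m
    where
    self : ∀ w → violation w ≡ nothing → occ (suc (suc j)) w ≤ occ (suc j) w
    self w h = ℕ.≤-trans (ℕ.m≤n+m _ (A (suc j) w)) (ℕ.≤-reflexive (trans (sym (occ-balance (suc j) w))
      (trans (cong (λ z → occ (suc j) w + z) (violation-nothing w h j)) (ℕ.+-identityʳ _))))
    tail : ∀ c w → violation (c ∷ w) ≡ nothing → violation w ≡ nothing
    tail c w h with violation w
    ... | nothing = refl
    aux : ∀ w → violation w ≡ nothing → ∀ {s} → s ∈ suffixes w → occ (suc (suc j)) s ≤ occ (suc j) s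
    aux []      h (here refl) = z≤n
    aux (c ∷ w) h (here refl) = self (c ∷ w) h
    aux (c ∷ w) h (there m)   = aux w (tail c w h) m

  occ-beyond : ∀ w {k} → maxL w < k → occ k w ≡ 0
  occ-beyond [] h = refl
  occ-beyond (c ∷ w) h = trans (occ-≢ w (λ e → ℕ.<⇒≱ h (subst (_≤ c ⊔ maxL w) (sym e) (ℕ.m≤m⊔n c (maxL w)))))
    (occ-beyond w (ℕ.≤-trans (s≤s (ℕ.m≤n⊔m c (maxL w))) h))

  suffix-maxL : ∀ w {s} → s ∈ suffixes w → maxL s ≤ maxL w
  suffix-maxL []      (here refl) = ℕ.≤-refl
  suffix-maxL (c ∷ w) (here refl) = ℕ.≤-refl
  suffix-maxL (c ∷ w) (there m)   = ℕ.≤-trans (suffix-maxL w m) (ℕ.m≤n⊔m c (maxL w))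

  -- Adjacent letters suffice by transitivity, and letters above the maximum of the word do not
  -- occur in any suffix.
  isRevLattice-isLattice : ∀ w → isRevLattice w ≡ isLattice w
  isRevLattice-isLattice w = bool-≡ to from′
    where
    test : Word → ℕ → ℕ → Bool
    test s a b = not (a <ᵇ b) ∨ (occ b s ≤ᵇ occ a s)
    is-lattice : violation w ≡ nothing → isLattice w ≡ true
    is-lattice eq with violation w
    ... | nothing = refl
    lattice-is : isLattice w ≡ true → violation w ≡ nothing
    lattice-is h with violation w
    ... | nothing = refl
    to : isRevLattice w ≡ true → isLattice w ≡ true
    to h = is-lattice (occ≤⇒lattice w λ {s} m j → adjacent s m j)
      where
      adjacent : ∀ s → s ∈ suffixes w → ∀ j → occ (suc (suc j)) s ≤ occ (suc j) s
      adjacent s m j with suc (suc j) ≤? maxL w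
      ... | no ¬p = subst (_≤ occ (suc j) s) (sym (occ-beyond s (ℕ.≤-trans (s≤s (suffix-maxL w m)) (ℕ.≰⇒> ¬p)))) z≤n
      ... | yes p = ≤ᵇ⁻ (implies⁻ (allB⁻ (test s (suc j)) (allB⁻ (λ a → allB (test s a) (range1 (maxL w)))
          (allB⁻ (λ s → allB (λ a → allB (test s a) (range1 (maxL w))) (range1 (maxL w))) h m)
          (range1-∈⁺ (s≤s z≤n) (ℕ.<⇒≤ p))) (range1-∈⁺ (s≤s z≤n) p)) (≤ᵇ-true (ℕ.≤-refl {suc (suc j)})))
    from′ : isLattice w ≡ true → isRevLattice w ≡ true
    from′ h = allB⁺ _ (suffixes w) λ {s} m → allB⁺ _ (range1 (maxL w)) λ {a} a∈ → allB⁺ _ (range1 (maxL w)) λ {b} _ →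
      implies⁺ λ a<b → ≤ᵇ-true (chain s m a b (proj₁ (range1-∈⁻ a∈)) (<ᵇ⁻ a<b))
      where
      chain : ∀ s → s ∈ suffixes w → ∀ a b → 1 ≤ a → a < b → occ b s ≤ occ a s
      chain s m a (suc b) 1≤a (s≤s a≤b) with ℕ.m≤n⇒m<n∨m≡n a≤b
      chain s m (suc a) (suc .(suc a)) 1≤a _ | inj₂ refl = lattice⇒occ≤ w (lattice-is h) m a
      chain s m a (suc (suc b)) 1≤a _ | inj₁ a<b =
        ℕ.≤-trans (lattice⇒occ≤ w (lattice-is h) m b) (chain s m a (suc b) 1≤a a<b)

  module Multiplicities (n : ℕ) (la mu : List ℕ) (skew : IsSkewShape la mu) (γ θ : Vec ℕ (length la)) where
    open Family n la mu skew γ θ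
    open RowsOK

    level : ∀ {T} r → Valid n C (shapes r) (stack T r) → ∀ s → s < r →
      Row n (a s) (b s) (θ′ s) (prof T s) × Below n (equalities s) (thresholds n C (stack T s)) (prof T s)
    level (suc r) (rb ∷ v) s s< with s ≟ r
    ... | yes refl = rb
    ... | no s≢r   = level r v s (ℕ.≤∧≢⇒< (ℕ.≤-pred s<) s≢r)

    module Columns {T : Filling} (mem : Member T) (k : ℕ) (k<n : k < n) where
      private
        ok = Good.rowsOK (Member.isGood mem)
        lev = level {T} N (Member.isValid mem)
        X : ℕ → ℕ → ℕ
        X r = thresholds n C (stack T r)
        p : ℕ → Profile
        p = prof T

      occupied : ℕ → ℕ → Bool
      occupied j r = inShape n la mu r j ∧ memB (suc k) (get n la mu T r j)

      covered : ℕ → ℕ → Bool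
      covered r j = anyB (occupied j) (upTo r)

      occupied-between : ∀ r → r < N → ∀ j → occupied j r ≡ between (x (p r) k) (y (p r) (suc k)) j
      occupied-between r r< j = bool-≡
        (λ t → let (t₁ , t₂) = ∧-split {inShape n la mu r j} t
                   (a≤j , j<b) = between-sound {a r} {b r} {j} t₁
                   (h , h′) = letter⇒ (boxes ok r r<) (a r) (b r) (length-r ok r r<) a≤j j<b (memB⁻ t₂)
               in between-true h h′)
        (λ t → let (h , h′) = between-sound {x (p r) k} {y (p r) (suc k)} {j} t
                   a≤j = ℕ.≤-trans (Ceiling.a≤X (Rowwise.U ok r r<) k k<n) h
                   j<b = ℕ.≤-trans h′ (Floor.y≤b (Rowwise.L ok r r<) (suc k))
               in ∧-join (between-true a≤j j<b) (memB⁺ (letter⇐ (boxes ok r r<) (a r) (b r) (length-r ok r r<) a≤j j<b h h′)))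

      covered-suc : ∀ r j → covered (suc r) j ≡ covered r j ∨ occupied j r
      covered-suc r j = trans (cong (anyB (occupied j)) (sym (List.upTo-∷ʳ r)))
        (trans (anyB-++ (occupied j) (upTo r) (r ∷ [])) (cong (covered r j ∨_) (∨-false (occupied j r))))
        where
        ∨-false : ∀ z → z ∨ false ≡ z
        ∨-false true  = refl
        ∨-false false = refl

      -- Going down, the interval of columns with a given letter starts further and further left,
      -- since `x ≤ y ≤ X`.
      covered-≥ : ∀ r → r ≤ N → ∀ j → covered r j ≡ true → X r k ≤ j
      covered-≥ (suc r) r< j h with covered r j in eq | trans (sym (covered-suc r j)) h
      ... | true | _ = ℕ.≤-trans (ℕ.m∸n≤m (y (p r) k) (ε (p r) (suc k)))
            (ℕ.≤-trans (under (proj₂ (lev r r<)) k (ℕ.<⇒≤ k<n)) (covered-≥ r (ℕ.<⇒≤ r<) j eq))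
      ... | false | h′ = proj₁ (between-sound {x (p r) k} {y (p r) (suc k)} {j} (trans (sym (occupied-between r r< j)) h′))

      -- The row directly above already contains the letter in such a column: its own interval
      -- starts at the threshold, and it ends no earlier because `y (k + 1)` of the lower row is at
      -- most the threshold at `k + 1`.
      ≥-covered : ∀ r → r < N → ∀ j → X r k ≤ j → j < y (p r) (suc k) → covered r j ≡ true
      ≥-covered zero    r< j h h′ = ⊥-elim (ℕ.<⇒≱ h′ (ℕ.≤-trans (Rowwise.y≤C ok 0 r< (suc k)) h))
      ≥-covered (suc s) r< j h h′ rewrite covered-suc s j | occupied-between s (ℕ.<⇒≤ r<) j
        | between-true {x (p s) k} {y (p s) (suc k)} {j} h
            (ℕ.≤-trans h′ (ℕ.≤-trans (under (proj₂ (lev (suc s) r<)) (suc k) k<n) (ℕ.m∸n≤m (y (p s) (suc k)) (ε (p s) (suc (suc k)))))) with covered s j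
      ... | true  = refl
      ... | false = refl

      -- A row adds exactly its columns before the threshold, the same cut that `pivots` makes. Thus
      -- a letter is read once for every column that contains it.
      new : ∀ r → r < N → ∀ j → indicator (covered (suc r) j) ≡
        indicator (covered r j) + indicator (between (x (p r) k) (y (p r) (suc k) ⊓ X r k) j)
      new r r< j rewrite covered-suc r j | occupied-between r r< j with covered r j in eq
      ... | true rewrite between-false {x (p r) k} {y (p r) (suc k) ⊓ X r k} {j}
              (λ (_ , h) → ℕ.<⇒≱ (ℕ.≤-trans h (ℕ.m⊓n≤n _ _)) (covered-≥ r (ℕ.<⇒≤ r<) j eq)) = refl
      ... | false = cong indicator (bool-≡
              (λ t → let (h , h′) = between-sound {x (p r) k} {y (p r) (suc k)} {j} t in
                between-true h (ℕ.⊓-glb h′ (ℕ.≰⇒> λ X≤j → contra (trans (sym eq) (≥-covered r r< j X≤j h′)))))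
              (λ t → let (h , h′) = between-sound {x (p r) k} {y (p r) (suc k) ⊓ X r k} {j} t in
                between-true h (ℕ.≤-trans h′ (ℕ.m⊓n≤m _ _))))
        where
        contra : false ≡ true → ⊥
        contra ()

      count-covered : ∀ r → r ≤ N → total (λ j → indicator (covered r j)) C ≡ occ (suc k) (stackWord n C (stack T r))
      count-covered zero    _  = total-zero C λ _ _ → refl
      count-covered (suc r) r< = trans (total-cong C λ j _ → new r r< j) (trans (total-+ _ _ C)
        (trans (cong₂ _+_ (count-covered r (ℕ.<⇒≤ r<)) (trans (total-between (x (p r) k) _ 0 C z≤n) piece))
        (trans (ℕ.+-comm (occ (suc k) (stackWord n C (stack T r))) _) (sym (occ-++ (suc k) (wordBelow n (X r) (p r)) _)))))
        where
        R = proj₁ (lev r r<)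
        piece : ((y (p r) (suc k) ⊓ X r k) ⊓ (0 + C)) ∸ x (p r) k ≡ occ (suc k) (wordBelow n (X r) (p r))
        piece = trans (lia (y (p r) (suc k) ∷ X r k ∷ C ∷ y (p r) k ∷ ε (p r) (suc k) ∷ a r ∷ [])
            (λ y′ X C y e a → y′ :≤ C ⇒ y :≤ y′ ⇒ y :≤ X ⇒ e :+ a :≤ y ⇒
              ((y′ :⊓ X) :⊓ (# 0 :+ C)) :∸ (y :∸ e) :≡ e :+ ((y′ :⊓ X) :∸ y)) refl
            (Rowwise.y≤C ok r r< (suc k)) (mono R k k<n) (under (proj₂ (lev r r<)) k (ℕ.<⇒≤ k<n)) (room R k k<n))
          (sym (trans (occ-++ (suc k) (descending _ n) _) (cong₂ _+_ (occ-descending _ n k<n) (occ-ascending _ n k<n))))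

      count-column : countB (λ j → anyB (λ r → inShape n la mu r j ∧ memB (suc k) (get n la mu T r j)) (rowsR n la mu)) (colsR n la mu)
                     ≡ occ (suc k) (readWord n la mu T)
      count-column = trans (countB-applyUpTo _ id C) (trans (count-covered N ℕ.≤-refl) (cong (occ (suc k)) (sym (read-member mem))))

    ircont-content : ∀ {T} → Member T → ircont n la mu T ≡ content n (readWord n la mu T)
    ircont-content {T} mem = trans (tabulate-vec _ n) (vec-cong-< n λ k k<n → Columns.count-column mem k k<n)

    countB-length : ∀ {X : Set} (p : X → Bool) xs → countB p xs ≤ length xs
    countB-length p [] = z≤n
    countB-length p (x ∷ xs) with p x
    ... | true  = s≤s (countB-length p xs)
    ... | false = ℕ.m≤n⇒m≤1+n (countB-length p xs)

    -- Every multiplicity counts columns, which explains the bound `at la 0` on the parts of the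
    -- partitions in the theorem.
    content-bounded : ∀ {w} → w ∈ words → Bounded C (content n w)
    content-bounded w∈ with ∈-map⁻ (readWord n la mu) w∈
    ... | T , T∈ , refl = subst (Bounded C) (trans (sym (tabulate-vec column n)) (ircont-content (member⁻ T∈)))
      (vec-Bounded n λ k → ℕ.≤-trans (countB-length _ (colsR n la mu)) (ℕ.≤-reflexive (List.length-upTo C)))
      where
      column : ℕ → ℕ
      column k = countB (λ j → anyB (λ r → inShape n la mu r j ∧ memB (suc k) (get n la mu T r j)) (rowsR n la mu)) (colsR n la mu)

    selected-ircont : ∀ {T} → T ∈ fillings n la mu → ∀ (α : Vec ℕ n) → selected T ∧ eqVecᵇ (content n (readWord n la mu T)) α ≡
      isSVRPP n la mu T ∧ eqVecᵇ (ircont n la mu T) α ∧ eqVecᵇ (ceq n la mu T) γ ∧ eqVecᵇ (ex n la mu T) θ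
    selected-ircont {T} T∈ α with selected T in sel
    ... | true rewrite sym (ircont-content (member⁻ (∈-filterB⁺ selected T∈ sel))) =
            sym (shuffle (isSVRPP n la mu T) (eqVecᵇ (ircont n la mu T) α) (eqVecᵇ (ceq n la mu T) γ) (eqVecᵇ (ex n la mu T) θ) sel)
      where
      shuffle : ∀ s i c e → s ∧ c ∧ e ≡ true → s ∧ i ∧ c ∧ e ≡ i
      shuffle true true  true true refl = refl
      shuffle true false true true refl = refl
    ... | false = sym (shuffle (isSVRPP n la mu T) (eqVecᵇ (ircont n la mu T) α) (eqVecᵇ (ceq n la mu T) γ) (eqVecᵇ (ex n la mu T) θ) sel)
      where
      shuffle : ∀ s i c e → s ∧ c ∧ e ≡ false → s ∧ i ∧ c ∧ e ≡ false
      shuffle false i     c e h = refl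
      shuffle true  false c e h = refl
      shuffle true  true  c e h = h

    coeffG-multiplicity : ∀ α → coeffG n la mu α γ θ ≡ multiplicity words α
    coeffG-multiplicity α = sym (trans (countB-map _ (readWord n la mu) family) (trans (countB-filterB _ selected (fillings n la mu))
      (countB-cong (fillings n la mu) λ T∈ → selected-ircont T∈ α)))

    H-latticeMultiplicity : ∀ ν → H n la mu ν γ θ ≡ latticeMultiplicity words ν
    H-latticeMultiplicity ν = sym (trans (countB-map _ (readWord n la mu) family) (trans (countB-filterB _ selected (fillings n la mu))
      (countB-cong (fillings n la mu) λ {T} T∈ → trans
        (assoc₁ (selected T) (eqVecᵇ (content n (readWord n la mu T)) ν) (isLattice (readWord n la mu T)))
        (trans (cong₂ _∧_ (selected-ircont T∈ ν) (sym (isRevLattice-isLattice (readWord n la mu T))))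
        (assoc₂ (isSVRPP n la mu T) (eqVecᵇ (ircont n la mu T) ν) (eqVecᵇ (ceq n la mu T) γ) (eqVecᵇ (ex n la mu T) θ) _)))))
      where
      assoc₁ : ∀ s c l → s ∧ c ∧ l ≡ (s ∧ c) ∧ l
      assoc₁ true  c l = refl
      assoc₁ false c l = refl
      assoc₂ : ∀ s i c e l → (s ∧ i ∧ c ∧ e) ∧ l ≡ s ∧ i ∧ c ∧ e ∧ l
      assoc₂ false i     c     e l = refl
      assoc₂ true  false c     e l = refl
      assoc₂ true  true  false e l = refl
      assoc₂ true  true  true  e l = refl

-- A straight shape without excess and equalities has exactly one lattice word.

module Tableaux where
  open import Defs hiding (rowWord; content)
  open LIA using (lia; :⊥; _:≤_; _:<_; _:≡_; _⇒_; #_; _:+_; _:∸_)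
  open Counting hiding ([_])
  open Words hiding (to)
  open Crystal
  open RowWords hiding (low)
  open Profiles
  open Rows hiding (module Distributed; boxes; mins≡; nonPivots≡)
  open Reading
  open Fillings
  open Statistics
  open import Data.Nat using (ℕ; zero; suc; _+_; _∸_; _≤_; _<_; z≤n; s≤s; _≟_; _≤?_; _<?_; _<ᵇ_)
  import Data.Nat.Properties as ℕ
  import Data.Integer as ℤ
  open import Data.Bool using (true; false; _∧_; if_then_else_)
  open import Data.Maybe using (just; nothing)
  open import Data.List using (List; []; _∷_; _++_; length; replicate)
  import Data.List.Properties as List
  open import Data.List.Membership.Propositional using (_∈_)
  open import Data.List.Membership.Propositional.Properties using (∈-map⁻)
  open import Data.List.Relation.Unary.All as All using ([]; _∷_)
  open import Data.Vec as Vec using (Vec; []; _∷_; toList)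
  import Data.Vec.Properties as Vec
  open import Data.Product using (_×_; _,_; proj₁; proj₂)
  open import Data.Sum using (_⊎_; inj₁; inj₂)
  open import Data.Empty using (⊥; ⊥-elim)
  open import Relation.Nullary using (yes; no)
  open import Relation.Binary.PropositionalEquality hiding ([_]; J)

  total≡0 : ∀ {g} n → total g n ≡ 0 → ∀ k → k < n → g k ≡ 0
  total≡0 {g} (suc n) h k k< with k ≟ n
  ... | yes refl = ℕ.m+n≡0⇒n≡0 (total g n) h
  ... | no k≢n   = total≡0 n (ℕ.m+n≡0⇒m≡0 (total g n) h) k (ℕ.≤∧≢⇒< (ℕ.≤-pred k<) k≢n)

  ascending-empty : ∀ {u} n → (∀ k → k < n → u k ≡ 0) → ascending u n ≡ []
  ascending-empty zero    h = refl
  ascending-empty (suc n) h rewrite h n ℕ.≤-refl = trans (List.++-identityʳ _) (ascending-empty n λ k k< → h k (ℕ.m≤n⇒m≤1+n k<))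

  descending-empty : ∀ {u} n → (∀ k → k < n → u k ≡ 0) → descending u n ≡ []
  descending-empty zero    h = refl
  descending-empty (suc n) h rewrite h n ℕ.≤-refl = descending-empty n λ k k< → h k (ℕ.m≤n⇒m≤1+n k<)

  ascending-single : ∀ {u} n r → r < n → (∀ k → k < n → k ≢ r → u k ≡ 0) → ascending u n ≡ replicate (u r) (suc r)
  ascending-single {u} (suc n) r r< h with r ≟ n
  ... | yes refl = cong (_++ replicate (u n) (suc n)) (ascending-empty n λ k k< → h k (ℕ.m≤n⇒m≤1+n k<) (ℕ.<⇒≢ k<))
  ... | no r≢n rewrite h n ℕ.≤-refl (≢-sym r≢n) = trans (List.++-identityʳ _)
    (ascending-single n r (ℕ.≤∧≢⇒< (ℕ.≤-pred r<) r≢n) λ k k< → h k (ℕ.m≤n⇒m≤1+n k<))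

  A≤occ : ∀ i w → A i w ≤ occ i w
  A≤occ i [] = z≤n
  A≤occ i (c ∷ w) with kind i c | kindView i c
  ... | .lo  | lo rewrite occ-≡ i w = s≤s (A≤occ i w)
  ... | .hi  | hi rewrite occ-≢ w (λ (p : i ≡ suc i) → ℕ.1+n≢n (sym p)) = ℕ.≤-trans (ℕ.m∸n≤m (A i w) 1) (A≤occ i w)
  ... | .other | other p _ rewrite occ-≢ w (≢-sym p) = A≤occ i w

  violation-suffix : ∀ xs w → violation (xs ++ w) ≡ nothing → violation w ≡ nothing
  violation-suffix []       w h = h
  violation-suffix (c ∷ xs) w h = violation-suffix xs w (tail c (xs ++ w) h)
    where
    tail : ∀ c w → violation (c ∷ w) ≡ nothing → violation w ≡ nothing
    tail c w h with violation w
    ... | nothing = refl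

  -- The reading word of the tableau whose r-th row (counted from 0) consists of letters r + 1.
  yamanouchi : (ℕ → ℕ) → ℕ → Word
  yamanouchi b zero    = []
  yamanouchi b (suc r) = replicate (b r) (suc r) ++ yamanouchi b r

  occ-yamanouchi-≥ : ∀ b r {k} → r ≤ k → occ (suc k) (yamanouchi b r) ≡ 0
  occ-yamanouchi-≥ b zero    h = refl
  occ-yamanouchi-≥ b (suc r) {k} h = trans (occ-++ (suc k) (replicate (b r) (suc r)) _)
    (cong₂ _+_ (occ-replicate-≢ (b r) (λ e → ℕ.<⇒≢ h (sym (ℕ.suc-injective e)))) (occ-yamanouchi-≥ b r (ℕ.<⇒≤ h)))

  occ-yamanouchi : ∀ b r {k} → k < r → occ (suc k) (yamanouchi b r) ≡ b k
  occ-yamanouchi b (suc r) {k} k< = trans (occ-++ (suc k) (replicate (b r) (suc r)) _) (go (k ≟ r))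
    where
    go : Relation.Nullary.Dec (k ≡ r) → occ (suc k) (replicate (b r) (suc r)) + occ (suc k) (yamanouchi b r) ≡ b k
    go (yes refl) = trans (cong₂ _+_ (occ-replicate (b r) (suc r)) (occ-yamanouchi-≥ b r ℕ.≤-refl)) (ℕ.+-identityʳ _)
    go (no k≢r)   = cong₂ _+_ (occ-replicate-≢ (b r) (λ e → k≢r (ℕ.suc-injective e))) (occ-yamanouchi b r (ℕ.≤∧≢⇒< (ℕ.≤-pred k<) k≢r))

  A-yamanouchi : ∀ b r → A (suc r) (yamanouchi b r) ≡ 0
  A-yamanouchi b r = ℕ.n≤0⇒n≡0 (subst (A (suc r) (yamanouchi b r) ≤_) (occ-yamanouchi-≥ b r ℕ.≤-refl) (A≤occ (suc r) (yamanouchi b r)))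

  -- The letters `s + 2` of a row meet the `b s` free letters `s + 1` of the row above, and there
  -- are at most that many of them.
  violation-yamanouchi : ∀ b → (∀ r → b (suc r) ≤ b r) → ∀ r → violation (yamanouchi b r) ≡ nothing
  violation-yamanouchi b dec zero = refl
  violation-yamanouchi b dec (suc zero) = ones (b 0)
    where
    ones : ∀ k → violation (replicate k 1 ++ []) ≡ nothing
    ones zero    = refl
    ones (suc k) rewrite ones k = refl
  violation-yamanouchi b dec (suc (suc s)) = go (violation-yamanouchi b dec (suc s)) (b (suc s)) (dec s)
    where
    w = yamanouchi b (suc s)
    free : A (suc s) w ≡ b s
    free = trans (A-los (suc s) (b s) (yamanouchi b s)) (trans (cong (b s +_) (A-yamanouchi b s)) (ℕ.+-identityʳ _))
    go : violation w ≡ nothing → ∀ k → k ≤ b s → violation (replicate k (suc (suc s)) ++ w) ≡ nothing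
    go ih zero    _ = ih
    go ih (suc k) h rewrite go ih k (ℕ.<⇒≤ h) with A (suc s) (replicate k (suc (suc s)) ++ w) in eq
    ... | suc _ = refl
    ... | zero = ⊥-elim (lia (b s ∷ k ∷ []) (λ b k → # 1 :+ k :≤ b ⇒ b :∸ k :≡ # 0 ⇒ :⊥) refl h
                   (trans (cong (_∸ k) (sym free)) (trans (sym (A-his (suc s) k w)) eq)))

  at-replicate : ∀ n r → at (toList (Vec.replicate n 0)) r ≡ 0
  at-replicate zero    r       = refl
  at-replicate (suc n) zero    = refl
  at-replicate (suc n) (suc r) = at-replicate n r

  module Straight (n : ℕ) (ν : Vec ℕ n) (skew : IsSkewShape (toList ν) []) where

    zeros : Vec ℕ (length (toList ν))
    zeros = Vec.replicate _ 0

    open Family n (toList ν) [] skew zeros zeros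
    open Multiplicities n (toList ν) [] skew zeros zeros

    N≡n : N ≡ n
    N≡n = Vec.length-toList ν

    equalities≡0 : ∀ r → equalities r ≡ 0
    equalities≡0 zero    = refl
    equalities≡0 (suc r) = at-replicate N r

    θ≡0 : ∀ r → θ′ r ≡ 0
    θ≡0 r = at-replicate N r

    lastZero : LastZero
    lastZero r _ _ = at-replicate N r

    -- The profile of a row of length b r filled with letters r + 1.
    superstandard : ℕ → Profile
    superstandard r = profile (λ k → if r <ᵇ k then b r else 0) (λ _ → 0)

    superstandards : ℕ → List Profile
    superstandards zero    = []
    superstandards (suc r) = superstandard r ∷ superstandards r

    <ᵇ-true : ∀ {m k} → m < k → (m <ᵇ k) ≡ true
    <ᵇ-true h = ≤ᵇ-true h

    <ᵇ-false : ∀ {m k} → k ≤ m → (m <ᵇ k) ≡ false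
    <ᵇ-false h = ≤ᵇ-false (s≤s h)

    above : ∀ r {k} → r < k → y (superstandard r) k ≡ b r
    above r h rewrite <ᵇ-true h = refl

    upto : ∀ r {k} → k ≤ r → y (superstandard r) k ≡ 0
    upto r h rewrite <ᵇ-false h = refl

    y≤b : ∀ r k → y (superstandard r) k ≤ b r
    y≤b r k with r <ᵇ k
    ... | true  = ℕ.≤-refl
    ... | false = z≤n

    superstandard-Row : ∀ r → r < n → Row n 0 (b r) (θ′ r) (superstandard r)
    superstandard-Row r r< = mkRow (upto r z≤n) (above r r<) mono′ (λ _ _ → z≤n) (λ _ → z≤n) refl
      (trans (total-zero n λ _ _ → refl) (sym (θ≡0 r)))
      where
      mono′ : ∀ k → k < n → y (superstandard r) k ≤ y (superstandard r) (suc k)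
      mono′ k _ with r <? k
      ... | yes h rewrite above r h | above r (ℕ.m≤n⇒m≤1+n h) = ℕ.≤-refl
      ... | no h rewrite upto r (ℕ.≮⇒≥ h) = z≤n

    -- The shift from `k` to `k + 1` expresses column strictness: it yields the order of the rows
    -- and the absence of equalities at once.
    shifted≤ : ∀ r k → y (superstandard r) (suc k) ≤ thresholds n C (superstandards r) k
    shifted≤ zero    k = ℕ.≤-trans (y≤b 0 (suc k)) (b≤C 0)
    shifted≤ (suc s) k with s <? k
    ... | yes h rewrite above s h = ℕ.≤-trans (y≤b (suc s) (suc k)) (b-mono s)
    ... | no h rewrite upto (suc s) (s≤s (ℕ.≮⇒≥ h)) = z≤n

    superstandard-valid : ∀ r → r ≤ n → Valid n C (shapes r) (superstandards r)
    superstandard-valid zero    _  = []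
    superstandard-valid (suc r) r< = (superstandard-Row r r< , mkBelow
        (λ k k≤ → ℕ.≤-trans (rising k) (shifted≤ r k))
        (trans (total-zero n λ k _ → ℕ.m≤n⇒m∸n≡0 (shifted≤ r k)) (sym (equalities≡0 r))))
      ∷ superstandard-valid r (ℕ.<⇒≤ r<)
      where
      rising : ∀ k → y (superstandard r) k ≤ y (superstandard r) (suc k)
      rising k with r <? k
      ... | yes h rewrite above r h | above r (ℕ.m≤n⇒m≤1+n h) = ℕ.≤-refl
      ... | no h rewrite upto r (ℕ.≮⇒≥ h) = z≤n

    superstandard-word : ∀ r → r ≤ n → stackWord n C (superstandards r) ≡ yamanouchi b r
    superstandard-word zero    _  = refl
    superstandard-word (suc r) r< = cong₂ _++_ (trans (cong (_++ ascending (pivots (thresholds n C (superstandards r)) (superstandard r)) n) (descending-empty n λ _ _ → refl))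
        (trans (ascending-single n r r< others) (cong (λ z → replicate z (suc r)) single))) (superstandard-word r (ℕ.<⇒≤ r<))
      where
      pivots-shift : ∀ k → pivots (thresholds n C (superstandards r)) (superstandard r) k ≡ y (superstandard r) (suc k) ∸ y (superstandard r) k
      pivots-shift k = cong (_∸ y (superstandard r) k) (ℕ.m≤n⇒m⊓n≡m (shifted≤ r k))
      others : ∀ k → k < n → k ≢ r → pivots (thresholds n C (superstandards r)) (superstandard r) k ≡ 0
      others k _ k≢r with r <? k
      ... | yes h = trans (pivots-shift k) (trans (cong₂ _∸_ (above r (ℕ.m≤n⇒m≤1+n h)) (above r h)) (ℕ.n∸n≡0 (b r)))
      ... | no h  = trans (pivots-shift k) (trans (cong (_∸ y (superstandard r) k) (upto r (ℕ.≤∧≢⇒< (ℕ.≮⇒≥ h) k≢r))) (ℕ.0∸n≡0 (y (superstandard r) k)))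
      single : pivots (thresholds n C (superstandards r)) (superstandard r) r ≡ b r
      single = trans (pivots-shift r) (cong₂ _∸_ (above r ℕ.≤-refl) (upto r ℕ.≤-refl))

    yamanouchi-∈ : yamanouchi b n ∈ words
    yamanouchi-∈ = subst (_∈ words) (superstandard-word n ℕ.≤-refl)
      (realise-stack lastZero (subst (λ z → Valid n C (shapes z) (superstandards n)) (sym N≡n) (superstandard-valid n ℕ.≤-refl)))

    -- A lattice word in the family has only letters r + 1 in row r: smaller letters are excluded by column strictness,
    -- and a larger letter would have no partner to its right.
    module _ {T : Filling} where
      data Forced : ℕ → Set where
        none : Forced 0
        step  : ∀ {r} → (∀ k → k ≤ r → y (prof T r) k ≡ 0) → (∀ k → k ≤ n → ε (prof T r) (suc k) ≡ 0) → Forced (suc r)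

      forced : ∀ r → r ≤ n → Valid n C (shapes r) (stack T r) → violation (stackWord n C (stack T r)) ≡ nothing →
        stackWord n C (stack T r) ≡ yamanouchi b r × Forced r
      forced zero    _  v lat = refl , none
      forced (suc r) r< ((R , bl) ∷ v) lat = trans wordEq (cong₂ _++_ (cong (λ z → replicate z (suc r)) u-r) (proj₁ ih)) , step low noε
        where
        p = prof T r
        X = thresholds n C (stack T r)
        u = pivots X p
        w = stackWord n C (stack T r)
        ih = forced r (ℕ.<⇒≤ r<) v (violation-suffix (wordBelow n X p) w lat)
        noε : ∀ k → k ≤ n → ε p (suc k) ≡ 0
        noε k k≤ with ℕ.m≤n⇒m<n∨m≡n k≤
        ... | inj₁ k< = total≡0 n (trans (size R) (θ≡0 r)) k k<
        ... | inj₂ refl = last R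
        strict : ∀ k → k < n → y p (suc k) ≤ X k
        strict k k< = ℕ.m∸n≡0⇒m≤n (total≡0 n (trans (equality bl) (equalities≡0 r)) k k<)
        low-suc : ∀ r → Forced r → (∀ k → k < n → y p (suc k) ≤ thresholds n C (stack T r) k) → r < n → ∀ k → suc k ≤ r → y p (suc k) ≡ 0
        low-suc (suc s) (step z _) st r< k (s≤s k≤) = ℕ.n≤0⇒n≡0 (ℕ.≤-trans (st k (ℕ.≤-trans (s≤s k≤) (ℕ.<⇒≤ r<)))
          (ℕ.≤-trans (ℕ.m∸n≤m (y (prof T s) k) (ε (prof T s) (suc k))) (ℕ.≤-reflexive (z k k≤))))
        low : ∀ k → k ≤ r → y p k ≡ 0
        low zero    _ = Row.start R
        low (suc k) h = low-suc r (proj₂ ih) strict r< k h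
        u≡ : ∀ k → k < n → u k ≡ y p (suc k) ∸ y p k
        u≡ k k< = cong (_∸ y p k) (ℕ.m≤n⇒m⊓n≡m (strict k k<))
        u-low : ∀ k → k < r → u k ≡ 0
        u-low k k< = trans (u≡ k (ℕ.<-trans k< r<)) (trans (cong (_∸ y p k) (low (suc k) k<)) (ℕ.0∸n≡0 (y p k)))
        latI : violation (ascending u n ++ w) ≡ nothing
        latI = subst (λ z → violation z ≡ nothing) (trans (List.++-assoc (descending _ n) (ascending u n) w)
          (cong (_++ (ascending u n ++ w)) (descending-empty n λ k k< → noε k (ℕ.<⇒≤ k<)))) lat
        -- By induction the rows above contain letters up to `r` only, so they offer no free letter
        -- to anything larger than `r + 1`.
        partner : ∀ m → r < m → A m w ≡ 0
        partner m r<m = trans (cong (A m) (proj₁ ih)) (ℕ.n≤0⇒n≡0 (subst (A m (yamanouchi b r) ≤_) (absent m r<m) (A≤occ m (yamanouchi b r))))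
          where
          absent : ∀ m → r < m → occ m (yamanouchi b r) ≡ 0
          absent (suc m) (s≤s h) = occ-yamanouchi-≥ b r h
        -- Descending induction on the letter: once all larger ones are gone, a letter `m + 1` would
        -- stand directly before `w` and be unmatched. The alternative `m ≤ r` ends the descent.
        u-high : ∀ d m → m + d ≡ n → violation (ascending u m ++ w) ≡ nothing × (∀ k → m ≤ k → k < n → u k ≡ 0) ⊎ m ≤ r
        u-high zero m e = inj₁ (subst (λ z → violation (ascending u z ++ w) ≡ nothing) (trans (sym e) (ℕ.+-identityʳ m)) latI ,
          λ k h k< → ⊥-elim (ℕ.<⇒≱ k< (subst (_≤ k) (trans (sym (ℕ.+-identityʳ m)) e) h)))
        u-high (suc d) m e with m ≤? r
        ... | yes h = inj₂ h
        ... | no m≰r with u-high d (suc m) (trans (sym (ℕ.+-suc m d)) e)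
        ...   | inj₂ h = inj₂ (ℕ.<⇒≤ h)
        ...   | inj₁ (lat′ , zs) = inj₁ (subst (λ z → violation (z ++ w) ≡ nothing) (trans (cong (λ z → ascending u m ++ replicate z (suc m)) um≡0) (List.++-identityʳ _)) lat′ ,
                λ k h k< → zeroAt k h k<)
          where
          r<m = ℕ.≰⇒> m≰r
          tail : violation (replicate (u m) (suc m) ++ w) ≡ nothing
          tail = violation-suffix (ascending u m) _ (subst (λ z → violation z ≡ nothing) (List.++-assoc (ascending u m) _ w) lat′)
          um≡0 : u m ≡ 0
          um≡0 = go m (u m) r<m tail
            where
            go : ∀ m j → r < m → violation (replicate j (suc m) ++ w) ≡ nothing → j ≡ 0
            go m       zero    _ _ = refl
            go (suc m) (suc j) h t = ⊥-elim (1≢0 (trans (sym one) (violation-nothing (suc (suc m) ∷ replicate j (suc (suc m)) ++ w) t m)))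
              where
              one : B (suc m) (suc (suc m) ∷ replicate j (suc (suc m)) ++ w) ≡ suc (B (suc m) (replicate j (suc (suc m)) ++ w))
              one rewrite kind-hi (suc m) | A-his (suc m) j w | partner (suc m) h | ℕ.0∸n≡0 j = refl
              1≢0 : ∀ {z} → suc z ≢ 0
              1≢0 ()
          zeroAt : ∀ k → m ≤ k → k < n → u k ≡ 0
          zeroAt k h k< with ℕ.m≤n⇒m<n∨m≡n h
          ... | inj₁ m<k  = zs k m<k k<
          ... | inj₂ refl = um≡0
        u-high′ : ∀ k → r < k → k < n → u k ≡ 0
        u-high′ with u-high (n ∸ suc r) (suc r) (ℕ.m+[n∸m]≡n r<)
        ... | inj₁ (_ , zs) = zs
        ... | inj₂ h = ⊥-elim (ℕ.<⇒≱ ℕ.≤-refl h)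
        high : ∀ d k → k + d ≡ n → r < k → y p k ≡ b r
        high zero    k e h = trans (cong (y p) (trans (sym (ℕ.+-identityʳ k)) e)) (end R)
        high (suc d) k e h = trans (ℕ.≤-antisym (mono R k k<n) (ℕ.m∸n≡0⇒m≤n (trans (sym (u≡ k k<n)) (u-high′ k h k<n))))
            (high d (suc k) (trans (sym (ℕ.+-suc k d)) e) (ℕ.m≤n⇒m≤1+n h))
          where k<n = lia (k ∷ d ∷ n ∷ []) (λ k d n → k :+ (# 1 :+ d) :≡ n ⇒ k :< n) refl e
        u-r : u r ≡ b r
        u-r = trans (u≡ r r<) (cong₂ _∸_ (high (n ∸ suc r) (suc r) (ℕ.m+[n∸m]≡n r<) ℕ.≤-refl) (low r ℕ.≤-refl))
        wordEq : stackWord n C (stack T (suc r)) ≡ replicate (u r) (suc r) ++ w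
        wordEq = cong (_++ w) (trans (cong (_++ ascending u n) (descending-empty n λ k k< → noε k (ℕ.<⇒≤ k<)))
          (ascending-single n r r< λ k k< k≢r → separate k k< k≢r))
          where
          separate : ∀ k → k < n → k ≢ r → u k ≡ 0
          separate k k< k≢r with k <? r
          ... | yes h = u-low k h
          ... | no h  = u-high′ k (ℕ.≤∧≢⇒< (ℕ.≮⇒≥ h) (≢-sym k≢r)) k<

    lattice-unique : ∀ {w} → w ∈ words → violation w ≡ nothing → w ≡ yamanouchi b n
    lattice-unique w∈ lat with ∈-map⁻ (readWord n (toList ν) []) w∈
    ... | T , T∈ , refl = trans (read-member m) (subst (λ z → stackWord n C (stack T z) ≡ yamanouchi b n) (sym N≡n)
        (proj₁ (forced {T} n ℕ.≤-refl (subst (λ z → Valid n C (shapes z) (stack T z)) N≡n (Member.isValid m))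
          (subst (λ z → violation (stackWord n C (stack T z)) ≡ nothing) N≡n (subst (λ z → violation z ≡ nothing) (read-member m) lat)))))
      where m = member⁻ T∈

    vec-at : ∀ {m} (v : Vec ℕ m) → vec (at (toList v)) m ≡ v
    vec-at []      = refl
    vec-at (x ∷ v) = cong (x ∷_) (vec-at v)

    content-yamanouchi : content n (yamanouchi b n) ≡ ν
    content-yamanouchi = trans (vec-cong-< n λ k k< → occ-yamanouchi b n k<) (vec-at ν)

    latticeMultiplicity-straight : ∀ κ → ℤ.+ latticeMultiplicity words κ ≡ Counting.[ eqVecᵇ ν κ ]
    latticeMultiplicity-straight κ = trans (countB-∑ _ words) (trans
      (∑-single (λ w → Counting.[ eqVecᵇ (content n w) κ ∧ isLattice w ]) (CrystalClosed.unique closed) yamanouchi-∈ others)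
      (cong Counting.[_] (trans (cong₂ (λ z l → eqVecᵇ z κ ∧ l) content-yamanouchi lat) (∧-true _))))
      where
      ∧-true : ∀ z → z ∧ true ≡ z
      ∧-true true  = refl
      ∧-true false = refl
      lat : isLattice (yamanouchi b n) ≡ true
      lat rewrite violation-yamanouchi b b-mono n = refl
      others : ∀ {w} → w ∈ words → w ≢ yamanouchi b n → Counting.[ eqVecᵇ (content n w) κ ∧ isLattice w ] ≡ ℤ.0ℤ
      others {w} w∈ w≢ with violation w in eq
      ... | just _  = cong Counting.[_] (∧-false (eqVecᵇ (content n w) κ))
        where
        ∧-false : ∀ z → z ∧ false ≡ false
        ∧-false true  = refl
        ∧-false false = refl
      ... | nothing = ⊥-elim (w≢ (lattice-unique w∈ eq))

-- Semistandard tableaux as fillings of a straight shape.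

module SSYTs where
  open import Defs hiding (rowWord; content)
  open LIA using (lia; _:≡_; _⇒_; #_; _:+_; _:∸_; _:⊓_)
  open Counting hiding ([_])
  open Crystal
  open RowWords hiding (low)
  open Profiles
  open Rows hiding (module Distributed; boxes; mins≡; nonPivots≡)
  open Reading
  open Lists
  open Fillings
  open Statistics
  open Tableaux
  open import Data.Nat using (ℕ; zero; suc; _+_; _≤_; _<_; z≤n; s≤s; _<?_; _≤ᵇ_; _<ᵇ_)
  import Data.Nat.Properties as ℕ
  open import Data.Bool using (Bool; true; false; _∧_; _∨_; not)
  open import Data.List using (List; []; _∷_; map; concat; length; upTo)
  import Data.List.Properties as List
  open import Data.List.Membership.Propositional using (_∈_)
  open import Data.List.Membership.Propositional.Properties using (∈-map⁺; ∈-upTo⁺; ∈-upTo⁻)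
  open import Data.List.Relation.Unary.Any using (here; there)
  open import Data.List.Relation.Unary.All as All using (All; []; _∷_)
  open import Data.List.Relation.Unary.Unique.Propositional using (Unique)
  open import Data.Vec as Vec using (Vec; []; _∷_; toList)
  open import Data.Product using (_×_; _,_; proj₁; proj₂)
  open import Data.Empty using (⊥; ⊥-elim)
  open import Function using (_∘_; id)
  open import Relation.Nullary using (yes; no)
  open import Relation.Binary.PropositionalEquality hiding ([_]; J)

  atD-map-≡ : ∀ {X Y : Set} (φ : X → Y) xs d i → atD (map φ xs) i (φ d) ≡ φ (atD xs i d)
  atD-map-≡ φ []       d i       = refl
  atD-map-≡ φ (x ∷ xs) d zero    = refl
  atD-map-≡ φ (x ∷ xs) d (suc i) = atD-map-≡ φ xs d i

  singletons : List ℕ → List (List ℕ)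
  singletons = map (_∷ [])

  atD-singletons : ∀ l {j} → j < length l → atD (singletons l) j [] ≡ at l j ∷ []
  atD-singletons (x ∷ l) {zero}  h       = refl
  atD-singletons (x ∷ l) {suc j} (s≤s h) = atD-singletons l h

  Weak-intro : ∀ {n} l s → (0 < length l → s ≤ at l 0) → (∀ {x} → x ∈ l → x ≤ n) → (∀ j → suc j < length l → at l j ≤ at l (suc j)) → Weak n s l
  Weak-intro []      s h b c = []
  Weak-intro (x ∷ l) s h b c = (h (s≤s z≤n) , b (here refl)) ∷ Weak-intro l x (λ p → c 0 (s≤s p)) (b ∘ there) (λ j p → c (suc j) (s≤s p))

  Weak-chain : ∀ {n s l} → Weak n s l → ∀ j → suc j < length l → at l j ≤ at l (suc j)
  Weak-chain (_ ∷ ((p , _) ∷ w)) zero    h       = p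
  Weak-chain (_ ∷ w)             (suc j) (s≤s h) = Weak-chain w j h

  Weak-∈ : ∀ {n s l x} → Weak n s l → x ∈ l → s ≤ x × x ≤ n
  Weak-∈ (b ∷ w) (here refl) = b
  Weak-∈ ((p , _) ∷ w) (there m) = let (h , h′) = Weak-∈ w m in ℕ.≤-trans p h , h′

  singletons-Boxes : ∀ {n s l} → Weak n s l → Boxes n s (singletons l)
  singletons-Boxes []            = []
  singletons-Boxes ((p , q) ∷ w) = box p q [] (singletons-Boxes w)

  nonPivots-singletons : ∀ l → nonPivots (singletons l) ≡ []
  nonPivots-singletons []      = refl
  nonPivots-singletons (x ∷ l) = nonPivots-singletons l

  mins-singletons : ∀ l → mins (singletons l) ≡ l
  mins-singletons []      = refl
  mins-singletons (x ∷ l) = cong (x ∷_) (mins-singletons l)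

  distribute-[] : ∀ l → distribute l [] ≡ singletons l
  distribute-[] []          = refl
  distribute-[] (x ∷ [])    = refl
  distribute-[] (x ∷ z ∷ l) = cong ((x ∷ []) ∷_) (distribute-[] (z ∷ l))

  occ-concat : ∀ k S → occ k (concat S) ≡ total (λ r → occ k (atD S r [])) (length S)
  occ-concat k []      = refl
  occ-concat k (l ∷ S) = trans (occ-++ k l (concat S)) (trans (cong (occ k l +_) (occ-concat k S)) (sym (total-front _ (length S))))

  countB≡0 : ∀ {X : Set} (p : X → Bool) xs → countB p xs ≡ 0 → ∀ {x} → x ∈ xs → p x ≡ false
  countB≡0 p (x ∷ xs) h m with p x in eq
  countB≡0 p (x ∷ xs) h (here refl) | false = eq
  countB≡0 p (x ∷ xs) h (there m)   | false = countB≡0 p xs h m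

  module Semistandard (n : ℕ) (ν : Vec ℕ n) (skew : IsSkewShape (toList ν) []) where
    open Straight n ν skew using (zeros; N≡n; equalities≡0; θ≡0; lastZero)
    open Family n (toList ν) [] skew zeros zeros
    open RowsOK

    rowS : List (List ℕ) → ℕ → List ℕ
    rowS S r = atD S r []

    record SSYT (S : List (List ℕ)) : Set where
      constructor ssyt
      field
        length-S : length S ≡ n
        length-s : ∀ r → r < n → length (rowS S r) ≡ b r
        entries  : ∀ r → r < n → ∀ {x} → x ∈ rowS S r → 1 ≤ x × x ≤ n
        weak     : ∀ r j → r < n → suc j < b r → at (rowS S r) j ≤ at (rowS S r) (suc j)
        strict   : ∀ r j → suc r < n → j < b (suc r) → at (rowS S r) j < at (rowS S (suc r)) j
    open SSYT

    tableaux : List (List (List ℕ))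
    tableaux = filterB (isSSYT n ν) (tabFillings n ν)

    -- Merges the two maps of the definition, so that the membership and uniqueness facts for
    -- `cartesian` apply.
    tabFillings-≡ : tabFillings n ν ≡ cartesian (map (λ r → allLists (range1 n) (b r)) (upTo n))
    tabFillings-≡ = cong cartesian (sym (List.map-∘ (upTo n)))

    private
      cell : List (List ℕ) → ℕ → ℕ → Bool
      cell S r j = (not ((j <ᵇ b r) ∧ (suc j <ᵇ b r)) ∨ (at (rowS S r) j ≤ᵇ at (rowS S r) (suc j)))
                 ∧ (not ((j <ᵇ b r) ∧ (j <ᵇ b (suc r))) ∨ (at (rowS S r) j <ᵇ at (rowS S (suc r)) j))

    tableaux⁻ : ∀ {S} → S ∈ tableaux → SSYT S
    tableaux⁻ {S} S∈ with ∈-filterB⁻ (isSSYT n ν) {tabFillings n ν} S∈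
    ... | S∈t , h = ssyt (proj₁ mem) (λ r r< → proj₁ (rowmem r r<)) (λ r r< m → range1-∈⁻ (proj₂ (rowmem r r<) m))
        (λ r j r< j< → ≤ᵇ⁻ (implies⁻ (proj₁ (cells r j r< (ℕ.≤-trans (ℕ.<⇒≤ j<) (b≤C r)))) (∧-join (≤ᵇ-true (ℕ.<⇒≤ j<)) (≤ᵇ-true j<))))
        (λ r j r< j< → <ᵇ⁻ (implies⁻ (proj₂ (cells r j (ℕ.<⇒≤ r<) (ℕ.≤-trans j< (b≤C (suc r)))))
          (∧-join (≤ᵇ-true (ℕ.≤-trans j< (b-mono r))) (≤ᵇ-true j<))))
      where
      mem = ∈-cartesian⁻ (λ r → allLists (range1 n) (b r)) id n [] (subst (S ∈_) tabFillings-≡ S∈t)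
      rowmem : ∀ r → r < n → length (rowS S r) ≡ b r × (∀ {x} → x ∈ rowS S r → x ∈ range1 n)
      rowmem r r< = ∈-allLists⁻ (b r) (proj₂ mem r r<)
      cells : ∀ r j → r < n → j < C → _
      cells r j r< j< = ∧-split {not ((j <ᵇ b r) ∧ (suc j <ᵇ b r)) ∨ (at (rowS S r) j ≤ᵇ at (rowS S r) (suc j))}
        (allB⁻ (cell S r) (allB⁻ (λ r → allB (cell S r) (upTo C)) h (∈-upTo⁺ r<)) (∈-upTo⁺ j<))

    tableaux⁺ : ∀ {S} → SSYT S → S ∈ tableaux
    tableaux⁺ {S} s = ∈-filterB⁺ (isSSYT n ν) (subst (S ∈_) (sym tabFillings-≡)
        (∈-cartesian⁺ (λ r → allLists (range1 n) (b r)) id n S [] (length-S s)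
          (λ r r< → subst (λ z → rowS S r ∈ allLists (range1 n) z) (length-s s r r<)
            (∈-allLists⁺ (rowS S r) λ m → let (p , q) = entries s r r< m in range1-∈⁺ p q))))
      (allB⁺ (λ r → allB (cell S r) (upTo C)) (upTo n) λ {r} r∈ → allB⁺ (cell S r) (upTo C) λ {j} _ →
        ∧-join (implies⁺ (horizontal r j (∈-upTo⁻ r∈))) (implies⁺ (vertical r j)))
      where
      horizontal : ∀ r j → r < n → (j <ᵇ b r) ∧ (suc j <ᵇ b r) ≡ true → (at (rowS S r) j ≤ᵇ at (rowS S r) (suc j)) ≡ true
      horizontal r j r< t = ≤ᵇ-true (weak s r j r< (<ᵇ⁻ (proj₂ (∧-split {j <ᵇ b r} t))))
      vertical : ∀ r j → (j <ᵇ b r) ∧ (j <ᵇ b (suc r)) ≡ true → (at (rowS S r) j <ᵇ at (rowS S (suc r)) j) ≡ true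
      vertical r j t with suc r <? n
      ... | yes r< = ≤ᵇ-true (strict s r j r< (<ᵇ⁻ (proj₂ (∧-split {j <ᵇ b r} t))))
      ... | no r≮  = ⊥-elim (ℕ.n≮0 (subst (j <_) (b-beyond (subst (_≤ suc r) (sym N≡n) (ℕ.≮⇒≥ r≮))) (<ᵇ⁻ {j} (proj₂ (∧-split {j <ᵇ b r} t)))))

    boxed : List (List ℕ) → Filling
    boxed = map singletons

    row-boxed : ∀ S r → row (boxed S) r ≡ singletons (rowS S r)
    row-boxed S r = atD-map-≡ singletons S [] r

    boxed-∈ : ∀ {S} → SSYT S → boxed S ∈ family
    boxed-∈ {S} s = member⁺ ok (Rowwise.toValid ok fits (λ r r< → trans (cong length (trans (cong nonPivots (row-boxed S r)) (nonPivots-singletons (rowS S r)))) (sym (θ≡0 r)))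
        (λ r r< → trans (countB-none (Rowwise.equal ok r) (upTo C) (λ {j} _ → unequal r j r<)) (sym (equalities≡0 (suc r)))) N ℕ.≤-refl) lastZero
      where
      <n : ∀ {r} → r < N → r < n
      <n = subst (_ <_) N≡n
      weakRow : ∀ r → r < n → Weak n 1 (rowS S r)
      weakRow r r< = Weak-intro (rowS S r) 1 (λ l → proj₁ (entries s r r< (atD-∈ (rowS S r) 0 l)))
        (λ m → proj₂ (entries s r r< m)) (λ j j< → weak s r j r< (subst (suc j <_) (length-s s r r<) j<))
      ok : RowsOK (boxed S)
      ok = record
        { length-T = trans (List.length-map singletons S) (trans (length-S s) (sym N≡n))
        ; boxes = λ r r< → subst (Boxes n 1) (sym (row-boxed S r)) (singletons-Boxes (weakRow r (<n r<)))
        ; length-r = λ r r< → trans (cong length (row-boxed S r)) (trans (List.length-map _ (rowS S r)) (length-s s r (<n r<))) }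
      entry : ∀ r j → r < n → j < b r → get n (toList ν) [] (boxed S) r j ≡ at (rowS S r) j ∷ []
      entry r j r< j< = trans (cong (λ z → atD z j []) (row-boxed S r)) (atD-singletons (rowS S r) (subst (j <_) (sym (length-s s r r<)) j<))
      below : ∀ r j → suc r < n → j < b (suc r) → maxL (get n (toList ν) [] (boxed S) r j) < minL (get n (toList ν) [] (boxed S) (suc r) j)
      below r j r< j< rewrite entry r j (ℕ.<⇒≤ r<) (ℕ.≤-trans j< (b-mono r)) | entry (suc r) j r< j< | ℕ.⊔-identityʳ (at (rowS S r) j) = strict s r j r< j<
      fits : ∀ r → suc r < N → Rowwise.Fits ok r
      fits r r< c _ c< = ℕ.<⇒≤ (below r c (<n r<) c<)
      unequal : ∀ r j → suc r < N → Rowwise.equal ok r j ≡ false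
      unequal r j r< with Rowwise.equal ok r j in eq
      ... | false = refl
      ... | true  = let (_ , q) = ∧-split {inShape n (toList ν) [] r j} eq
                        (q₁ , q₂) = ∧-split {inShape n (toList ν) [] (suc r) j} q
        in ⊥-elim (ℕ.<⇒≢ (below r j (<n r<) (proj₂ (between-sound {0} {b (suc r)} {j} q₁))) (≡ᵇ⁻ q₂))

    -- Vanishing `ex` makes every box a singleton, and vanishing `ceq` turns the weak order of the
    -- columns into a strict one.
    family-boxed : ∀ {T} → T ∈ family → T ∈ map boxed tableaux
    family-boxed {T} T∈ = subst (_∈ map boxed tableaux) (sym T≡) (∈-map⁺ boxed (tableaux⁺ s))
      where
      m = member⁻ T∈
      ok = Good.rowsOK (Member.isGood m)
      facts = Rowwise.fromValid ok ℕ.≤-refl (Member.isValid m)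
      S = map mins T
      >n : ∀ {r} → r < n → r < N
      >n = subst (_ <_) (sym N≡n)
      row-S : ∀ r → rowS S r ≡ mins (row T r)
      row-S r = atD-map-≡ mins T [] r
      row-T : ∀ r → r < N → row T r ≡ singletons (mins (row T r))
      row-T r r< = trans (distribute-unique (boxes ok r r<)) (trans (cong (distribute (mins (row T r))) (empty (nonPivots (row T r))
        (trans (proj₁ facts r r<) (θ≡0 r)))) (distribute-[] (mins (row T r))))
        where
        empty : ∀ (l : List ℕ) → length l ≡ 0 → l ≡ []
        empty [] _ = refl
      T≡ : T ≡ boxed S
      T≡ = atD-ext T (boxed S) [] (sym (trans (List.length-map singletons S) (List.length-map mins T)))
        λ r r< → trans (row-T r (subst (r <_) (length-T ok) r<)) (sym (trans (row-boxed S r) (cong singletons (row-S r))))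
      width : ∀ r → r < N → length (mins (row T r)) ≡ b r
      width r r< = trans (List.length-map minL (row T r)) (length-r ok r r<)
      entry : ∀ r j → r < N → j < b r → get n (toList ν) [] T r j ≡ at (rowS S r) j ∷ []
      entry r j r< j< = trans (cong (λ z → atD z j []) (row-T r r<)) (trans (atD-singletons (mins (row T r)) (subst (j <_) (sym (width r r<)) j<))
        (cong (λ z → at z j ∷ []) (sym (row-S r))))
      s : SSYT S
      s = ssyt (trans (List.length-map mins T) (trans (length-T ok) N≡n))
        (λ r r< → trans (cong length (row-S r)) (width r (>n r<)))
        (λ r r< {x} x∈ → Weak-∈ (mins-Weak (boxes ok r (>n r<))) (subst (x ∈_) (row-S r) x∈))
        (λ r j r< j< → subst (λ z → at z j ≤ at z (suc j)) (sym (row-S r))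
          (Weak-chain (mins-Weak (boxes ok r (>n r<))) j (subst (suc j <_) (sym (width r (>n r<))) j<)))
        strict′
        where
        strict′ : ∀ r j → suc r < n → j < b (suc r) → at (rowS S r) j < at (rowS S (suc r)) j
        strict′ r j r< j< = ℕ.≤∧≢⇒< (subst₂ _≤_ maxEq minEq (proj₁ fe j z≤n j<)) λ e → contra (trans (sym unequal)
            (∧-join (between-true z≤n (ℕ.≤-trans j< (b-mono r))) (∧-join (between-true z≤n j<) (≡ᵇ⁺ (trans maxEq (trans e (sym minEq)))))))
          where
          fe = proj₂ facts r (>n r<)
          maxEq : maxL (get n (toList ν) [] T r j) ≡ at (rowS S r) j
          maxEq = trans (cong maxL (entry r j (ℕ.<⇒≤ (>n r<)) (ℕ.≤-trans j< (b-mono r)))) (ℕ.⊔-identityʳ _)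
          minEq : minL (get n (toList ν) [] T (suc r) j) ≡ at (rowS S (suc r)) j
          minEq = cong minL (entry (suc r) j (>n r<) j<)
          unequal : Rowwise.equal ok r j ≡ false
          unequal = countB≡0 (Rowwise.equal ok r) (upTo C) (trans (proj₂ fe) (equalities≡0 (suc r))) (∈-upTo⁺ (ℕ.≤-trans j< (b≤C (suc r))))
          contra : false ≡ true → ⊥
          contra ()

    -- There are no non-pivots, and strict columns leave no pivot to omit, so every entry of the
    -- tableau is read exactly once.
    content-boxed : ∀ {S} → SSYT S → content n (readWord n (toList ν) [] (boxed S)) ≡ Defs.content n S
    content-boxed {S} s = sym (trans (tabulate-vec _ n) (vec-cong-< n λ k k<n → sym (trans (cong (occ (suc k)) (read-member m))
        (trans (occ-stack k k<n N (Member.isValid m)) (trans (trans (total-cong N λ r _ → cong (occ (suc k)) (trans (cong mins (row-boxed S r)) (mins-singletons (rowS S r))))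
          (cong (total _) (trans N≡n (sym (length-S s))))) (sym (occ-concat (suc k) S)))))))
      where
      T = boxed S
      m = member⁻ (boxed-∈ s)
      ok = Good.rowsOK (Member.isGood m)
      occ-stack : ∀ k → k < n → ∀ r → Valid n C (shapes r) (stack T r) → occ (suc k) (stackWord n C (stack T r)) ≡ total (λ s → occ (suc k) (mins (row T s))) r
      occ-stack k k<n zero    _ = refl
      occ-stack k k<n (suc r) ((R , bl) ∷ v) = trans (occ-++ (suc k) (wordBelow n X p) _) (trans (ℕ.+-comm (occ (suc k) (wordBelow n X p)) _)
        (cong₂ _+_ (occ-stack k k<n r v) (trans (occ-++ (suc k) (descending _ n) _) (trans (cong₂ _+_ (occ-descending _ n k<n) (occ-ascending _ n k<n)) piece))))
        where
        p = prof T r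
        X = thresholds n C (stack T r)
        piece : ε p (suc k) + pivots X p k ≡ occ (suc k) (mins (row T r))
        piece = lia (ε p (suc k) ∷ y p (suc k) ∷ X k ∷ y p k ∷ count≤ k (mins (row T r)) ∷ occ (suc k) (mins (row T r)) ∷ count≤ (suc k) (mins (row T r)) ∷ [])
          (λ e y′ X y c o c′ → e :≡ # 0 ⇒ y′ :∸ X :≡ # 0 ⇒ y :≡ c ⇒ y′ :≡ c′ ⇒ c′ :≡ c :+ o ⇒ e :+ ((y′ :⊓ X) :∸ y) :≡ o) refl
          (total≡0 n (trans (size R) (θ≡0 r)) k k<n) (total≡0 n (trans (equality bl) (equalities≡0 r)) k k<n) refl refl (count≤-suc k (mins (row T r)))

    schurCoeff-multiplicity : ∀ α → schurCoeff n ν α ≡ multiplicity words α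
    schurCoeff-multiplicity α = sym (trans (countB-map _ (readWord n (toList ν) []) family) (trans (sym (countB-↭ _ perm))
      (trans (countB-map _ boxed tableaux) (trans (countB-cong tableaux λ S∈ → cong (λ z → eqVecᵇ z α) (content-boxed (tableaux⁻ S∈)))
        (countB-filterB _ (isSSYT n ν) (tabFillings n ν))))))
      where
      unique : Unique tableaux
      unique = Unique-filterB (isSSYT n ν) (subst Unique (sym tabFillings-≡) (Unique-cartesian (go (upTo n))))
        where
        go : ∀ rs → All Unique (map (λ r → allLists (range1 n) (b r)) rs)
        go []       = []
        go (r ∷ rs) = Unique-allLists (Unique-range1 n) (b r) ∷ go rs
      perm = bijection-↭ boxed unique (Unique-filterB selected (Unique-fillings n (toList ν) []))
        (λ S∈ → boxed-∈ (tableaux⁻ S∈))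
        (λ _ _ eq → List.map-injective (λ e → List.map-injective (λ e′ → List.∷-injectiveˡ e′) e) eq)
        family-boxed

open import Defs
open import Data.Nat using (ℕ; _≤_; _*_)
open import Data.List using (List; length; map)
open import Data.Nat.ListAction using (sum)
open import Data.Vec using (Vec)
open import Relation.Binary.PropositionalEquality using (_≡_)

-- Assembly over the box of bounded exponent vectors.

module Expansion where
  open Alternants using (Bounded; Decreasing)
  open Counting using (∈-filterB⁺; ∈-filterB⁻; Unique-filterB)
  open Crystal using (module LittlewoodRichardson)
  open Words using (Word)
  open Lists
  open Fillings using (module Family)
  open Statistics using (module Multiplicities)
  open Tableaux using (module Straight)
  open SSYTs using (module Semistandard)
  import Data.Nat.Properties as ℕ
  open import Data.Nat using (suc; zero; z≤n; s≤s; _<_; _<?_)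
  open import Data.Bool using (_∧_)
  open import Data.List using ([]; _∷_; upTo)
  open import Data.List.Membership.Propositional using (_∈_)
  open import Data.List.Membership.Propositional.Properties using (∈-upTo⁺; ∈-upTo⁻)
  open import Data.List.Relation.Unary.Any using (here; there)
  open import Data.List.Relation.Unary.Unique.Propositional using (Unique)
  import Data.List.Relation.Unary.Unique.Propositional.Properties as Unique
  open import Data.Vec as Vec using ([]; _∷_; toList)
  import Data.Vec.Properties as Vec
  import Data.Vec.Relation.Unary.All as VAll
  open import Data.Product using (_,_; proj₁; proj₂)
  open import Function using (_∘_)
  open import Relation.Nullary using (yes; no)
  open import Relation.Binary.PropositionalEquality using (refl; sym; trans; cong₂; subst)

  private
    isDecreasing : ∀ n → Vec ℕ n → _
    isDecreasing n v = allB (λ i → at (toList v) (suc i) Data.Nat.≤ᵇ at (toList v) i) (upTo n)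

  box : ℕ → ∀ n → List (Vec ℕ n)
  box c n = allVecs (upTo (suc c)) n

  at-bounded : ∀ {n c} (v : Vec ℕ n) → Bounded c v → ∀ {i} → i < n → ∀ d → atD (toList v) i d ≤ c
  at-bounded (x ∷ v) (p VAll.∷ b) {zero}  _        d = p
  at-bounded (x ∷ v) (p VAll.∷ b) {suc i} (s≤s i<) d = at-bounded v b i< d

  box-complete : ∀ {n c} (v : Vec ℕ n) → Bounded c v → v ∈ box c n
  box-complete v b = ∈-allVecs⁺ v λ i< d → ∈-upTo⁺ (s≤s (at-bounded v b i< d))

  box-bounded : ∀ {n c} (v : Vec ℕ n) → v ∈ box c n → Bounded c v
  box-bounded {c = c} v v∈ = go v (λ x∈ → ℕ.≤-pred (∈-upTo⁻ (∈-allVecs⁻ v v∈ x∈)))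
    where
    go : ∀ {n} (v : Vec ℕ n) → (∀ {x} → x ∈ toList v → x ≤ c) → Bounded c v
    go []      h = VAll.[]
    go (x ∷ v) h = h (here refl) VAll.∷ go v (h ∘ there)

  box-unique : ∀ c n → Unique (box c n)
  box-unique c n = Unique-allVecs (Unique.upTo⁺ (suc c)) n

  decreasing-at : ∀ {n} (v : Vec ℕ n) → Decreasing v → ∀ i → at (toList v) (suc i) ≤ at (toList v) i
  decreasing-at []          d i       = z≤n
  decreasing-at (x ∷ [])    d i       = z≤n
  decreasing-at (x ∷ z ∷ v) (p , d) zero    = p
  decreasing-at (x ∷ z ∷ v) (p , d) (suc i) = decreasing-at (z ∷ v) d i

  partition-skew : ∀ {n c} {ν : Vec ℕ n} → ν ∈ partitionsBounded n c → IsSkewShape (toList ν) []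
  partition-skew {n} {c} {ν} ν∈ = decreasing , (λ _ → z≤n) , (λ _ → z≤n)
    where
    decreasing : IsPartition (toList ν)
    decreasing i with i <? n
    ... | yes i<n = ≤ᵇ⁻ (allB⁻ _ (proj₂ (∈-filterB⁻ (isDecreasing n) {box c n} ν∈)) (∈-upTo⁺ i<n))
    -- Only indices below `n` are tested in the definition; past the end of the list the default
    -- value 0 of `at` settles the inequality.
    ... | no i≮n  = subst (_≤ at (toList ν) i) (sym (at-beyond (toList ν) 0 (subst (_≤ suc i) (sym (Vec.length-toList ν))
                      (ℕ.m≤n⇒m≤1+n (ℕ.≮⇒≥ i≮n))))) z≤n

  -- Spelled out without a proof that ν is a partition, because a list of words is required for
  -- every vector; for a partition it agrees with `Family.words` by definition.
  straightWords : ∀ {n} → Vec ℕ n → List Word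
  straightWords {n} ν = map (readWord n (toList ν) []) (filterB (λ T → isSVRPP n (toList ν) [] T ∧
    eqVecᵇ (ceq n (toList ν) [] T) (Vec.replicate _ 0) ∧ eqVecᵇ (ex n (toList ν) [] T) (Vec.replicate _ 0)) (fillings n (toList ν) []))

  sum-cong : ∀ {X : Set} {g h : X → ℕ} xs → (∀ {x} → x ∈ xs → g x ≡ h x) → sum (map g xs) ≡ sum (map h xs)
  sum-cong []       eq = refl
  sum-cong (x ∷ xs) eq = cong₂ Data.Nat._+_ (eq (here refl)) (sum-cong xs (eq ∘ there))

  expansion : ∀ la mu → IsSkewShape la mu → ∀ n (α : Vec ℕ n) (γ θ : Vec ℕ (length la)) →
    coeffG n la mu α γ θ ≡ sum (map (λ ν → H n la mu ν γ θ * schurCoeff n ν α) (partitionsBounded n (at la 0)))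
  expansion la mu skew n α γ θ = trans (M.coeffG-multiplicity α) (trans (LR.expansion α) (sym (sum-cong (partitionsBounded n c)
      λ {ν} ν∈ → cong₂ _*_ (M.H-latticeMultiplicity ν) (Semistandard.schurCoeff-multiplicity n ν (partition-skew ν∈) α))))
    where
    c = at la 0
    module F = Family n la mu skew γ θ
    module M = Multiplicities n la mu skew γ θ
    ν-bounded : ∀ {ν : Vec ℕ n} → ν ∈ partitionsBounded n c → at (toList ν) 0 ≤ c
    ν-bounded {ν} ν∈ = first ν (box-bounded ν (proj₁ (∈-filterB⁻ (isDecreasing n) {box c n} ν∈)))
      where
      first : ∀ {m} (v : Vec ℕ m) → Bounded c v → at (toList v) 0 ≤ c
      first []      _             = z≤n
      first (x ∷ v) (p VAll.∷ _) = p
    module LR = LittlewoodRichardson {n} {c} {box c n} {partitionsBounded n c}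
      (box-unique c n) box-complete
      (Unique-filterB (isDecreasing n) (box-unique c n))
      (λ κ b d → ∈-filterB⁺ (isDecreasing n) (box-complete κ b)
        (allB⁺ _ (upTo n) λ {i} _ → Rows.≤ᵇ-true (decreasing-at κ d i)))
      F.words F.closed M.content-bounded
      straightWords
      (λ {ν} ν∈ → Family.closed n (toList ν) [] (partition-skew ν∈) (Vec.replicate _ 0) (Vec.replicate _ 0))
      -- Contents for ν are bounded by its first part, and this part is at most `c`.
      (λ {ν} ν∈ w∈ → VAll.map (λ h → ℕ.≤-trans h (ν-bounded ν∈))
        (Multiplicities.content-bounded n (toList ν) [] (partition-skew ν∈) (Vec.replicate _ 0) (Vec.replicate _ 0) w∈))
      (λ {ν} ν∈ → Straight.latticeMultiplicity-straight n ν (partition-skew ν∈))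

theorem1p3 : (la mu : List ℕ) → IsSkewShape la mu → (n : ℕ) → 1 ≤ n →
    (α : Vec ℕ n) (γ θ : Vec ℕ (length la)) →
    coeffG n la mu α γ θ
      ≡ sum (map (λ ν → H n la mu ν γ θ * schurCoeff n ν α)
                 (partitionsBounded n (at la 0)))
theorem1p3 la mu skew n _ α γ θ = Expansion.expansion la mu skew n α γ θ
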